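{- (1) Let $1\le\ell_1\le\dots\le\ell_r\le n$ and $T=C_r\otimes\cdots\otimes C_1$ with $C_i\in B(\varpi_{\ell_i})$. Then $\widetilde\psi_T=\prod_{i=1}^{r-1}\widetilde\psi_{C_{i+1}\otimes C_i}$. (2) Let $1\le a\le b\le n$, $F\in B(\varpi_b)$, $E\in B(\varpi_a)$. Then: (a) if $F\otimes E$ is not semistandard, $\widetilde\psi_{F\otimes E}=0$; (b) if $E=(1,\dots,a)$ and $F\otimes E$ is semistandard, $\widetilde\psi_{F\otimes E}=1$; (c) if $F\otimes E$ is semistandard and $j\in[n-1]$ with $s_jE\le E$, then $$\widetilde\psi_{F\otimes E}=\begin{cases}t\,\widetilde\psi_{s_jF\otimes s_jE}+(1-t)\,\widetilde\psi_{F\otimes s_jE}, & \text{if } s_jF\ge F,\\ \widetilde\psi_{s_jF\otimes s_jE}, & \text{if } s_jF\le F.\end{cases}$$ In particular every $\widetilde\psi_T$ lies in $\mathbb Z[t]$.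
   Context: Fix $n\ge1$, $[n]=\{1,\dots,n\}$. $S_n$ is the symmetric group with simple transpositions $s_i=(i,i+1)$ and length function $\ell(\cdot)$; it acts on $\mathbb Z^n$ by permuting coordinates; $\varpi_k=\varepsilon_1+\dots+\varepsilon_k$ ($\varepsilon_i$ standard basis). For $\lambda\in\mathbb Z^n$, $S_{n,\lambda}=\{w:w\lambda=\lambda\}$ and $W_\lambda(t)=\sum_{w\in S_{n,\lambda}}t^{\ell(w)}$. The affine Hecke algebra $H$ is the $\mathbb Z[t^{\pm1}]$-algebra with generators $T_1,\dots,T_{n-1},X_1^{\pm1},\dots,X_n^{\pm1}$ and relations $T_i^2=(t-1)T_i+t$, $T_iT_{i+1}T_i=T_{i+1}T_iT_{i+1}$, $T_iT_j=T_jT_i$ ($|i-j|>1$), $X_iX_j=X_jX_i$, $T_iX_iT_i=tX_{i+1}$, $T_iX_j=X_jT_i$ ($j\notin\{i,i+1\}$). $T_w=T_{i_1}\cdots T_{i_m}$ for a reduced word of $w$. $H_n$ is the subalgebra generated by the $T_i$ (basis $\{T_w\}$); $H_{n,\lambda}$ is the span of $\{T_w:w\in S_{n,\lambda}\}$; $\mathbf 1_\lambda=\sum_{w\in S_{n,\lambda}}T_w$. Columns: a column of length $\ell$ is $C=(c_1<\dots<c_\ell)\subseteq[n]$; $B(\varpi_\ell)$ is their set; partial order $E\le F$ iff $e_i\le f_i$ for all $i$. $u_C\in S_n$ sends $k\mapsto c_k$ ($k\le\ell$) and sends $\ell+1,\dots,n$ increasingly onto $[n]\setminus C$. $s_jC$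 is the column whose underlying set is the image of $C$ under the transposition $(j,j+1)$. Tensors $T=C_r\otimes\cdots\otimes C_1$ ($C_i\in B(\varpi_{\ell_i})$, $\ell_1\le\dots\le\ell_r$) are fillings of the Young diagram of $\lambda=\sum\varpi_{\ell_i}$ with columns $C_r,\dots,C_1$ left to right; semistandard means rows weakly increase left to right. Definition of $\Psi$: every $h\in H_n$ is uniquely $\sum_{F\in B(\varpi_\ell)}T_{u_F}h_F$ with $h_F\in H_{n,\varpi_\ell}$. For a column $C\in B(\varpi_\ell)$, $\Psi_C=t^{\ell(u_C)}(T_{u_C^{ -1}})^{ -1}\mathbf 1_{\varpi_\ell}$; for $T=C\otimes S$, $C\in B(\varpi_\ell)$, $S$ a tensor of columns of lengths $\le\ell$, write $\Psi_S=\sum_{E\in B(\varpi_\ell)}T_{u_E}h_{E,S}$ ($h_{E,S}\in H_{n,\varpi_\ell}$) and set $\Psi_T=t^{\ell(u_C)}(T_{u_C^{ -1}})^{ -1}h_{C,S}$. Definition of $\widetilde\psi$: for $T$ of shape $\lambda$ with $\Psi_T=\sum_{w\in S_n}a_wT_w$ ($a_w\in\mathbb Z[t^{\pm1}]$), $\widetilde\psi_T=W_\lambda(t)^{ -1}\sum_w a_wt^{\ell(w)}\in\mathbb Q(t)$; equivalently $\widetilde\psi_T\mathbf 1_0=W_\lambda(t)^{ -1}\Psi_T\mathbf 1_0$ where $\mathbf 1_0=\sum_{w\in S_n}T_w$. -}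

module Defs where

open import Data.Bool.Base using (true; false; if_then_else_)
open import Data.Fin.Base as Fin using (Fin; zero; suc; toℕ; fromℕ<; inject₁; inject≤; punchIn)
open import Data.Fin.Patterns using (0F; 1F)
import Data.Fin.Properties as Finₚ
open import Data.Fin.Permutation as Perm
  using (Permutation′; _⟨$⟩ʳ_; _⟨$⟩ˡ_; _≈_; _∘ₚ_; transpose; lift₀; insert; remove; flip)
open import Data.Fin.Subset using (Subset; inside; outside; ∣_∣)
open import Data.Fin.Subset.Properties using (∣p∣≤n)
open import Data.Integer.Base as ℤ using (ℤ; +_; 0ℤ; 1ℤ)
import Data.Integer.Properties as ℤₚ
open import Data.List.Base as List
  using (List; []; _∷_; _++_; map; foldr; length; allFin; concatMap; filter)
import Data.List.Properties as Listₚ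
open import Data.Nat.Base as ℕ using (ℕ; zero; suc; _≤_; _<_; z≤n; s≤s; ∣_-_∣)
import Data.Nat.Properties as ℕₚ
open import Data.Product.Base using (∃; ∃-syntax; Σ-syntax; _×_; _,_; proj₁; proj₂)
open import Data.Sum.Base using (_⊎_; inj₁; inj₂; [_,_]′)
open import Data.Vec.Base as Vec using (Vec; []; _∷_; lookup; tabulate)
import Data.Vec.Properties as Vecₚ
open import Algebra.Properties.CommutativeMonoid.Sum ℕₚ.+-0-commutativeMonoid
  using (sum; sum-permute)
open import Relation.Nullary using (¬_; Dec; yes; no; contradiction; recompute)
open import Relation.Binary.PropositionalEquality
  using (_≡_; _≢_; refl; sym; trans; cong; cong₂; subst; module ≡-Reasoning)

private
  variable
    A : Set
    m n k l : ℕ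

------------------------------------------------------------------------
-- ℤ[t]: coefficient lists, constant term first, so trailing zeros are
-- allowed and equality is coefficientwise.

ℤ[t] : Set
ℤ[t] = List ℤ

coeff : ℤ[t] → ℕ → ℤ
coeff []      _       = 0ℤ
coeff (a ∷ p) zero    = a
coeff (a ∷ p) (suc i) = coeff p i

infix 4 _≈ₚ_
_≈ₚ_ : ℤ[t] → ℤ[t] → Set
p ≈ₚ q = ∀ i → coeff p i ≡ coeff q i

0ₚ 1ₚ t : ℤ[t]
0ₚ = []
1ₚ = 1ℤ ∷ []
t  = 0ℤ ∷ 1ℤ ∷ []

infixl 6 _+ₚ_
infixl 7 _*ₚ_
infixr 8 _^ₚ_
infix  8 -ₚ_

_+ₚ_ : ℤ[t] → ℤ[t] → ℤ[t]
[]      +ₚ q       = q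
(a ∷ p) +ₚ []      = a ∷ p
(a ∷ p) +ₚ (b ∷ q) = a ℤ.+ b ∷ p +ₚ q

-ₚ_ : ℤ[t] → ℤ[t]
-ₚ_ = map (ℤ.-_)

_*ₚ_ : ℤ[t] → ℤ[t] → ℤ[t]
[]      *ₚ q = []
(a ∷ p) *ₚ q = map (a ℤ.*_) q +ₚ (0ℤ ∷ p *ₚ q)

_^ₚ_ : ℤ[t] → ℕ → ℤ[t]
p ^ₚ zero  = 1ₚ
p ^ₚ suc i = p *ₚ p ^ₚ i

∑ₚ : List A → (A → ℤ[t]) → ℤ[t]
∑ₚ xs f = foldr (λ x → f x +ₚ_) 0ₚ xs

-- ℤ[t] has no zero divisors; needed to multiply denominators in ℚ(t).

coeff-+ₚ : ∀ p q i → coeff (p +ₚ q) i ≡ coeff p i ℤ.+ coeff q i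
coeff-+ₚ []      q       i       = sym (ℤₚ.+-identityˡ _)
coeff-+ₚ (a ∷ p) []      i       = sym (ℤₚ.+-identityʳ _)
coeff-+ₚ (a ∷ p) (b ∷ q) zero    = refl
coeff-+ₚ (a ∷ p) (b ∷ q) (suc i) = coeff-+ₚ p q i

coeff-scale : ∀ a p i → coeff (map (a ℤ.*_) p) i ≡ a ℤ.* coeff p i
coeff-scale a []      i       = sym (ℤₚ.*-zeroʳ a)
coeff-scale a (b ∷ p) zero    = refl
coeff-scale a (b ∷ p) (suc i) = coeff-scale a p i

*ₚ-shiftʳ : ∀ p q → p *ₚ (0ℤ ∷ q) ≈ₚ 0ℤ ∷ p *ₚ q
*ₚ-shiftʳ []      q zero    = refl
*ₚ-shiftʳ []      q (suc i) = refl
*ₚ-shiftʳ (a ∷ p) q zero    = trans (ℤₚ.+-identityʳ _) (ℤₚ.*-zeroʳ a)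
*ₚ-shiftʳ (a ∷ p) q (suc i) =
  trans (coeff-+ₚ (map (a ℤ.*_) q) (p *ₚ (0ℤ ∷ q)) i)
    (trans (cong (λ z → coeff (map (a ℤ.*_) q) i ℤ.+ z) (*ₚ-shiftʳ p q i))
      (sym (coeff-+ₚ (map (a ℤ.*_) q) (0ℤ ∷ p *ₚ q) i)))

*ₚ-congʳ : ∀ p q r → q ≈ₚ r → p *ₚ q ≈ₚ p *ₚ r
*ₚ-congʳ []      q r q≈r i = refl
*ₚ-congʳ (a ∷ p) q r q≈r i = begin
  coeff (map (a ℤ.*_) q +ₚ (0ℤ ∷ p *ₚ q)) i                ≡⟨ coeff-+ₚ (map (a ℤ.*_) q) _ i ⟩
  coeff (map (a ℤ.*_) q) i ℤ.+ coeff (0ℤ ∷ p *ₚ q) i       ≡⟨ cong₂ ℤ._+_ (scale i) (tail i) ⟩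
  coeff (map (a ℤ.*_) r) i ℤ.+ coeff (0ℤ ∷ p *ₚ r) i       ≡⟨ coeff-+ₚ (map (a ℤ.*_) r) _ i ⟨
  coeff (map (a ℤ.*_) r +ₚ (0ℤ ∷ p *ₚ r)) i                ∎
  where
  open ≡-Reasoning
  scale : ∀ i → coeff (map (a ℤ.*_) q) i ≡ coeff (map (a ℤ.*_) r) i
  scale i = trans (coeff-scale a q i)
              (trans (cong (a ℤ.*_) (q≈r i)) (sym (coeff-scale a r i)))
  tail : ∀ i → coeff (0ℤ ∷ p *ₚ q) i ≡ coeff (0ℤ ∷ p *ₚ r) i
  tail zero    = refl
  tail (suc i) = *ₚ-congʳ p q r q≈r i

∷-≈0 : ∀ {a p} → a ≡ 0ℤ → p ≈ₚ 0ₚ → a ∷ p ≈ₚ 0ₚ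
∷-≈0 a≡0 p≈0 zero    = a≡0
∷-≈0 a≡0 p≈0 (suc i) = p≈0 i

-- q is annihilated by a polynomial with non-zero constant term
cancel : ∀ {a} p → a ≢ 0ℤ → ∀ q → (a ∷ p) *ₚ q ≈ₚ 0ₚ → q ≈ₚ 0ₚ
cancel p a≢0 []      _ = λ _ → refl
cancel {a} p a≢0 (b ∷ q) e = ∷-≈0 b≡0 (cancel p a≢0 q tail)
  where
  b≡0 : b ≡ 0ℤ
  b≡0 = [ (λ a≡0 → contradiction a≡0 a≢0) , (λ z → z) ]′
          (ℤₚ.i*j≡0⇒i≡0∨j≡0 a (trans (sym (ℤₚ.+-identityʳ (a ℤ.* b))) (e 0)))
  shift : b ∷ q ≈ₚ 0ℤ ∷ q
  shift zero    = b≡0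
  shift (suc i) = refl
  tail : (a ∷ p) *ₚ q ≈ₚ 0ₚ
  tail i = trans (sym (*ₚ-shiftʳ (a ∷ p) q (suc i)))
             (trans (sym (*ₚ-congʳ (a ∷ p) (b ∷ q) (0ℤ ∷ q) shift (suc i))) (e (suc i)))

*ₚ-≈0 : ∀ p q → p *ₚ q ≈ₚ 0ₚ → p ≈ₚ 0ₚ ⊎ q ≈ₚ 0ₚ
*ₚ-≈0 []      q e = inj₁ (λ _ → refl)
*ₚ-≈0 (a ∷ p) q e with a ℤₚ.≟ 0ℤ
... | no  a≢0  = inj₂ (cancel p a≢0 q e)
... | yes refl with *ₚ-≈0 p q tail
  where
  tail : p *ₚ q ≈ₚ 0ₚ
  tail i = begin
    coeff (p *ₚ q) i                                            ≡⟨ ℤₚ.+-identityˡ _ ⟨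
    0ℤ ℤ.+ coeff (p *ₚ q) i                                     ≡⟨ cong (ℤ._+ coeff (p *ₚ q) i) (coeff-scale 0ℤ q (suc i)) ⟨
    coeff (map (0ℤ ℤ.*_) q) (suc i) ℤ.+ coeff (p *ₚ q) i        ≡⟨ coeff-+ₚ (map (0ℤ ℤ.*_) q) (0ℤ ∷ p *ₚ q) (suc i) ⟨
    coeff ((0ℤ ∷ p) *ₚ q) (suc i)                               ≡⟨ e (suc i) ⟩
    0ℤ                                                          ∎
    where open ≡-Reasoning
...   | inj₁ p≈0 = inj₁ (∷-≈0 refl p≈0)
...   | inj₂ q≈0 = inj₂ q≈0

------------------------------------------------------------------------
-- ℤ[t^±1]: p /t^ d stands for t^(-d) p.

infix 5 _/t^_
record ℤ[t^±1] : Set where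
  constructor _/t^_
  field
    num : ℤ[t]
    exp : ℕ

infix 4 _≈ₗ_
_≈ₗ_ : ℤ[t^±1] → ℤ[t^±1] → Set
(p /t^ d) ≈ₗ (q /t^ e) = p *ₚ t ^ₚ e ≈ₚ q *ₚ t ^ₚ d

⟦_⟧ₗ : ℤ[t] → ℤ[t^±1]
⟦ p ⟧ₗ = p /t^ 0

infixl 6 _+ₗ_
infixl 7 _*ₗ_

_+ₗ_ : ℤ[t^±1] → ℤ[t^±1] → ℤ[t^±1]
(p /t^ d) +ₗ (q /t^ e) = (p *ₚ t ^ₚ e +ₚ q *ₚ t ^ₚ d) /t^ (d ℕ.+ e)

_*ₗ_ : ℤ[t^±1] → ℤ[t^±1] → ℤ[t^±1]
(p /t^ d) *ₗ (q /t^ e) = (p *ₚ q) /t^ (d ℕ.+ e)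

∑ₗ : List A → (A → ℤ[t^±1]) → ℤ[t^±1]
∑ₗ xs f = foldr (λ x → f x +ₗ_) ⟦ 0ₚ ⟧ₗ xs

------------------------------------------------------------------------
-- ℚ(t), as the fraction field of ℤ[t].

record ℚ⟨t⟩ : Set where
  constructor frac
  field
    num   : ℤ[t]
    den   : ℤ[t]
    den≉0 : ¬ den ≈ₚ 0ₚ

infix 4 _≃_
_≃_ : ℚ⟨t⟩ → ℚ⟨t⟩ → Set
frac p d _ ≃ frac q e _ = p *ₚ e ≈ₚ q *ₚ d

1ₚ≉0 : ¬ 1ₚ ≈ₚ 0ₚ
1ₚ≉0 e with () ← e 0

t^≉0 : ∀ d → ¬ t ^ₚ d ≈ₚ 0ₚ
t^≉0 zero    = 1ₚ≉0
t^≉0 (suc d) e = [ (λ t≈0 → 1ₚ≉0 (λ i → t≈0 (suc i))) , t^≉0 d ]′ (*ₚ-≈0 t (t ^ₚ d) e)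

*ₚ-≉0 : ∀ p q → ¬ p ≈ₚ 0ₚ → ¬ q ≈ₚ 0ₚ → ¬ p *ₚ q ≈ₚ 0ₚ
*ₚ-≉0 p q p≉0 q≉0 e = [ p≉0 , q≉0 ]′ (*ₚ-≈0 p q e)

⟦_⟧ : ℤ[t] → ℚ⟨t⟩
⟦ p ⟧ = frac p 1ₚ 1ₚ≉0

fromLaurent : ℤ[t^±1] → ℚ⟨t⟩
fromLaurent (p /t^ d) = frac p (t ^ₚ d) (t^≉0 d)

infixl 6 _+_
infixl 7 _*_

_+_ : ℚ⟨t⟩ → ℚ⟨t⟩ → ℚ⟨t⟩
frac p d d≉0 + frac q e e≉0 = frac (p *ₚ e +ₚ q *ₚ d) (d *ₚ e) (*ₚ-≉0 d e d≉0 e≉0)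

_*_ : ℚ⟨t⟩ → ℚ⟨t⟩ → ℚ⟨t⟩
frac p d d≉0 * frac q e e≉0 = frac (p *ₚ q) (d *ₚ e) (*ₚ-≉0 d e d≉0 e≉0)

∏ : List A → (A → ℚ⟨t⟩) → ℚ⟨t⟩
∏ xs f = foldr (λ x → f x *_) ⟦ 1ₚ ⟧ xs

------------------------------------------------------------------------
-- The symmetric group S_n, n = suc m.  Indices start at 0.  Library
-- composition is diagrammatic: the product uv, k ↦ u (v k), is v ∘ₚ u.

s : Fin m → Permutation′ (suc m)
s i = transpose (inject₁ i) (suc i)

-- i₁ ⋯ iᵣ ↦ s_{i₁} ⋯ s_{iᵣ}
eval : List (Fin m) → Permutation′ (suc m)
eval []       = Perm.id
eval (i ∷ is) = eval is ∘ₚ s i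

Reduced : Permutation′ (suc m) → List (Fin m) → Set
Reduced w is = eval is ≈ w × (∀ js → eval js ≈ w → length is ≤ length js)

-- The reduced word chosen below is read off from the Lehmer code: if w
-- sends the first index to j then w = s_{j-1} ⋯ s_0 · lift₀ (remove 0F w).

down : Fin (suc m) → List (Fin m)
down zero            = []
down {suc m} (suc i) = map suc (down i) ++ 0F ∷ []

lehmer : Permutation′ (suc m) → List (Fin m)
lehmer {zero}  w = []
lehmer {suc m} w = down (w ⟨$⟩ʳ 0F) ++ map suc (lehmer (remove 0F w))

s-suc : ∀ (i : Fin m) k → s (suc i) ⟨$⟩ʳ k ≡ lift₀ (s i) ⟨$⟩ʳ k
s-suc i = Perm.lift₀-transpose (inject₁ i) (suc i)

eval-++ : ∀ (is js : List (Fin m)) k →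
          eval (is ++ js) ⟨$⟩ʳ k ≡ eval is ⟨$⟩ʳ (eval js ⟨$⟩ʳ k)
eval-++ []       js k = refl
eval-++ (i ∷ is) js k = cong (s i ⟨$⟩ʳ_) (eval-++ is js k)

eval-map-suc : ∀ (is : List (Fin m)) k → eval (map suc is) ⟨$⟩ʳ k ≡ lift₀ (eval is) ⟨$⟩ʳ k
eval-map-suc []       zero    = refl
eval-map-suc []       (suc k) = refl
eval-map-suc (i ∷ is) k =
  trans (cong (s (suc i) ⟨$⟩ʳ_) (eval-map-suc is k))
    (trans (s-suc i _) (Perm.lift₀-comp (eval is) (s i) k))

eval-down-0 : ∀ (j : Fin (suc m)) → eval (down j) ⟨$⟩ʳ 0F ≡ j
eval-down-0 zero            = refl
eval-down-0 {suc m} (suc j) =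
  trans (eval-++ (map suc (down j)) (0F ∷ []) 0F)
    (trans (eval-map-suc (down j) 1F) (cong suc (eval-down-0 j)))

eval-down-suc : ∀ (j : Fin (suc m)) k → eval (down j) ⟨$⟩ʳ suc k ≡ punchIn j k
eval-down-suc zero            k       = refl
eval-down-suc {suc m} (suc j) zero    =
  trans (eval-++ (map suc (down j)) (0F ∷ []) 1F) (eval-map-suc (down j) 0F)
eval-down-suc {suc m} (suc j) (suc k) =
  trans (eval-++ (map suc (down j)) (0F ∷ []) (suc (suc k)))
    (trans (eval-map-suc (down j) (suc (suc k))) (cong suc (eval-down-suc j k)))

length-down : ∀ (j : Fin (suc m)) → length (down j) ≡ toℕ j
length-down zero            = refl
length-down {suc m} (suc j) = begin
  length (map suc (down j) ++ 0F ∷ [])      ≡⟨ Listₚ.length-++ (map suc (down j)) ⟩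
  length (map suc (down j)) ℕ.+ 1           ≡⟨ cong (ℕ._+ 1) (Listₚ.length-map suc (down j)) ⟩
  length (down j) ℕ.+ 1                     ≡⟨ cong (ℕ._+ 1) (length-down j) ⟩
  toℕ j ℕ.+ 1                               ≡⟨ ℕₚ.+-comm (toℕ j) 1 ⟩
  suc (toℕ j)                               ∎
  where open ≡-Reasoning

eval-lehmer : ∀ (w : Permutation′ (suc m)) → eval (lehmer w) ≈ w
eval-lehmer {zero}  w zero with w ⟨$⟩ʳ 0F
... | zero = refl
eval-lehmer {suc m} w k =
  trans (eval-++ (down (w ⟨$⟩ʳ 0F)) _ k)
    (trans (cong (eval (down (w ⟨$⟩ʳ 0F)) ⟨$⟩ʳ_) (eval-map-suc (lehmer (remove 0F w)) k)) (rest k))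
  where
  rest : ∀ k → eval (down (w ⟨$⟩ʳ 0F)) ⟨$⟩ʳ (lift₀ (eval (lehmer (remove 0F w))) ⟨$⟩ʳ k) ≡ w ⟨$⟩ʳ k
  rest zero    = eval-down-0 (w ⟨$⟩ʳ 0F)
  rest (suc k) = trans (eval-down-suc (w ⟨$⟩ʳ 0F) _)
    (trans (cong (punchIn (w ⟨$⟩ʳ 0F)) (eval-lehmer (remove 0F w) k)) (sym (Perm.punchIn-permute w 0F k)))

-- The length of lehmer w, by recursion
inv : Permutation′ (suc m) → ℕ
inv {zero}  w = 0
inv {suc m} w = toℕ (w ⟨$⟩ʳ 0F) ℕ.+ inv (remove 0F w)

length-lehmer : ∀ (w : Permutation′ (suc m)) → length (lehmer w) ≡ inv w
length-lehmer {zero}  w = refl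
length-lehmer {suc m} w =
  trans (Listₚ.length-++ (down (w ⟨$⟩ʳ 0F)))
    (cong₂ ℕ._+_ (length-down (w ⟨$⟩ʳ 0F))
      (trans (Listₚ.length-map suc (lehmer (remove 0F w))) (length-lehmer (remove 0F w))))

remove-cong : ∀ (v w : Permutation′ (suc m)) → v ≈ w → remove 0F v ≈ remove 0F w
remove-cong v w v≈w k = Finₚ.punchIn-injective (w ⟨$⟩ʳ 0F) _ _ (begin
  punchIn (w ⟨$⟩ʳ 0F) (remove 0F v ⟨$⟩ʳ k)  ≡⟨ cong (λ j → punchIn j (remove 0F v ⟨$⟩ʳ k)) (v≈w 0F) ⟨
  punchIn (v ⟨$⟩ʳ 0F) (remove 0F v ⟨$⟩ʳ k)  ≡⟨ Perm.punchIn-permute v 0F k ⟨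
  v ⟨$⟩ʳ suc k                              ≡⟨ v≈w (suc k) ⟩
  w ⟨$⟩ʳ suc k                              ≡⟨ Perm.punchIn-permute w 0F k ⟩
  punchIn (w ⟨$⟩ʳ 0F) (remove 0F w ⟨$⟩ʳ k)  ∎)
  where open ≡-Reasoning

inv-cong : ∀ (v w : Permutation′ (suc m)) → v ≈ w → inv v ≡ inv w
inv-cong {zero}  v w v≈w = refl
inv-cong {suc m} v w v≈w =
  cong₂ ℕ._+_ (cong toℕ (v≈w 0F)) (inv-cong (remove 0F v) (remove 0F w) (remove-cong v w v≈w))

-- How s i meets the deletion of a value j
data Meet {m} (i : Fin (suc m)) (j : Fin (suc (suc m))) : Set where
  move : (∀ k → s i ⟨$⟩ʳ punchIn j k ≡ punchIn (s i ⟨$⟩ʳ j) k) →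
         toℕ (s i ⟨$⟩ʳ j) ≤ suc (toℕ j) → Meet i j
  pass : (i′ : Fin m) → s i ⟨$⟩ʳ j ≡ j →
         (∀ k → s i ⟨$⟩ʳ punchIn j k ≡ punchIn j (s i′ ⟨$⟩ʳ k)) → Meet i j

meet : ∀ (i : Fin (suc m)) j → Meet i j
meet zero zero = move (λ { zero → refl ; (suc k) → refl }) (s≤s z≤n)
meet zero (suc zero) = move (λ { zero → refl ; (suc k) → refl }) z≤n
meet {suc m} zero (suc (suc j)) =
  pass zero refl (λ { zero → refl ; (suc zero) → refl ; (suc (suc k)) → refl })
meet {suc m} (suc i) zero = pass i refl (λ k → s-suc i (suc k))
meet {suc m} (suc i) (suc j) with meet i j
... | move f b = move g (subst (λ x → toℕ x ≤ suc (suc (toℕ j))) (sym (s-suc i (suc j))) (s≤s b))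
  where
  g : ∀ k → s (suc i) ⟨$⟩ʳ punchIn (suc j) k ≡ punchIn (s (suc i) ⟨$⟩ʳ suc j) k
  g k = trans (s-suc i (punchIn (suc j) k))
          (trans (h k) (cong (λ x → punchIn x k) (sym (s-suc i (suc j)))))
    where
    h : ∀ k → lift₀ (s i) ⟨$⟩ʳ punchIn (suc j) k ≡ punchIn (suc (s i ⟨$⟩ʳ j)) k
    h zero    = refl
    h (suc k) = cong suc (f k)
... | pass i′ e f = pass (suc i′) (trans (s-suc i (suc j)) (cong suc e)) g
  where
  g : ∀ k → s (suc i) ⟨$⟩ʳ punchIn (suc j) k ≡ punchIn (suc j) (s (suc i′) ⟨$⟩ʳ k)
  g zero    = s-suc i zero
  g (suc k) = trans (s-suc i (suc (punchIn j k)))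
                (trans (cong suc (f k)) (cong (punchIn (suc j)) (sym (s-suc i′ (suc k)))))

inv-s-step : ∀ (i : Fin (suc m)) w → Meet i (w ⟨$⟩ʳ 0F) →
             (∀ i′ → inv (remove 0F w ∘ₚ s i′) ≤ suc (inv (remove 0F w))) →
             inv (w ∘ₚ s i) ≤ suc (inv w)
inv-s-step i w (move f b) _ = ℕₚ.+-mono-≤ b bound
  where
  open ≡-Reasoning
  same : remove 0F (w ∘ₚ s i) ≈ remove 0F w
  same k = Finₚ.punchIn-injective (s i ⟨$⟩ʳ (w ⟨$⟩ʳ 0F)) _ _ (begin
    punchIn (s i ⟨$⟩ʳ (w ⟨$⟩ʳ 0F)) (remove 0F (w ∘ₚ s i) ⟨$⟩ʳ k)  ≡⟨ Perm.punchIn-permute (w ∘ₚ s i) 0F k ⟨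
    s i ⟨$⟩ʳ (w ⟨$⟩ʳ suc k)                                       ≡⟨ cong (s i ⟨$⟩ʳ_) (Perm.punchIn-permute w 0F k) ⟩
    s i ⟨$⟩ʳ punchIn (w ⟨$⟩ʳ 0F) (remove 0F w ⟨$⟩ʳ k)             ≡⟨ f _ ⟩
    punchIn (s i ⟨$⟩ʳ (w ⟨$⟩ʳ 0F)) (remove 0F w ⟨$⟩ʳ k)           ∎)
  bound : inv (remove 0F (w ∘ₚ s i)) ≤ inv (remove 0F w)
  bound = ℕₚ.≤-reflexive (inv-cong (remove 0F (w ∘ₚ s i)) (remove 0F w) same)
inv-s-step i w (pass i′ e f) IH = ℕₚ.≤-trans
      (ℕₚ.+-mono-≤ (ℕₚ.≤-reflexive (cong toℕ e)) bound)
      (ℕₚ.≤-reflexive (ℕₚ.+-suc (toℕ (w ⟨$⟩ʳ 0F)) (inv (remove 0F w))))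
  where
  open ≡-Reasoning
  same : remove 0F (w ∘ₚ s i) ≈ remove 0F w ∘ₚ s i′
  same k = Finₚ.punchIn-injective (w ⟨$⟩ʳ 0F) _ _ (begin
    punchIn (w ⟨$⟩ʳ 0F) (remove 0F (w ∘ₚ s i) ⟨$⟩ʳ k)             ≡⟨ cong (λ j → punchIn j (remove 0F (w ∘ₚ s i) ⟨$⟩ʳ k)) e ⟨
    punchIn (s i ⟨$⟩ʳ (w ⟨$⟩ʳ 0F)) (remove 0F (w ∘ₚ s i) ⟨$⟩ʳ k)  ≡⟨ Perm.punchIn-permute (w ∘ₚ s i) 0F k ⟨
    s i ⟨$⟩ʳ (w ⟨$⟩ʳ suc k)                                       ≡⟨ cong (s i ⟨$⟩ʳ_) (Perm.punchIn-permute w 0F k) ⟩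
    s i ⟨$⟩ʳ punchIn (w ⟨$⟩ʳ 0F) (remove 0F w ⟨$⟩ʳ k)             ≡⟨ f _ ⟩
    punchIn (w ⟨$⟩ʳ 0F) (s i′ ⟨$⟩ʳ (remove 0F w ⟨$⟩ʳ k))          ∎)
  bound : inv (remove 0F (w ∘ₚ s i)) ≤ suc (inv (remove 0F w))
  bound = subst (_≤ suc (inv (remove 0F w)))
    (sym (inv-cong (remove 0F (w ∘ₚ s i)) (remove 0F w ∘ₚ s i′) same)) (IH i′)

inv-s : ∀ (i : Fin m) w → inv (w ∘ₚ s i) ≤ suc (inv w)
inv-s {suc m} i w =
  inv-s-step i w (meet i (w ⟨$⟩ʳ 0F)) (λ i′ → inv-s i′ (remove 0F w))

inv-id : inv (Perm.id {suc m}) ≡ 0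
inv-id {zero}  = refl
inv-id {suc m} = trans (inv-cong (remove 0F Perm.id) (Perm.id {suc m}) same) (inv-id {m})
  where
  same : remove 0F (Perm.id {suc (suc m)}) ≈ Perm.id
  same k = Finₚ.suc-injective (sym (Perm.punchIn-permute Perm.id 0F k))

inv-eval : ∀ (is : List (Fin m)) → inv (eval is) ≤ length is
inv-eval {m} []   = ℕₚ.≤-reflexive (inv-id {m})
inv-eval (i ∷ is) = ℕₚ.≤-trans (inv-s i (eval is)) (s≤s (inv-eval is))

reducedWord : ∀ (w : Permutation′ (suc m)) → ∃[ is ] Reduced w is
reducedWord w = lehmer w , eval-lehmer w , λ js e →
  ℕₚ.≤-trans (ℕₚ.≤-reflexive (trans (length-lehmer w) (sym (inv-cong (eval js) w e)))) (inv-eval js)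

ℓ : Permutation′ (suc m) → ℕ
ℓ w = length (proj₁ (reducedWord w))

-- Every permutation occurs exactly once up to ≈, the one sending 0F to j
-- being insert 0F j of a permutation of the remaining indices.
𝔖 : ∀ n → List (Permutation′ n)
𝔖 zero    = Perm.id ∷ []
𝔖 (suc n) = concatMap (λ j → map (insert 0F j) (𝔖 n)) (allFin (suc n))

Weight : ℕ → Set
Weight n = Fin n → ℤ

infixr 7 _⋆_
_⋆_ : Permutation′ n → Weight n → Weight n
(w ⋆ μ) i = μ (w ⟨$⟩ˡ i)

fixes? : ∀ (μ : Weight n) (w : Permutation′ n) → Dec (∀ i → (w ⋆ μ) i ≡ μ i)
fixes? μ w = Finₚ.all? (λ i → (w ⋆ μ) i ℤₚ.≟ μ i)

Stab : Weight n → List (Permutation′ n)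
Stab {n} μ = filter (fixes? μ) (𝔖 n)

W : Weight (suc m) → ℤ[t]
W μ = ∑ₚ (Stab μ) λ w → t ^ₚ ℓ w

-- ϖ k = ε₁ + ⋯ + εₖ
ϖ : ℕ → Weight n
ϖ k i with toℕ i ℕₚ.<? k
... | yes _ = 1ℤ
... | no  _ = 0ℤ

------------------------------------------------------------------------
-- The affine Hecke algebra of rank n = suc m: the ℤ[t^±1]-algebra given
-- by generators and relations, as terms modulo the congruence _≈ᴴ_.
-- ι a is the multiple a·1 of the unit.

infixl 6 _+ᴴ_
infixl 7 _*ᴴ_

data H (m : ℕ) : Set where
  ι         : ℤ[t^±1] → H m
  T         : Fin m → H m
  X X⁻¹     : Fin (suc m) → H m
  _+ᴴ_ _*ᴴ_ : H m → H m → H m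

0ᴴ 1ᴴ : H m
0ᴴ = ι ⟦ 0ₚ ⟧ₗ
1ᴴ = ι ⟦ 1ₚ ⟧ₗ

infix 4 _≈ᴴ_
data _≈ᴴ_ {m} : H m → H m → Set where
  reflᴴ  : ∀ {x} → x ≈ᴴ x
  symᴴ   : ∀ {x y} → x ≈ᴴ y → y ≈ᴴ x
  transᴴ : ∀ {x y z} → x ≈ᴴ y → y ≈ᴴ z → x ≈ᴴ z
  +-cong : ∀ {x x′ y y′} → x ≈ᴴ x′ → y ≈ᴴ y′ → x +ᴴ y ≈ᴴ x′ +ᴴ y′
  *-cong : ∀ {x x′ y y′} → x ≈ᴴ x′ → y ≈ᴴ y′ → x *ᴴ y ≈ᴴ x′ *ᴴ y′

  +-assoc     : ∀ x y z → (x +ᴴ y) +ᴴ z ≈ᴴ x +ᴴ (y +ᴴ z)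
  +-comm      : ∀ x y → x +ᴴ y ≈ᴴ y +ᴴ x
  +-identityˡ : ∀ x → 0ᴴ +ᴴ x ≈ᴴ x
  +-inverseˡ  : ∀ x → ι ⟦ -ₚ 1ₚ ⟧ₗ *ᴴ x +ᴴ x ≈ᴴ 0ᴴ
  *-assoc     : ∀ x y z → (x *ᴴ y) *ᴴ z ≈ᴴ x *ᴴ (y *ᴴ z)
  *-identityˡ : ∀ x → 1ᴴ *ᴴ x ≈ᴴ x
  *-identityʳ : ∀ x → x *ᴴ 1ᴴ ≈ᴴ x
  distribˡ    : ∀ x y z → x *ᴴ (y +ᴴ z) ≈ᴴ x *ᴴ y +ᴴ x *ᴴ z
  distribʳ    : ∀ x y z → (y +ᴴ z) *ᴴ x ≈ᴴ y *ᴴ x +ᴴ z *ᴴ x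

  ι-cong    : ∀ {a b} → a ≈ₗ b → ι a ≈ᴴ ι b
  ι-+       : ∀ a b → ι (a +ₗ b) ≈ᴴ ι a +ᴴ ι b
  ι-*       : ∀ a b → ι (a *ₗ b) ≈ᴴ ι a *ᴴ ι b
  ι-central : ∀ a x → ι a *ᴴ x ≈ᴴ x *ᴴ ι a

  quadratic : ∀ i → T i *ᴴ T i ≈ᴴ ι ⟦ t +ₚ -ₚ 1ₚ ⟧ₗ *ᴴ T i +ᴴ ι ⟦ t ⟧ₗ
  braid     : ∀ i j → toℕ j ≡ suc (toℕ i) →
              T i *ᴴ T j *ᴴ T i ≈ᴴ T j *ᴴ T i *ᴴ T j
  T-comm    : ∀ i j → 1 < ∣ toℕ i - toℕ j ∣ → T i *ᴴ T j ≈ᴴ T j *ᴴ T i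
  X-comm    : ∀ i j → X i *ᴴ X j ≈ᴴ X j *ᴴ X i
  X-X⁻¹     : ∀ i → X i *ᴴ X⁻¹ i ≈ᴴ 1ᴴ
  X⁻¹-X     : ∀ i → X⁻¹ i *ᴴ X i ≈ᴴ 1ᴴ
  TXT       : ∀ i → T i *ᴴ X (inject₁ i) *ᴴ T i ≈ᴴ ι ⟦ t ⟧ₗ *ᴴ X (suc i)
  TX-comm   : ∀ i j → j ≢ inject₁ i → j ≢ suc i → T i *ᴴ X j ≈ᴴ X j *ᴴ T i

∑ᴴ : List A → (A → H m) → H m
∑ᴴ xs f = foldr (λ x → f x +ᴴ_) 0ᴴ xs

T[_] : Permutation′ (suc m) → H m
T[ w ] = foldr (λ i → T i *ᴴ_) 1ᴴ (proj₁ (reducedWord w))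

-- H_{n,μ}
_∈H⟨_⟩ : H m → Weight (suc m) → Set
_∈H⟨_⟩ {m} x μ = Σ[ a ∈ (Permutation′ (suc m) → ℤ[t^±1]) ]
  x ≈ᴴ ∑ᴴ (Stab μ) (λ w → ι (a w) *ᴴ T[ w ])

𝟏 : Weight (suc m) → H m
𝟏 μ = ∑ᴴ (Stab μ) T[_]

IsInverse : H m → H m → Set
IsInverse x y = x *ᴴ y ≈ᴴ 1ᴴ × y *ᴴ x ≈ᴴ 1ᴴ

------------------------------------------------------------------------
-- Columns: Column n k is B(ϖ_k), a column being a k-element subset of [n].

record Column (n k : ℕ) : Set where
  constructor col
  field
    set   : Subset n
    .size : ∣ set ∣ ≡ k

open Column public using (set)

-- The elements of p in increasing order
elements : (p : Subset n) → Vec (Fin n) ∣ p ∣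
elements []            = []
elements (inside  ∷ p) = 0F ∷ Vec.map suc (elements p)
elements (outside ∷ p) = Vec.map suc (elements p)

entry : Column n k → Fin k → Fin n
entry (col p e) i = lookup (elements p) (Fin.cast (sym e) i)

infix 4 _⊑_
_⊑_ : Column n k → Column n k → Set
E ⊑ F = ∀ i → entry E i Fin.≤ entry F i

-- One-line notation of uPerm p: elements of p, then those of its
-- complement, each in increasing order.  If 0F ∉ p then 0F is the value
-- at position ∣ p ∣.
uPerm : Subset n → Permutation′ n
uPerm []            = Perm.id
uPerm (inside  ∷ p) = lift₀ (uPerm p)
uPerm (outside ∷ p) = insert (fromℕ< (s≤s (∣p∣≤n p))) 0F (uPerm p)

u : Column n k → Permutation′ n
u C = uPerm (set C)

columns : ∀ n k → List (Column n k)
columns zero    zero    = col [] refl ∷ []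
columns zero    (suc k) = []
columns (suc n) zero    = map (λ (col p e) → col (outside ∷ p) e) (columns n zero)
columns (suc n) (suc k) = map (λ (col p e) → col (inside ∷ p) (cong suc e)) (columns n k)
                       ++ map (λ (col p e) → col (outside ∷ p) e) (columns n (suc k))

∣tabulate∣ : ∀ (f : Fin n → _) → ∣ tabulate f ∣ ≡ sum (λ i → if f i then 1 else 0)
∣tabulate∣ {zero}  f = refl
∣tabulate∣ {suc n} f with f 0F
... | true  = cong suc (∣tabulate∣ (λ i → f (suc i)))
... | false = ∣tabulate∣ (λ i → f (suc i))

∣image∣ : ∀ (w : Permutation′ n) p → ∣ tabulate (λ i → lookup p (w ⟨$⟩ˡ i)) ∣ ≡ ∣ p ∣
∣image∣ w p = begin
  ∣ tabulate (λ i → lookup p (w ⟨$⟩ˡ i)) ∣               ≡⟨ ∣tabulate∣ (λ i → lookup p (w ⟨$⟩ˡ i)) ⟩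
  sum (λ i → if lookup p (w ⟨$⟩ˡ i) then 1 else 0)       ≡⟨ sum-permute (λ i → if lookup p i then 1 else 0) (flip w) ⟨
  sum (λ i → if lookup p i then 1 else 0)                ≡⟨ ∣tabulate∣ (lookup p) ⟨
  ∣ tabulate (lookup p) ∣                                ≡⟨ cong ∣_∣ (Vecₚ.tabulate∘lookup p) ⟩
  ∣ p ∣                                                  ∎
  where open ≡-Reasoning

-- The image of a column under a permutation
infixr 7 _·_
_·_ : Permutation′ n → Column n k → Column n k
w · col p e = col (tabulate (λ i → lookup p (w ⟨$⟩ˡ i))) (trans (∣image∣ w p) e)

------------------------------------------------------------------------
-- Tensors C_r ⊗ ⋯ ⊗ C_1, indexed by the length of the leftmost column.

data Tensor (n : ℕ) : ℕ → Set where
  single : .(1 ≤ k) → Column n k → Tensor n k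
  cons   : .(k ≤ l) → Column n l → Tensor n k → Tensor n l

leftmost : Tensor n k → Column n k
leftmost (single _ C) = C
leftmost (cons _ C _) = C

pair : .(1 ≤ k) → .(k ≤ l) → Column n l → Column n k → Tensor n l
pair 1≤k k≤l F E = cons k≤l F (single 1≤k E)

1≤ : Tensor n k → 1 ≤ k
1≤ (single 1≤k _)   = recompute (1 ℕₚ.≤? _) 1≤k
1≤ (cons k≤l _ S) = ℕₚ.≤-trans (1≤ S) (recompute (_ ℕₚ.≤? _) k≤l)

-- The two-column tensors C_{i+1} ⊗ C_i
neighbours : Tensor n k → List (∃ (Tensor n))
neighbours (single _ _)   = []
neighbours (cons k≤l C S) = (_ , pair (1≤ S) k≤l C (leftmost S)) ∷ neighbours S

shape : Tensor n k → Weight n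
shape (single {k} _ _) i = ϖ k i
shape (cons {l = l} _ _ S) i = ϖ l i ℤ.+ shape S i

Semistandard : .(k ≤ l) → Column n l → Column n k → Set
Semistandard k≤l F E = ∀ i → entry F (inject≤ i k≤l) Fin.≤ entry E i

------------------------------------------------------------------------
-- Ψ and ψ̃, as relations: in the quotient H the inverses, the components
-- h_F and the coefficients a_w are determined by their defining equations
-- and not computed from a representing term.

t^ : ℕ → H m
t^ d = ι ⟦ t ^ₚ d ⟧ₗ

-- IsΨ S x: x represents Ψ_S
IsΨ : Tensor (suc m) k → H m → Set
IsΨ (single {k} _ C) x = ∃[ y ]
    IsInverse T[ flip (u C) ] y
  × x ≈ᴴ t^ (ℓ (u C)) *ᴴ (y *ᴴ 𝟏 (ϖ k))
IsΨ {m} (cons {l = l} _ C S) x = ∃[ z ] Σ[ h ∈ (Column (suc m) l → H m) ] ∃[ y ]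
    IsΨ S z
  × (∀ F → h F ∈H⟨ ϖ l ⟩)
  × z ≈ᴴ ∑ᴴ (columns (suc m) l) (λ F → T[ u F ] *ᴴ h F)
  × IsInverse T[ flip (u C) ] y
  × x ≈ᴴ t^ (ℓ (u C)) *ᴴ (y *ᴴ h C)

-- Isψ̃ S p: p = W_λ(t)⁻¹ ∑ a_w t^ℓ(w), with the (non-zero) W_λ(t) cleared
Isψ̃ : Tensor (suc m) k → ℚ⟨t⟩ → Set
Isψ̃ {m} S p = ∃[ x ] Σ[ a ∈ (Permutation′ (suc m) → ℤ[t^±1]) ]
    IsΨ S x
  × x ≈ᴴ ∑ᴴ (𝔖 (suc m)) (λ w → ι (a w) *ᴴ T[ w ])
  × ⟦ W (shape S) ⟧ * p ≃ fromLaurent (∑ₗ (𝔖 (suc m)) (λ w → a w *ₗ ⟦ t ^ₚ ℓ w ⟧ₗ))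

{-# OPTIONS --safe #-}

-- H acts on functions on words: T_i acts on the letters i and i+1 by the
-- R-matrix, and the X_i act through Jucys–Murphy elements.  On words in n
-- letters the action is faithful on the span of the T_w, so the components
-- h_F are unique.  On words in two letters it contains, for each b, the module
-- induced from the index character of H_{n,ϖ_b}, with basis v_F = T_{u_F} v_b;
-- if z = Σ T_{u_F} h_F, the index character of h_F is the coefficient of v_F
-- in z v_b.
--
-- Let C be the leftmost column of S, of length k.  As Ψ_S is right invariant
-- under the T_i with i > k, so is its component along any column; hence such a
-- component h acts on v_b, b ≥ k, like its index character times
-- 𝟏_{ϖ_k} / W_{ϖ_k}.  So Ψ_S v_b is a multiple of Ψ_C v_b, and the values
-- factor over neighbouring columns; the denominators match because
-- W_λ W_{ϖ_k + ϖ_b} = W_{ϖ_k} W_{λ + ϖ_b}.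
--
-- Finally 𝟏_{ϖ_a} v_b = W_{ϖ_a + ϖ_b} Φ₀, where Φ₀ is the sum of the v_G with
-- G ⊇ {1, …, a}.  So ψ̃ of F ⊗ E is the coefficient of v_F in
-- t^ℓ(u_E) (T_{u_E⁻¹})⁻¹ Φ₀, and (2) is the effect of t T_j⁻¹ on it.

module Submission where

open import Defs
open import Algebra.Bundles using (CommutativeRing; CommutativeMonoid; Ring)
open import Data.Bool.Base using (Bool; true; false; if_then_else_)
import Data.Bool.Properties as Boolₚ
open import Data.Empty using (⊥-elim)
open import Data.Fin.Base as Fin using (Fin; zero; suc; toℕ; fromℕ<; inject₁; inject≤; punchIn)
open import Data.Fin.Patterns using (0F; 1F)
import Data.Fin.Properties as Finₚ
open import Data.Fin.Permutation as Perm
  using (Permutation′; _⟨$⟩ʳ_; _⟨$⟩ˡ_; _≈_; _∘ₚ_; insert; remove; flip; inverseˡ; inverseʳ)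
open import Data.Fin.Subset using (Subset; inside; outside; ∣_∣)
open import Data.Fin.Subset.Properties using (∣p∣≤n)
open import Data.Integer.Base as ℤ using (ℤ; 0ℤ; 1ℤ)
import Data.Integer.Properties as ℤₚ
open import Data.List.Base as List
  using (List; []; _∷_; _++_; map; foldr; length; reverse; concatMap; filter; allFin)
import Data.List.Properties as Listₚ
open import Data.List.Membership.Propositional using (_∈_)
import Data.List.Membership.Propositional.Properties as ∈ₚ
open import Data.List.Relation.Unary.All as All using (All; []; _∷_)
import Data.List.Relation.Unary.All.Properties as Allₚ
open import Data.List.Relation.Unary.Any as Any using (here; there)
open import Data.List.Relation.Unary.AllPairs as AllPairs using (AllPairs; []; _∷_)
import Data.List.Relation.Unary.AllPairs.Properties as AllPairsₚ
open import Data.Nat.Base as ℕ using (ℕ; zero; suc; _≤_; _<_; s≤s; z≤n; ∣_-_∣)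
import Data.Nat.Properties as ℕₚ
open import Data.Product.Base using (∃; ∃-syntax; Σ-syntax; _×_; _,_; proj₁; proj₂)
open import Data.Sum.Base using (inj₁; inj₂)
open import Data.Vec.Base as Vec using (Vec; []; _∷_; lookup; tabulate)
import Data.Vec.Properties as Vecₚ
open import Function.Bundles using (_⇔_; mk⇔)
open import Level using (0ℓ)
open import Relation.Binary.Bundles using (Setoid)
open import Relation.Binary.Definitions using (DecidableEquality; tri<; tri≈; tri>)
open import Relation.Binary.PropositionalEquality
  using (_≡_; _≢_; refl; sym; trans; cong; cong₂; subst; subst₂; module ≡-Reasoning)
open import Relation.Binary.Structures using (IsEquivalence)
open import Relation.Nullary using (¬_; Dec; yes; no; contradiction; does; recompute)
import Algebra.Properties.AbelianGroup
import Algebra.Properties.Ring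
import Algebra.Solver.Ring.NaturalCoefficients.Default as NatSolver
import Relation.Binary.Reasoning.Setoid as SetoidReasoning

-- `H` is given by generators and relations only, so linear independence has to be earned: an
-- equation between elements of H_n may be derived through terms containing the X_j, and only a
-- representation of the whole presentation pins down the coefficients a_w and the components h_F.
-- Existence is proved inside `H`: the span of the T_w and the set of decomposable elements contain
-- 1 and absorb T_i from the left. Distinct letters are what makes the action faithful. The
-- numerator Σ a_w t^ℓ(w) is read off on two-letter words, where the constant word spans the index
-- representation of H_n. The quotient 𝟏_{ϖ_k} / W_{ϖ_k} is never formed: identities are kept
-- multiplied by W and cancelled at the end, which is legitimate because W has constant term 1 and
-- ℤ[t] has no zero divisors. The Lehmer code drives most inductions. Deleting the first position
-- maps the stabiliser of a dominant weight onto that of its tail, so reduced words, W, 𝟏 and the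
-- action of 𝟏 all split along the first position.

private
  variable
    A : Set
    m n k l : ℕ

-- Arithmetic of ℤ[t] and of its fraction field

-- _≈ₚ_ and _≃_ unfold, which hides their arguments from unification.

infix 4 _≋_ _≅_

record _≋_ (p q : ℤ[t]) : Set where
  constructor mk≋
  field at : p ≈ₚ q

open _≋_

record _≅_ (x y : ℚ⟨t⟩) : Set where
  constructor mk≅
  field un : x ≃ y

open _≅_

lift≋ : ∀ p q → p ≈ₚ q → p ≋ q
lift≋ p q = mk≋

≋-isEquivalence : IsEquivalence _≋_
≋-isEquivalence = record
  { refl  = mk≋ λ _ → refl
  ; sym   = λ e → mk≋ λ i → sym (at e i)
  ; trans = λ e f → mk≋ λ i → trans (at e i) (at f i)
  }

module ≋ = IsEquivalence ≋-isEquivalence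

coeff-neg : ∀ p i → coeff (-ₚ p) i ≡ ℤ.- coeff p i
coeff-neg []      i       = refl
coeff-neg (a ∷ p) zero    = refl
coeff-neg (a ∷ p) (suc i) = coeff-neg p i

+ₚ-cong : ∀ {p p′ q q′} → p ≋ p′ → q ≋ q′ → p +ₚ q ≋ p′ +ₚ q′
+ₚ-cong {p} {p′} {q} {q′} e f = mk≋ λ i →
  trans (coeff-+ₚ p q i) (trans (cong₂ ℤ._+_ (at e i) (at f i)) (sym (coeff-+ₚ p′ q′ i)))

-ₚ-cong : ∀ {p q} → p ≋ q → -ₚ p ≋ -ₚ q
-ₚ-cong {p} {q} e = mk≋ λ i →
  trans (coeff-neg p i) (trans (cong ℤ.-_ (at e i)) (sym (coeff-neg q i)))

+ₚ-assoc : ∀ p q r → p +ₚ q +ₚ r ≋ p +ₚ (q +ₚ r)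
+ₚ-assoc p q r = mk≋ go
  where
  go : p +ₚ q +ₚ r ≈ₚ p +ₚ (q +ₚ r)
  go i rewrite coeff-+ₚ (p +ₚ q) r i | coeff-+ₚ p q i | coeff-+ₚ p (q +ₚ r) i | coeff-+ₚ q r i =
    ℤₚ.+-assoc (coeff p i) _ _

+ₚ-comm : ∀ p q → p +ₚ q ≋ q +ₚ p
+ₚ-comm p q = mk≋ λ i →
  trans (coeff-+ₚ p q i) (trans (ℤₚ.+-comm (coeff p i) _) (sym (coeff-+ₚ q p i)))

+ₚ-identityʳ : ∀ p → p +ₚ [] ≋ p
+ₚ-identityʳ p = mk≋ λ i → trans (coeff-+ₚ p [] i) (ℤₚ.+-identityʳ _)

+ₚ-inverseʳ : ∀ p → p +ₚ -ₚ p ≋ []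
+ₚ-inverseʳ p = mk≋ λ i → trans (coeff-+ₚ p (-ₚ p) i)
  (trans (cong (λ z → coeff p i ℤ.+ z) (coeff-neg p i)) (ℤₚ.+-inverseʳ (coeff p i)))

infixr 7 _·ₚ_
_·ₚ_ : ℤ → ℤ[t] → ℤ[t]
a ·ₚ p = map (a ℤ.*_) p

∷-cong : ∀ {a b p q} → a ≡ b → p ≋ q → a ∷ p ≋ b ∷ q
∷-cong a≡b e = mk≋ λ { zero → a≡b ; (suc i) → at e i }

·ₚ-distribˡ : ∀ a p q → a ·ₚ (p +ₚ q) ≋ a ·ₚ p +ₚ a ·ₚ q
·ₚ-distribˡ a p q = mk≋ go
  where
  go : a ·ₚ (p +ₚ q) ≈ₚ a ·ₚ p +ₚ a ·ₚ q
  go i rewrite coeff-+ₚ (a ·ₚ p) (a ·ₚ q) i | coeff-scale a (p +ₚ q) i | coeff-+ₚ p q i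
             | coeff-scale a p i | coeff-scale a q i = ℤₚ.*-distribˡ-+ a (coeff p i) _

·ₚ-assoc : ∀ a b p → (a ℤ.* b) ·ₚ p ≋ a ·ₚ (b ·ₚ p)
·ₚ-assoc a b p = mk≋ go
  where
  go : (a ℤ.* b) ·ₚ p ≈ₚ a ·ₚ (b ·ₚ p)
  go i rewrite coeff-scale (a ℤ.* b) p i | coeff-scale a (b ·ₚ p) i | coeff-scale b p i =
    ℤₚ.*-assoc a b (coeff p i)

·ₚ-zero : ∀ p → 0ℤ ·ₚ p ≋ []
·ₚ-zero p = mk≋ λ i → coeff-scale 0ℤ p i

·ₚ-identity : ∀ p → 1ℤ ·ₚ p ≋ p
·ₚ-identity p = mk≋ λ i → trans (coeff-scale 1ℤ p i) (ℤₚ.*-identityˡ _)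

+ₚ-interchange : ∀ p q r u → (p +ₚ q) +ₚ (r +ₚ u) ≋ (p +ₚ r) +ₚ (q +ₚ u)
+ₚ-interchange p q r u =
  ≋.trans (+ₚ-assoc p q (r +ₚ u)) (≋.trans (+ₚ-cong (≋.refl {p}) middle) (≋.sym (+ₚ-assoc p r (q +ₚ u))))
  where
  middle : q +ₚ (r +ₚ u) ≋ r +ₚ (q +ₚ u)
  middle = ≋.trans (≋.sym (+ₚ-assoc q r u))
    (≋.trans (+ₚ-cong (+ₚ-comm q r) (≋.refl {u})) (+ₚ-assoc r q u))

*ₚ-zeroʳ : ∀ p → p *ₚ [] ≋ []
*ₚ-zeroʳ []      = ≋.refl
*ₚ-zeroʳ (a ∷ p) = mk≋ λ { zero → refl ; (suc i) → at (*ₚ-zeroʳ p) i }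

*ₚ-∷ʳ : ∀ a p q → q *ₚ (a ∷ p) ≋ a ·ₚ q +ₚ (0ℤ ∷ q *ₚ p)
*ₚ-∷ʳ a p []      = mk≋ λ { zero → refl ; (suc i) → refl }
*ₚ-∷ʳ a p (b ∷ q) = ∷-cong
  (trans (ℤₚ.+-identityʳ _) (trans (ℤₚ.*-comm b a) (sym (ℤₚ.+-identityʳ _))))
  (≋.trans (+ₚ-cong (≋.refl {b ·ₚ p}) (*ₚ-∷ʳ a p q))
    (≋.trans (≋.sym (+ₚ-assoc (b ·ₚ p) (a ·ₚ q) _))
      (≋.trans (+ₚ-cong (+ₚ-comm (b ·ₚ p) (a ·ₚ q)) ≋.refl) (+ₚ-assoc (a ·ₚ q) (b ·ₚ p) _))))

*ₚ-comm : ∀ p q → p *ₚ q ≋ q *ₚ p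
*ₚ-comm []      q = ≋.sym (*ₚ-zeroʳ q)
*ₚ-comm (a ∷ p) q =
  ≋.trans (+ₚ-cong (≋.refl {a ·ₚ q}) (∷-cong refl (*ₚ-comm p q))) (≋.sym (*ₚ-∷ʳ a p q))

*ₚ-cong : ∀ {p p′ q q′} → p ≋ p′ → q ≋ q′ → p *ₚ q ≋ p′ *ₚ q′
*ₚ-cong {p} {p′} {q} {q′} e f =
  ≋.trans (mk≋ (*ₚ-congʳ p q q′ (at f)))
    (≋.trans (*ₚ-comm p q′) (≋.trans (mk≋ (*ₚ-congʳ q′ p p′ (at e))) (*ₚ-comm q′ p′)))

*ₚ-distribˡ : ∀ p q r → p *ₚ (q +ₚ r) ≋ p *ₚ q +ₚ p *ₚ r
*ₚ-distribˡ []      q r = ≋.refl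
*ₚ-distribˡ (a ∷ p) q r =
  ≋.trans (+ₚ-cong (·ₚ-distribˡ a q r) (∷-cong refl (*ₚ-distribˡ p q r)))
    (+ₚ-interchange (a ·ₚ q) (a ·ₚ r) (0ℤ ∷ p *ₚ q) (0ℤ ∷ p *ₚ r))

*ₚ-distribʳ : ∀ p q r → (q +ₚ r) *ₚ p ≋ q *ₚ p +ₚ r *ₚ p
*ₚ-distribʳ p q r =
  ≋.trans (*ₚ-comm (q +ₚ r) p)
    (≋.trans (*ₚ-distribˡ p q r) (+ₚ-cong (*ₚ-comm p q) (*ₚ-comm p r)))

*ₚ-shiftˡ : ∀ p q → (0ℤ ∷ p) *ₚ q ≋ 0ℤ ∷ p *ₚ q
*ₚ-shiftˡ p q = +ₚ-cong (·ₚ-zero q) (≋.refl {0ℤ ∷ p *ₚ q})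

·ₚ-*ₚ : ∀ a p q → (a ·ₚ p) *ₚ q ≋ a ·ₚ (p *ₚ q)
·ₚ-*ₚ a []      q = ≋.refl
·ₚ-*ₚ a (b ∷ p) q =
  ≋.trans (+ₚ-cong (·ₚ-assoc a b q) (∷-cong (sym (ℤₚ.*-zeroʳ a)) (·ₚ-*ₚ a p q)))
    (≋.sym (·ₚ-distribˡ a (b ·ₚ q) (0ℤ ∷ p *ₚ q)))

*ₚ-assoc : ∀ p q r → p *ₚ q *ₚ r ≋ p *ₚ (q *ₚ r)
*ₚ-assoc []      q r = ≋.refl
*ₚ-assoc (a ∷ p) q r =
  ≋.trans (*ₚ-distribʳ r (a ·ₚ q) (0ℤ ∷ p *ₚ q))
    (+ₚ-cong (·ₚ-*ₚ a q r)
      (≋.trans (*ₚ-shiftˡ (p *ₚ q) r) (∷-cong refl (*ₚ-assoc p q r))))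

*ₚ-identityˡ : ∀ p → 1ₚ *ₚ p ≋ p
*ₚ-identityˡ p =
  ≋.trans (+ₚ-cong (·ₚ-identity p) (mk≋ {0ℤ ∷ []} {[]} λ { zero → refl ; (suc i) → refl })) (+ₚ-identityʳ p)

ℤ[t]-ring : CommutativeRing 0ℓ 0ℓ
ℤ[t]-ring = record
  { Carrier = ℤ[t] ; _≈_ = _≋_ ; _+_ = _+ₚ_ ; _*_ = _*ₚ_ ; -_ = -ₚ_ ; 0# = 0ₚ ; 1# = 1ₚ
  ; isCommutativeRing = record
    { isRing = record
      { +-isAbelianGroup = record
        { isGroup = record
          { isMonoid = record
            { isSemigroup = record
              { isMagma = record { isEquivalence = ≋-isEquivalence ; ∙-cong = +ₚ-cong }
              ; assoc = +ₚ-assoc }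
            ; identity = (λ _ → ≋.refl) , +ₚ-identityʳ }
          ; inverse = (λ p → ≋.trans (+ₚ-comm (-ₚ p) p) (+ₚ-inverseʳ p)) , +ₚ-inverseʳ
          ; ⁻¹-cong = -ₚ-cong }
        ; comm = +ₚ-comm }
      ; *-cong = *ₚ-cong
      ; *-assoc = *ₚ-assoc
      ; *-identity = *ₚ-identityˡ , λ p → ≋.trans (*ₚ-comm p 1ₚ) (*ₚ-identityˡ p)
      ; distrib = *ₚ-distribˡ , *ₚ-distribʳ }
    ; *-comm = *ₚ-comm }
  }

module P = CommutativeRing ℤ[t]-ring
module PSolver = NatSolver P.commutativeSemiring
module PProperties = Algebra.Properties.Ring P.ring

*ₚ-cancelˡ : ∀ d p q → ¬ d ≈ₚ 0ₚ → d *ₚ p ≋ d *ₚ q → p ≋ q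
*ₚ-cancelˡ d p q d≉0 e with *ₚ-≈0 d (p +ₚ -ₚ q) (at zero-product)
  where
  zero-product : d *ₚ (p +ₚ -ₚ q) ≋ 0ₚ
  zero-product = P.trans (*ₚ-distribˡ d p (-ₚ q))
    (P.trans (+ₚ-cong e (P.sym (PProperties.-‿distribʳ-* d q))) (+ₚ-inverseʳ (d *ₚ q)))
... | inj₁ d≈0 = contradiction d≈0 d≉0
... | inj₂ e   = PProperties.x∙y⁻¹≈ε⇒x≈y p q (mk≋ e)

-- Transitivity is where ℤ[t] must be a domain: the middle denominator `e` is cancelled.
≅-isEquivalence : IsEquivalence _≅_
≅-isEquivalence = record
  { refl  = mk≅ λ _ → refl
  ; sym   = λ { (mk≅ e) → mk≅ λ i → sym (e i) }
  ; trans = λ { {frac p d _} {frac q e e≉0} {frac r f _} (mk≅ x) (mk≅ y) → mk≅ (at (*ₚ-cancelˡ e (p *ₚ f) (r *ₚ d) e≉0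
      (let open SetoidReasoning P.setoid in begin
        e *ₚ (p *ₚ f)  ≈⟨ solve 3 (λ e p f → e :* (p :* f) := (p :* e) :* f) P.refl e p f ⟩
        (p *ₚ e) *ₚ f  ≈⟨ *ₚ-cong (lift≋ (p *ₚ e) (q *ₚ d) x) (P.refl {f}) ⟩
        (q *ₚ d) *ₚ f  ≈⟨ solve 3 (λ q d f → (q :* d) :* f := (q :* f) :* d) P.refl q d f ⟩
        (q *ₚ f) *ₚ d  ≈⟨ *ₚ-cong (lift≋ (q *ₚ f) (r *ₚ e) y) (P.refl {d}) ⟩
        (r *ₚ e) *ₚ d  ≈⟨ solve 3 (λ r e d → (r :* e) :* d := e :* (r :* d)) P.refl r e d ⟩
        e *ₚ (r *ₚ d)  ∎))) }
  }
  where open PSolver using (solve; _:=_; _:+_; _:*_; con)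

module ≅ = IsEquivalence ≅-isEquivalence

module _ where
  open PSolver using (solve; _:=_; _:+_; _:*_; con)

  +-congᶠ : ∀ {x x′ y y′} → x ≅ x′ → y ≅ y′ → x + y ≅ x′ + y′
  +-congᶠ {frac p d _} {frac p′ d′ _} {frac q e _} {frac q′ e′ _} (mk≅ x) (mk≅ y) = mk≅ (at (begin
    (p *ₚ e +ₚ q *ₚ d) *ₚ (d′ *ₚ e′)
      ≈⟨ solve 6 (λ p d q e d′ e′ → (p :* e :+ q :* d) :* (d′ :* e′) := (p :* d′) :* (e :* e′) :+ (q :* e′) :*
        (d :* d′)) P.refl p d q e d′ e′ ⟩
    (p *ₚ d′) *ₚ (e *ₚ e′) +ₚ (q *ₚ e′) *ₚ (d *ₚ d′)
      ≈⟨ +ₚ-cong (*ₚ-cong (lift≋ (p *ₚ d′) (p′ *ₚ d) x) (P.refl {e *ₚ e′}))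
        (*ₚ-cong (lift≋ (q *ₚ e′) (q′ *ₚ e) y) (P.refl {d *ₚ d′})) ⟩
    (p′ *ₚ d) *ₚ (e *ₚ e′) +ₚ (q′ *ₚ e) *ₚ (d *ₚ d′)
      ≈⟨ solve 6 (λ p′ d q′ e d′ e′ → (p′ :* d) :* (e :* e′) :+ (q′ :* e) :* (d :* d′) :=
        (p′ :* e′ :+ q′ :* d′) :* (d :* e)) P.refl p′ d q′ e d′ e′ ⟩
    (p′ *ₚ e′ +ₚ q′ *ₚ d′) *ₚ (d *ₚ e) ∎))
    where open SetoidReasoning P.setoid

  *-congᶠ : ∀ {x x′ y y′} → x ≅ x′ → y ≅ y′ → x * y ≅ x′ * y′
  *-congᶠ {frac p d _} {frac p′ d′ _} {frac q e _} {frac q′ e′ _} (mk≅ x) (mk≅ y) = mk≅ (at (begin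
    (p *ₚ q) *ₚ (d′ *ₚ e′)
      ≈⟨ solve 4 (λ p q d′ e′ → (p :* q) :* (d′ :* e′) := (p :* d′) :* (q :* e′)) P.refl p q d′ e′ ⟩
    (p *ₚ d′) *ₚ (q *ₚ e′)
      ≈⟨ *ₚ-cong (lift≋ (p *ₚ d′) (p′ *ₚ d) x) (lift≋ (q *ₚ e′) (q′ *ₚ e) y) ⟩
    (p′ *ₚ d) *ₚ (q′ *ₚ e)
      ≈⟨ solve 4 (λ p q d′ e′ → (p :* d′) :* (q :* e′) := (p :* q) :* (d′ :* e′)) P.refl p′ q′ d e ⟩
    (p′ *ₚ q′) *ₚ (d *ₚ e) ∎))
    where open SetoidReasoning P.setoid

  infix 8 -ᶠ_
  -ᶠ_ : ℚ⟨t⟩ → ℚ⟨t⟩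
  -ᶠ frac p d d≉0 = frac (-ₚ p) d d≉0

  -ᶠ-cong : ∀ {x y} → x ≅ y → -ᶠ x ≅ -ᶠ y
  -ᶠ-cong {frac p d _} {frac q e _} (mk≅ x) = mk≅ (at
    (P.trans (P.sym (PProperties.-‿distribˡ-* p e))
      (P.trans (-ₚ-cong (lift≋ (p *ₚ e) (q *ₚ d) x)) (PProperties.-‿distribˡ-* q d))))

  ℚ⟨t⟩-ring : CommutativeRing 0ℓ 0ℓ
  ℚ⟨t⟩-ring = record
    { Carrier = ℚ⟨t⟩ ; _≈_ = _≅_ ; _+_ = _+_ ; _*_ = _*_ ; -_ = -ᶠ_ ; 0# = ⟦ 0ₚ ⟧ ; 1# = ⟦ 1ₚ ⟧
    ; isCommutativeRing = record
      { isRing = record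
        { +-isAbelianGroup = record
          { isGroup = record
            { isMonoid = record
              { isSemigroup = record
                { isMagma = record { isEquivalence = ≅-isEquivalence ; ∙-cong = +-congᶠ }
                ; assoc = λ { (frac p d _) (frac q e _) (frac r f _) → mk≅ (at (solve 6 (λ p d q e r f →
                    ((p :* e :+ q :* d) :* f :+ r :* (d :* e)) :* (d :* (e :* f))
                    := (p :* (e :* f) :+ (q :* f :+ r :* e) :* d) :* ((d :* e) :* f)) P.refl p d q e r f)) } }
              ; identity = +-idˡ , λ x → ≅.trans (commᶠ x ⟦ 0ₚ ⟧) (+-idˡ x) }
            ; inverse = (λ x → ≅.trans (commᶠ (-ᶠ x) x) (+-invʳ x)) , +-invʳ
            ; ⁻¹-cong = -ᶠ-cong }
          ; comm = commᶠ }
        ; *-cong = *-congᶠ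
        ; *-assoc = λ { (frac p d _) (frac q e _) (frac r f _) → mk≅ (at (solve 6 (λ p d q e r f →
            ((p :* q) :* r) :* (d :* (e :* f)) := (p :* (q :* r)) :* ((d :* e) :* f)) P.refl p d q e r f)) }
        ; *-identity = *-idˡ , λ x → ≅.trans (*-commᶠ x ⟦ 1ₚ ⟧) (*-idˡ x)
        ; distrib = distˡ , λ x y z → ≅.trans (*-commᶠ (y + z) x)
            (≅.trans (distˡ x y z) (+-congᶠ (*-commᶠ x y) (*-commᶠ x z))) }
      ; *-comm = *-commᶠ }
    }
    where
    commᶠ : ∀ x y → x + y ≅ y + x
    commᶠ (frac p d _) (frac q e _) = mk≅ (at (solve 4 (λ p d q e →
      (p :* e :+ q :* d) :* (e :* d) := (q :* d :+ p :* e) :* (d :* e)) P.refl p d q e))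
    *-commᶠ : ∀ x y → x * y ≅ y * x
    *-commᶠ (frac p d _) (frac q e _) = mk≅ (at (solve 4 (λ p d q e →
      (p :* q) :* (e :* d) := (q :* p) :* (d :* e)) P.refl p d q e))
    +-idˡ : ∀ x → ⟦ 0ₚ ⟧ + x ≅ x
    +-idˡ (frac p d _) = mk≅ (at (solve 2 (λ p d →
      (con 0 :* d :+ p :* con 1) :* d := p :* (con 1 :* d)) P.refl p d))
    *-idˡ : ∀ x → ⟦ 1ₚ ⟧ * x ≅ x
    *-idˡ (frac p d _) = mk≅ (at (solve 2 (λ p d →
      (con 1 :* p) :* d := p :* (con 1 :* d)) P.refl p d))
    +-invʳ : ∀ x → x + -ᶠ x ≅ ⟦ 0ₚ ⟧
    +-invʳ (frac p d _) = mk≅ (at (P.trans (P.*-identityʳ _)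
      (P.trans (+ₚ-cong P.refl (P.sym (PProperties.-‿distribˡ-* p d))) (+ₚ-inverseʳ (p *ₚ d)))))
    distˡ : ∀ x y z → x * (y + z) ≅ x * y + x * z
    distˡ (frac p d _) (frac q e _) (frac r f _) = mk≅ (at (solve 6 (λ p d q e r f →
      (p :* (q :* f :+ r :* e)) :* ((d :* e) :* (d :* f))
      := ((p :* q) :* (d :* f) :+ (p :* r) :* (d :* e)) :* (d :* (e :* f))) P.refl p d q e r f))

module K = CommutativeRing ℚ⟨t⟩-ring

t^-+ : ∀ d e → t ^ₚ (d ℕ.+ e) ≋ t ^ₚ d *ₚ t ^ₚ e
t^-+ zero    e = P.sym (*ₚ-identityˡ (t ^ₚ e))
t^-+ (suc d) e = P.trans (*ₚ-cong (P.refl {t}) (t^-+ d e)) (P.sym (*ₚ-assoc t (t ^ₚ d) (t ^ₚ e)))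

fromLaurent-+ : ∀ a b → fromLaurent (a +ₗ b) ≅ fromLaurent a + fromLaurent b
fromLaurent-+ (p /t^ d) (q /t^ e) =
  mk≅ (at (*ₚ-cong (P.refl {p *ₚ t ^ₚ e +ₚ q *ₚ t ^ₚ d}) (P.sym (t^-+ d e))))

fromLaurent-* : ∀ a b → fromLaurent (a *ₗ b) ≅ fromLaurent a * fromLaurent b
fromLaurent-* (p /t^ d) (q /t^ e) = mk≅ (at (*ₚ-cong (P.refl {p *ₚ q}) (P.sym (t^-+ d e))))

⟦⟧-cancelˡ : ∀ d x y → ¬ d ≈ₚ 0ₚ → ⟦ d ⟧ * x ≅ ⟦ d ⟧ * y → x ≅ y
⟦⟧-cancelˡ d (frac p e _) (frac q f _) d≉0 (mk≅ x) = mk≅ (at (*ₚ-cancelˡ d (p *ₚ f) (q *ₚ e) d≉0 (begin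
  d *ₚ (p *ₚ f)               ≈⟨ solve 3 (λ d p f → d :* (p :* f) := (d :* p) :* (con 1 :* f)) P.refl d p f ⟩
  (d *ₚ p) *ₚ (1ₚ *ₚ f)       ≈⟨ lift≋ ((d *ₚ p) *ₚ (1ₚ *ₚ f)) ((d *ₚ q) *ₚ (1ₚ *ₚ e)) x ⟩
  (d *ₚ q) *ₚ (1ₚ *ₚ e)       ≈⟨ solve 3 (λ d p f → (d :* p) :* (con 1 :* f) := d :* (p :* f)) P.refl d q e ⟩
  d *ₚ (q *ₚ e)               ∎)))
  where
  open PSolver using (solve; _:=_; _:+_; _:*_; con)
  open SetoidReasoning P.setoid

-- Simple transpositions

s-left : ∀ (i : Fin m) → s i ⟨$⟩ʳ inject₁ i ≡ suc i
s-left zero    = refl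
s-left (suc i) = trans (s-suc i (suc (inject₁ i))) (cong suc (s-left i))

s-right : ∀ (i : Fin m) → s i ⟨$⟩ʳ suc i ≡ inject₁ i
s-right zero    = refl
s-right (suc i) = trans (s-suc i (suc (suc i))) (cong suc (s-right i))

s-other : ∀ (i : Fin m) {k} → k ≢ inject₁ i → k ≢ suc i → s i ⟨$⟩ʳ k ≡ k
s-other zero    {zero}        k≢i _   = contradiction refl k≢i
s-other zero    {suc zero}    _   k≢i = contradiction refl k≢i
s-other zero    {suc (suc k)} _   _   = refl
s-other (suc i) {zero}        _   _   = s-suc i zero
s-other (suc i) {suc k}       k≢i k≢j = trans (s-suc i (suc k))
  (cong suc (s-other i (λ e → k≢i (cong suc e)) (λ e → k≢j (cong suc e))))

data Touch (i : Fin m) (k : Fin (suc m)) : Set where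
  atˡ  : k ≡ inject₁ i → Touch i k
  atʳ  : k ≡ suc i → Touch i k
  away : k ≢ inject₁ i → k ≢ suc i → Touch i k

touch : ∀ (i : Fin m) k → Touch i k
touch i k with k Finₚ.≟ inject₁ i | k Finₚ.≟ suc i
... | yes e | _     = atˡ e
... | no  _ | yes e = atʳ e
... | no  f | no  g = away f g

s-involutive : ∀ (i : Fin m) k → s i ⟨$⟩ʳ (s i ⟨$⟩ʳ k) ≡ k
s-involutive i k with touch i k
... | atˡ refl = trans (cong (s i ⟨$⟩ʳ_) (s-left i)) (s-right i)
... | atʳ refl = trans (cong (s i ⟨$⟩ʳ_) (s-right i)) (s-left i)
... | away f g = trans (cong (s i ⟨$⟩ʳ_) (s-other i f g)) (s-other i f g)

s-flip : ∀ (i : Fin m) k → s i ⟨$⟩ˡ k ≡ s i ⟨$⟩ʳ k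
s-flip i k = trans (cong (s i ⟨$⟩ˡ_) (sym (s-involutive i k))) (inverseˡ (s i))

-- An injection that sends a neighbouring pair to a neighbouring pair intertwines the two
-- transpositions. It is applied to the deletion of a value and to `uPerm p`.
s-conj : ∀ (f : Fin (suc m) → Fin (suc n)) → (∀ {x y} → f x ≡ f y → x ≡ y) →
         ∀ i j → f (inject₁ i) ≡ inject₁ j → f (suc i) ≡ suc j →
         ∀ k → s j ⟨$⟩ʳ f k ≡ f (s i ⟨$⟩ʳ k)
s-conj f f-inj i j fi fj k with touch i k
... | atˡ refl = trans (cong (s j ⟨$⟩ʳ_) fi) (trans (s-left j) (sym (trans (cong f (s-left i)) fj)))
... | atʳ refl = trans (cong (s j ⟨$⟩ʳ_) fj) (trans (s-right j) (sym (trans (cong f (s-right i)) fi)))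
... | away g h = trans (s-other j (λ e → g (f-inj (trans e (sym fi)))) (λ e → h (f-inj (trans e (sym fj)))))
                   (cong f (sym (s-other i g h)))

perm-injective : ∀ (w : Permutation′ n) {x y} → w ⟨$⟩ʳ x ≡ w ⟨$⟩ʳ y → x ≡ y
perm-injective w e = trans (sym (inverseˡ w)) (trans (cong (w ⟨$⟩ˡ_) e) (inverseˡ w))

flip-injective : ∀ (w : Permutation′ n) {x y} → w ⟨$⟩ˡ x ≡ w ⟨$⟩ˡ y → x ≡ y
flip-injective w = perm-injective (flip w)

flip-cong : ∀ (v w : Permutation′ n) → v ≈ w → flip v ≈ flip w
flip-cong v w e k = perm-injective w
  (trans (sym (e (v ⟨$⟩ˡ k))) (trans (inverseʳ v) (sym (inverseʳ w))))

remove-flip : ∀ (w : Permutation′ (suc m)) k →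
              w ⟨$⟩ˡ punchIn (w ⟨$⟩ʳ 0F) k ≡ suc (remove 0F w ⟨$⟩ˡ k)
remove-flip w k = perm-injective w (trans (inverseʳ w)
  (trans (cong (punchIn (w ⟨$⟩ʳ 0F)) (sym (inverseʳ (remove 0F w))))
    (sym (Perm.punchIn-permute w 0F _))))

inject₁≢suc : ∀ (i : Fin m) → inject₁ i ≢ suc i
inject₁≢suc (suc i) e = inject₁≢suc i (Finₚ.suc-injective e)

-- Words modulo the braid and commutation relations

infix 4 _∼_
data _∼_ {m} : List (Fin m) → List (Fin m) → Set where
  ∼refl  : ∀ {is} → is ∼ is
  ∼sym   : ∀ {is js} → is ∼ js → js ∼ is
  ∼trans : ∀ {is js ks} → is ∼ js → js ∼ ks → is ∼ ks
  ∼∷     : ∀ i {is js} → is ∼ js → i ∷ is ∼ i ∷ js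
  ∼braid : ∀ i j is → toℕ j ≡ suc (toℕ i) → i ∷ j ∷ i ∷ is ∼ j ∷ i ∷ j ∷ is
  ∼comm  : ∀ i j is → 1 < ∣ toℕ i - toℕ j ∣ → i ∷ j ∷ is ∼ j ∷ i ∷ is

∼-setoid : ℕ → Setoid 0ℓ 0ℓ
∼-setoid m = record { Carrier = List (Fin m) ; _≈_ = _∼_
  ; isEquivalence = record { refl = ∼refl ; sym = ∼sym ; trans = ∼trans } }

module ∼-Reasoning {m} = SetoidReasoning (∼-setoid m)

∼-reflexive : ∀ {is js : List (Fin m)} → is ≡ js → is ∼ js
∼-reflexive refl = ∼refl

∼-++ʳ : ∀ {is js : List (Fin m)} ks → is ∼ js → is ++ ks ∼ js ++ ks
∼-++ʳ ks ∼refl             = ∼refl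
∼-++ʳ ks (∼sym e)          = ∼sym (∼-++ʳ ks e)
∼-++ʳ ks (∼trans e f)      = ∼trans (∼-++ʳ ks e) (∼-++ʳ ks f)
∼-++ʳ ks (∼∷ i e)          = ∼∷ i (∼-++ʳ ks e)
∼-++ʳ ks (∼braid i j is x) = ∼braid i j (is ++ ks) x
∼-++ʳ ks (∼comm i j is x)  = ∼comm i j (is ++ ks) x

∼-++ˡ : ∀ (ks : List (Fin m)) {is js} → is ∼ js → ks ++ is ∼ ks ++ js
∼-++ˡ []       e = e
∼-++ˡ (k ∷ ks) e = ∼∷ k (∼-++ˡ ks e)

∼-map-suc : ∀ {is js : List (Fin m)} → is ∼ js → map Fin.suc is ∼ map suc js
∼-map-suc ∼refl             = ∼refl
∼-map-suc (∼sym e)          = ∼sym (∼-map-suc e)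
∼-map-suc (∼trans e f)      = ∼trans (∼-map-suc e) (∼-map-suc f)
∼-map-suc (∼∷ i e)          = ∼∷ (suc i) (∼-map-suc e)
∼-map-suc (∼braid i j is x) = ∼braid (suc i) (suc j) (map suc is) (cong suc x)
∼-map-suc (∼comm i j is x)  = ∼comm (suc i) (suc j) (map suc is) x

∼-length : ∀ {is js : List (Fin m)} → is ∼ js → length is ≡ length js
∼-length ∼refl             = refl
∼-length (∼sym e)          = sym (∼-length e)
∼-length (∼trans e f)      = trans (∼-length e) (∼-length f)
∼-length (∼∷ i e)          = cong suc (∼-length e)
∼-length (∼braid i j is x) = refl
∼-length (∼comm i j is x)  = refl

-- Letters shifted twice are at least 2, hence commute with 0.
0-past : ∀ (is : List (Fin m)) js →
         0F ∷ map suc (map suc is) ++ js ∼ map suc (map suc is) ++ 0F ∷ js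
0-past []       js = ∼refl
0-past (i ∷ is) js = ∼trans (∼comm 0F (suc (suc i)) _ (s≤s (s≤s z≤n))) (∼∷ _ (0-past is js))

-- What happens to a letter in front of `down j`, the word of s_{j-1} ⋯ s_0: it lengthens the word
-- to the next one, it equals its first letter, or it crosses and comes out as `suc i′`, where the
-- deletion of the value `j` matches `i′` with `i`.
data Slide {m} (i : Fin (suc m)) (j : Fin (suc (suc m))) : Set where
  up   : j ≡ inject₁ i → Slide i j
  dn   : j ≡ suc i → Slide i j
  pass : ∀ i′ → punchIn j (inject₁ i′) ≡ inject₁ i → punchIn j (suc i′) ≡ suc i →
         i ∷ down j ∼ down j ++ suc i′ ∷ [] → Slide i j

-- For i = 0 and j ≥ 2 the letter commutes until it meets the final 1 0 of `down j`; there one braid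
-- move turns 0 1 0 into 1 0 1.
slide : ∀ (i : Fin (suc m)) j → Slide i j
slide         zero    zero          = up refl
slide         zero    (suc zero)    = dn refl
slide {suc m} zero    (suc (suc j)) = pass zero refl refl (begin
  0F ∷ map suc (map suc (down j) ++ 0F ∷ []) ++ 0F ∷ []
    ≡⟨ cong (0F ∷_) shape-down ⟩
  0F ∷ map suc (map suc (down j)) ++ 1F ∷ 0F ∷ []
    ≈⟨ 0-past (down j) _ ⟩
  map suc (map suc (down j)) ++ 0F ∷ 1F ∷ 0F ∷ []
    ≈⟨ ∼-++ˡ (map suc (map suc (down j))) (∼braid 0F 1F [] refl) ⟩
  map suc (map suc (down j)) ++ 1F ∷ 0F ∷ 1F ∷ []
    ≡⟨ Listₚ.++-assoc (map suc (map suc (down j))) (1F ∷ 0F ∷ []) (1F ∷ []) ⟨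
  (map suc (map suc (down j)) ++ 1F ∷ 0F ∷ []) ++ 1F ∷ []
    ≡⟨ cong (_++ 1F ∷ []) shape-down ⟨
  (map suc (map suc (down j) ++ 0F ∷ []) ++ 0F ∷ []) ++ 1F ∷ [] ∎)
  where
  open ∼-Reasoning
  shape-down : map suc (map suc (down j) ++ 0F ∷ []) ++ 0F ∷ [] ≡ map suc (map suc (down j)) ++ 1F ∷ 0F ∷ []
  shape-down = trans (cong (_++ 0F ∷ []) (Listₚ.map-++ suc (map suc (down j)) (0F ∷ [])))
                 (Listₚ.++-assoc (map suc (map suc (down j))) (1F ∷ []) (0F ∷ []))
slide {suc m} (suc i) zero          = pass i refl refl ∼refl
slide {suc m} (suc i) (suc j) with slide i j
... | up e = up (cong suc e)
... | dn e = dn (cong suc e)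
... | pass i′ e f g = pass (suc i′) (cong suc e) (cong suc f) (begin
  suc i ∷ map suc (down j) ++ 0F ∷ []                       ≈⟨ ∼-++ʳ (0F ∷ []) (∼-map-suc g) ⟩
  map suc (down j ++ suc i′ ∷ []) ++ 0F ∷ []                ≡⟨ cong (_++ 0F ∷ []) (Listₚ.map-++ suc (down j) _) ⟩
  (map suc (down j) ++ suc (suc i′) ∷ []) ++ 0F ∷ []        ≡⟨ Listₚ.++-assoc (map suc (down j)) _ _ ⟩
  map suc (down j) ++ suc (suc i′) ∷ 0F ∷ []                ≈⟨ ∼-++ˡ (map suc (down j)) (0-past (i′ ∷ []) []) ⟨
  map suc (down j) ++ 0F ∷ suc (suc i′) ∷ []                ≡⟨ Listₚ.++-assoc (map suc (down j)) _ _ ⟨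
  (map suc (down j) ++ 0F ∷ []) ++ suc (suc i′) ∷ []        ∎)
  where open ∼-Reasoning

down-suc : ∀ (i : Fin m) → down (suc i) ≡ i ∷ down (inject₁ i)
down-suc zero    = refl
down-suc (suc i) = cong (λ is → map suc is ++ 0F ∷ []) (down-suc i)

s-punchIn : ∀ (i : Fin m) k → s i ⟨$⟩ʳ punchIn (inject₁ i) k ≡ punchIn (suc i) k
s-punchIn zero    zero    = refl
s-punchIn zero    (suc k) = refl
s-punchIn (suc i) zero    = s-suc i zero
s-punchIn (suc i) (suc k) = trans (s-suc i (suc (punchIn (inject₁ i) k))) (cong suc (s-punchIn i k))

lehmer-cong : ∀ (v w : Permutation′ (suc m)) → v ≈ w → lehmer v ≡ lehmer w
lehmer-cong {zero}  v w e = refl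
lehmer-cong {suc m} v w e = cong₂ _++_ (cong down (e 0F))
  (cong (map suc) (lehmer-cong (remove 0F v) (remove 0F w) (remove-cong v w e)))

ℓ-cong : ∀ (v w : Permutation′ (suc m)) → v ≈ w → ℓ v ≡ ℓ w
ℓ-cong v w e = cong length (lehmer-cong v w e)

ℓ-eval : ∀ (is : List (Fin m)) → ℓ (eval is) ≤ length is
ℓ-eval is = ℕₚ.≤-trans (ℕₚ.≤-reflexive (length-lehmer (eval is))) (inv-eval is)

-- As `w ∘ₚ s i` is the product s_i w, left ascents compare the positions of two neighbouring
-- values; right ascents compare the values at two neighbouring positions.
Ascentˡ Descentˡ Ascentʳ : Fin m → Permutation′ (suc m) → Set
Ascentˡ  i w = w ⟨$⟩ˡ inject₁ i Fin.< w ⟨$⟩ˡ suc i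
Descentˡ i w = w ⟨$⟩ˡ suc i Fin.< w ⟨$⟩ˡ inject₁ i
Ascentʳ  i w = w ⟨$⟩ʳ inject₁ i Fin.< w ⟨$⟩ʳ suc i

data Mulˡ (i : Fin m) (w : Permutation′ (suc m)) : Set where
  asc  : Ascentˡ i w → i ∷ lehmer w ∼ lehmer (w ∘ₚ s i) → Mulˡ i w
  desc : Descentˡ i w → lehmer w ∼ i ∷ lehmer (w ∘ₚ s i) → Mulˡ i w

lehmer-up : ∀ (i : Fin (suc m)) w → w ⟨$⟩ʳ 0F ≡ inject₁ i → lehmer (w ∘ₚ s i) ≡ i ∷ lehmer w
lehmer-up i w e = cong₂ _++_
  (trans (cong (λ x → down (s i ⟨$⟩ʳ x)) e)
    (trans (cong down (s-left i)) (trans (down-suc i) (cong (λ x → i ∷ down x) (sym e)))))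
  (cong (map suc) (lehmer-cong (remove 0F (w ∘ₚ s i)) (remove 0F w) same))
  where
  open ≡-Reasoning
  same : remove 0F (w ∘ₚ s i) ≈ remove 0F w
  same k = Finₚ.punchIn-injective (s i ⟨$⟩ʳ (w ⟨$⟩ʳ 0F)) _ _ (begin
    punchIn (s i ⟨$⟩ʳ (w ⟨$⟩ʳ 0F)) (remove 0F (w ∘ₚ s i) ⟨$⟩ʳ k)  ≡⟨ Perm.punchIn-permute (w ∘ₚ s i) 0F k ⟨
    s i ⟨$⟩ʳ (w ⟨$⟩ʳ suc k)                                       ≡⟨ cong (s i ⟨$⟩ʳ_) (Perm.punchIn-permute w 0F k) ⟩
    s i ⟨$⟩ʳ punchIn (w ⟨$⟩ʳ 0F) (remove 0F w ⟨$⟩ʳ k)             ≡⟨ cong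
      (λ x → s i ⟨$⟩ʳ punchIn x (remove 0F w ⟨$⟩ʳ k)) e ⟩
    s i ⟨$⟩ʳ punchIn (inject₁ i) (remove 0F w ⟨$⟩ʳ k)             ≡⟨ s-punchIn i _ ⟩
    punchIn (suc i) (remove 0F w ⟨$⟩ʳ k)                          ≡⟨ cong (λ x → punchIn x (remove 0F w ⟨$⟩ʳ k))
      (trans (cong (s i ⟨$⟩ʳ_) e) (s-left i)) ⟨
    punchIn (s i ⟨$⟩ʳ (w ⟨$⟩ʳ 0F)) (remove 0F w ⟨$⟩ʳ k)           ∎)

first-lowest : ∀ (w : Permutation′ (suc m)) {x y} → w ⟨$⟩ʳ 0F ≡ x → x ≢ y → w ⟨$⟩ˡ x Fin.< w ⟨$⟩ˡ y
first-lowest w {x} {y} e x≢y with w ⟨$⟩ˡ x in p | w ⟨$⟩ˡ y in q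
... | suc _ | _     with () ← trans (sym p) (trans (cong (w ⟨$⟩ˡ_) (sym e)) (inverseˡ w))
... | zero  | zero  = contradiction (flip-injective w (trans p (sym q))) x≢y
... | zero  | suc _ = s≤s z≤n

-- The letter is pushed through the first block of the Lehmer word. Either that block absorbs it, or
-- it continues as `i′` in the word of `remove 0F w`, and the induction hypothesis decides between
-- ascent and descent.
mulˡ : ∀ (i : Fin m) w → Mulˡ i w
mulˡ {suc m} i w with slide i (w ⟨$⟩ʳ 0F)
... | up e = asc (first-lowest w e (inject₁≢suc i)) (∼-reflexive (sym (lehmer-up i w e)))
... | dn e = desc (first-lowest w e (λ x → inject₁≢suc i (sym x)))
  (∼-reflexive (trans (lehmer-cong w ((w ∘ₚ s i) ∘ₚ s i) (λ k → sym (s-involutive i _)))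
    (lehmer-up i (w ∘ₚ s i) (trans (cong (s i ⟨$⟩ʳ_) e) (s-right i)))))
... | pass i′ e f g = go (mulˡ i′ (remove 0F w))
  where
  j = w ⟨$⟩ʳ 0F
  v = remove 0F w
  conj : ∀ k → s i ⟨$⟩ʳ punchIn j k ≡ punchIn j (s i′ ⟨$⟩ʳ k)
  conj = s-conj (punchIn j) (λ {x} {y} → Finₚ.punchIn-injective j x y) i′ i e f
  fixed : s i ⟨$⟩ʳ j ≡ j
  fixed = s-other i (λ x → Finₚ.punchInᵢ≢i j _ (trans e (sym x))) (λ x → Finₚ.punchInᵢ≢i j _ (trans f (sym x)))
  same : remove 0F (w ∘ₚ s i) ≈ v ∘ₚ s i′
  same k = Finₚ.punchIn-injective j _ _ (begin
    punchIn j (remove 0F (w ∘ₚ s i) ⟨$⟩ʳ k)                        ≡⟨ cong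
      (λ x → punchIn x (remove 0F (w ∘ₚ s i) ⟨$⟩ʳ k)) fixed ⟨
    punchIn (s i ⟨$⟩ʳ j) (remove 0F (w ∘ₚ s i) ⟨$⟩ʳ k)             ≡⟨ Perm.punchIn-permute (w ∘ₚ s i) 0F k ⟨
    s i ⟨$⟩ʳ (w ⟨$⟩ʳ suc k)                                        ≡⟨ cong (s i ⟨$⟩ʳ_) (Perm.punchIn-permute w 0F k) ⟩
    s i ⟨$⟩ʳ punchIn j (v ⟨$⟩ʳ k)                                  ≡⟨ conj _ ⟩
    punchIn j (s i′ ⟨$⟩ʳ (v ⟨$⟩ʳ k))                               ∎)
    where open ≡-Reasoning
  word : lehmer (w ∘ₚ s i) ≡ down j ++ map suc (lehmer (v ∘ₚ s i′))
  word = cong₂ _++_ (cong down fixed) (cong (map suc) (lehmer-cong (remove 0F (w ∘ₚ s i)) (v ∘ₚ s i′) same))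
  through : ∀ is → i ∷ down j ++ is ∼ down j ++ suc i′ ∷ is
  through is = ∼trans (∼-++ʳ is g) (∼-reflexive (Listₚ.++-assoc (down j) (suc i′ ∷ []) is))
  posˡ : w ⟨$⟩ˡ inject₁ i ≡ suc (v ⟨$⟩ˡ inject₁ i′)
  posˡ = trans (cong (w ⟨$⟩ˡ_) (sym e)) (remove-flip w (inject₁ i′))
  posʳ : w ⟨$⟩ˡ suc i ≡ suc (v ⟨$⟩ˡ suc i′)
  posʳ = trans (cong (w ⟨$⟩ˡ_) (sym f)) (remove-flip w (suc i′))
  go : Mulˡ i′ v → Mulˡ i w
  go (asc lt h) = asc (subst₂ Fin._<_ (sym posˡ) (sym posʳ) (s≤s lt)) (begin
    i ∷ down j ++ map suc (lehmer v)          ≈⟨ through _ ⟩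
    down j ++ map suc (i′ ∷ lehmer v)         ≈⟨ ∼-++ˡ (down j) (∼-map-suc h) ⟩
    down j ++ map suc (lehmer (v ∘ₚ s i′))    ≡⟨ word ⟨
    lehmer (w ∘ₚ s i)                         ∎)
    where open ∼-Reasoning
  go (desc gt h) = desc (subst₂ Fin._<_ (sym posʳ) (sym posˡ) (s≤s gt)) (begin
    down j ++ map suc (lehmer v)                    ≈⟨ ∼-++ˡ (down j) (∼-map-suc h) ⟩
    down j ++ suc i′ ∷ map suc (lehmer (v ∘ₚ s i′)) ≈⟨ through _ ⟨
    i ∷ down j ++ map suc (lehmer (v ∘ₚ s i′))      ≡⟨ cong (i ∷_) word ⟨
    i ∷ lehmer (w ∘ₚ s i)                           ∎)
    where open ∼-Reasoning

data Ascending {m} : List (Fin m) → Set where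
  []  : Ascending []
  _∷_ : ∀ {i is} → Ascentˡ i (eval is) → Ascending is → Ascending (i ∷ is)

-- At a descent the tail `is` would evaluate to an element of length two more than `length is`. So
-- every letter of a reduced word is an ascent, and `mulˡ` supplies the braid moves to the Lehmer
-- word.
matsumoto : ∀ (is : List (Fin m)) → length is ≡ ℓ (eval is) → Ascending is × is ∼ lehmer (eval is)
matsumoto {m} [] e = [] , ∼-reflexive (sym (empty (lehmer (Perm.id {suc m})) (sym e)))
  where
  empty : ∀ {A : Set} (xs : List A) → length xs ≡ 0 → xs ≡ []
  empty [] _ = refl
matsumoto (i ∷ is) e with mulˡ i (eval is)
... | asc lt h = let a , r = matsumoto is (ℕₚ.suc-injective (trans e (sym (∼-length h)))) in
  lt ∷ a , ∼trans (∼∷ i r) h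
... | desc gt h = ⊥-elim (ℕₚ.<-irrefl refl (ℕₚ.<-≤-trans
  (subst (suc (length is) ℕ.<_) (sym (trans (∼-length h) (cong suc (sym e)))) ℕₚ.≤-refl)
  (ℕₚ.m≤n⇒m≤1+n (ℓ-eval is))))

lehmer-ascending : ∀ (w : Permutation′ (suc m)) → Ascending (lehmer w)
lehmer-ascending w = proj₁ (matsumoto (lehmer w) (ℓ-cong w (eval (lehmer w)) (λ k → sym (eval-lehmer w k))))

eval-reverse : ∀ (is : List (Fin m)) k → eval (reverse is) ⟨$⟩ʳ k ≡ eval is ⟨$⟩ˡ k
eval-reverse []       k = refl
eval-reverse (i ∷ is) k = trans (cong (λ js → eval js ⟨$⟩ʳ k) (Listₚ.unfold-reverse i is))
  (trans (eval-++ (reverse is) (i ∷ []) k)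
    (trans (eval-reverse is _) (cong (eval is ⟨$⟩ˡ_) (sym (s-flip i k)))))

ℓ-flip-≤ : ∀ (w : Permutation′ (suc m)) → ℓ (flip w) ≤ ℓ w
ℓ-flip-≤ w = ℕₚ.≤-trans
  (ℕₚ.≤-reflexive (ℓ-cong (flip w) (eval (reverse (lehmer w)))
    (λ k → sym (trans (eval-reverse (lehmer w) k) (flip-cong (eval (lehmer w)) w (eval-lehmer w) k)))))
  (ℕₚ.≤-trans (ℓ-eval (reverse (lehmer w))) (ℕₚ.≤-reflexive (Listₚ.length-reverse (lehmer w))))

ℓ-flip : ∀ (w : Permutation′ (suc m)) → ℓ (flip w) ≡ ℓ w
ℓ-flip w = ℕₚ.≤-antisym (ℓ-flip-≤ w)
  (ℕₚ.≤-trans (ℕₚ.≤-reflexive (ℓ-cong w (flip (flip w)) (λ _ → refl))) (ℓ-flip-≤ (flip w)))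

ascˡ : ∀ (i : Fin m) w → Ascentˡ i w → i ∷ lehmer w ∼ lehmer (w ∘ₚ s i)
ascˡ i w lt with mulˡ i w
... | asc  _  h = h
... | desc gt _ = ⊥-elim (ℕₚ.<-asym lt gt)

-- Inversion turns a right ascent of `w` into a left ascent of `flip w` and preserves length. Hence
-- the word with `i` appended is reduced, and `matsumoto` applies to it.
ascʳ : ∀ (i : Fin m) w → Ascentʳ i w → lehmer w ++ i ∷ [] ∼ lehmer (s i ∘ₚ w)
ascʳ i w lt = ∼trans
  (proj₂ (matsumoto (lehmer w ++ i ∷ []) (begin
    length (lehmer w ++ i ∷ [])       ≡⟨ Listₚ.length-++ (lehmer w) ⟩
    ℓ w ℕ.+ 1                         ≡⟨ ℕₚ.+-comm (ℓ w) 1 ⟩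
    suc (ℓ w)                         ≡⟨ cong suc (ℓ-flip w) ⟨
    suc (ℓ (flip w))                  ≡⟨ ∼-length (ascˡ i (flip w) lt) ⟩
    ℓ (flip w ∘ₚ s i)                 ≡⟨ ℓ-flip (flip w ∘ₚ s i) ⟨
    ℓ (flip (flip w ∘ₚ s i))          ≡⟨ ℓ-cong (flip (flip w ∘ₚ s i)) (eval (lehmer w ++ i ∷ []))
                                           (λ k → trans (cong (w ⟨$⟩ʳ_) (s-flip i k)) (sym (value k))) ⟩
    ℓ (eval (lehmer w ++ i ∷ []))     ∎)))
  (∼-reflexive (lehmer-cong (eval (lehmer w ++ i ∷ [])) (s i ∘ₚ w) value))
  where
  open ≡-Reasoning
  value : eval (lehmer w ++ i ∷ []) ≈ s i ∘ₚ w
  value k = trans (eval-++ (lehmer w) (i ∷ []) k) (eval-lehmer w _)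

data Mulʳ (i : Fin m) (w : Permutation′ (suc m)) : Set where
  asc  : lehmer w ++ i ∷ [] ∼ lehmer (s i ∘ₚ w) → Mulʳ i w
  desc : lehmer w ∼ lehmer (s i ∘ₚ w) ++ i ∷ [] → Mulʳ i w

mulʳ : ∀ (i : Fin m) w → Mulʳ i w
mulʳ i w with Finₚ.<-cmp (w ⟨$⟩ʳ inject₁ i) (w ⟨$⟩ʳ suc i)
... | tri< lt _ _ = asc (ascʳ i w lt)
... | tri≈ _ e _  = ⊥-elim (inject₁≢suc i (perm-injective w e))
... | tri> _ _ gt = desc (∼trans
  (∼-reflexive (lehmer-cong w (s i ∘ₚ s i ∘ₚ w) (λ k → cong (w ⟨$⟩ʳ_) (sym (s-involutive i k)))))
  (∼sym (ascʳ i (s i ∘ₚ w) (subst₂ Fin._<_ (cong (w ⟨$⟩ʳ_) (sym (s-left i))) (cong (w ⟨$⟩ʳ_) (sym (s-right i))) gt))))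

-- Finite sums in a commutative monoid

module Sum {a b} (M : CommutativeMonoid a b) where
  open CommutativeMonoid M renaming (Carrier to C; _≈_ to _≐_; _∙_ to _⊕_; refl to ≐refl; sym to ≐sym; trans to
    ≐trans)

  ∑ : List A → (A → C) → C
  ∑ xs f = foldr (λ x → f x ⊕_) ε xs

  ∑-cong : ∀ (xs : List A) {f g} → (∀ {x} → x ∈ xs → f x ≐ g x) → ∑ xs f ≐ ∑ xs g
  ∑-cong []       e = ≐refl
  ∑-cong (x ∷ xs) e = ∙-cong (e (here refl)) (∑-cong xs (λ p → e (there p)))

  ∑-zero : ∀ (xs : List A) {f} → (∀ {x} → x ∈ xs → f x ≐ ε) → ∑ xs f ≐ ε
  ∑-zero []       e = ≐refl
  ∑-zero (x ∷ xs) e = ≐trans (∙-cong (e (here refl)) (∑-zero xs (λ p → e (there p)))) (identityˡ ε)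

  ∑-++ : ∀ (xs ys : List A) f → ∑ (xs ++ ys) f ≐ ∑ xs f ⊕ ∑ ys f
  ∑-++ []       ys f = ≐sym (identityˡ _)
  ∑-++ (x ∷ xs) ys f = ≐trans (∙-congˡ (∑-++ xs ys f)) (≐sym (assoc _ _ _))

  ∑-map : ∀ {B : Set} (h : B → A) xs f → ∑ (map h xs) f ≡ ∑ xs (λ x → f (h x))
  ∑-map h []       f = refl
  ∑-map h (x ∷ xs) f = cong (f (h x) ⊕_) (∑-map h xs f)

  ∑-concatMap-map : ∀ {B D : Set} (h : B → D → A) (ys : List D) (xs : List B) f →
                    ∑ (concatMap (λ x → map (h x) ys) xs) f ≐ ∑ xs (λ x → ∑ ys (λ y → f (h x y)))
  ∑-concatMap-map h ys []       f = ≐refl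
  ∑-concatMap-map h ys (x ∷ xs) f = ≐trans (∑-++ (map (h x) ys) _ f)
    (∙-cong (reflexive (∑-map (h x) ys f)) (∑-concatMap-map h ys xs f))

  interchange : ∀ p q r u → (p ⊕ q) ⊕ (r ⊕ u) ≐ (p ⊕ r) ⊕ (q ⊕ u)
  interchange p q r u = ≐trans (assoc p q (r ⊕ u))
    (≐trans (∙-congˡ (≐trans (≐sym (assoc q r u)) (≐trans (∙-congʳ (comm q r)) (assoc r q u))))
      (≐sym (assoc p r (q ⊕ u))))

  ∑-⊕ : ∀ (xs : List A) f g → ∑ xs (λ x → f x ⊕ g x) ≐ ∑ xs f ⊕ ∑ xs g
  ∑-⊕ []       f g = ≐sym (identityˡ ε)
  ∑-⊕ (x ∷ xs) f g = ≐trans (∙-congˡ (∑-⊕ xs f g)) (interchange _ _ _ _)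

  -- Permutations are distinct only up to pointwise equality, so a relation `_~_` stands in for
  -- `_≡_`. It need not be symmetric: the first vanishing hypothesis serves the terms before `x`,
  -- the second those after it.
  ∑-pick : ∀ {_~_ : A → A → Set} {xs x f} → AllPairs (λ y z → ¬ y ~ z) xs → x ∈ xs →
           (∀ {y} → y ∈ xs → ¬ y ~ x → f y ≐ ε) → (∀ {y} → y ∈ xs → ¬ x ~ y → f y ≐ ε) → ∑ xs f ≐ f x
  ∑-pick (px ∷ pxs) (here refl) e e′ = ≐trans
    (∙-congˡ (∑-zero _ (λ p → e′ (there p) (All.lookup px p)))) (identityʳ _)
  ∑-pick (px ∷ pxs) (there p) e e′ = ≐trans
    (∙-cong (e (here refl) (All.lookup px p)) (∑-pick pxs p (λ q → e (there q)) (λ q → e′ (there q)))) (identityˡ _)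

  ∑-hom : ∀ {B : Set} (_⊎_ : B → B → B) (z : B) (φ : B → C) → φ z ≐ ε → (∀ x y → φ (x ⊎ y) ≐ φ x ⊕ φ y) →
          ∀ (xs : List A) (f : A → B) → φ (foldr (λ x → f x ⊎_) z xs) ≐ ∑ xs (λ x → φ (f x))
  ∑-hom _⊎_ z φ φ0 φ+ []       f = φ0
  ∑-hom _⊎_ z φ φ0 φ+ (x ∷ xs) f = ≐trans (φ+ _ _) (∙-congˡ (∑-hom _⊎_ z φ φ0 φ+ xs f))

-- Enumeration of the symmetric group and of the columns

insert-cong : ∀ i j (v w : Permutation′ n) → v ≈ w → insert i j v ≈ insert i j w
insert-cong i j v w e k with i Finₚ.≟ k
... | yes _ = refl
... | no  _ = cong (punchIn j) (e _)

𝔖-complete : ∀ (w : Permutation′ n) → ∃[ v ] v ∈ 𝔖 n × v ≈ w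
𝔖-complete {zero}  w = Perm.id , here refl , λ ()
𝔖-complete {suc n} w with 𝔖-complete (remove 0F w)
... | v , v∈ , e = insert 0F (w ⟨$⟩ʳ 0F) v
  , ∈ₚ.∈-concatMap⁺ (λ j → map (insert 0F j) (𝔖 n)) (Any.map (λ { refl → ∈ₚ.∈-map⁺ (insert 0F (w ⟨$⟩ʳ 0F)) v∈ })
    (∈ₚ.∈-allFin (w ⟨$⟩ʳ 0F)))
  , λ k → trans (insert-cong 0F (w ⟨$⟩ʳ 0F) v (remove 0F w) e k) (Perm.insert-remove 0F w k)

Distinct : List (Permutation′ n) → Set
Distinct = AllPairs (λ v w → ¬ v ≈ w)

𝔖-distinct : ∀ n → Distinct (𝔖 n)
𝔖-distinct zero    = [] ∷ []
𝔖-distinct (suc n) = AllPairsₚ.concat⁺ {xss = map row (allFin (suc n))}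
  (Allₚ.map⁺ {f = row} (All.universal (λ j → AllPairsₚ.map⁺ {f = insert 0F j}
    (AllPairs.map (λ {v} {w} → same j v w) (𝔖-distinct n))) (allFin (suc n))))
  (AllPairsₚ.map⁺ {f = row} (AllPairs.map (λ {i} {j} → rows i j) (AllPairsₚ.tabulate⁺ {f = λ j → j} (λ i≢j → i≢j))))
  where
  row : Fin (suc n) → List (Permutation′ (suc n))
  row j = map (insert 0F j) (𝔖 n)
  rows : ∀ i j → i ≢ j → All (λ v → All (λ w → ¬ v ≈ w) (row j)) (row i)
  rows i j i≢j = Allₚ.map⁺ {f = insert 0F i} (All.universal
    (λ v → Allₚ.map⁺ {f = insert 0F j} (All.universal (λ w e → i≢j (e 0F)) (𝔖 n))) (𝔖 n))
  same : ∀ j (v w : Permutation′ n) → ¬ v ≈ w → ¬ insert 0F j v ≈ insert 0F j w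
  same j v w v≉w e = v≉w (λ k → trans (sym (Perm.remove-insert 0F j v k))
    (trans (remove-cong′ (insert 0F j v) (insert 0F j w) e k) (Perm.remove-insert 0F j w k)))
    where
    remove-cong′ : ∀ (v w : Permutation′ (suc n)) → v ≈ w → remove 0F v ≈ remove 0F w
    remove-cong′ v w e k = Finₚ.punchIn-injective (w ⟨$⟩ʳ 0F) _ _
      (trans (cong (λ x → punchIn x (remove 0F v ⟨$⟩ʳ k)) (sym (e 0F)))
        (trans (sym (Perm.punchIn-permute v 0F k)) (trans (e (suc k)) (Perm.punchIn-permute w 0F k))))

Fixes : Weight n → Permutation′ n → Set
Fixes μ w = ∀ i → (w ⋆ μ) i ≡ μ i

fixesʳ : ∀ (μ : Weight n) w → Fixes μ w → ∀ k → μ (w ⟨$⟩ʳ k) ≡ μ k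
fixesʳ μ w f k = trans (sym (f (w ⟨$⟩ʳ k))) (cong μ (inverseˡ w))

fixesˡ : ∀ (μ : Weight n) w → (∀ k → μ (w ⟨$⟩ʳ k) ≡ μ k) → Fixes μ w
fixesˡ μ w f k = trans (sym (f (w ⟨$⟩ˡ k))) (cong μ (inverseʳ w))

fixes-cong : ∀ (μ : Weight n) v w → v ≈ w → Fixes μ v → Fixes μ w
fixes-cong μ v w e f = fixesˡ μ w (λ k → trans (cong μ (sym (e k))) (fixesʳ μ v f k))

Stab-complete : ∀ (μ : Weight n) w → Fixes μ w → ∃[ v ] v ∈ Stab μ × v ≈ w
Stab-complete μ w f with 𝔖-complete w
... | v , v∈ , e = v , ∈ₚ.∈-filter⁺ (fixes? μ) v∈ (fixes-cong μ w v (λ k → sym (e k)) f) , e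

Stab-distinct : ∀ (μ : Weight n) → Distinct (Stab μ)
Stab-distinct {n} μ = AllPairsₚ.filter⁺ (fixes? μ) (𝔖-distinct n)

Stab-fixes : ∀ (μ : Weight n) {w} → w ∈ Stab μ → Fixes μ w
Stab-fixes {n} μ p = proj₂ (∈ₚ.∈-filter⁻ (fixes? μ) {xs = 𝔖 n} p)

columns-complete : ∀ (C : Column n k) → C ∈ columns n k
columns-complete {k = k} (col p e) = go p k (recompute (∣ p ∣ ℕₚ.≟ k) e)
  where
  go : ∀ (p : Subset n) k (e : ∣ p ∣ ≡ k) → col p e ∈ columns n k
  go []            zero    e = here refl
  go (inside  ∷ p) (suc k) e = ∈ₚ.∈-++⁺ˡ (∈ₚ.∈-map⁺ _ (go p k (ℕₚ.suc-injective e)))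
  go (outside ∷ p) zero    e = ∈ₚ.∈-map⁺ _ (go p zero e)
  go (outside ∷ p) (suc k) e = ∈ₚ.∈-++⁺ʳ (map _ (columns _ k)) (∈ₚ.∈-map⁺ _ (go p (suc k) e))

columns-distinct : ∀ n k → AllPairs (λ C D → ¬ set C ≡ set D) (columns n k)
columns-distinct zero    zero    = [] ∷ []
columns-distinct zero    (suc k) = []
columns-distinct (suc n) zero    = AllPairsₚ.map⁺ (AllPairs.map (λ C≢D e → C≢D (Vecₚ.∷-injectiveʳ e))
    (columns-distinct n zero))
columns-distinct (suc n) (suc k) = AllPairsₚ.++⁺
  (AllPairsₚ.map⁺ (AllPairs.map (λ C≢D e → C≢D (Vecₚ.∷-injectiveʳ e)) (columns-distinct n k)))
  (AllPairsₚ.map⁺ (AllPairs.map (λ C≢D e → C≢D (Vecₚ.∷-injectiveʳ e)) (columns-distinct n (suc k))))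
  (Allₚ.map⁺ (All.universal (λ C → Allₚ.map⁺ (All.universal (λ D ()) _)) _))

-- Stabilisers of dominant weights

Dominant : Weight n → Set
Dominant μ = ∀ {i j} → i Fin.≤ j → μ j ℤ.≤ μ i

tail : Weight (suc n) → Weight n
tail μ i = μ (suc i)

tail-dominant : ∀ {μ : Weight (suc n)} → Dominant μ → Dominant (tail μ)
tail-dominant d i≤j = d (s≤s i≤j)

dominant-between : ∀ {μ : Weight (suc (suc n))} → Dominant μ → ∀ {j} → μ (suc j) ≡ μ 0F → μ 1F ≡ μ 0F
dominant-between {μ = μ} d {j} e =
  ℤₚ.≤-antisym (d z≤n) (subst (ℤ._≤ μ 1F) e (d {1F} {suc j} (s≤s z≤n)))

-- By dominance the positions with the value of the first one form an initial interval; deleting any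
-- of them leaves the same sequence as deleting the first.
punchIn-block : ∀ {μ : Weight (suc n)} → Dominant μ → ∀ {j} → μ j ≡ μ 0F → ∀ k → μ (punchIn j k) ≡ μ (suc k)
punchIn-block d {zero}  e k       = refl
punchIn-block {n = suc n} {μ} d {suc j} e zero    = sym (dominant-between {μ = μ} d e)
punchIn-block {n = suc n} {μ} d {suc j} e (suc k) =
  punchIn-block {μ = tail μ} (tail-dominant {μ = μ} d) (trans e (sym (dominant-between {μ = μ} d e))) k

module _ {μ : Weight (suc (suc m))} (d : Dominant μ) (w : Permutation′ (suc (suc m))) where

  fixes-head : Fixes μ w → μ (w ⟨$⟩ʳ 0F) ≡ μ 0F
  fixes-head f = fixesʳ μ w f 0F

  fixes-remove : Fixes μ w → Fixes (tail μ) (remove 0F w)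
  fixes-remove f = fixesˡ (tail μ) (remove 0F w) (λ k →
    trans (sym (punchIn-block {μ = μ} d (fixes-head f) _))
      (trans (cong μ (sym (Perm.punchIn-permute w 0F k))) (fixesʳ μ w f (suc k))))

  fixes-insert : μ (w ⟨$⟩ʳ 0F) ≡ μ 0F → Fixes (tail μ) (remove 0F w) → Fixes μ w
  fixes-insert e f = fixesˡ μ w go
    where
    go : ∀ k → μ (w ⟨$⟩ʳ k) ≡ μ k
    go zero    = e
    go (suc k) = trans (cong μ (Perm.punchIn-permute w 0F k))
      (trans (punchIn-block {μ = μ} d e _) (fixesʳ (tail μ) (remove 0F w) f k))

block : Weight (suc n) → List (Fin (suc n))
block μ = filter (λ j → μ j ℤₚ.≟ μ 0F) (allFin _)

-- The Lehmer words of the stabiliser of a dominant weight in recursive form: 0 goes to some `j` of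
-- its block, and the rest stabilises the tail. The product formulas for W and for the symmetriser
-- rest on this recursion.
words : Weight (suc m) → List (List (Fin m))
words {zero}  μ = [] ∷ []
words {suc m} μ = concatMap (λ j → map (λ is → down j ++ map suc is) (words (tail μ))) (block μ)

-- The lists agree even in their order, because `𝔖` is enumerated by the image of 0F. Rows outside
-- the block are filtered away entirely; inside it the condition on a permutation is the one on its
-- `remove 0F` for the tail.
map-lehmer-Stab : ∀ {μ : Weight (suc m)} → Dominant μ → map lehmer (Stab μ) ≡ words μ
map-lehmer-Stab {zero} {μ} d = cong (map lehmer)
  (Listₚ.filter-accept (fixes? μ) {x = insert 0F 0F Perm.id} {xs = []} (λ { zero → refl }))
map-lehmer-Stab {suc m} {μ} d = rows (allFin _)
  where
  row : ∀ j (ws : List (Permutation′ (suc m))) → μ j ≡ μ 0F →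
        map lehmer (filter (fixes? μ) (map (insert 0F j) ws)) ≡
        map (λ is → down j ++ map suc is) (map lehmer (filter (fixes? (tail μ)) ws))
  row j []       e = refl
  row j (w ∷ ws) e = step (fixes? (tail μ) w)
    where
    v = insert 0F j w
    v≈ : remove 0F v ≈ w
    v≈ = Perm.remove-insert 0F j w
    step : Dec (Fixes (tail μ) w) →
           map lehmer (filter (fixes? μ) (v ∷ map (insert 0F j) ws)) ≡
           map (λ is → down j ++ map suc is) (map lehmer (filter (fixes? (tail μ)) (w ∷ ws)))
    step (yes f) = trans
      (cong (map lehmer) (Listₚ.filter-accept (fixes? μ)
        (fixes-insert {μ = μ} d v e (fixes-cong (tail μ) w (remove 0F v) (λ k → sym (v≈ k)) f))))
      (trans (cong₂ _∷_ (cong (λ is → down j ++ map suc is) (lehmer-cong (remove 0F v) w v≈)) (row j ws e))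
        (cong (λ L → map (λ is → down j ++ map suc is) (map lehmer L))
          (sym (Listₚ.filter-accept (fixes? (tail μ)) f))))
    step (no ¬f) = trans
      (cong (map lehmer) (Listₚ.filter-reject (fixes? μ)
        (λ f → ¬f (fixes-cong (tail μ) (remove 0F v) w v≈ (fixes-remove {μ = μ} d v f)))))
      (trans (row j ws e)
        (cong (λ L → map (λ is → down j ++ map suc is) (map lehmer L))
          (sym (Listₚ.filter-reject (fixes? (tail μ)) ¬f))))
  row-empty : ∀ j (ws : List (Permutation′ (suc m))) → μ j ≢ μ 0F →
              filter (fixes? μ) (map (insert 0F j) ws) ≡ []
  row-empty j []       e = refl
  row-empty j (w ∷ ws) e = trans
    (Listₚ.filter-reject (fixes? μ) (λ f → e (fixes-head {μ = μ} d (insert 0F j w) f))) (row-empty j ws e)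
  rows : ∀ js → map lehmer (filter (fixes? μ) (concatMap (λ j → map (insert 0F j) (𝔖 (suc m))) js)) ≡
         concatMap (λ j → map (λ is → down j ++ map suc is) (words (tail μ))) (filter (λ j → μ j ℤₚ.≟ μ 0F) js)
  rows [] = refl
  rows (j ∷ js) with μ j ℤₚ.≟ μ 0F
  ... | yes e = trans (cong (map lehmer) (Listₚ.filter-++ (fixes? μ) (map (insert 0F j) (𝔖 (suc m))) _))
    (trans (Listₚ.map-++ lehmer (filter (fixes? μ) (map (insert 0F j) (𝔖 (suc m)))) _)
      (cong₂ _++_ (trans (row j (𝔖 (suc m)) e)
        (cong (map _) (map-lehmer-Stab {μ = tail μ} (tail-dominant {μ = μ} d)))) (rows js)))
  ... | no e = trans (cong (map lehmer) (trans (Listₚ.filter-++ (fixes? μ) (map (insert 0F j) (𝔖 (suc m))) _)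
    (cong (_++ filter (fixes? μ) (concatMap (λ j → map (insert 0F j) (𝔖 (suc m))) js))
      (row-empty j (𝔖 (suc m)) e)))) (rows js)

Stabilises : Weight (suc m) → Fin m → Set
Stabilises μ i = μ (inject₁ i) ≡ μ (suc i)

down-stabilises : ∀ {μ : Weight (suc m)} → Dominant μ → ∀ j → μ j ≡ μ 0F → All (Stabilises μ) (down j)
down-stabilises d zero e = []
down-stabilises {suc m} {μ} d (suc j) e = Allₚ.++⁺
  (Allₚ.map⁺ (down-stabilises {μ = tail μ} (tail-dominant {μ = μ} d) j (trans e (sym μ₁≡μ₀))))
  (sym μ₁≡μ₀ ∷ [])
  where
  μ₁≡μ₀ : μ 1F ≡ μ 0F
  μ₁≡μ₀ = dominant-between {μ = μ} d e

-- The parabolic property of reduced words: since a block is an interval, the descent `down j`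
-- inside it only uses simple reflections that fix the weight.
lehmer-stabilises : ∀ {μ : Weight (suc m)} → Dominant μ → ∀ w → Fixes μ w → All (Stabilises μ) (lehmer w)
lehmer-stabilises {zero}      d w f = []
lehmer-stabilises {suc m} {μ} d w f = Allₚ.++⁺
  (down-stabilises {μ = μ} d _ (fixes-head {μ = μ} d w f))
  (Allₚ.map⁺ (lehmer-stabilises {μ = tail μ} (tail-dominant {μ = μ} d) (remove 0F w) (fixes-remove {μ = μ} d w f)))

-- Poincaré polynomials

module ∑P = Sum P.+-commutativeMonoid

block-sum : Weight (suc n) → ℤ[t]
block-sum μ = ∑ₚ (block μ) λ j → t ^ₚ toℕ j

-- For a dominant weight each `block-sum` is the t-number of the part of a block that remains from
-- that position on, so the product is that of the t-factorials of the block sizes.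
Wt : Weight n → ℤ[t]
Wt {zero}  μ = 1ₚ
Wt {suc n} μ = block-sum μ *ₚ Wt (tail μ)

∑-*ₚˡ : ∀ p (xs : List A) f → p *ₚ ∑ₚ xs f ≋ ∑ₚ xs (λ x → p *ₚ f x)
∑-*ₚˡ p xs f = ∑P.∑-hom _+ₚ_ 0ₚ (p *ₚ_) (*ₚ-zeroʳ p) (*ₚ-distribˡ p) xs f

∑-*ₚʳ : ∀ p (xs : List A) f → ∑ₚ xs f *ₚ p ≋ ∑ₚ xs (λ x → f x *ₚ p)
∑-*ₚʳ p xs f = ∑P.∑-hom _+ₚ_ 0ₚ (_*ₚ p) P.refl (*ₚ-distribʳ p) xs f

W-words : ∀ {μ : Weight (suc m)} → Dominant μ → W μ ≡ ∑ₚ (words μ) (λ is → t ^ₚ length is)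
W-words {μ = μ} d = trans (sym (∑P.∑-map lehmer (Stab μ) (λ is → t ^ₚ length is)))
  (cong (λ L → ∑ₚ L (λ is → t ^ₚ length is)) (map-lehmer-Stab {μ = μ} d))

words-Wt : ∀ (μ : Weight (suc m)) → ∑ₚ (words μ) (λ is → t ^ₚ length is) ≋ Wt μ
words-Wt {zero}  μ with μ 0F ℤₚ.≟ μ 0F
... | yes _ = lift≋ _ _ λ { zero → refl ; (suc zero) → refl ; (suc (suc i)) → refl }
... | no ¬e = contradiction refl ¬e
words-Wt {suc m} μ = begin
  ∑ₚ (words μ) (λ is → t ^ₚ length is)
    ≈⟨ ∑P.∑-concatMap-map (λ j is → down j ++ map suc is) (words (tail μ)) (block μ) _ ⟩
  ∑ₚ (block μ) (λ j → ∑ₚ (words (tail μ)) (λ is → t ^ₚ length (down j ++ map suc is)))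
    ≈⟨ ∑P.∑-cong (block μ) (λ {j} _ → P.trans
         (∑P.∑-cong (words (tail μ)) (λ {is} _ → P.trans (P.reflexive (cong (t ^ₚ_) (len j is)))
           (t^-+ (toℕ j) (length is))))
         (P.sym (∑-*ₚˡ (t ^ₚ toℕ j) (words (tail μ)) _))) ⟩
  ∑ₚ (block μ) (λ j → t ^ₚ toℕ j *ₚ ∑ₚ (words (tail μ)) (λ is → t ^ₚ length is))
    ≈⟨ ∑-*ₚʳ (∑ₚ (words (tail μ)) (λ is → t ^ₚ length is)) (block μ) (λ j → t ^ₚ toℕ j) ⟨
  block-sum μ *ₚ ∑ₚ (words (tail μ)) (λ is → t ^ₚ length is)
    ≈⟨ *ₚ-cong (P.refl {block-sum μ}) (words-Wt (tail μ)) ⟩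
  Wt μ ∎
  where
  open SetoidReasoning P.setoid
  len : ∀ j is → length (down j ++ map suc is) ≡ toℕ j ℕ.+ length is
  len j is = trans (Listₚ.length-++ (down j)) (cong₂ ℕ._+_ (length-down j) (Listₚ.length-map suc is))

W-Wt : ∀ {μ : Weight (suc m)} → Dominant μ → W μ ≋ Wt μ
W-Wt {μ = μ} d = P.trans (P.reflexive (W-words {μ = μ} d)) (words-Wt μ)

coeff₀-* : ∀ p q → coeff (p *ₚ q) 0 ≡ coeff p 0 ℤ.* coeff q 0
coeff₀-* []      q = refl
coeff₀-* (a ∷ p) q = trans (coeff-+ₚ (a ·ₚ q) (0ℤ ∷ p *ₚ q) 0) (trans (ℤₚ.+-identityʳ _) (coeff-scale a q 0))

coeff₀-block : ∀ (μ : Weight (suc n)) → coeff (block-sum μ) 0 ≡ 1ℤ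
coeff₀-block {n} μ with μ 0F ℤₚ.≟ μ 0F
... | no ¬e = contradiction refl ¬e
... | yes _ = trans (coeff-+ₚ 1ₚ (∑ₚ rest (λ j → t ^ₚ toℕ j)) 0)
  (cong (λ z → 1ℤ ℤ.+ z) (higher rest (Allₚ.filter⁺ (λ j → μ j ℤₚ.≟ μ 0F) {xs = List.tabulate suc}
    (Allₚ.tabulate⁺ {f = suc} (λ _ ())))))
  where
  rest = filter (λ j → μ j ℤₚ.≟ μ 0F) (List.tabulate suc)
  higher : ∀ (js : List (Fin (suc n))) → All (_≢ 0F) js → coeff (∑ₚ js (λ j → t ^ₚ toℕ j)) 0 ≡ 0ℤ
  higher []           []       = refl
  higher (zero ∷ js)  (p ∷ ps) = contradiction refl p
  higher (suc j ∷ js) (p ∷ ps) = trans (coeff-+ₚ (t *ₚ t ^ₚ toℕ j) (∑ₚ js (λ j → t ^ₚ toℕ j)) 0)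
    (cong₂ ℤ._+_ (coeff₀-* t (t ^ₚ toℕ j)) (higher js ps))

-- In each block sum only the position 0F has exponent 0. This constant term makes all the
-- denominators W non-zero.
coeff₀-Wt : ∀ (μ : Weight n) → coeff (Wt μ) 0 ≡ 1ℤ
coeff₀-Wt {zero}  μ = refl
coeff₀-Wt {suc n} μ = trans (coeff₀-* (block-sum μ) (Wt (tail μ))) (cong₂ ℤ._*_ (coeff₀-block μ) (coeff₀-Wt (tail μ)))

Wt≉0 : ∀ (μ : Weight n) → ¬ Wt μ ≈ₚ 0ₚ
Wt≉0 μ e with () ← trans (sym (coeff₀-Wt μ)) (e 0)

W≉0 : ∀ {μ : Weight (suc m)} → Dominant μ → ¬ W μ ≈ₚ 0ₚ
W≉0 {μ = μ} d e = Wt≉0 μ (at (P.trans (P.sym (W-Wt {μ = μ} d)) (lift≋ (W μ) 0ₚ e)))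
  where open _≋_

block-cong : ∀ (μ ν : Weight (suc n)) → (∀ j → μ j ≡ μ 0F → ν j ≡ ν 0F) → (∀ j → ν j ≡ ν 0F → μ j ≡ μ 0F) →
             block-sum μ ≡ block-sum ν
block-cong μ ν f g = cong (λ L → ∑ₚ L (λ j → t ^ₚ toℕ j))
  (Listₚ.filter-≐ (λ j → μ j ℤₚ.≟ μ 0F) (λ j → ν j ℤₚ.≟ ν 0F) ((λ {j} → f j) , (λ {j} → g j)) (allFin _))

Wt-pattern : ∀ (μ ν : Weight n) → (∀ i j → μ i ≡ μ j → ν i ≡ ν j) → (∀ i j → ν i ≡ ν j → μ i ≡ μ j) → Wt μ ≡ Wt ν
Wt-pattern {zero}  μ ν f g = refl
Wt-pattern {suc n} μ ν f g = cong₂ _*ₚ_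
  (block-cong μ ν (λ j → f j 0F) (λ j → g j 0F))
  (Wt-pattern (tail μ) (tail ν) (λ i j → f (suc i) (suc j)) (λ i j → g (suc i) (suc j)))

module ℤ+ = Algebra.Properties.AbelianGroup ℤₚ.+-0-abelianGroup

-- The two features of a shape with leftmost column of length k on which the exchange of Poincaré
-- polynomials depends: a strict drop at k and constancy from there on.
record Splits (k : ℕ) (μ : Weight n) : Set where
  field
    drop  : ∀ i j → toℕ i < k → k ≤ toℕ j → μ j ℤ.< μ i
    const : ∀ i j → k ≤ toℕ i → k ≤ toℕ j → μ i ≡ μ j

infixl 6 _⊞_
_⊞_ : Weight n → Weight n → Weight n
(ρ ⊞ μ) i = ρ i ℤ.+ μ i

block-⊞ : ∀ k {μ ρ : Weight (suc n)} → Splits (suc k) μ → Dominant ρ → (∀ j → toℕ j < suc k → ρ 0F ≡ ρ j) →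
          block-sum μ ≡ block-sum (ρ ⊞ μ)
block-⊞ k {μ} {ρ} S dρ flat = block-cong μ (ρ ⊞ μ) to from
  where
  open Splits S
  to : ∀ j → μ j ≡ μ 0F → (ρ ⊞ μ) j ≡ (ρ ⊞ μ) 0F
  to j e with toℕ j ℕₚ.<? suc k
  ... | yes j<k = cong₂ ℤ._+_ (sym (flat j j<k)) e
  ... | no  j≮k = contradiction (drop 0F j (s≤s z≤n) (ℕₚ.≮⇒≥ j≮k)) (ℤₚ.<-irrefl e)
  from : ∀ j → (ρ ⊞ μ) j ≡ (ρ ⊞ μ) 0F → μ j ≡ μ 0F
  from j e with toℕ j ℕₚ.<? suc k
  ... | yes j<k = ℤ+.∙-cancelˡ (ρ j) (μ j) (μ 0F) (trans e (cong (ℤ._+ μ 0F) (flat j j<k)))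
  ... | no  j≮k = contradiction
    (ℤₚ.+-mono-≤-< (dρ {0F} {j} z≤n) (drop 0F j (s≤s z≤n) (ℕₚ.≮⇒≥ j≮k))) (ℤₚ.<-irrefl e)

-- A position before k has the same block in μ and in ρ ⊞ μ, one after k has
-- the same block in μ as in ν and in ρ ⊞ μ as in ρ ⊞ ν.
Wt-exchange : ∀ k (μ ν ρ : Weight n) → Splits k μ → Splits k ν → Dominant ρ →
              (∀ i j → toℕ i < k → toℕ j < k → ρ i ≡ ρ j) →
              Wt μ *ₚ Wt (ρ ⊞ ν) ≋ Wt ν *ₚ Wt (ρ ⊞ μ)
Wt-exchange zero μ ν ρ Sμ Sν dρ flat = P.reflexive (cong₂ _*ₚ_
  (Wt-pattern μ ν (λ i j _ → const Sν i j z≤n z≤n) (λ i j _ → const Sμ i j z≤n z≤n))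
  (Wt-pattern (ρ ⊞ ν) (ρ ⊞ μ) (λ i j → shift Sν Sμ i j) (λ i j → shift Sμ Sν i j)))
  where
  open Splits
  shift : ∀ {α β} → Splits 0 α → Splits 0 β → ∀ i j → (ρ ⊞ α) i ≡ (ρ ⊞ α) j → (ρ ⊞ β) i ≡ (ρ ⊞ β) j
  shift {α} {β} Sα Sβ i j e = cong₂ ℤ._+_
    (ℤ+.∙-cancelʳ (α i) (ρ i) (ρ j) (trans e (cong (λ z → ρ j ℤ.+ z) (const Sα j i z≤n z≤n)))) (const Sβ i j z≤n z≤n)
Wt-exchange {zero}  (suc k) μ ν ρ Sμ Sν dρ flat = P.refl
Wt-exchange {suc n} (suc k) μ ν ρ Sμ Sν dρ flat = begin
  (block-sum μ *ₚ Wt (tail μ)) *ₚ (block-sum (ρ ⊞ ν) *ₚ Wt (tail ρ ⊞ tail ν))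
    ≈⟨ solve 4 (λ a b c d → (a :* b) :* (c :* d) := (a :* c) :* (b :* d)) P.refl
         (block-sum μ) (Wt (tail μ)) (block-sum (ρ ⊞ ν)) (Wt (tail ρ ⊞ tail ν)) ⟩
  (block-sum μ *ₚ block-sum (ρ ⊞ ν)) *ₚ (Wt (tail μ) *ₚ Wt (tail ρ ⊞ tail ν))
    ≈⟨ *ₚ-cong (P.reflexive (cong₂ _*ₚ_ (same Sμ) (sym (same Sν))))
         (Wt-exchange k (tail μ) (tail ν) (tail ρ) (tail-splits Sμ) (tail-splits Sν) (tail-dominant {μ = ρ} dρ)
           (λ i j i<k j<k → flat (suc i) (suc j) (s≤s i<k) (s≤s j<k))) ⟩
  (block-sum (ρ ⊞ μ) *ₚ block-sum ν) *ₚ (Wt (tail ν) *ₚ Wt (tail ρ ⊞ tail μ))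
    ≈⟨ solve 4 (λ a b c d → (a :* b) :* (c :* d) := (b :* c) :* (a :* d)) P.refl
         (block-sum (ρ ⊞ μ)) (block-sum ν) (Wt (tail ν)) (Wt (tail ρ ⊞ tail μ)) ⟩
  (block-sum ν *ₚ Wt (tail ν)) *ₚ (block-sum (ρ ⊞ μ) *ₚ Wt (tail ρ ⊞ tail μ)) ∎
  where
  open SetoidReasoning P.setoid
  open PSolver using (solve; _:=_; _:+_; _:*_; con)
  open Splits
  tail-splits : ∀ {μ : Weight (suc n)} → Splits (suc k) μ → Splits k (tail μ)
  tail-splits S = record
    { drop  = λ i j i<k k≤j → drop S (suc i) (suc j) (s≤s i<k) (s≤s k≤j)
    ; const = λ i j k≤i k≤j → const S (suc i) (suc j) (s≤s k≤i) (s≤s k≤j) }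
  same : ∀ {μ} → Splits (suc k) μ → block-sum μ ≡ block-sum (ρ ⊞ μ)
  same S = block-⊞ k S dρ (λ j j<k → flat 0F j (s≤s z≤n) j<k)

ϖ-< : ∀ k (i : Fin n) → toℕ i < k → ϖ k i ≡ 1ℤ
ϖ-< k i i<k with toℕ i ℕₚ.<? k
... | yes _  = refl
... | no i≮k = contradiction i<k i≮k

ϖ-≥ : ∀ k (i : Fin n) → k ≤ toℕ i → ϖ k i ≡ 0ℤ
ϖ-≥ k i k≤i with toℕ i ℕₚ.<? k
... | yes i<k = contradiction k≤i (ℕₚ.<⇒≱ i<k)
... | no _    = refl

ϖ-dominant : ∀ k → Dominant {n} (ϖ k)
ϖ-dominant k {i} {j} i≤j with toℕ i ℕₚ.<? k | toℕ j ℕₚ.<? k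
... | yes _  | yes _  = ℤₚ.≤-refl
... | yes _  | no  _  = ℤ.+≤+ z≤n
... | no i≮k | yes j<k = contradiction (ℕₚ.≤-<-trans i≤j j<k) i≮k
... | no _   | no _   = ℤₚ.≤-refl

ϖ-splits : ∀ k → Splits {n} k (ϖ k)
ϖ-splits k = record
  { drop  = λ i j i<k k≤j → subst₂ ℤ._<_ (sym (ϖ-≥ k j k≤j)) (sym (ϖ-< k i i<k)) (ℤ.+<+ (s≤s z≤n))
  ; const = λ i j k≤i k≤j → trans (ϖ-≥ k i k≤i) (sym (ϖ-≥ k j k≤j)) }

recompute-≤ : .(k ≤ l) → k ≤ l
recompute-≤ {k} {l} k≤l = recompute (k ℕₚ.≤? l) k≤l

shape-dominant : ∀ (S : Tensor n k) → Dominant (shape S)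
shape-dominant (single {k} _ _)     i≤j = ϖ-dominant k i≤j
shape-dominant (cons {l = l} _ _ S) i≤j = ℤₚ.+-mono-≤ (ϖ-dominant l i≤j) (shape-dominant S i≤j)

shape-splits : ∀ (S : Tensor n k) → Splits k (shape S)
shape-splits (single {k} _ _) = record { drop = drop (ϖ-splits k) ; const = const (ϖ-splits k) }
  where open Splits
shape-splits (cons {l = l} k≤l _ S) = record
  { drop  = λ i j i<l l≤j → ℤₚ.+-mono-<-≤ (drop (ϖ-splits l) i j i<l l≤j)
      (shape-dominant S (ℕₚ.<⇒≤ (ℕₚ.<-≤-trans i<l l≤j)))
  ; const = λ i j l≤i l≤j → cong₂ ℤ._+_ (const (ϖ-splits l) i j l≤i l≤j)
      (const (shape-splits S) i j (ℕₚ.≤-trans (recompute-≤ k≤l) l≤i)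
        (ℕₚ.≤-trans (recompute-≤ k≤l) l≤j)) }
  where open Splits

pair-weight : ∀ l k → Weight n
pair-weight l k = ϖ l ⊞ ϖ k

pair-weight-dominant : ∀ l k → Dominant {n} (pair-weight l k)
pair-weight-dominant l k i≤j = ℤₚ.+-mono-≤ (ϖ-dominant l i≤j) (ϖ-dominant k i≤j)

W-shape : ∀ {k l m} .(k≤l : k ≤ l) (C : Column (suc m) l) (S : Tensor (suc m) k) →
          W {m} (shape S) *ₚ W {m} (pair-weight l k) ≋ W {m} (ϖ k) *ₚ W {m} (shape (cons k≤l C S))
W-shape {k} {l} {m} k≤l C S = begin
  W {m} (shape S) *ₚ W {m} (pair-weight l k)
    ≈⟨ *ₚ-cong (W-Wt {m} {shape S} (shape-dominant S)) (W-Wt {m} {pair-weight l k} (pair-weight-dominant l k)) ⟩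
  Wt {suc m} (shape S) *ₚ Wt {suc m} (pair-weight l k)
    ≈⟨ Wt-exchange k (shape S) (ϖ k) (ϖ l) (shape-splits S) (ϖ-splits k) (λ {i} {j} → ϖ-dominant l {i} {j})
         (λ i j i<k j<k → trans (ϖ-< l i (ℕₚ.<-≤-trans i<k (recompute-≤ k≤l)))
           (sym (ϖ-< l j (ℕₚ.<-≤-trans j<k (recompute-≤ k≤l))))) ⟩
  Wt {suc m} (ϖ k) *ₚ Wt {suc m} (ϖ l ⊞ shape S)
    ≈⟨ *ₚ-cong (W-Wt {m} {ϖ k} (ϖ-dominant k)) (W-Wt {m} {shape (cons k≤l C S)} (shape-dominant (cons k≤l C S))) ⟨
  W {m} (ϖ k) *ₚ W {m} (shape (cons k≤l C S)) ∎
  where open SetoidReasoning P.setoid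

-- Words over an ordered alphabet

sw : Fin m → Vec A (suc m) → Vec A (suc m)
sw zero    (a ∷ b ∷ w) = b ∷ a ∷ w
sw (suc i) (a ∷ w)     = a ∷ sw i w

data At {A : Set} (a b : A) : Fin m → Vec A (suc m) → Set where
  here  : ∀ {w : Vec A m} → At a b zero (a ∷ b ∷ w)
  there : ∀ {i : Fin m} {x w} → At a b i w → At a b (suc i) (x ∷ w)

at? : ∀ (i : Fin m) (w : Vec A (suc m)) → ∃[ a ] ∃[ b ] At a b i w
at? zero    (a ∷ b ∷ w) = a , b , here
at? (suc i) (x ∷ w)     = let a , b , p = at? i w in a , b , there p

sw-sw : ∀ (i : Fin m) (w : Vec A (suc m)) → sw i (sw i w) ≡ w
sw-sw zero    (a ∷ b ∷ w) = refl
sw-sw (suc i) (a ∷ w)     = cong (a ∷_) (sw-sw i w)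

sw-at : ∀ {i : Fin m} {w : Vec A (suc m)} {a b} → At a b i w → At b a i (sw i w)
sw-at here      = here
sw-at (there p) = there (sw-at p)

sw-fixed : ∀ {i : Fin m} {w : Vec A (suc m)} {a} → At a a i w → sw i w ≡ w
sw-fixed here              = refl
sw-fixed (there {x = x} p) = cong (x ∷_) (sw-fixed p)

sw-map : ∀ {B : Set} (f : A → B) (i : Fin m) w → Vec.map f (sw i w) ≡ sw i (Vec.map f w)
sw-map f zero    (a ∷ b ∷ w) = refl
sw-map f (suc i) (a ∷ w)     = cong (f a ∷_) (sw-map f i w)

at-map : ∀ {B : Set} (f : A → B) {i : Fin m} {w a b} → At a b i w → At (f a) (f b) i (Vec.map f w)
at-map f here      = here
at-map f (there p) = there (at-map f p)

at-unique : ∀ {i : Fin m} {w : Vec A (suc m)} {a b a′ b′} → At a b i w → At a′ b′ i w → a ≡ a′ × b ≡ b′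
at-unique here      here      = refl , refl
at-unique (there p) (there q) = at-unique p q

at-lookup : ∀ (i : Fin m) (w : Vec A (suc m)) → At (lookup w (inject₁ i)) (lookup w (suc i)) i w
at-lookup zero    (a ∷ b ∷ w) = here
at-lookup (suc i) (x ∷ w)     = there (at-lookup i w)

sw-tabulate : ∀ (i : Fin m) (f : Fin (suc m) → A) → sw i (tabulate f) ≡ tabulate (λ k → f (s i ⟨$⟩ʳ k))
sw-tabulate zero    f = refl
sw-tabulate (suc i) f = cong₂ _∷_ (cong f (sym (s-suc i zero)))
  (trans (sw-tabulate i (λ k → f (suc k))) (Vecₚ.tabulate-cong (λ k → cong f (sym (s-suc i (suc k))))))

sw-far : ∀ (i j : Fin m) → 1 < ∣ toℕ i - toℕ j ∣ → ∀ (w : Vec A (suc m)) → sw i (sw j w) ≡ sw j (sw i w)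
sw-far zero          (suc zero)    (s≤s ())
sw-far zero          (suc (suc j)) _ (a ∷ b ∷ w) = refl
sw-far (suc zero)    zero          (s≤s ())
sw-far (suc (suc i)) zero          _ (a ∷ b ∷ w) = refl
sw-far (suc i)       (suc j)       d (a ∷ w)     = cong (a ∷_) (sw-far i j d w)

sw-braid : ∀ (i j : Fin m) → toℕ j ≡ suc (toℕ i) → ∀ (w : Vec A (suc m)) →
           sw i (sw j (sw i w)) ≡ sw j (sw i (sw j w))
sw-braid zero    (suc zero) refl (a ∷ b ∷ c ∷ w) = refl
sw-braid (suc i) (suc j)    e    (a ∷ w)         = cong (a ∷_) (sw-braid i j (ℕₚ.suc-injective e) w)

data Order : Set where
  lt eq gt : Order

rev : Order → Order
rev lt = gt
rev eq = eq
rev gt = lt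

cmp : ℕ → ℕ → Order
cmp zero    zero    = eq
cmp zero    (suc b) = lt
cmp (suc a) zero    = gt
cmp (suc a) (suc b) = cmp a b

cmp-rev : ∀ a b → cmp b a ≡ rev (cmp a b)
cmp-rev zero    zero    = refl
cmp-rev zero    (suc b) = refl
cmp-rev (suc a) zero    = refl
cmp-rev (suc a) (suc b) = cmp-rev a b

cmp-< : ∀ {a b} → a < b → cmp a b ≡ lt
cmp-< {zero}  {suc b} _         = refl
cmp-< {suc a} {suc b} (s≤s a<b) = cmp-< a<b

cmp-refl : ∀ a → cmp a a ≡ eq
cmp-refl zero    = refl
cmp-refl (suc a) = cmp-refl a

-- The possible values of cmp a b, cmp b c and cmp a c
data Consistent : Order → Order → Order → Set where
  lll : Consistent lt lt lt
  lel : Consistent lt eq lt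
  lgl : Consistent lt gt lt
  lge : Consistent lt gt eq
  lgg : Consistent lt gt gt
  ell : Consistent eq lt lt
  eee : Consistent eq eq eq
  egg : Consistent eq gt gt
  gll : Consistent gt lt lt
  gle : Consistent gt lt eq
  glg : Consistent gt lt gt
  geg : Consistent gt eq gt
  ggg : Consistent gt gt gt

consistent : ∀ a b c → Consistent (cmp a b) (cmp b c) (cmp a c)
consistent zero    zero    zero    = eee
consistent zero    zero    (suc c) = ell
consistent zero    (suc b) zero    = lge
consistent (suc a) zero    zero    = geg
consistent (suc a) (suc b) (suc c) = consistent a b c
consistent zero    (suc b) (suc c) with cmp b c
... | lt = lll
... | eq = lel
... | gt = lgl
consistent (suc a) zero    (suc c) with cmp a c
... | lt = gll
... | eq = gle
... | gt = glg
consistent (suc a) (suc b) zero with cmp a b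
... | lt = lgg
... | eq = egg
... | gt = ggg

-- The R-matrix operators over an abstract ring of scalars

record Scalars (R : CommutativeRing 0ℓ 0ℓ) : Set where
  open CommutativeRing R renaming (Carrier to C; _≈_ to _≈ᴿ_; _+_ to _⊕_; _*_ to _⊗_; 0# to 0ᴿ; 1# to 1ᴿ)
  field
    q s′ r q⁻¹ : C
    q≈1+s      : q ≈ᴿ 1ᴿ ⊕ s′
    s+r≈0      : s′ ⊕ r ≈ᴿ 0ᴿ
    q⊗q⁻¹      : q ⊗ q⁻¹ ≈ᴿ 1ᴿ
    φ          : ℤ[t^±1] → C
    φ-cong     : ∀ {a b} → a ≈ₗ b → φ a ≈ᴿ φ b
    φ-+        : ∀ a b → φ (a +ₗ b) ≈ᴿ φ a ⊕ φ b
    φ-*        : ∀ a b → φ (a *ₗ b) ≈ᴿ φ a ⊗ φ b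
    φ-0        : φ ⟦ 0ₚ ⟧ₗ ≈ᴿ 0ᴿ
    φ-1        : φ ⟦ 1ₚ ⟧ₗ ≈ᴿ 1ᴿ
    φ-t        : φ ⟦ t ⟧ₗ ≈ᴿ q
    φ-s        : φ ⟦ t +ₚ -ₚ 1ₚ ⟧ₗ ≈ᴿ s′
    φ-r        : φ ⟦ 1ₚ +ₚ -ₚ t ⟧ₗ ≈ᴿ r
    φ-neg      : φ ⟦ -ₚ 1ₚ ⟧ₗ ⊕ 1ᴿ ≈ᴿ 0ᴿ

-- With `R` abstract no fraction ever unfolds; the instance in view is ℚ(t) with q = t, s′ = t - 1,
-- r = 1 - t. The solver works in semirings, so s′ and its negative r are separate constants, tied
-- together by `s+r≈0`.
module Operators (R : CommutativeRing 0ℓ 0ℓ) (Σc : Scalars R) (A : Set) (rank : A → ℕ) where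
  open CommutativeRing R public using () renaming
    ( Carrier to C; _≈_ to _≈ᴿ_; _+_ to _⊕_; _*_ to _⊗_; 0# to 0ᴿ; 1# to 1ᴿ; setoid to R-setoid
    ; refl to ≈refl; sym to ≈sym; trans to ≈trans; reflexive to ≈reflexive; +-cong to ⊕-cong; *-cong to ⊗-cong
    ; commutativeSemiring to R-semiring; +-identityˡ to ⊕-identityˡ; +-identityʳ to ⊕-identityʳ; zeroˡ to
      ⊗-zeroˡ; zeroʳ to ⊗-zeroʳ
    ; *-identityˡ to ⊗-identityˡ; *-congˡ to ⊗-congˡ; +-congˡ to ⊕-congˡ; *-assoc to ⊗-assoc; *-comm to ⊗-comm;
      +-comm to ⊕-comm; +-assoc to ⊕-assoc
    ; distribˡ to ⊗-distribˡ; distribʳ to ⊗-distribʳ)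
  open Scalars Σc public
  open NatSolver R-semiring public using (solve; _:=_; _:+_; _:*_; con)
  module ≈-Reasoning = SetoidReasoning R-setoid

  Fun : ℕ → Set
  Fun n = Vec A n → C

  infix 4 _≐_
  _≐_ : Fun n → Fun n → Set
  f ≐ g = ∀ w → f w ≈ᴿ g w

  ≐sym : ∀ {f g : Fun n} → f ≐ g → g ≐ f
  ≐sym e w = ≈sym (e w)

  ≐trans : ∀ {f g h : Fun n} → f ≐ g → g ≐ h → f ≐ h
  ≐trans e e′ w = ≈trans (e w) (e′ w)

  ≐refl : ∀ {f : Fun n} → f ≐ f
  ≐refl w = ≈refl

  infixr 7 _∙_
  _∙_ : C → Fun n → Fun n
  (a ∙ f) w = a ⊗ f w

  infixl 6 _⊹_
  _⊹_ : Fun n → Fun n → Fun n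
  (f ⊹ g) w = f w ⊕ g w

  record Linear (F : Fun m → Fun n) : Set where
    field
      F-cong : ∀ {f g} → f ≐ g → F f ≐ F g
      F-⊹    : ∀ f g → F (f ⊹ g) ≐ F f ⊹ F g
      F-∙    : ∀ a f → F (a ∙ f) ≐ a ∙ F f
  open Linear public

  ord : Fin m → Vec A (suc m) → Order
  ord zero    (a ∷ b ∷ w) = cmp (rank a) (rank b)
  ord (suc i) (a ∷ w)     = ord i w

  ord-at : ∀ {i : Fin m} {w a b} → At a b i w → ord i w ≡ cmp (rank a) (rank b)
  ord-at here      = refl
  ord-at (there p) = ord-at p

  ord-sw : ∀ (i : Fin m) w → ord i (sw i w) ≡ rev (ord i w)
  ord-sw zero    (a ∷ b ∷ w) = cmp-rev (rank a) (rank b)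
  ord-sw (suc i) (a ∷ w)     = ord-sw i w

  ord-far : ∀ (i j : Fin m) → 1 < ∣ toℕ i - toℕ j ∣ → ∀ w → ord i (sw j w) ≡ ord i w
  ord-far zero          (suc zero)    (s≤s ())
  ord-far zero          (suc (suc j)) _ (a ∷ b ∷ w) = refl
  ord-far (suc zero)    zero          (s≤s ())
  ord-far (suc (suc i)) zero          _ (a ∷ b ∷ w) = refl
  ord-far (suc i)       (suc j)       d (a ∷ w)     = ord-far i j d w

  -- For three consecutive letters a, b, c, the orders that occur on both sides of the braid
  -- relation are those of (a, b), (b, c), (a, c) and their reverses.
  record Braided (i j : Fin m) (w : Vec A (suc m)) : Set where
    field
      outer  : ord i (sw j w) ≡ ord j (sw i w)
      first  : ord j (sw i (sw j w)) ≡ ord i w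
      second : ord i (sw j (sw i w)) ≡ ord j w
      orders : Consistent (ord i w) (ord j w) (ord j (sw i w))

  braided : ∀ (i j : Fin m) → toℕ j ≡ suc (toℕ i) → ∀ w → Braided i j w
  braided zero    (suc zero) refl (a ∷ b ∷ c ∷ w) = record
    { outer = refl ; first = refl ; second = refl ; orders = consistent (rank a) (rank b) (rank c) }
  braided (suc i) (suc j)    e    (a ∷ w) = record
    { outer = outer ; first = first ; second = second ; orders = orders }
    where open Braided (braided i j (ℕₚ.suc-injective e) w)

  -- T_i and t T_i⁻¹ both have this form and share `α`; linearity and far commutation are proved for
  -- both at once.
  op : (α β : Order → C) → Fin m → Fun (suc m) → Fun (suc m)
  op α β i f w = α (ord i w) ⊗ f (sw i w) ⊕ β (ord i w) ⊗ f w

  op-linear : ∀ α β (i : Fin m) → Linear (op α β i)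
  op-linear α β i = record
    { F-cong = λ e w → ⊕-cong (⊗-congˡ (e (sw i w))) (⊗-congˡ (e w))
    ; F-⊹ = λ f g w → solve 6 (λ a b x y x′ y′ → a :* (x :+ y) :+ b :* (x′ :+ y′) := (a :* x :+ b :* x′) :+
        (a :* y :+ b :* y′))
        ≈refl (α (ord i w)) (β (ord i w)) (f (sw i w)) (g (sw i w)) (f w) (g w)
    ; F-∙ = λ k f w → solve 5 (λ a b k x y → a :* (k :* x) :+ b :* (k :* y) := k :* (a :* x :+ b :* y))
        ≈refl (α (ord i w)) (β (ord i w)) k (f (sw i w)) (f w) }

  op-at : ∀ α β (i : Fin m) f {w v x} → ord i w ≡ x → sw i w ≡ v → op α β i f w ≈ᴿ α x ⊗ f v ⊕ β x ⊗ f w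
  op-at α β i f refl refl = ≈refl

  op-far : ∀ α β α′ β′ (i j : Fin m) → 1 < ∣ toℕ i - toℕ j ∣ → ∀ f → op α β i (op α′ β′ j f) ≐ op α′ β′ j (op α β i f)
  op-far α β α′ β′ i j d f w = begin
    α x ⊗ op α′ β′ j f (sw i w) ⊕ β x ⊗ op α′ β′ j f w
      ≈⟨ ⊕-cong (⊗-congˡ (op-at α′ β′ j f (ord-far j i (subst (1 <_) (ℕₚ.∣-∣-comm (toℕ i) (toℕ j)) d) w) refl))
        ≈refl ⟩
    α x ⊗ (α′ y ⊗ f (sw j (sw i w)) ⊕ β′ y ⊗ f (sw i w)) ⊕ β x ⊗ (α′ y ⊗ f (sw j w) ⊕ β′ y ⊗ f w)
      ≈⟨ solve 8 (λ a b a′ b′ f₁ f₂ f₃ f₄ → a :* (a′ :* f₁ :+ b′ :* f₂) :+ b :* (a′ :* f₃ :+ b′ :* f₄)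
           := a′ :* (a :* f₁ :+ b :* f₃) :+ b′ :* (a :* f₂ :+ b :* f₄)) ≈refl
           (α x) (β x) (α′ y) (β′ y) (f (sw j (sw i w))) (f (sw i w)) (f (sw j w)) (f w) ⟩
    α′ y ⊗ (α x ⊗ f (sw j (sw i w)) ⊕ β x ⊗ f (sw j w)) ⊕ β′ y ⊗ (α x ⊗ f (sw i w) ⊕ β x ⊗ f w)
      ≈⟨ ⊕-cong (⊗-congˡ (op-at α β i f (ord-far i j d w) (sw-far i j d w))) ≈refl ⟨
    α′ y ⊗ op α β i f (sw j w) ⊕ β′ y ⊗ op α β i f w ∎
    where
    open ≈-Reasoning
    x = ord i w
    y = ord j w

  -- The two sides of the braid relation at w involve six values of f.  Their
  -- coefficients at three of them agree identically; the others are those of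
  -- f w (yb₀), f (sw i w) (yb₁) and f (sw j w) (yb₂).
  record YangBaxter (α β : Order → C) (x y z : Order) : Set where
    field
      yb₀ : α x ⊗ α (rev x) ⊗ β z ⊕ β x ⊗ β x ⊗ β y ≈ᴿ α y ⊗ α (rev y) ⊗ β z ⊕ β y ⊗ β y ⊗ β x
      yb₁ : α x ⊗ (β z ⊗ β (rev x) ⊕ β x ⊗ β y) ≈ᴿ β y ⊗ α x ⊗ β z
      yb₂ : β x ⊗ α y ⊗ β z ≈ᴿ α y ⊗ (β z ⊗ β (rev y) ⊕ β y ⊗ β x)

  op-braid : ∀ α β → (∀ {x y z} → Consistent x y z → YangBaxter α β x y z) →
             ∀ (i j : Fin m) → toℕ j ≡ suc (toℕ i) → ∀ f →
             op α β i (op α β j (op α β i f)) ≐ op α β j (op α β i (op α β j f))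
  op-braid α β yb i j e f w = begin
    α x ⊗ op α β j (op α β i f) (sw i w) ⊕ β x ⊗ op α β j (op α β i f) w
      ≈⟨ ⊕-cong
           (⊗-congˡ (⊕-cong (⊗-congˡ (op-at α β i f second refl))
             (⊗-congˡ (op-at α β i f (ord-sw i w) (sw-sw i w)))))
           (⊗-congˡ (⊕-cong (⊗-congˡ (op-at α β i f outer refl)) ≈refl)) ⟩
    α x ⊗ (α z ⊗ (α y ⊗ f₁ ⊕ β y ⊗ f₂) ⊕ β z ⊗ (α (rev x) ⊗ f₀ ⊕ β (rev x) ⊗ f₃))
      ⊕ β x ⊗ (α y ⊗ (α z ⊗ f₄ ⊕ β z ⊗ f₅) ⊕ β y ⊗ (α x ⊗ f₃ ⊕ β x ⊗ f₀))
      ≈⟨ solve 14 (λ ax ax̄ ay az bx bx̄ by bz f₀ f₁ f₂ f₃ f₄ f₅ →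
           ax :* (az :* (ay :* f₁ :+ by :* f₂) :+ bz :* (ax̄ :* f₀ :+ bx̄ :* f₃)) :+ bx :*
             (ay :* (az :* f₄ :+ bz :* f₅) :+ by :* (ax :* f₃ :+ bx :* f₀))
           := (ax :* ay :* az :* f₁ :+ ax :* az :* by :* f₂ :+ ay :* az :* bx :* f₄)
              :+ ((ax :* ax̄ :* bz :+ bx :* bx :* by) :* f₀ :+ (ax :* (bz :* bx̄ :+ bx :* by)) :* f₃ :+
                (bx :* ay :* bz) :* f₅)) ≈refl
           (α x) (α (rev x)) (α y) (α z) (β x) (β (rev x)) (β y) (β z) f₀ f₁ f₂ f₃ f₄ f₅ ⟩
    (α x ⊗ α y ⊗ α z ⊗ f₁ ⊕ α x ⊗ α z ⊗ β y ⊗ f₂ ⊕ α y ⊗ α z ⊗ β x ⊗ f₄)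
      ⊕ ((α x ⊗ α (rev x) ⊗ β z ⊕ β x ⊗ β x ⊗ β y) ⊗ f₀ ⊕ (α x ⊗ (β z ⊗ β (rev x) ⊕ β x ⊗ β y)) ⊗ f₃ ⊕
        (β x ⊗ α y ⊗ β z) ⊗ f₅)
      ≈⟨ ⊕-congˡ (⊕-cong (⊕-cong (⊗-cong yb₀ ≈refl) (⊗-cong yb₁ ≈refl)) (⊗-cong yb₂ ≈refl)) ⟩
    (α x ⊗ α y ⊗ α z ⊗ f₁ ⊕ α x ⊗ α z ⊗ β y ⊗ f₂ ⊕ α y ⊗ α z ⊗ β x ⊗ f₄)
      ⊕ ((α y ⊗ α (rev y) ⊗ β z ⊕ β y ⊗ β y ⊗ β x) ⊗ f₀ ⊕ (β y ⊗ α x ⊗ β z) ⊗ f₃ ⊕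
        (α y ⊗ (β z ⊗ β (rev y) ⊕ β y ⊗ β x)) ⊗ f₅)
      ≈⟨ solve 14 (λ ax ay aȳ az bx by bȳ bz f₀ f₁ f₂ f₃ f₄ f₅ →
           (ax :* ay :* az :* f₁ :+ ax :* az :* by :* f₂ :+ ay :* az :* bx :* f₄)
              :+ ((ay :* aȳ :* bz :+ by :* by :* bx) :* f₀ :+ (by :* ax :* bz) :* f₃ :+
                (ay :* (bz :* bȳ :+ by :* bx)) :* f₅)
           := ay :* (az :* (ax :* f₁ :+ bx :* f₄) :+ bz :* (aȳ :* f₀ :+ bȳ :* f₅)) :+ by :*
             (ax :* (az :* f₂ :+ bz :* f₃) :+ bx :* (ay :* f₅ :+ by :* f₀))) ≈refl
           (α x) (α y) (α (rev y)) (α z) (β x) (β y) (β (rev y)) (β z) f₀ f₁ f₂ f₃ f₄ f₅ ⟩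
    α y ⊗ (α z ⊗ (α x ⊗ f₁ ⊕ β x ⊗ f₄) ⊕ β z ⊗ (α (rev y) ⊗ f₀ ⊕ β (rev y) ⊗ f₅))
      ⊕ β y ⊗ (α x ⊗ (α z ⊗ f₂ ⊕ β z ⊗ f₃) ⊕ β x ⊗ (α y ⊗ f₅ ⊕ β y ⊗ f₀))
      ≈⟨ ⊕-cong
           (⊗-congˡ (≈trans (op-at α β i (op α β j f) outer refl)
             (⊕-cong (⊗-congˡ (op-at α β j f first (sym (sw-braid i j e w))))
             (⊗-congˡ (op-at α β j f (ord-sw j w) (sw-sw j w))))))
           (⊗-congˡ (⊕-cong (⊗-congˡ (op-at α β j f refl refl)) ≈refl)) ⟨
    α y ⊗ op α β i (op α β j f) (sw j w) ⊕ β y ⊗ op α β i (op α β j f) w ∎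
    where
    open ≈-Reasoning
    open Braided (braided i j e w)
    x = ord i w
    y = ord j w
    z = ord j (sw i w)
    open YangBaxter (yb orders)
    f₀ = f w
    f₁ = f (sw i (sw j (sw i w)))
    f₂ = f (sw j (sw i w))
    f₃ = f (sw i w)
    f₄ = f (sw i (sw j w))
    f₅ = f (sw j w)

  -- The tables act on values of functions. On the indicator of a word, the operator with `α` and
  -- `β` swaps an ascending pair with coefficient 1, sends a descending pair to q times the swapped
  -- word plus s′ times itself, and multiplies a pair of equal letters by q.
  α β β′ : Order → C
  α lt = q
  α eq = 0ᴿ
  α gt = 1ᴿ
  β lt = 0ᴿ
  β eq = q
  β gt = s′
  β′ lt = r
  β′ eq = 1ᴿ
  β′ gt = 0ᴿ

  -- τ i is the action of T_i and τ′ i that of t T_i⁻¹ = T_i - (t - 1).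
  τ τ′ : Fin m → Fun (suc m) → Fun (suc m)
  τ  = op α β
  τ′ = op α β′

  q+r≈1 : q ⊕ r ≈ᴿ 1ᴿ
  q+r≈1 = ≈trans (⊕-cong q≈1+s ≈refl) (≈trans (⊕-assoc 1ᴿ s′ r) (≈trans (⊕-congˡ s+r≈0) (⊕-identityʳ 1ᴿ)))

  absorb-s : ∀ a → q ⊗ a ≈ᴿ a ⊕ s′ ⊗ a
  absorb-s a = ≈trans (⊗-cong q≈1+s ≈refl) (solve 2 (λ s a → (con 1 :+ s) :* a := a :+ s :* a) ≈refl s′ a)

  absorb-r : ∀ a → a ≈ᴿ q ⊗ a ⊕ r ⊗ a
  absorb-r a = ≈trans (≈sym (⊗-identityˡ a)) (≈trans (⊗-cong (≈sym q+r≈1) ≈refl) (⊗-distribʳ a q r))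

  quadratic-at : ∀ x → (α x ⊗ α (rev x) ⊕ β x ⊗ β x ≈ᴿ s′ ⊗ β x ⊕ q) × (α x ⊗ β (rev x) ⊕ β x ⊗ α x ≈ᴿ s′ ⊗ α x)
  quadratic-at lt = solve 2 (λ q s → q :* con 1 :+ con 0 :* con 0 := s :* con 0 :+ q) ≈refl q s′
                  , solve 2 (λ q s → q :* s :+ con 0 :* q := s :* q) ≈refl q s′
  quadratic-at eq = ≈trans (⊕-cong (⊗-zeroˡ 0ᴿ) (absorb-s q))
      (solve 2 (λ q s → con 0 :+ (q :+ s :* q) := s :* q :+ q) ≈refl q s′)
                  , solve 2 (λ q s → con 0 :* q :+ q :* con 0 := s :* con 0) ≈refl q s′
  quadratic-at gt = solve 2 (λ q s → con 1 :* q :+ s :* s := s :* s :+ q) ≈refl q s′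
                  , solve 2 (λ q s → con 1 :* con 0 :+ s :* con 1 := s :* con 1) ≈refl q s′

  op-op : ∀ α β α′ β′ (i : Fin m) f w → let x = ord i w in
          op α β i (op α′ β′ i f) w ≈ᴿ (α x ⊗ α′ (rev x) ⊕ β x ⊗ β′ x) ⊗ f w ⊕
            (α x ⊗ β′ (rev x) ⊕ β x ⊗ α′ x) ⊗ f (sw i w)
  op-op α β α′ β′ i f w = ≈trans
    (⊕-cong (⊗-congˡ (op-at α′ β′ i f (ord-sw i w) (sw-sw i w))) ≈refl)
    (solve 8 (λ a b a′ b′ ā b̄ f g → a :* (ā :* f :+ b̄ :* g) :+ b :* (a′ :* g :+ b′ :* f) :=
      (a :* ā :+ b :* b′) :* f :+ (a :* b̄ :+ b :* a′) :* g)
      ≈refl (α x) (β x) (α′ x) (β′ x) (α′ (rev x)) (β′ (rev x)) (f w) (f (sw i w)))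
    where x = ord i w

  τ-quadratic : ∀ (i : Fin m) f → τ i (τ i f) ≐ s′ ∙ τ i f ⊹ q ∙ f
  τ-quadratic i f w = ≈trans (op-op α β α β i f w)
    (≈trans (⊕-cong (⊗-cong (proj₁ (quadratic-at x)) ≈refl) (⊗-cong (proj₂ (quadratic-at x)) ≈refl))
      (solve 6 (λ a b q s f g → (s :* b :+ q) :* f :+ (s :* a) :* g := s :* (a :* g :+ b :* f) :+ q :* f) ≈refl
        (α x) (β x) q s′ (f w) (f (sw i w))))
    where x = ord i w

  inverse-at : ∀ x → (α x ⊗ α (rev x) ⊕ β x ⊗ β′ x ≈ᴿ q) × (α x ⊗ β′ (rev x) ⊕ β x ⊗ α x ≈ᴿ 0ᴿ) ×
      (α x ⊗ β (rev x) ⊕ β′ x ⊗ α x ≈ᴿ 0ᴿ)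
  inverse-at lt = solve 2 (λ q r → q :* con 1 :+ con 0 :* r := q) ≈refl q r
                , solve 1 (λ q → q :* con 0 :+ con 0 :* q := con 0) ≈refl q
                , ≈trans (solve 3 (λ q r s → q :* s :+ r :* q := (s :+ r) :* q) ≈refl q r s′)
                  (≈trans (⊗-cong s+r≈0 ≈refl) (⊗-zeroˡ q))
  inverse-at eq = solve 1 (λ q → con 0 :* con 0 :+ q :* con 1 := q) ≈refl q
                , solve 1 (λ q → con 0 :* con 1 :+ q :* con 0 := con 0) ≈refl q
                , solve 1 (λ q → con 0 :* q :+ con 1 :* con 0 := con 0) ≈refl q
  inverse-at gt = solve 2 (λ q s → con 1 :* q :+ s :* con 0 := q) ≈refl q s′
                , ≈trans (solve 2 (λ r s → con 1 :* r :+ s :* con 1 := s :+ r) ≈refl r s′) s+r≈0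
                , solve 0 (con 1 :* con 0 :+ con 0 :* con 1 := con 0) ≈refl

  ττ′ : ∀ (i : Fin m) f → τ i (τ′ i f) ≐ q ∙ f
  ττ′ i f w = ≈trans (op-op α β α β′ i f w)
    (≈trans (⊕-cong (⊗-cong (proj₁ (inverse-at x)) ≈refl) (⊗-cong (proj₁ (proj₂ (inverse-at x))) ≈refl))
      (solve 3 (λ q f g → q :* f :+ con 0 :* g := q :* f) ≈refl q (f w) (f (sw i w))))
    where x = ord i w

  τ′τ : ∀ (i : Fin m) f → τ′ i (τ i f) ≐ q ∙ f
  τ′τ i f w = ≈trans (op-op α β′ α β i f w)
    (≈trans (⊕-cong (⊗-cong (≈trans (⊕-congˡ (⊗-comm (β′ x) (β x))) (proj₁ (inverse-at x))) ≈refl)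
      (⊗-cong (proj₂ (proj₂ (inverse-at x))) ≈refl))
      (solve 3 (λ q f g → q :* f :+ con 0 :* g := q :* f) ≈refl q (f w) (f (sw i w))))
    where x = ord i w

  -- Only `egg` and `geg`, where two of the letters are equal and lie above the third, use q = 1 +
  -- s′. All other cases are identities of semirings.
  τ-yb : ∀ {x y z} → Consistent x y z → YangBaxter α β x y z
  τ-yb lll = record { yb₀ = ≈refl ; yb₁ = solve 2 (λ q s → q :*
      (con 0 :* s :+ con 0 :* con 0) := con 0 :* q :* con 0) ≈refl q s′ ; yb₂ = solve 2
        (λ q s → con 0 :* q :* con 0 := q :* (con 0 :* s :+ con 0 :* con 0)) ≈refl q s′ }
  τ-yb lel = record
      { yb₀ = solve 1 (λ q → q :* con 1 :* con 0 :+ con 0 :* con 0 :* q := con 0 :* con 0 :* con 0 :+ q :* q :*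
          con 0) ≈refl q
      ; yb₁ = solve 2 (λ q s → q :* (con 0 :* s :+ con 0 :* q) := q :* q :* con 0) ≈refl q s′
      ; yb₂ = solve 1 (λ q → con 0 :* con 0 :* con 0 := con 0 :* (con 0 :* q :+ q :* con 0)) ≈refl q }
  τ-yb lgl = record
      { yb₀ = solve 2 (λ q s → q :* con 1 :* con 0 :+ con 0 :* con 0 :* s := con 1 :* q :* con 0 :+ s :* s :*
          con 0) ≈refl q s′
      ; yb₁ = solve 2 (λ q s → q :* (con 0 :* s :+ con 0 :* s) := s :* q :* con 0) ≈refl q s′
      ; yb₂ = solve 1 (λ s → con 0 :* con 1 :* con 0 := con 1 :* (con 0 :* con 0 :+ s :* con 0)) ≈refl s′ }
  τ-yb lge = record
      { yb₀ = solve 2 (λ q s → q :* con 1 :* q :+ con 0 :* con 0 :* s := con 1 :* q :* q :+ s :* s :* con 0)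
          ≈refl q s′
      ; yb₁ = solve 2 (λ q s → q :* (q :* s :+ con 0 :* s) := s :* q :* q) ≈refl q s′
      ; yb₂ = solve 2 (λ q s → con 0 :* con 1 :* q := con 1 :* (q :* con 0 :+ s :* con 0)) ≈refl q s′ }
  τ-yb lgg = record
      { yb₀ = solve 2 (λ q s → q :* con 1 :* s :+ con 0 :* con 0 :* s := con 1 :* q :* s :+ s :* s :* con 0)
          ≈refl q s′
      ; yb₁ = solve 2 (λ q s → q :* (s :* s :+ con 0 :* s) := s :* q :* s) ≈refl q s′
      ; yb₂ = solve 2 (λ q s → con 0 :* con 1 :* s := con 1 :* (s :* con 0 :+ s :* con 0)) ≈refl q s′ }
  τ-yb ell = record
      { yb₀ = solve 1 (λ q → con 0 :* con 0 :* con 0 :+ q :* q :* con 0 := q :* con 1 :* con 0 :+ con 0 :* con 0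
          :* q) ≈refl q
      ; yb₁ = solve 1 (λ q → con 0 :* (con 0 :* q :+ q :* con 0) := con 0 :* con 0 :* con 0) ≈refl q
      ; yb₂ = solve 2 (λ q s → q :* q :* con 0 := q :* (con 0 :* s :+ con 0 :* q)) ≈refl q s′ }
  τ-yb eee = record
      { yb₀ = ≈refl
      ; yb₁ = solve 1 (λ q → con 0 :* (q :* q :+ q :* q) := q :* con 0 :* q) ≈refl q
      ; yb₂ = solve 1 (λ q → q :* con 0 :* q := con 0 :* (q :* q :+ q :* q)) ≈refl q }
  τ-yb egg = record
      { yb₀ = ≈trans (solve 2 (λ q s → con 0 :* con 0 :* s :+ q :* q :* s := q :* (q :* s)) ≈refl q s′)
                (≈trans (absorb-s (q ⊗ s′)) (solve 2 (λ q s → q :* s :+ s :*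
                  (q :* s) := con 1 :* q :* s :+ s :* s :* q) ≈refl q s′))
      ; yb₁ = solve 2 (λ q s → con 0 :* (s :* q :+ q :* s) := s :* con 0 :* s) ≈refl q s′
      ; yb₂ = solve 2 (λ q s → q :* con 1 :* s := con 1 :* (s :* con 0 :+ s :* q)) ≈refl q s′ }
  τ-yb gll = record
      { yb₀ = solve 2 (λ q s → con 1 :* q :* con 0 :+ s :* s :* con 0 := q :* con 1 :* con 0 :+ con 0 :* con 0
          :* s) ≈refl q s′
      ; yb₁ = solve 1 (λ s → con 1 :* (con 0 :* con 0 :+ s :* con 0) := con 0 :* con 1 :* con 0) ≈refl s′
      ; yb₂ = solve 2 (λ q s → s :* q :* con 0 := q :* (con 0 :* s :+ con 0 :* s)) ≈refl q s′ }
  τ-yb gle = record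
      { yb₀ = solve 2 (λ q s → con 1 :* q :* q :+ s :* s :* con 0 := q :* con 1 :* q :+ con 0 :* con 0 :* s)
          ≈refl q s′
      ; yb₁ = solve 2 (λ q s → con 1 :* (q :* con 0 :+ s :* con 0) := con 0 :* con 1 :* q) ≈refl q s′
      ; yb₂ = solve 2 (λ q s → s :* q :* q := q :* (q :* s :+ con 0 :* s)) ≈refl q s′ }
  τ-yb glg = record
      { yb₀ = solve 2 (λ q s → con 1 :* q :* s :+ s :* s :* con 0 := q :* con 1 :* s :+ con 0 :* con 0 :* s)
          ≈refl q s′
      ; yb₁ = solve 1 (λ s → con 1 :* (s :* con 0 :+ s :* con 0) := con 0 :* con 1 :* s) ≈refl s′
      ; yb₂ = solve 2 (λ q s → s :* q :* s := q :* (s :* s :+ con 0 :* s)) ≈refl q s′ }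
  τ-yb geg = record
      { yb₀ = ≈sym (≈trans (solve 2 (λ q s → con 0 :* con 0 :* s :+ q :* q :* s := q :* (q :* s)) ≈refl q s′)
                (≈trans (absorb-s (q ⊗ s′)) (solve 2 (λ q s → q :* s :+ s :*
                  (q :* s) := con 1 :* q :* s :+ s :* s :* q) ≈refl q s′)))
      ; yb₁ = solve 2 (λ q s → con 1 :* (s :* con 0 :+ s :* q) := q :* con 1 :* s) ≈refl q s′
      ; yb₂ = solve 2 (λ q s → s :* con 0 :* s := con 0 :* (s :* q :+ q :* s)) ≈refl q s′ }
  τ-yb ggg = record
      { yb₀ = ≈refl
      ; yb₁ = solve 1 (λ s → con 1 :* (s :* con 0 :+ s :* s) := s :* con 1 :* s) ≈refl s′
      ; yb₂ = solve 1 (λ s → s :* con 1 :* s := con 1 :* (s :* con 0 :+ s :* s)) ≈refl s′ }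

-- Palindromic words of the Jucys-Murphy elements

pal : Fin (suc m) → List (Fin m)
pal {zero}  zero    = []
pal {suc m} zero    = zero ∷ map suc (pal zero) ++ zero ∷ []
pal {suc m} (suc j) = map suc (pal j)

-- Half the length of `pal j`, which runs through j, j + 1, ..., m - 1 and back to j. It is the
-- exponent that normalises the action of X_j.
codepth : Fin (suc m) → ℕ
codepth {m}     zero    = m
codepth {suc m} (suc j) = codepth j

length-pal : ∀ (j : Fin (suc m)) → length (pal j) ≡ codepth j ℕ.+ codepth j
length-pal {zero}  zero    = refl
length-pal {suc m} zero    = cong suc (begin
  length (map suc (pal {m} zero) ++ 0F ∷ [])     ≡⟨ Listₚ.length-++ (map suc (pal {m} zero)) {0F ∷ []} ⟩
  length (map suc (pal {m} zero)) ℕ.+ 1          ≡⟨ cong (ℕ._+ 1) (Listₚ.length-map suc (pal {m} zero)) ⟩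
  length (pal {m} zero) ℕ.+ 1                    ≡⟨ cong (ℕ._+ 1) (length-pal {m} zero) ⟩
  m ℕ.+ m ℕ.+ 1                                  ≡⟨ ℕₚ.+-comm (m ℕ.+ m) 1 ⟩
  suc (m ℕ.+ m)                                  ≡⟨ ℕₚ.+-suc m m ⟨
  m ℕ.+ suc m                                    ∎)
  where open ≡-Reasoning
length-pal {suc m} (suc j) = trans (Listₚ.length-map suc (pal j)) (length-pal j)

codepth-inject₁ : ∀ (i : Fin m) → codepth (inject₁ i) ≡ suc (codepth (suc i))
codepth-inject₁ {suc m} zero    = refl
codepth-inject₁ {suc m} (suc i) = codepth-inject₁ i

pal-inject₁ : ∀ (i : Fin m) → pal (inject₁ i) ≡ i ∷ pal (suc i) ++ i ∷ []
pal-inject₁ {suc m} zero    = refl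
pal-inject₁ {suc m} (suc i) = trans (cong (map suc) (pal-inject₁ i))
  (cong (suc i ∷_) (Listₚ.map-++ suc (pal (suc i)) (i ∷ [])))

past-snoc : ∀ (i : Fin m) is → i ∷ is ∼ is ++ i ∷ [] → ∀ js → i ∷ is ++ js ∼ is ++ i ∷ js
past-snoc i is e js = ∼trans (∼-++ʳ js e) (∼-reflexive (Listₚ.++-assoc is (i ∷ []) js))

-- The letter 1 is carried across by two braid moves, 1 0 1 to 0 1 0 at the left end and 0 1 0 to 1
-- 0 1 at the right end, with a 0 commuting past the inner palindrome in between. A larger letter
-- commutes with both outer 0s, and the inner palindrome is the induction hypothesis.
pal-0-comm : ∀ (i : Fin m) → suc i ∷ pal zero ∼ pal zero ++ suc i ∷ []
pal-0-comm {suc m} zero = begin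
  1F ∷ 0F ∷ map suc (0F ∷ Q ++ 0F ∷ []) ++ 0F ∷ []      ≡⟨ cong (λ is → 1F ∷ 0F ∷ 1F ∷ is) shape-Q ⟩
  1F ∷ 0F ∷ 1F ∷ map suc Q ++ 1F ∷ 0F ∷ []              ≈⟨ ∼braid 0F 1F _ refl ⟨
  0F ∷ 1F ∷ 0F ∷ map suc Q ++ 1F ∷ 0F ∷ []              ≈⟨ ∼∷ 0F (∼∷ 1F (0-past (pal zero) _)) ⟩
  0F ∷ 1F ∷ map suc Q ++ 0F ∷ 1F ∷ 0F ∷ []              ≈⟨ ∼∷ 0F (∼∷ 1F (∼-++ˡ (map suc Q) (∼braid 0F 1F [] refl))) ⟩
  0F ∷ 1F ∷ map suc Q ++ 1F ∷ 0F ∷ 1F ∷ []              ≡⟨ cong (λ is → 0F ∷ 1F ∷ is)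
    (Listₚ.++-assoc (map suc Q) (1F ∷ 0F ∷ []) (1F ∷ [])) ⟨
  0F ∷ 1F ∷ (map suc Q ++ 1F ∷ 0F ∷ []) ++ 1F ∷ []      ≡⟨ cong (λ is → 0F ∷ 1F ∷ is ++ 1F ∷ []) shape-Q ⟨
  (0F ∷ map suc (0F ∷ Q ++ 0F ∷ []) ++ 0F ∷ []) ++ 1F ∷ []  ∎
  where
  open ∼-Reasoning
  Q = map suc (pal zero)
  shape-Q : map suc (Q ++ 0F ∷ []) ++ 0F ∷ [] ≡ map suc Q ++ 1F ∷ 0F ∷ []
  shape-Q = trans (cong (_++ 0F ∷ []) (Listₚ.map-++ suc Q (0F ∷ []))) (Listₚ.++-assoc (map suc Q) (1F ∷ []) (0F ∷ []))
pal-0-comm {suc m} (suc i) = begin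
  suc (suc i) ∷ 0F ∷ map suc (pal zero) ++ 0F ∷ []       ≈⟨ ∼comm 0F (suc (suc i)) _ (s≤s (s≤s z≤n)) ⟨
  0F ∷ suc (suc i) ∷ map suc (pal zero) ++ 0F ∷ []       ≈⟨ ∼∷ 0F
    (past-snoc (suc (suc i)) (map suc (pal zero)) inner (0F ∷ [])) ⟩
  0F ∷ map suc (pal zero) ++ suc (suc i) ∷ 0F ∷ []       ≈⟨ ∼∷ 0F
    (∼-++ˡ (map suc (pal zero)) (∼comm 0F (suc (suc i)) [] (s≤s (s≤s z≤n)))) ⟨
  0F ∷ map suc (pal zero) ++ 0F ∷ suc (suc i) ∷ []       ≡⟨ cong (0F ∷_)
    (Listₚ.++-assoc (map suc (pal zero)) (0F ∷ []) _) ⟨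
  0F ∷ (map suc (pal zero) ++ 0F ∷ []) ++ suc (suc i) ∷ []  ∎
  where
  open ∼-Reasoning
  inner : suc (suc i) ∷ map suc (pal zero) ∼ map suc (pal zero) ++ suc (suc i) ∷ []
  inner = ∼trans (∼-map-suc (pal-0-comm i)) (∼-reflexive (Listₚ.map-++ suc (pal zero) (suc i ∷ [])))

pal-comm : ∀ (i : Fin m) j → j ≢ inject₁ i → j ≢ suc i → i ∷ pal j ∼ pal j ++ i ∷ []
pal-comm         zero    zero          p _ = contradiction refl p
pal-comm         zero    (suc zero)    _ p = contradiction refl p
pal-comm {suc (suc m)} zero (suc (suc j)) _ _ = ∼trans
  (∼-reflexive (cong (0F ∷_) (sym (Listₚ.++-identityʳ (pal (suc (suc j))))))) (0-past (pal j) [])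
pal-comm         (suc i) zero          _ _ = pal-0-comm i
pal-comm {suc m} (suc i) (suc j)       p p′ = ∼trans
  (∼-map-suc (pal-comm i j (λ e → p (cong suc e)) (λ e → p′ (cong suc e))))
  (∼-reflexive (Listₚ.map-++ suc (pal j) (i ∷ [])))

-- If one index is 0 and the other is not, every letter of the second palindrome is at least 1 and
-- so commutes with `pal zero`.
pal-pal : ∀ (i j : Fin (suc m)) → pal i ++ pal j ∼ pal j ++ pal i
pal-pal {zero}  zero    zero    = ∼refl
pal-pal {suc m} zero    zero    = ∼refl
pal-pal {suc m} zero    (suc j) = ∼sym (past (pal j))
  where
  past : ∀ is → map suc is ++ pal zero ∼ pal zero ++ map suc is
  past []       = ∼-reflexive (sym (Listₚ.++-identityʳ (pal zero)))
  past (i ∷ is) = ∼trans (∼∷ (suc i) (past is)) (past-snoc (suc i) (pal zero) (pal-0-comm i) (map suc is))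
pal-pal {suc m} (suc i) zero    = ∼sym (pal-pal zero (suc i))
pal-pal {suc m} (suc i) (suc j) = ∼trans (∼-reflexive (sym (Listₚ.map-++ suc (pal i) (pal j))))
  (∼trans (∼-map-suc (pal-pal i j)) (∼-reflexive (Listₚ.map-++ suc (pal j) (pal i))))

-- The action of the affine Hecke algebra on functions on words

Tw : List (Fin m) → H m
Tw = foldr (λ i → T i *ᴴ_) 1ᴴ

module Action (R : CommutativeRing 0ℓ 0ℓ) (Σc : Scalars R) (A : Set) (_≟ᴬ_ : DecidableEquality A) (rank : A → ℕ) where
  open Operators R Σc A rank public

  ∙-cong : ∀ {a b} {f g : Fun n} → a ≈ᴿ b → f ≐ g → a ∙ f ≐ b ∙ g
  ∙-cong e e′ w = ⊗-cong e (e′ w)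

  q⁻¹⊗q : q⁻¹ ⊗ q ≈ᴿ 1ᴿ
  q⁻¹⊗q = ≈trans (⊗-comm q⁻¹ q) q⊗q⁻¹

  q-cancel : ∀ {f g : Fun n} → q ∙ f ≐ q ∙ g → f ≐ g
  q-cancel {f = f} {g} e w = begin
    f w              ≈⟨ unit (f w) ⟨
    q⁻¹ ⊗ (q ⊗ f w)  ≈⟨ ⊗-congˡ (e w) ⟩
    q⁻¹ ⊗ (q ⊗ g w)  ≈⟨ unit (g w) ⟩
    g w              ∎
    where
    open ≈-Reasoning
    unit : ∀ a → q⁻¹ ⊗ (q ⊗ a) ≈ᴿ a
    unit a = ≈trans (≈sym (⊗-assoc q⁻¹ q a)) (≈trans (⊗-cong q⁻¹⊗q ≈refl) (⊗-identityˡ a))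

  τ-linear : ∀ (i : Fin m) → Linear (τ i)
  τ-linear = op-linear α β

  τ′-linear : ∀ (i : Fin m) → Linear (τ′ i)
  τ′-linear = op-linear α β′

  τ-injective : ∀ (i : Fin m) {f g} → τ i f ≐ τ i g → f ≐ g
  τ-injective i {f} {g} e = q-cancel (≐trans (≐sym (τ′τ i f)) (≐trans (F-cong (τ′-linear i) e) (τ′τ i g)))

  τ′-injective : ∀ (i : Fin m) {f g} → τ′ i f ≐ τ′ i g → f ≐ g
  τ′-injective i {f} {g} e = q-cancel (≐trans (≐sym (ττ′ i f)) (≐trans (F-cong (τ-linear i) e) (ττ′ i g)))

  τ-braid : ∀ (i j : Fin m) → toℕ j ≡ suc (toℕ i) → ∀ f → τ i (τ j (τ i f)) ≐ τ j (τ i (τ j f))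
  τ-braid = op-braid α β τ-yb

  -- Inherited from `τ`: under τ i, τ j, τ i, which are injective, both sides become q³ f.
  τ′-braid : ∀ (i j : Fin m) → toℕ j ≡ suc (toℕ i) → ∀ f → τ′ i (τ′ j (τ′ i f)) ≐ τ′ j (τ′ i (τ′ j f))
  τ′-braid i j e f = τ-injective i (τ-injective j (τ-injective i
    (≐trans (undo i j (τ′ i f) (ττ′ i f)) (≐sym
      (≐trans (τ-braid i j e _) (undo j i (τ′ j f) (ττ′ j f)))))))
    where
    undo : ∀ i j g → τ i g ≐ q ∙ f → τ i (τ j (τ i (τ′ i (τ′ j g)))) ≐ q ∙ q ∙ q ∙ f
    undo i j g e = ≐trans (F-cong (τ-linear i) (≐trans (F-cong (τ-linear j) (ττ′ i _))
        (≐trans (F-∙ (τ-linear j) q (τ′ j g)) (∙-cong ≈refl (ττ′ j g)))))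
      (≐trans (F-∙ (τ-linear i) q (q ∙ g)) (∙-cong ≈refl (≐trans (F-∙ (τ-linear i) q g) (∙-cong ≈refl e))))

  ∘-linear : ∀ {F : Fun n → Fun k} {G : Fun m → Fun n} → Linear F → Linear G → Linear (λ f → F (G f))
  ∘-linear LF LG = record
    { F-cong = λ e → F-cong LF (F-cong LG e)
    ; F-⊹ = λ f g → ≐trans (F-cong LF (F-⊹ LG f g)) (F-⊹ LF _ _)
    ; F-∙ = λ a f → ≐trans (F-cong LF (F-∙ LG a f)) (F-∙ LF a _) }

  id-linear : Linear (λ (f : Fun n) → f)
  id-linear = record { F-cong = λ e → e ; F-⊹ = λ _ _ _ → ≈refl ; F-∙ = λ _ _ _ → ≈refl }

  ∙-linear : ∀ a → Linear (λ (f : Fun n) → a ∙ f)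
  ∙-linear a = record
    { F-cong = ∙-cong ≈refl
    ; F-⊹ = λ f g w → ⊗-distribˡ a (f w) (g w)
    ; F-∙ = λ b f w → solve 3 (λ a b x → a :* (b :* x) := b :* (a :* x)) ≈refl a b (f w) }

  ⊹-linear : ∀ {F G : Fun m → Fun n} → Linear F → Linear G → Linear (λ f → F f ⊹ G f)
  ⊹-linear {F = F} {G} LF LG = record
    { F-cong = λ e w → ⊕-cong (F-cong LF e w) (F-cong LG e w)
    ; F-⊹ = λ f g w → ≈trans (⊕-cong (F-⊹ LF f g w) (F-⊹ LG f g w))
        (solve 4 (λ a b c d → (a :+ b) :+ (c :+ d) := (a :+ c) :+ (b :+ d)) ≈refl (F f w) (F g w) (G f w) (G g w))
    ; F-∙ = λ a f w → ≈trans (⊕-cong (F-∙ LF a f w) (F-∙ LG a f w)) (≈sym (⊗-distribˡ a (F f w) (G f w))) }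

  module _ {F : Fin m → Fun (suc m) → Fun (suc m)} (LF : ∀ i → Linear (F i)) where
    act-linear : ∀ is → Linear (λ f → foldr F f is)
    act-linear []       = id-linear
    act-linear (i ∷ is) = ∘-linear (LF i) (act-linear is)

    act-∼ : (∀ i j → toℕ j ≡ suc (toℕ i) → ∀ f → F i (F j (F i f)) ≐ F j (F i (F j f))) →
            (∀ i j → 1 < ∣ toℕ i - toℕ j ∣ → ∀ f → F i (F j f) ≐ F j (F i f)) →
            ∀ {is js} → is ∼ js → ∀ f → foldr F f is ≐ foldr F f js
    act-∼ br far ∼refl             f = ≐refl
    act-∼ br far (∼sym e)          f = ≐sym (act-∼ br far e f)
    act-∼ br far (∼trans e e′)     f = ≐trans (act-∼ br far e f) (act-∼ br far e′ f)
    act-∼ br far (∼∷ i e)          f = F-cong (LF i) (act-∼ br far e f)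
    act-∼ br far (∼braid i j is x) f = br i j x (foldr F f is)
    act-∼ br far (∼comm i j is x)  f = far i j x (foldr F f is)

  acts acts′ : List (Fin m) → Fun (suc m) → Fun (suc m)
  acts  is f = foldr τ f is
  acts′ is f = foldr τ′ f is

  acts-linear : ∀ (is : List (Fin m)) → Linear (acts is)
  acts-linear = act-linear τ-linear

  acts′-linear : ∀ (is : List (Fin m)) → Linear (acts′ is)
  acts′-linear = act-linear τ′-linear

  acts′-∼ : ∀ {is js : List (Fin m)} → is ∼ js → ∀ f → acts′ is f ≐ acts′ js f
  acts′-∼ = act-∼ τ′-linear τ′-braid (op-far α β′ α β′)

  acts-++ : ∀ (is js : List (Fin m)) f → acts (is ++ js) f ≐ acts is (acts js f)
  acts-++ is js f w = ≈reflexive (cong (λ g → g w) (Listₚ.foldr-++ τ f is js))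

  acts′-++ : ∀ (is js : List (Fin m)) f → acts′ (is ++ js) f ≐ acts′ is (acts′ js f)
  acts′-++ is js f w = ≈reflexive (cong (λ g → g w) (Listₚ.foldr-++ τ′ f is js))

  pow : C → ℕ → C
  pow a zero    = 1ᴿ
  pow a (suc n) = a ⊗ pow a n

  pow-+ : ∀ a k l → pow a (k ℕ.+ l) ≈ᴿ pow a k ⊗ pow a l
  pow-+ a zero    l = ≈sym (⊗-identityˡ _)
  pow-+ a (suc k) l = ≈trans (⊗-congˡ (pow-+ a k l)) (≈sym (⊗-assoc a _ _))

  pow-inverse : ∀ k → pow q⁻¹ k ⊗ pow q k ≈ᴿ 1ᴿ
  pow-inverse zero    = ⊗-identityˡ 1ᴿ
  pow-inverse (suc k) = ≈trans (solve 4 (λ a b c d → (a :* b) :* (c :* d) := (a :* c) :* (b :* d)) ≈refl q⁻¹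
      (pow q⁻¹ k) q (pow q k))
    (≈trans (⊗-cong q⁻¹⊗q (pow-inverse k)) (⊗-identityˡ 1ᴿ))

  q^-cancel : ∀ k {f g : Fun n} → pow q k ∙ f ≐ pow q k ∙ g → f ≐ g
  q^-cancel zero    e w = ≈trans (≈sym (⊗-identityˡ _)) (≈trans (e w) (⊗-identityˡ _))
  q^-cancel (suc k) e = q^-cancel k (q-cancel (λ w → ≈trans (≈sym (⊗-assoc q _ _)) (≈trans (e w) (⊗-assoc q _ _))))

  ∙-assoc : ∀ a b (f : Fun n) → a ∙ b ∙ f ≐ (a ⊗ b) ∙ f
  ∙-assoc a b f w = ≈sym (⊗-assoc a b (f w))

  acts-reverse : ∀ (is : List (Fin m)) i f → acts (reverse (i ∷ is)) f ≐ acts (reverse is) (τ i f)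
  acts-reverse is i f w = ≈trans (≈reflexive (cong (λ js → acts js f w) (Listₚ.unfold-reverse i is)))
      (acts-++ (reverse is) (i ∷ []) f w)

  acts-acts′ : ∀ (is : List (Fin m)) f → acts (reverse is) (acts′ is f) ≐ pow q (length is) ∙ f
  acts-acts′ []       f w = ≈sym (⊗-identityˡ _)
  acts-acts′ (i ∷ is) f = ≐trans (acts-reverse is i _)
    (≐trans (F-cong (acts-linear (reverse is)) (ττ′ i _))
      (≐trans (F-∙ (acts-linear (reverse is)) q _) (≐trans (∙-cong ≈refl (acts-acts′ is f)) (∙-assoc q _ f))))

  acts′-acts : ∀ (is : List (Fin m)) f → acts′ is (acts (reverse is) f) ≐ pow q (length is) ∙ f
  acts′-acts []       f w = ≈sym (⊗-identityˡ _)
  acts′-acts (i ∷ is) f = ≐trans (F-cong (acts′-linear (i ∷ is)) (acts-reverse is i f))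
    (≐trans (F-cong (τ′-linear i) (acts′-acts is (τ i f)))
      (≐trans (F-∙ (τ′-linear i) _ _) (≐trans (∙-cong ≈refl (τ′τ i f))
        (≐trans (∙-assoc _ q f) (∙-cong (⊗-comm _ q) ≐refl)))))

  -- X_j acts as t^(n-j) (T_j ⋯ T_(n-1) T_(n-1) ⋯ T_j)⁻¹.  The normalisation
  -- X_n = 1 is compatible with deleting the first letter of a word.
  ξ ξ⁻¹ : Fin (suc m) → Fun (suc m) → Fun (suc m)
  ξ   j f = pow q⁻¹ (codepth j) ∙ acts′ (pal j) f
  ξ⁻¹ j f = pow q⁻¹ (codepth j) ∙ acts (reverse (pal j)) f

  ξ-linear : ∀ (j : Fin (suc m)) → Linear (ξ j)
  ξ-linear j = ∘-linear (∙-linear _) (acts′-linear (pal j))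

  ξ⁻¹-linear : ∀ (j : Fin (suc m)) → Linear (ξ⁻¹ j)
  ξ⁻¹-linear j = ∘-linear (∙-linear _) (acts-linear (reverse (pal j)))

  -- The two normalising factors carry half the length of the palindrome each, and together undo the
  -- q^length left by a word and its inverse.
  ξ-cancel : ∀ (j : Fin (suc m)) (f : Fun (suc m)) {g} → g ≐ pow q (length (pal j)) ∙ f →
             pow q⁻¹ (codepth j) ∙ pow q⁻¹ (codepth j) ∙ g ≐ f
  ξ-cancel j f {g} e w = begin
    a ⊗ (a ⊗ g w)                               ≈⟨ ⊗-assoc a a (g w) ⟨
    (a ⊗ a) ⊗ g w                               ≈⟨ ⊗-cong (≈sym (pow-+ q⁻¹ (codepth j) (codepth j))) (e w) ⟩
    pow q⁻¹ d ⊗ (pow q (length (pal j)) ⊗ f w)  ≡⟨ cong (λ l → pow q⁻¹ d ⊗ (pow q l ⊗ f w)) (length-pal j) ⟩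
    pow q⁻¹ d ⊗ (pow q d ⊗ f w)                 ≈⟨ ⊗-assoc _ _ (f w) ⟨
    (pow q⁻¹ d ⊗ pow q d) ⊗ f w                 ≈⟨ ⊗-cong (pow-inverse d) ≈refl ⟩
    1ᴿ ⊗ f w                                    ≈⟨ ⊗-identityˡ (f w) ⟩
    f w                                         ∎
    where
    open ≈-Reasoning
    a = pow q⁻¹ (codepth j)
    d = codepth j ℕ.+ codepth j

  ξξ⁻¹ : ∀ (j : Fin (suc m)) f → ξ j (ξ⁻¹ j f) ≐ f
  ξξ⁻¹ j f = ≐trans (∙-cong ≈refl (F-∙ (acts′-linear (pal j)) _ _)) (ξ-cancel j f (acts′-acts (pal j) f))

  ξ⁻¹ξ : ∀ (j : Fin (suc m)) f → ξ⁻¹ j (ξ j f) ≐ f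
  ξ⁻¹ξ j f = ≐trans (∙-cong ≈refl (F-∙ (acts-linear (reverse (pal j))) _ _)) (ξ-cancel j f (acts-acts′ (pal j) f))

  ξ-comm : ∀ (i j : Fin (suc m)) f → ξ i (ξ j f) ≐ ξ j (ξ i f)
  ξ-comm i j f = ≐trans (expand i j) (≐trans
    (∙-cong (⊗-comm (pow q⁻¹ (codepth i)) (pow q⁻¹ (codepth j))) (acts′-∼ (pal-pal i j) f)) (≐sym (expand j i)))
    where
    expand : ∀ i j → ξ i (ξ j f) ≐ (pow q⁻¹ (codepth i) ⊗ pow q⁻¹ (codepth j)) ∙ acts′ (pal i ++ pal j) f
    expand i j = ≐trans (∙-cong ≈refl (F-∙ (acts′-linear (pal i)) _ _))
      (≐trans (∙-assoc _ _ _) (∙-cong ≈refl (≐sym (acts′-++ (pal i) (pal j) f))))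

  τ′ξ : ∀ (i : Fin m) j → j ≢ inject₁ i → j ≢ suc i → ∀ f → τ′ i (ξ j f) ≐ ξ j (τ′ i f)
  τ′ξ i j p p′ f = ≐trans (F-∙ (τ′-linear i) _ _)
    (∙-cong ≈refl (≐trans (acts′-∼ (pal-comm i j p p′) f) (acts′-++ (pal j) (i ∷ []) f)))

  -- As `ξ j` is a word in the τ′, commutation is first obtained for `τ′ i` and transferred to its
  -- inverse up to q.
  τξ : ∀ (i : Fin m) j → j ≢ inject₁ i → j ≢ suc i → ∀ f → τ i (ξ j f) ≐ ξ j (τ i f)
  τξ i j p p′ f = τ′-injective i (≐trans (τ′τ i (ξ j f)) (≐sym
    (≐trans (τ′ξ i j p p′ (τ i f)) (≐trans (F-cong (ξ-linear j) (τ′τ i f)) (F-∙ (ξ-linear j) q f)))))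

  -- The palindrome of i is that of i + 1 between two letters i. The outer τ i cancel these two
  -- letters with a factor q each, and one of the two factors compensates the drop of `codepth`.
  τξτ : ∀ (i : Fin m) f → τ i (ξ (inject₁ i) (τ i f)) ≐ q ∙ ξ (suc i) f
  τξτ i f = ≐trans (F-∙ (τ-linear i) _ _) (≐trans (∙-cong ≈refl inner) (λ w → begin
    pow q⁻¹ (codepth (inject₁ i)) ⊗ (q ⊗ (q ⊗ g w))   ≡⟨ cong (λ d → pow q⁻¹ d ⊗ (q ⊗ (q ⊗ g w)))
      (codepth-inject₁ i) ⟩
    (q⁻¹ ⊗ p) ⊗ (q ⊗ (q ⊗ g w))                      ≈⟨ solve 4
      (λ a b c d → (a :* b) :* (c :* (c :* d)) := (a :* c) :* (c :* (b :* d))) ≈refl q⁻¹ p q (g w) ⟩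
    (q⁻¹ ⊗ q) ⊗ (q ⊗ (p ⊗ g w))                      ≈⟨ ⊗-cong q⁻¹⊗q ≈refl ⟩
    1ᴿ ⊗ (q ⊗ (p ⊗ g w))                             ≈⟨ ⊗-identityˡ _ ⟩
    q ⊗ (p ⊗ g w)                                    ∎))
    where
    open ≈-Reasoning
    g = acts′ (pal (suc i)) f
    p = pow q⁻¹ (codepth (suc i))
    inner : τ i (acts′ (pal (inject₁ i)) (τ i f)) ≐ q ∙ q ∙ g
    inner = ≐trans (λ w → ≈reflexive (cong (λ is → τ i (acts′ is (τ i f)) w) (pal-inject₁ i)))
      (≐trans (ττ′ i _) (∙-cong ≈refl (≐trans (acts′-++ (pal (suc i)) (i ∷ []) (τ i f))
        (≐trans (F-cong (acts′-linear (pal (suc i))) (τ′τ i f)) (F-∙ (acts′-linear (pal (suc i))) q f)))))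

  ⟪_⟫ : H m → Fun (suc m) → Fun (suc m)
  ⟪ ι a ⟫    f = φ a ∙ f
  ⟪ T i ⟫    f = τ i f
  ⟪ X j ⟫    f = ξ j f
  ⟪ X⁻¹ j ⟫  f = ξ⁻¹ j f
  ⟪ x +ᴴ y ⟫ f = ⟪ x ⟫ f ⊹ ⟪ y ⟫ f
  ⟪ x *ᴴ y ⟫ f = ⟪ x ⟫ (⟪ y ⟫ f)

  ⟪⟫-linear : ∀ (x : H m) → Linear ⟪ x ⟫
  ⟪⟫-linear (ι a)    = ∙-linear (φ a)
  ⟪⟫-linear (T i)    = τ-linear i
  ⟪⟫-linear (X j)    = ξ-linear j
  ⟪⟫-linear (X⁻¹ j)  = ξ⁻¹-linear j
  ⟪⟫-linear (x +ᴴ y) = ⊹-linear (⟪⟫-linear x) (⟪⟫-linear y)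
  ⟪⟫-linear (x *ᴴ y) = ∘-linear (⟪⟫-linear x) (⟪⟫-linear y)

  ⟪1⟫ : ∀ (f : Fun (suc m)) → ⟪ 1ᴴ ⟫ f ≐ f
  ⟪1⟫ f w = ≈trans (⊗-cong φ-1 ≈refl) (⊗-identityˡ (f w))

  ⟪0⟫ : ∀ (f : Fun (suc m)) w → ⟪ 0ᴴ ⟫ f w ≈ᴿ 0ᴿ
  ⟪0⟫ f w = ≈trans (⊗-cong φ-0 ≈refl) (⊗-zeroˡ (f w))

  sound : ∀ {x y : H m} → x ≈ᴴ y → ∀ f → ⟪ x ⟫ f ≐ ⟪ y ⟫ f
  sound reflᴴ           f = ≐refl
  sound (symᴴ e)        f = ≐sym (sound e f)
  sound (transᴴ e e′)   f = ≐trans (sound e f) (sound e′ f)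
  sound (+-cong e e′)   f w = ⊕-cong (sound e f w) (sound e′ f w)
  sound (*-cong {x} e e′) f = ≐trans (F-cong (⟪⟫-linear x) (sound e′ f)) (sound e _)
  sound (+-assoc x y z) f w = ⊕-assoc _ _ _
  sound (+-comm x y)    f w = ⊕-comm _ _
  sound (+-identityˡ x) f w = ≈trans (⊕-cong (⟪0⟫ f w) ≈refl) (⊕-identityˡ _)
  sound (+-inverseˡ x)  f w = ≈trans (⊕-congˡ (≈sym (⊗-identityˡ _)))
    (≈trans (≈sym (⊗-distribʳ _ _ _)) (≈trans (⊗-cong φ-neg ≈refl) (≈trans (⊗-zeroˡ _) (≈sym (⟪0⟫ f w)))))
  sound (*-assoc x y z) f = ≐refl
  sound (*-identityˡ x) f = ⟪1⟫ (⟪ x ⟫ f)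
  sound (*-identityʳ x) f = F-cong (⟪⟫-linear x) (⟪1⟫ f)
  sound (distribˡ x y z) f = F-⊹ (⟪⟫-linear x) _ _
  sound (distribʳ x y z) f = ≐refl
  sound (ι-cong e)      f w = ⊗-cong (φ-cong e) ≈refl
  sound (ι-+ a b)       f w = ≈trans (⊗-cong (φ-+ a b) ≈refl) (⊗-distribʳ _ _ _)
  sound (ι-* a b)       f w = ≈trans (⊗-cong (φ-* a b) ≈refl) (⊗-assoc _ _ _)
  sound (ι-central a x) f = ≐sym (F-∙ (⟪⟫-linear x) (φ a) f)
  sound (quadratic i)   f = ≐trans (τ-quadratic i f) (λ w → ⊕-cong (⊗-cong (≈sym φ-s) ≈refl)
      (⊗-cong (≈sym φ-t) ≈refl))
  sound (braid i j e)   f = τ-braid i j e f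
  sound (T-comm i j e)  f = op-far α β α β i j e f
  sound (X-comm i j)    f = ξ-comm i j f
  sound (X-X⁻¹ j)       f = ≐trans (ξξ⁻¹ j f) (≐sym (⟪1⟫ f))
  sound (X⁻¹-X j)       f = ≐trans (ξ⁻¹ξ j f) (≐sym (⟪1⟫ f))
  sound (TXT i)         f = ≐trans (τξτ i f) (∙-cong (≈sym φ-t) ≐refl)
  sound (TX-comm i j p p′) f = τξ i j p p′ f

  ⟪Tw⟫ : ∀ (is : List (Fin m)) f → ⟪ Tw is ⟫ f ≐ acts is f
  ⟪Tw⟫ []       f = ⟪1⟫ f
  ⟪Tw⟫ (i ∷ is) f = F-cong (τ-linear i) (⟪Tw⟫ is f)

  module ∑R = Sum (CommutativeRing.+-commutativeMonoid R)
  open ∑R public using (∑)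

  ⟪∑⟫ : ∀ {B : Set} (xs : List B) (h : B → H m) f w → ⟪ ∑ᴴ xs h ⟫ f w ≈ᴿ ∑ xs (λ x → ⟪ h x ⟫ f w)
  ⟪∑⟫ xs h f w = ∑R.∑-hom _+ᴴ_ 0ᴴ (λ x → ⟪ x ⟫ f w) (⟪0⟫ f w) (λ x y → ≈refl) xs h

  ∑-⊗ : ∀ {B : Set} (xs : List B) (g : B → C) a → ∑ xs g ⊗ a ≈ᴿ ∑ xs (λ x → g x ⊗ a)
  ∑-⊗ xs g a = ∑R.∑-hom _⊕_ 0ᴿ (_⊗ a) (⊗-zeroˡ a) (λ x y → ⊗-distribʳ a x y) xs g

  acts-eigen : ∀ {f : Fun (suc m)} {is} → All (λ i → τ i f ≐ q ∙ f) is → acts is f ≐ pow q (length is) ∙ f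
  acts-eigen []               w = ≈sym (⊗-identityˡ _)
  acts-eigen (_∷_ {i} e es) = ≐trans (F-cong (τ-linear i) (acts-eigen es))
    (≐trans (F-∙ (τ-linear i) _ _) (≐trans (∙-cong ≈refl e) (≐trans (∙-assoc _ q _) (∙-cong (⊗-comm _ q) ≐refl))))

  acts-injective : ∀ (is : List (Fin m)) {f g} → acts is f ≐ acts is g → f ≐ g
  acts-injective []       e = e
  acts-injective (i ∷ is) e = acts-injective is (τ-injective i e)

  _≟ᵛ_ : DecidableEquality (Vec A n)
  _≟ᵛ_ = Vecₚ.≡-dec _≟ᴬ_

  δ : Vec A n → Fun n
  δ y w = if does (y ≟ᵛ w) then 1ᴿ else 0ᴿ

  δ-same : ∀ (y : Vec A n) → δ y y ≈ᴿ 1ᴿ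
  δ-same y with y ≟ᵛ y
  ... | yes _ = ≈refl
  ... | no ¬e = contradiction refl ¬e

  δ-diff : ∀ {y w : Vec A n} → y ≢ w → δ y w ≈ᴿ 0ᴿ
  δ-diff {y = y} {w} ¬e with y ≟ᵛ w
  ... | yes e = contradiction e ¬e
  ... | no _  = ≈refl

  δ-sw : ∀ (i : Fin m) y w → δ y (sw i w) ≈ᴿ δ (sw i y) w
  δ-sw i y w with y ≟ᵛ sw i w
  ... | yes refl = ≈sym (≈trans (≈reflexive (cong (λ v → δ v w) (sw-sw i w))) (δ-same w))
  ... | no ¬e    = ≈sym (δ-diff (λ e → ¬e (trans (sym (sw-sw i y)) (cong (sw i) e))))

  τ-δ-up : ∀ (i : Fin m) y → ord i y ≡ lt → τ i (δ y) ≐ δ (sw i y)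
  τ-δ-up i y o w = cases (w ≟ᵛ y) (w ≟ᵛ sw i y)
    where
    y≢swy : y ≢ sw i y
    y≢swy e with () ← trans (sym o) (trans (cong (ord i) e) (trans (ord-sw i y) (cong rev o)))
    cases : Dec (w ≡ y) → Dec (w ≡ sw i y) → τ i (δ y) w ≈ᴿ δ (sw i y) w
    cases (yes refl) _ = ≈trans (op-at α β i (δ y) o refl)
      (≈trans (⊕-cong (⊗-congˡ (δ-diff y≢swy)) (⊗-zeroˡ _)) (≈trans (⊕-identityʳ _)
        (≈trans (⊗-zeroʳ q) (≈sym (δ-diff (λ e → y≢swy (sym e)))))))
    cases (no _) (yes refl) = ≈trans (op-at α β i (δ y) (trans (ord-sw i y) (cong rev o)) (sw-sw i y))
      (≈trans (⊕-cong (≈trans (⊗-identityˡ _) (δ-same y)) (⊗-congˡ (δ-diff y≢swy)))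
        (≈trans (⊕-congˡ (⊗-zeroʳ s′)) (≈trans (⊕-identityʳ 1ᴿ) (≈sym (δ-same (sw i y))))))
    cases (no w≢y) (no w≢swy) = ≈trans
      (⊕-cong (⊗-congˡ (≈trans (δ-sw i y w) (δ-diff (λ e → w≢swy (sym e))))) (⊗-congˡ (δ-diff (λ e → w≢y (sym e)))))
      (≈trans (solve 2 (λ a b → a :* con 0 :+ b :* con 0 := con 0) ≈refl (α (ord i w)) (β (ord i w)))
        (≈sym (δ-diff (λ e → w≢swy (sym e)))))

  τ-δ-eq : ∀ (i : Fin m) y → ord i y ≡ eq → sw i y ≡ y → τ i (δ y) ≐ q ∙ δ y
  τ-δ-eq i y o fixed w = cases (w ≟ᵛ y)
    where
    cases : Dec (w ≡ y) → τ i (δ y) w ≈ᴿ q ⊗ δ y w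
    cases (yes refl) = ≈trans (op-at α β i (δ y) o refl) (≈trans (⊕-cong (⊗-zeroˡ _) ≈refl) (⊕-identityˡ _))
    cases (no w≢y) = ≈trans
      (⊕-cong (⊗-congˡ (≈trans (δ-sw i y w) (δ-diff (λ e → w≢y (sym (trans (sym fixed) e))))))
        (⊗-congˡ (δ-diff (λ e → w≢y (sym e)))))
      (≈trans (solve 3 (λ a b q → a :* con 0 :+ b :* con 0 := q :* con 0) ≈refl (α (ord i w)) (β (ord i w)) q)
        (⊗-congˡ (≈sym (δ-diff (λ e → w≢y (sym e))))))

-- Columns

∣sw∣ : ∀ (i : Fin m) p → ∣ sw i p ∣ ≡ ∣ p ∣
∣sw∣ zero    (inside  ∷ inside  ∷ p) = refl
∣sw∣ zero    (inside  ∷ outside ∷ p) = refl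
∣sw∣ zero    (outside ∷ inside  ∷ p) = refl
∣sw∣ zero    (outside ∷ outside ∷ p) = refl
∣sw∣ (suc i) (inside  ∷ p)           = cong suc (∣sw∣ i p)
∣sw∣ (suc i) (outside ∷ p)           = ∣sw∣ i p

swᶜ : Fin m → Column (suc m) k → Column (suc m) k
swᶜ i (col p e) = col (sw i p) (trans (∣sw∣ i p) e)

set-· : ∀ (j : Fin m) (C : Column (suc m) k) → set (s j · C) ≡ sw j (set C)
set-· j (col p e) = trans (Vecₚ.tabulate-cong (λ i → cong (lookup p) (s-flip j i)))
  (trans (sym (sw-tabulate j (lookup p))) (cong (sw j) (Vecₚ.tabulate∘lookup p)))

top : ∀ n → ℕ → Subset n
top zero    l       = []
top (suc n) zero    = outside ∷ top n zero
top (suc n) (suc l) = inside ∷ top n l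

∣top∣ : l ≤ n → ∣ top n l ∣ ≡ l
∣top∣ {n = zero}  z≤n       = refl
∣top∣ {n = suc n} z≤n       = ∣top∣ {n = n} z≤n
∣top∣             (s≤s l≤n) = cong suc (∣top∣ l≤n)

-- Induction on ℓ(u_C): every column arises from the initial one of its size by replacing an element
-- i with i + 1 ∉ C by i + 1, and each such move raises the length by one.
data Reach : Subset n → Set where
  base : ∀ n l → Reach (top n l)
  step : ∀ {m} {i : Fin m} {p : Subset (suc m)} → At inside outside i p → Reach p → Reach (sw i p)

reach-inside : ∀ {p : Subset n} → Reach p → Reach (inside ∷ p)
reach-inside (base n l) = base (suc n) (suc l)
reach-inside (step a r) = step (there a) (reach-inside r)

reach-outside : ∀ {p : Subset n} → Reach p → Reach (outside ∷ p)
reach-outside (base zero l)          = base 1 0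
reach-outside (base (suc n) zero)    = base (suc (suc n)) zero
reach-outside (base (suc n) (suc l)) = step here (reach-inside (reach-outside (base n l)))
reach-outside (step a r)             = step (there a) (reach-outside r)

reach : ∀ (p : Subset n) → Reach p
reach []            = base 0 0
reach (inside  ∷ p) = reach-inside (reach p)
reach (outside ∷ p) = reach-outside (reach p)

top-at : ∀ (i : Fin m) l → suc (toℕ i) ≢ l → ∃[ a ] At a a i (top (suc m) l)
top-at {suc m} zero    zero          _ = outside , here
top-at {suc m} zero    (suc zero)    p = contradiction refl p
top-at {suc m} zero    (suc (suc l)) _ = inside , here
top-at {suc m} (suc i) zero          _ = let a , q = top-at i zero (λ ()) in a , there q
top-at {suc m} (suc i) (suc l)       p = let a , q = top-at i l (λ e → p (cong suc e)) in a , there q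

slot : ∀ (p : Subset n) → Fin (suc n)
slot p = fromℕ< (s≤s (∣p∣≤n p))

toℕ-slot : ∀ (p : Subset n) → toℕ (slot p) ≡ ∣ p ∣
toℕ-slot p = Finₚ.toℕ-fromℕ< (s≤s (∣p∣≤n p))

slot-cong : ∀ (p p′ : Subset n) → ∣ p ∣ ≡ ∣ p′ ∣ → slot p ≡ slot p′
slot-cong p p′ e = Finₚ.toℕ-injective (trans (toℕ-slot p) (trans e (sym (toℕ-slot p′))))

slot-inside : ∀ (p : Subset n) → slot (inside ∷ p) ≡ suc (slot p)
slot-inside p = Finₚ.toℕ-injective (trans (toℕ-slot (inside ∷ p)) (cong suc (sym (toℕ-slot p))))

pos : Subset n → Fin n → Fin n
pos p v = uPerm p ⟨$⟩ˡ v

-- The identity u_{s_i C} = s_i u_C is stated for inverses: on the values 0F and `suc v` the inverse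
-- of an `insert` computes, whereas the forward map would compare positions with the slot.
pos-sw : ∀ {i : Fin m} {p} → At inside outside i p → ∀ v → pos (sw i p) v ≡ pos p (s i ⟨$⟩ʳ v)
pos-sw (here {w = p}) zero          = slot-inside p
pos-sw (here {w = p}) (suc zero)    = cong (λ x → punchIn x zero) (slot-inside p)
pos-sw (here {w = p}) (suc (suc v)) = cong (λ x → punchIn x (suc (pos p v))) (slot-inside p)
pos-sw {i = suc i} (there {x = inside} {p} a) zero = cong (pos (inside ∷ p)) (sym (s-suc i zero))
pos-sw {i = suc i} (there {x = inside} {p} a) (suc v) =
  trans (cong suc (pos-sw a v)) (cong (pos (inside ∷ p)) (sym (s-suc i (suc v))))
pos-sw {i = suc i} (there {x = outside} {p} a) zero =
  trans (slot-cong (sw i p) p (∣sw∣ i p)) (cong (pos (outside ∷ p)) (sym (s-suc i zero)))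
pos-sw {i = suc i} (there {x = outside} {p} a) (suc v) =
  trans (cong₂ punchIn (slot-cong (sw i p) p (∣sw∣ i p)) (pos-sw a v))
    (cong (pos (outside ∷ p)) (sym (s-suc i (suc v))))

u-sw : ∀ {i : Fin m} {p} → At inside outside i p → uPerm (sw i p) ≈ uPerm p ∘ₚ s i
u-sw {i = i} {p} a = flip-cong (flip (uPerm (sw i p))) (flip (uPerm p ∘ₚ s i))
  (λ v → trans (pos-sw a v) (cong (pos p) (sym (s-flip i v))))

punchIn-< : ∀ (k : Fin (suc n)) x → toℕ x < toℕ k → toℕ (punchIn k x) ≡ toℕ x
punchIn-< (suc k) zero    _         = refl
punchIn-< (suc k) (suc x) (s≤s x<k) = cong suc (punchIn-< k x x<k)

punchIn-≥ : ∀ (k : Fin (suc n)) x → toℕ k ≤ toℕ x → toℕ (punchIn k x) ≡ suc (toℕ x)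
punchIn-≥ zero    x       _         = refl
punchIn-≥ (suc k) (suc x) (s≤s k≤x) = cong suc (punchIn-≥ k x k≤x)

punch-slot-< : ∀ (p : Subset n) x → toℕ x < ∣ p ∣ → toℕ (punchIn (slot p) x) ≡ toℕ x
punch-slot-< p x h = punchIn-< (slot p) x (subst (toℕ x <_) (sym (toℕ-slot p)) h)

punch-slot-≥ : ∀ (p : Subset n) x → ∣ p ∣ ≤ toℕ x → toℕ (punchIn (slot p) x) ≡ suc (toℕ x)
punch-slot-≥ p x h = punchIn-≥ (slot p) x (subst (_≤ toℕ x) (sym (toℕ-slot p)) h)

pos-inside : ∀ (p : Subset n) v → lookup p v ≡ inside → toℕ (pos p v) < ∣ p ∣
pos-inside (inside  ∷ p) zero    e = s≤s z≤n
pos-inside (inside  ∷ p) (suc v) e = s≤s (pos-inside p v e)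
pos-inside (outside ∷ p) (suc v) e =
  subst (_< ∣ p ∣) (sym (punch-slot-< p (pos p v) (pos-inside p v e))) (pos-inside p v e)

pos-outside : ∀ (p : Subset n) v → lookup p v ≡ outside → ∣ p ∣ ≤ toℕ (pos p v)
pos-outside (inside  ∷ p) (suc v) e = s≤s (pos-outside p v e)
pos-outside (outside ∷ p) zero    e = ℕₚ.≤-reflexive (sym (toℕ-slot p))
pos-outside (outside ∷ p) (suc v) e =
  subst (∣ p ∣ ≤_) (sym (punch-slot-≥ p (pos p v) (pos-outside p v e))) (ℕₚ.m≤n⇒m≤1+n (pos-outside p v e))

lookup-at : ∀ {A : Set} {a b : A} {i : Fin m} {p} → At a b i p → lookup p (inject₁ i) ≡ a × lookup p (suc i) ≡ b
lookup-at here      = refl , refl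
lookup-at (there a) = lookup-at a

pos-equal : ∀ {a} {i : Fin m} {p} → At a a i p → toℕ (pos p (suc i)) ≡ suc (toℕ (pos p (inject₁ i)))
pos-equal {a = inside}  here = refl
pos-equal {a = outside} (here {w = p}) =
  trans (punch-slot-≥ (outside ∷ p) (slot p) (ℕₚ.≤-reflexive (sym (toℕ-slot p))))
    (cong suc (trans (toℕ-slot p) (sym (toℕ-slot (outside ∷ p)))))
pos-equal (there {x = inside} a) = cong suc (pos-equal a)
pos-equal {a = inside} {i = suc i} (there {x = outside} {p} a) = trans
  (punch-slot-< p (pos p (suc i)) (pos-inside p _ (proj₂ (lookup-at a))))
  (trans (pos-equal a) (cong suc (sym (punch-slot-< p (pos p (inject₁ i)) (pos-inside p _ (proj₁ (lookup-at a)))))))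
pos-equal {a = outside} {i = suc i} (there {x = outside} {p} a) = trans
  (punch-slot-≥ p (pos p (suc i)) (pos-outside p _ (proj₂ (lookup-at a))))
  (cong suc (trans (pos-equal a) (sym (punch-slot-≥ p (pos p (inject₁ i)) (pos-outside p _ (proj₁ (lookup-at a)))))))

pos-ascent : ∀ {i : Fin m} {p} → At inside outside i p → Ascentˡ i (uPerm p)
pos-ascent {i = i} {p} a = ℕₚ.<-≤-trans (pos-inside p _ (proj₁ (lookup-at a))) (pos-outside p _ (proj₂ (lookup-at a)))

-- When i and i + 1 lie on the same side of the column they occupy neighbouring positions of u, on
-- the same side of the cut at ∣ p ∣. So s_i u = u s_{i′} with s_{i′} in the stabiliser of ϖ, and
-- both sides have length ℓ(u) + 1.
record Conjugate (i : Fin m) (p : Subset (suc m)) : Set where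
  field
    i′       : Fin m
    interior : suc (toℕ i′) ≢ ∣ p ∣
    conj     : uPerm p ∘ₚ s i ≈ s i′ ∘ₚ uPerm p
    ascentˡ  : Ascentˡ i (uPerm p)
    ascentʳ  : Ascentʳ i′ (uPerm p)

conjugate : ∀ {a} {i : Fin m} {p} → At a a i p → Conjugate i p
conjugate {a = a} {i} {p} at with pos p (suc i) in posʳ | pos-equal at
... | suc i′ | e = record
  { i′ = i′ ; interior = interior a at
  ; conj = s-conj (uPerm p ⟨$⟩ʳ_) (perm-injective (uPerm p)) i′ i
      (trans (cong (uPerm p ⟨$⟩ʳ_) (sym posˡ)) (inverseʳ (uPerm p)))
      (trans (cong (uPerm p ⟨$⟩ʳ_) (sym posʳ)) (inverseʳ (uPerm p)))
  ; ascentˡ = subst₂ Fin._<_ (sym posˡ) (sym posʳ) (s≤s (ℕₚ.≤-reflexive (Finₚ.toℕ-inject₁ i′)))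
  ; ascentʳ = subst₂ Fin._<_ (trans (sym (inverseʳ (uPerm p))) (cong (uPerm p ⟨$⟩ʳ_) posˡ))
      (trans (sym (inverseʳ (uPerm p))) (cong (uPerm p ⟨$⟩ʳ_) posʳ)) (s≤s (ℕₚ.≤-reflexive (Finₚ.toℕ-inject₁ i))) }
  where
  posˡ : pos p (inject₁ i) ≡ inject₁ i′
  posˡ = Finₚ.toℕ-injective (trans (ℕₚ.suc-injective (sym e)) (sym (Finₚ.toℕ-inject₁ i′)))
  interior : ∀ a → At a a i p → suc (toℕ i′) ≢ ∣ p ∣
  interior inside  at e′ = ℕₚ.<-irrefl (trans (cong toℕ posʳ) e′) (pos-inside p (suc i) (proj₂ (lookup-at at)))
  interior outside at e′ = ℕₚ.<-irrefl (sym e′) (s≤s (subst (∣ p ∣ ≤_) (trans (cong toℕ posˡ) (Finₚ.toℕ-inject₁ i′))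
    (pos-outside p (inject₁ i) (proj₁ (lookup-at at)))))

ϖ-stabilises : ∀ l (i : Fin m) → suc (toℕ i) ≢ l → Stabilises (ϖ l) i
ϖ-stabilises l i h with ℕₚ.<-cmp (suc (toℕ i)) l
... | tri< i<l _ _ = trans (ϖ-< l (inject₁ i) (subst (_< l) (sym (Finₚ.toℕ-inject₁ i))
    (ℕₚ.<-trans ℕₚ.≤-refl i<l))) (sym (ϖ-< l (suc i) i<l))
... | tri≈ _ e _   = contradiction e h
... | tri> _ _ l≤i = trans (ϖ-≥ l (inject₁ i) (subst (l ≤_) (sym (Finₚ.toℕ-inject₁ i)) (ℕ.s≤s⁻¹ l≤i)))
    (sym (ϖ-≥ l (suc i) (ℕₚ.<⇒≤ l≤i)))

stabilises-ϖ : ∀ l (i : Fin m) → Stabilises (ϖ l) i → suc (toℕ i) ≢ l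
stabilises-ϖ .(suc (toℕ i)) i e refl with () ←
  trans (sym (ϖ-< (suc (toℕ i)) (inject₁ i) (s≤s (ℕₚ.≤-reflexive (Finₚ.toℕ-inject₁ i)))))
    (trans e (ϖ-≥ (suc (toℕ i)) (suc i) ℕₚ.≤-refl))

u-top : ∀ n l → uPerm (top n l) ≈ Perm.id
u-top (suc n) zero    k       = trans (cong (λ x → insert x 0F (uPerm (top n zero)) ⟨$⟩ʳ k) slot-top) (inserted k)
  where
  slot-top : slot (top n zero) ≡ 0F
  slot-top = Finₚ.toℕ-injective (trans (toℕ-slot (top n zero)) (∣top∣ {n = n} z≤n))
  inserted : insert 0F 0F (uPerm (top n zero)) ≈ Perm.id
  inserted zero    = refl
  inserted (suc k) = cong suc (u-top n zero k)
u-top (suc n) (suc l) zero    = refl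
u-top (suc n) (suc l) (suc k) = cong suc (u-top n l k)

-- Column order through counting

cnt : Subset n → ℕ → ℕ
cnt []            x       = 0
cnt (b ∷ p)       zero    = 0
cnt (inside ∷ p)  (suc x) = suc (cnt p x)
cnt (outside ∷ p) (suc x) = cnt p x

cnt-mono : ∀ (p : Subset n) {x y} → x ≤ y → cnt p x ≤ cnt p y
cnt-mono []            x≤y       = z≤n
cnt-mono (b ∷ p)       z≤n       = z≤n
cnt-mono (inside ∷ p)  (s≤s x≤y) = s≤s (cnt-mono p x≤y)
cnt-mono (outside ∷ p) (s≤s x≤y) = cnt-mono p x≤y

cnt-≤ : ∀ (p : Subset n) x → cnt p x ≤ ∣ p ∣
cnt-≤ []            x       = z≤n
cnt-≤ (b ∷ p)       zero    = z≤n
cnt-≤ (inside ∷ p)  (suc x) = s≤s (cnt-≤ p x)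
cnt-≤ (outside ∷ p) (suc x) = cnt-≤ p x

cnt-element : ∀ (p : Subset n) j → let e = toℕ (lookup (elements p) j) in cnt p e ≡ toℕ j × cnt p (suc e) ≡ suc (toℕ j)
cnt-element (inside ∷ p) zero    = refl , cong suc (cnt-0 p)
  where
  cnt-0 : ∀ (p : Subset n) → cnt p 0 ≡ 0
  cnt-0 []      = refl
  cnt-0 (_ ∷ _) = refl
cnt-element (inside ∷ p) (suc j) rewrite Vecₚ.lookup-map j Fin.suc (elements p) =
  let e , e′ = cnt-element p j in cong suc e , cong suc e′
cnt-element (outside ∷ p) j rewrite Vecₚ.lookup-map j Fin.suc (elements p) = cnt-element p j

entry-cnt : ∀ (C : Column n k) i {x} → toℕ (entry C i) < x → suc (toℕ i) ≤ cnt (set C) x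
entry-cnt (col p e) i h = ℕₚ.≤-trans
  (ℕₚ.≤-reflexive (sym (trans (proj₂ (cnt-element p (Fin.cast (sym e) i))) (cong suc (Finₚ.toℕ-cast (sym e) i)))))
  (cnt-mono p h)

cnt-entry : ∀ (C : Column n k) i {x} → suc (toℕ i) ≤ cnt (set C) x → toℕ (entry C i) < x
cnt-entry (col p e) i {x} h with toℕ (lookup (elements p) (Fin.cast (sym e) i)) ℕₚ.<? x
... | yes <x = <x
... | no ≮x  = contradiction h (ℕₚ.<⇒≱ (s≤s (ℕₚ.≤-trans (cnt-mono p (ℕₚ.≮⇒≥ ≮x))
  (ℕₚ.≤-reflexive (trans (proj₁ (cnt-element p (Fin.cast (sym e) i))) (Finₚ.toℕ-cast (sym e) i))))))

size-of : ∀ (C : Column n k) → ∣ set C ∣ ≡ k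
size-of {k = k} (col p e) = recompute (∣ p ∣ ℕₚ.≟ k) e

⊑-cnt : ∀ (E F : Column n k) → E ⊑ F → ∀ x → cnt (set F) x ≤ cnt (set E) x
⊑-cnt E F E⊑F x with cnt (set F) x in c≡
... | zero  = z≤n
... | suc c = subst (λ z → suc z ≤ cnt (set E) x) (Finₚ.toℕ-fromℕ< c<k)
  (entry-cnt E (fromℕ< c<k) (ℕₚ.≤-<-trans (E⊑F (fromℕ< c<k))
    (cnt-entry F (fromℕ< c<k) (ℕₚ.≤-reflexive (trans (cong suc (Finₚ.toℕ-fromℕ< c<k)) (sym c≡))))))
  where
  c<k : suc c ≤ _
  c<k = subst₂ _≤_ c≡ (size-of F) (cnt-≤ (set F) x)

-- Small entries mean large counts. In this form columns of different lengths compare without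
-- matching their indices, and the effect of a swap is confined to one value of `x`.
Dominates : Subset n → Subset n → Set
Dominates p q = ∀ x → cnt q x ≤ cnt p x

dominates-semistandard : ∀ .(k≤l : k ≤ l) (F : Column n l) (E : Column n k) → Dominates (set F) (set E)
    → Semistandard k≤l F E
dominates-semistandard k≤l F E d i = ℕ.s≤s⁻¹ (cnt-entry F (inject≤ i k≤l)
  (ℕₚ.≤-trans (ℕₚ.≤-reflexive (cong suc (Finₚ.toℕ-inject≤ i k≤l)))
    (ℕₚ.≤-trans (entry-cnt E i ℕₚ.≤-refl) (d (suc (toℕ (entry E i)))))))

cnt-swap : ∀ {i : Fin m} {p} → At inside outside i p → cnt p (suc (toℕ i)) ≡ suc (cnt (sw i p) (suc (toℕ i)))
cnt-swap (here {w = []})    = refl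
cnt-swap (here {w = _ ∷ _}) = refl
cnt-swap (there {x = inside} a)  = cong suc (cnt-swap a)
cnt-swap (there {x = outside} a) = cnt-swap a

cnt-sw-other : ∀ (i : Fin m) p x → x ≢ suc (toℕ i) → cnt (sw i p) x ≡ cnt p x
cnt-sw-other zero    (a ∷ b ∷ p)   zero          _ = refl
cnt-sw-other zero    (a ∷ b ∷ p)   (suc zero)    h = contradiction refl h
cnt-sw-other zero    (inside ∷ inside ∷ p)   (suc (suc x)) _ = refl
cnt-sw-other zero    (inside ∷ outside ∷ p)  (suc (suc x)) _ = refl
cnt-sw-other zero    (outside ∷ inside ∷ p)  (suc (suc x)) _ = refl
cnt-sw-other zero    (outside ∷ outside ∷ p) (suc (suc x)) _ = refl
cnt-sw-other (suc i) (a ∷ p)       zero          _ = refl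
cnt-sw-other (suc i) (inside ∷ p)  (suc x)       h = cong suc (cnt-sw-other i p x (λ e → h (cong suc e)))
cnt-sw-other (suc i) (outside ∷ p) (suc x)       h = cnt-sw-other i p x (λ e → h (cong suc e))

cnt-at-outside : ∀ {b} {i : Fin m} {p} → At outside b i p → cnt p (suc (toℕ i)) ≡ cnt p (toℕ i)
cnt-at-outside {b = inside}  here = refl
cnt-at-outside {b = outside} here = refl
cnt-at-outside (there {x = inside} a)  = cong suc (cnt-at-outside a)
cnt-at-outside (there {x = outside} a) = cnt-at-outside a

-- Replacing j by j + 1 would lower one count, while s_j C ⊑ C never lowers any. What remains is
-- that s_j lowers the column or fixes it.
no-drop : ∀ (j : Fin m) (C : Column (suc m) k) → s j · C ⊑ C → ¬ At inside outside j (set C)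
no-drop j C h at = ℕₚ.<-irrefl refl (ℕₚ.≤-trans (ℕₚ.≤-reflexive (sym (cnt-swap at)))
  (subst (λ p → cnt (set C) (suc (toℕ j)) ≤ cnt p (suc (toℕ j))) (set-· j C) (⊑-cnt (s j · C) C h (suc (toℕ j)))))

no-rise : ∀ (j : Fin m) (C : Column (suc m) k) → C ⊑ s j · C → ¬ At outside inside j (set C)
no-rise j C h at = ℕₚ.<-irrefl refl (ℕₚ.≤-trans
  (ℕₚ.≤-reflexive (trans (cong (λ p → suc (cnt p (suc (toℕ j)))) (sym (sw-sw j (set C))))
    (sym (cnt-swap (sw-at at)))))
  (subst (λ p → cnt p (suc (toℕ j)) ≤ cnt (set C) (suc (toℕ j))) (set-· j C) (⊑-cnt C (s j · C) h (suc (toℕ j)))))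

module _ {i : Fin m} {p q : Subset (suc m)} (at : At inside outside i q) where

  private
    x₀ : ℕ
    x₀ = suc (toℕ i)

    cnt-sw-q : cnt (sw i q) x₀ ≡ cnt q (toℕ i)
    cnt-sw-q = trans (cnt-at-outside (sw-at at)) (cnt-sw-other i q (toℕ i) (λ e → ℕₚ.<-irrefl e ℕₚ.≤-refl))

  dominates-raise : Dominates p q → Dominates p (sw i q)
  dominates-raise d x with x ℕₚ.≟ x₀
  ... | yes refl = ℕₚ.≤-trans (ℕₚ.≤-trans (ℕₚ.n≤1+n _) (ℕₚ.≤-reflexive (sym (cnt-swap at)))) (d x)
  ... | no x≢    = ℕₚ.≤-trans (ℕₚ.≤-reflexive (cnt-sw-other i q x x≢)) (d x)

  -- Only at `x₀` can `p` and `sw i p` have different counts. There the raised `q` counts what `q`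
  -- counts one step earlier, where `p` and `sw i p` agree, and counts of `p` are monotone.
  dominates-swap : Dominates (sw i p) q → Dominates p (sw i q)
  dominates-swap d x with x ℕₚ.≟ x₀
  ... | yes refl = ℕₚ.≤-trans (ℕₚ.≤-reflexive cnt-sw-q) (ℕₚ.≤-trans (d (toℕ i))
    (ℕₚ.≤-trans (ℕₚ.≤-reflexive (cnt-sw-other i p (toℕ i) (λ e → ℕₚ.<-irrefl e ℕₚ.≤-refl)))
      (cnt-mono p (ℕₚ.n≤1+n (toℕ i)))))
  ... | no x≢    = ℕₚ.≤-trans (ℕₚ.≤-reflexive (cnt-sw-other i q x x≢))
    (ℕₚ.≤-trans (d x) (ℕₚ.≤-reflexive (cnt-sw-other i p x x≢)))

-- Columns containing {1, …, a}

prefix : ℕ → Subset n → Bool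
prefix zero    p       = true
prefix (suc a) []      = false
prefix (suc a) (b ∷ p) = if b then prefix a p else false

prefix-sw : ∀ a (i : Fin m) p → suc (toℕ i) ≢ a → prefix a (sw i p) ≡ prefix a p
prefix-sw zero          i       p                       _ = refl
prefix-sw (suc zero)    zero    p                       h = contradiction refl h
prefix-sw (suc (suc a)) zero    (inside ∷ inside ∷ p)   _ = refl
prefix-sw (suc (suc a)) zero    (inside ∷ outside ∷ p)  _ = refl
prefix-sw (suc (suc a)) zero    (outside ∷ inside ∷ p)  _ = refl
prefix-sw (suc (suc a)) zero    (outside ∷ outside ∷ p) _ = refl
prefix-sw (suc a)       (suc i) (inside ∷ p)            h = prefix-sw a i p (λ e → h (cong suc e))
prefix-sw (suc a)       (suc i) (outside ∷ p)           h = refl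

prefix-dominates : ∀ a (p : Subset n) → prefix a p ≡ true → Dominates p (top n a)
prefix-dominates {zero}  a       []            _ x = z≤n
prefix-dominates {suc n} zero    (inside ∷ p)  e zero    = z≤n
prefix-dominates {suc n} zero    (inside ∷ p)  e (suc x) = ℕₚ.m≤n⇒m≤1+n (prefix-dominates zero p refl x)
prefix-dominates {suc n} zero    (outside ∷ p) e zero    = z≤n
prefix-dominates {suc n} zero    (outside ∷ p) e (suc x) = prefix-dominates zero p refl x
prefix-dominates {suc n} (suc a) (inside ∷ p)  e zero    = z≤n
prefix-dominates {suc n} (suc a) (inside ∷ p)  e (suc x) = s≤s (prefix-dominates a p e x)

cnt-prefix : ∀ a (p : Subset n) → a ≤ cnt p a → prefix a p ≡ true
cnt-prefix zero    p             _       = refl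
cnt-prefix (suc a) (inside ∷ p)  (s≤s h) = cnt-prefix a p h
cnt-prefix (suc a) (outside ∷ p) h       = contradiction (bound p a) (ℕₚ.<⇒≱ h)
  where
  bound : ∀ {n} (p : Subset n) x → cnt p x ≤ x
  bound []            x       = z≤n
  bound (b ∷ p)       zero    = z≤n
  bound (inside ∷ p)  (suc x) = s≤s (bound p x)
  bound (outside ∷ p) (suc x) = ℕₚ.m≤n⇒m≤1+n (bound p x)

prefix-top : ∀ a (p : Subset n) → prefix a p ≡ true → ∣ p ∣ ≡ a → p ≡ top n a
prefix-top zero    []            _ _  = refl
prefix-top zero    (outside ∷ p) _ e  = cong (outside ∷_) (prefix-top zero p refl e)
prefix-top (suc a) (inside ∷ p)  e e′ = cong (inside ∷_) (prefix-top a p e (ℕₚ.suc-injective e′))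

low-entries-prefix : ∀ (C : Column n l) .(k≤l : k ≤ l) → (∀ (i : Fin k) → toℕ (entry C (inject≤ i k≤l)) ≤ toℕ i)
    → prefix k (set C) ≡ true
low-entries-prefix {k = zero}  C k≤l h = refl
low-entries-prefix {k = suc k} C k≤l h = cnt-prefix (suc k) (set C)
  (ℕₚ.≤-trans (ℕₚ.≤-reflexive (cong suc (sym (trans (Finₚ.toℕ-inject≤ (Fin.fromℕ k) k≤l) (Finₚ.toℕ-fromℕ k)))))
    (entry-cnt C (inject≤ (Fin.fromℕ k) k≤l) (s≤s (ℕₚ.≤-trans (h (Fin.fromℕ k))
      (ℕₚ.≤-reflexive (Finₚ.toℕ-fromℕ k))))))

-- The affine Hecke algebra as a ring

H-ring : ℕ → Ring 0ℓ 0ℓ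
H-ring m = record
  { Carrier = H m ; _≈_ = _≈ᴴ_ ; _+_ = _+ᴴ_ ; _*_ = _*ᴴ_ ; -_ = λ x → ι ⟦ -ₚ 1ₚ ⟧ₗ *ᴴ x ; 0# = 0ᴴ ; 1# = 1ᴴ
  ; isRing = record
    { +-isAbelianGroup = record
      { isGroup = record
        { isMonoid = record
          { isSemigroup = record
            { isMagma = record
              { isEquivalence = record { refl = reflᴴ ; sym = symᴴ ; trans = transᴴ }
              ; ∙-cong = +-cong }
            ; assoc = +-assoc }
          ; identity = +-identityˡ , λ x → transᴴ (+-comm x 0ᴴ) (+-identityˡ x) }
        ; inverse = +-inverseˡ , λ x → transᴴ (+-comm x _) (+-inverseˡ x)
        ; ⁻¹-cong = *-cong reflᴴ }
      ; comm = +-comm }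
    ; *-cong = *-cong
    ; *-assoc = *-assoc
    ; *-identity = *-identityˡ , *-identityʳ
    ; distrib = distribˡ , distribʳ } }

module Hᴿ {m} = Ring (H-ring m)
module H-Reasoning {m} = SetoidReasoning (Ring.setoid (H-ring m))
module ∑H {m} = Sum (Ring.+-commutativeMonoid (H-ring m))

qᴴ sᴴ rᴴ q⁻¹ᴴ : H m
qᴴ   = ι ⟦ t ⟧ₗ
sᴴ   = ι ⟦ t +ₚ -ₚ 1ₚ ⟧ₗ
rᴴ   = ι ⟦ 1ₚ +ₚ -ₚ t ⟧ₗ
q⁻¹ᴴ = ι (1ₚ /t^ 1)

s+r : sᴴ +ᴴ rᴴ ≈ᴴ 0ᴴ {m}
s+r = transᴴ (symᴴ (ι-+ _ _)) (ι-cong λ { zero → refl ; (suc zero) → refl ; (suc (suc zero)) → refl ;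
    (suc (suc (suc _))) → refl })

1+s : 1ᴴ +ᴴ sᴴ ≈ᴴ qᴴ {m}
1+s = transᴴ (symᴴ (ι-+ _ _)) (ι-cong λ { zero → refl ; (suc zero) → refl ; (suc (suc zero)) → refl ;
    (suc (suc (suc _))) → refl })

q⁻¹q : q⁻¹ᴴ *ᴴ qᴴ ≈ᴴ 1ᴴ {m}
q⁻¹q = transᴴ (symᴴ (ι-* _ _)) (ι-cong λ { zero → refl ; (suc zero) → refl ; (suc (suc zero)) → refl ;
    (suc (suc (suc zero))) → refl ; (suc (suc (suc (suc _)))) → refl })

-- The quadratic relation reads T_i (T_i + 1 - t) = t.
T⁻¹ : Fin m → H m
T⁻¹ i = q⁻¹ᴴ *ᴴ (T i +ᴴ rᴴ)

T-shifted : ∀ (i : Fin m) → T i *ᴴ (T i +ᴴ rᴴ) ≈ᴴ qᴴ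
T-shifted i = begin
  T i *ᴴ (T i +ᴴ rᴴ)                    ≈⟨ distribˡ (T i) (T i) rᴴ ⟩
  T i *ᴴ T i +ᴴ T i *ᴴ rᴴ               ≈⟨ +-cong (quadratic i) (symᴴ (ι-central _ (T i))) ⟩
  (sᴴ *ᴴ T i +ᴴ qᴴ) +ᴴ rᴴ *ᴴ T i        ≈⟨ +-cong (+-comm _ qᴴ) reflᴴ ⟩
  (qᴴ +ᴴ sᴴ *ᴴ T i) +ᴴ rᴴ *ᴴ T i        ≈⟨ +-assoc qᴴ _ _ ⟩
  qᴴ +ᴴ (sᴴ *ᴴ T i +ᴴ rᴴ *ᴴ T i)        ≈⟨ +-cong reflᴴ (distribʳ (T i) sᴴ rᴴ) ⟨
  qᴴ +ᴴ (sᴴ +ᴴ rᴴ) *ᴴ T i               ≈⟨ +-cong reflᴴ (transᴴ (*-cong s+r reflᴴ) (Hᴿ.zeroˡ (T i))) ⟩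
  qᴴ +ᴴ 0ᴴ                              ≈⟨ Hᴿ.+-identityʳ qᴴ ⟩
  qᴴ                                    ∎
  where open H-Reasoning

T-T⁻¹ : ∀ (i : Fin m) → T i *ᴴ T⁻¹ i ≈ᴴ 1ᴴ
T-T⁻¹ i = begin
  T i *ᴴ (q⁻¹ᴴ *ᴴ (T i +ᴴ rᴴ))   ≈⟨ *-assoc _ _ _ ⟨
  (T i *ᴴ q⁻¹ᴴ) *ᴴ (T i +ᴴ rᴴ)   ≈⟨ *-cong (symᴴ (ι-central _ (T i))) reflᴴ ⟩
  (q⁻¹ᴴ *ᴴ T i) *ᴴ (T i +ᴴ rᴴ)   ≈⟨ *-assoc _ _ _ ⟩
  q⁻¹ᴴ *ᴴ (T i *ᴴ (T i +ᴴ rᴴ))   ≈⟨ *-cong reflᴴ (T-shifted i) ⟩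
  q⁻¹ᴴ *ᴴ qᴴ                     ≈⟨ q⁻¹q ⟩
  1ᴴ                             ∎
  where open H-Reasoning

T⁻¹-T : ∀ (i : Fin m) → T⁻¹ i *ᴴ T i ≈ᴴ 1ᴴ
T⁻¹-T i = begin
  (q⁻¹ᴴ *ᴴ (T i +ᴴ rᴴ)) *ᴴ T i   ≈⟨ *-assoc _ _ _ ⟩
  q⁻¹ᴴ *ᴴ ((T i +ᴴ rᴴ) *ᴴ T i)   ≈⟨ *-cong reflᴴ (transᴴ (distribʳ (T i) (T i) rᴴ)
    (+-cong reflᴴ (ι-central _ (T i)))) ⟩
  q⁻¹ᴴ *ᴴ (T i *ᴴ T i +ᴴ T i *ᴴ rᴴ)  ≈⟨ *-cong reflᴴ (transᴴ (symᴴ (distribˡ (T i) (T i) rᴴ)) (T-shifted i)) ⟩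
  q⁻¹ᴴ *ᴴ qᴴ                     ≈⟨ q⁻¹q ⟩
  1ᴴ                             ∎
  where open H-Reasoning

Tw-++ : ∀ (is js : List (Fin m)) → Tw (is ++ js) ≈ᴴ Tw is *ᴴ Tw js
Tw-++ []       js = symᴴ (*-identityˡ _)
Tw-++ (i ∷ is) js = transᴴ (*-cong reflᴴ (Tw-++ is js)) (symᴴ (*-assoc _ _ _))

Tw-snoc : ∀ (is : List (Fin m)) i → Tw (is ++ i ∷ []) ≈ᴴ Tw is *ᴴ T i
Tw-snoc is i = transᴴ (Tw-++ is (i ∷ [])) (*-cong reflᴴ (*-identityʳ (T i)))

assoc₄ : ∀ (a b c d : H m) → a *ᴴ (b *ᴴ (c *ᴴ d)) ≈ᴴ (a *ᴴ b *ᴴ c) *ᴴ d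
assoc₄ a b c d = transᴴ (symᴴ (*-assoc a b (c *ᴴ d))) (symᴴ (*-assoc (a *ᴴ b) c d))

Tw-∼ : ∀ {is js : List (Fin m)} → is ∼ js → Tw is ≈ᴴ Tw js
Tw-∼ ∼refl             = reflᴴ
Tw-∼ (∼sym e)          = symᴴ (Tw-∼ e)
Tw-∼ (∼trans e e′)     = transᴴ (Tw-∼ e) (Tw-∼ e′)
Tw-∼ (∼∷ i e)          = *-cong reflᴴ (Tw-∼ e)
Tw-∼ (∼braid i j is x) = transᴴ (assoc₄ _ _ _ _) (transᴴ (*-cong (braid i j x) reflᴴ) (symᴴ (assoc₄ _ _ _ _)))
Tw-∼ (∼comm i j is x)  = transᴴ (symᴴ (*-assoc _ _ _)) (transᴴ (*-cong (T-comm i j x) reflᴴ) (*-assoc _ _ _))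

Tw⁻¹ : List (Fin m) → H m
Tw⁻¹ []       = 1ᴴ
Tw⁻¹ (i ∷ is) = Tw⁻¹ is *ᴴ T⁻¹ i

cancel-middle : ∀ {x x′ y y′ : H m} → x *ᴴ x′ ≈ᴴ 1ᴴ → y *ᴴ y′ ≈ᴴ 1ᴴ → (x *ᴴ y) *ᴴ (y′ *ᴴ x′) ≈ᴴ 1ᴴ
cancel-middle {x = x} {x′} {y} {y′} e e′ = begin
  (x *ᴴ y) *ᴴ (y′ *ᴴ x′)  ≈⟨ *-assoc x y _ ⟩
  x *ᴴ (y *ᴴ (y′ *ᴴ x′))  ≈⟨ *-cong reflᴴ (*-assoc y y′ x′) ⟨
  x *ᴴ ((y *ᴴ y′) *ᴴ x′)  ≈⟨ *-cong reflᴴ (transᴴ (*-cong e′ reflᴴ) (*-identityˡ x′)) ⟩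
  x *ᴴ x′                 ≈⟨ e ⟩
  1ᴴ                      ∎
  where open H-Reasoning

Tw-inverse : ∀ (is : List (Fin m)) → IsInverse (Tw is) (Tw⁻¹ is)
Tw-inverse []       = *-identityˡ 1ᴴ , *-identityˡ 1ᴴ
Tw-inverse (i ∷ is) = cancel-middle (T-T⁻¹ i) (proj₁ (Tw-inverse is)) , cancel-middle (proj₂ (Tw-inverse is))
    (T⁻¹-T i)

T[]-cong : ∀ (v w : Permutation′ (suc m)) → v ≈ w → T[ v ] ≈ᴴ T[ w ]
T[]-cong v w e = Hᴿ.reflexive (cong Tw (lehmer-cong v w e))

T-ascˡ : ∀ (i : Fin m) w → Ascentˡ i w → T i *ᴴ T[ w ] ≈ᴴ T[ w ∘ₚ s i ]
T-ascˡ i w a = Tw-∼ (ascˡ i w a)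

T-ascʳ : ∀ (i : Fin m) w → Ascentʳ i w → T[ w ] *ᴴ T i ≈ᴴ T[ s i ∘ₚ w ]
T-ascʳ i w a = transᴴ (symᴴ (Tw-snoc (lehmer w) i)) (Tw-∼ (ascʳ i w a))

quadraticˡ : ∀ (i : Fin m) x → T i *ᴴ (T i *ᴴ x) ≈ᴴ sᴴ *ᴴ (T i *ᴴ x) +ᴴ qᴴ *ᴴ x
quadraticˡ i x = transᴴ (symᴴ (*-assoc _ _ _)) (transᴴ (*-cong (quadratic i) reflᴴ)
  (transᴴ (distribʳ x _ _) (+-cong (*-assoc _ _ _) reflᴴ)))

quadraticʳ : ∀ (i : Fin m) x → (x *ᴴ T i) *ᴴ T i ≈ᴴ sᴴ *ᴴ (x *ᴴ T i) +ᴴ qᴴ *ᴴ x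
quadraticʳ i x = begin
  (x *ᴴ T i) *ᴴ T i                    ≈⟨ *-assoc _ _ _ ⟩
  x *ᴴ (T i *ᴴ T i)                    ≈⟨ *-cong reflᴴ (quadratic i) ⟩
  x *ᴴ (sᴴ *ᴴ T i +ᴴ qᴴ)               ≈⟨ distribˡ x _ _ ⟩
  x *ᴴ (sᴴ *ᴴ T i) +ᴴ x *ᴴ qᴴ          ≈⟨ +-cong (transᴴ (symᴴ (*-assoc _ _ _))
    (transᴴ (*-cong (symᴴ (ι-central _ x)) reflᴴ) (*-assoc _ _ _))) (symᴴ (ι-central _ x)) ⟩
  sᴴ *ᴴ (x *ᴴ T i) +ᴴ qᴴ *ᴴ x          ∎
  where open H-Reasoning

∑ᴴ-*ˡ : ∀ y (xs : List A) (f : A → H m) → y *ᴴ ∑ᴴ xs f ≈ᴴ ∑ᴴ xs (λ x → y *ᴴ f x)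
∑ᴴ-*ˡ y xs f = ∑H.∑-hom _+ᴴ_ 0ᴴ (y *ᴴ_) (Hᴿ.zeroʳ y) (distribˡ y) xs f

∑ᴴ-*ʳ : ∀ y (xs : List A) (f : A → H m) → ∑ᴴ xs f *ᴴ y ≈ᴴ ∑ᴴ xs (λ x → f x *ᴴ y)
∑ᴴ-*ʳ y xs f = ∑H.∑-hom _+ᴴ_ 0ᴴ (_*ᴴ y) (Hᴿ.zeroˡ y) (distribʳ y) xs f

-- Spans of the T_w

record Span {m} (L : List (Permutation′ (suc m))) (x : H m) : Set where
  constructor _,_
  field
    coefficient : Permutation′ (suc m) → ℤ[t^±1]
    expansion   : x ≈ᴴ ∑ᴴ L (λ w → ι (coefficient w) *ᴴ T[ w ])

∈⇒span : ∀ (μ : Weight (suc m)) {x} → x ∈H⟨ μ ⟩ → Span (Stab μ) x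
∈⇒span μ (a , e) = a , e

span⇒∈ : ∀ (μ : Weight (suc m)) {x} → Span (Stab μ) x → x ∈H⟨ μ ⟩
span⇒∈ μ (a , e) = a , e

module _ {m} {L : List (Permutation′ (suc m))} where

  span-resp : ∀ {x y : H m} → x ≈ᴴ y → Span L x → Span L y
  span-resp e (a , e′) = a , transᴴ (symᴴ e) e′

  span-0 : Span L 0ᴴ
  span-0 = (λ _ → ⟦ 0ₚ ⟧ₗ) , symᴴ (∑H.∑-zero L (λ _ → Hᴿ.zeroˡ _))

  span-+ : ∀ {x y} → Span L x → Span L y → Span L (x +ᴴ y)
  span-+ (a , e) (b , e′) = (λ w → a w +ₗ b w) , transᴴ (+-cong e e′)
    (transᴴ (symᴴ (∑H.∑-⊕ L _ _)) (∑H.∑-cong L (λ {w} _ → symᴴ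
      (transᴴ (*-cong (ι-+ (a w) (b w)) reflᴴ) (distribʳ _ _ _)))))

  span-ι : ∀ c {x} → Span L x → Span L (ι c *ᴴ x)
  span-ι c (a , e) = (λ w → c *ₗ a w) , transᴴ (*-cong reflᴴ e)
    (transᴴ (∑ᴴ-*ˡ _ L _) (∑H.∑-cong L (λ {w} _ → transᴴ (symᴴ (*-assoc _ _ _)) (*-cong (symᴴ (ι-* c (a w))) reflᴴ))))

  span-∑ : ∀ (xs : List A) {f} → (∀ {x} → x ∈ xs → Span L (f x)) → Span L (∑ᴴ xs f)
  span-∑ []       h = span-0
  span-∑ (x ∷ xs) h = span-+ (h (here refl)) (span-∑ xs (λ p → h (there p)))

  span-T : Distinct L → ∀ {v} w → v ∈ L → v ≈ w → Span L T[ w ]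
  span-T dist {v} w v∈L v≈w = a , symᴴ (transᴴ
    (∑H.∑-pick {_~_ = _≈_} dist v∈L (λ {y} _ y≉v → vanish y (λ y≈w → y≉v (λ i → trans (y≈w i) (sym (v≈w i)))))
      (λ {y} _ v≉y → vanish y (λ y≈w → v≉y (λ i → trans (v≈w i) (sym (y≈w i))))))
    (transᴴ (*-cong (Hᴿ.reflexive (cong ι (hit v v≈w))) reflᴴ) (transᴴ (*-identityˡ _) (T[]-cong v w v≈w))))
    where
    _≈?_ : ∀ (v w : Permutation′ (suc m)) → Dec (v ≈ w)
    v ≈? w = Finₚ.all? (λ i → v ⟨$⟩ʳ i Finₚ.≟ w ⟨$⟩ʳ i)
    indicator : ∀ {P : Set} → Dec P → ℤ[t^±1]
    indicator (yes _) = ⟦ 1ₚ ⟧ₗ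
    indicator (no _)  = ⟦ 0ₚ ⟧ₗ
    a : Permutation′ (suc m) → ℤ[t^±1]
    a y = indicator (y ≈? w)
    indicator-yes : ∀ {P : Set} (d : Dec P) → P → indicator d ≡ ⟦ 1ₚ ⟧ₗ
    indicator-yes (yes _) _ = refl
    indicator-yes (no ¬p) p = contradiction p ¬p
    indicator-no : ∀ {P : Set} (d : Dec P) → ¬ P → indicator d ≡ ⟦ 0ₚ ⟧ₗ
    indicator-no (yes p) ¬p = contradiction p ¬p
    indicator-no (no _)  _  = refl
    hit : ∀ y → y ≈ w → a y ≡ ⟦ 1ₚ ⟧ₗ
    hit y = indicator-yes (y ≈? w)
    vanish : ∀ y → ¬ y ≈ w → ι (a y) *ᴴ T[ y ] ≈ᴴ 0ᴴ
    vanish y ¬e = transᴴ (*-cong (Hᴿ.reflexive (cong ι (indicator-no (y ≈? w) ¬e))) reflᴴ) (Hᴿ.zeroˡ _)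

  span-*ˡ : ∀ y → (∀ {w} → w ∈ L → Span L (y *ᴴ T[ w ])) → ∀ {x} → Span L x → Span L (y *ᴴ x)
  span-*ˡ y h (a , e) = span-resp
    (symᴴ (transᴴ (*-cong reflᴴ e) (transᴴ (∑ᴴ-*ˡ y L _) (∑H.∑-cong L (λ {w} _ →
      transᴴ (symᴴ (*-assoc _ _ _)) (transᴴ (*-cong (symᴴ (ι-central _ y)) reflᴴ) (*-assoc _ _ _)))))))
    (span-∑ L (λ {w} w∈L → span-ι (a w) (h w∈L)))

  span-*ʳ : ∀ y → (∀ {w} → w ∈ L → Span L (T[ w ] *ᴴ y)) → ∀ {x} → Span L x → Span L (x *ᴴ y)
  span-*ʳ y h (a , e) = span-resp
    (symᴴ (transᴴ (*-cong e reflᴴ) (transᴴ (∑ᴴ-*ʳ y L _) (∑H.∑-cong L (λ _ → *-assoc _ _ _)))))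
    (span-∑ L (λ {w} w∈L → span-ι (a w) (h w∈L)))

  -- At an ascent T_i T_w is again a basis element. At a descent T_w = T_i T_{s_i w}, and the
  -- quadratic relation gives back T_w and T_{s_i w}.
  span-Tˡ : Distinct L → ∀ i → (∀ {w} → w ∈ L → ∃[ v ] v ∈ L × v ≈ w ∘ₚ s i) → ∀ {x} → Span L x → Span L (T i *ᴴ x)
  span-Tˡ dist i closed = span-*ˡ (T i) case
    where
    case : ∀ {w} → w ∈ L → Span L (T i *ᴴ T[ w ])
    case {w} w∈L with closed w∈L | mulˡ i w
    ... | v , v∈L , v≈ | asc _ e  = span-resp (symᴴ (Tw-∼ e)) (span-T dist (w ∘ₚ s i) v∈L v≈)
    ... | v , v∈L , v≈ | desc _ e = span-resp
      (symᴴ (transᴴ (*-cong reflᴴ (Tw-∼ e)) (transᴴ (quadraticˡ i _) (+-cong (*-cong reflᴴ (symᴴ (Tw-∼ e))) reflᴴ))))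
      (span-+ (span-ι _ (span-T dist w w∈L (λ _ → refl))) (span-ι _ (span-T dist (w ∘ₚ s i) v∈L v≈)))

  span-Tʳ : Distinct L → ∀ i → (∀ {w} → w ∈ L → ∃[ v ] v ∈ L × v ≈ s i ∘ₚ w) → ∀ {x} → Span L x → Span L (x *ᴴ T i)
  span-Tʳ dist i closed = span-*ʳ (T i) case
    where
    case : ∀ {w} → w ∈ L → Span L (T[ w ] *ᴴ T i)
    case {w} w∈L with closed w∈L | mulʳ i w
    ... | v , v∈L , v≈ | asc e  = span-resp (symᴴ (transᴴ (symᴴ (Tw-snoc (lehmer w) i)) (Tw-∼ e)))
        (span-T dist (s i ∘ₚ w) v∈L v≈)
    ... | v , v∈L , v≈ | desc e = span-resp
      (symᴴ (transᴴ (*-cong e′ reflᴴ) (transᴴ (quadraticʳ i _) (+-cong (*-cong reflᴴ (symᴴ e′)) reflᴴ))))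
      (span-+ (span-ι _ (span-T dist w w∈L (λ _ → refl))) (span-ι _ (span-T dist (s i ∘ₚ w) v∈L v≈)))
      where
      e′ : T[ w ] ≈ᴴ T[ s i ∘ₚ w ] *ᴴ T i
      e′ = transᴴ (Tw-∼ e) (Tw-snoc (lehmer (s i ∘ₚ w)) i)

s-fixes : ∀ {μ : Weight (suc m)} {i} → Stabilises μ i → ∀ k → μ (s i ⟨$⟩ʳ k) ≡ μ k
s-fixes {μ = μ} {i} e k with touch i k
... | atˡ refl = trans (cong μ (s-left i)) (sym e)
... | atʳ refl = trans (cong μ (s-right i)) e
... | away f g = cong μ (s-other i f g)

Stab-Tˡ : ∀ {μ : Weight (suc m)} {i} → Stabilises μ i → ∀ {x} → Span (Stab μ) x → Span (Stab μ) (T i *ᴴ x)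
Stab-Tˡ {μ = μ} {i} st = span-Tˡ (Stab-distinct μ) i (λ {w} w∈ → Stab-complete μ (w ∘ₚ s i)
  (fixesˡ μ (w ∘ₚ s i) (λ k → trans (s-fixes {μ = μ} st _) (fixesʳ μ w (Stab-fixes μ w∈) k))))

Stab-Tʳ : ∀ {μ : Weight (suc m)} {i} → Stabilises μ i → ∀ {x} → Span (Stab μ) x → Span (Stab μ) (x *ᴴ T i)
Stab-Tʳ {μ = μ} {i} st = span-Tʳ (Stab-distinct μ) i (λ {w} w∈ → Stab-complete μ (s i ∘ₚ w)
  (fixesˡ μ (s i ∘ₚ w) (λ k → trans (fixesʳ μ w (Stab-fixes μ w∈) _) (s-fixes {μ = μ} st k))))

T-id : T[ Perm.id ] ≈ᴴ 1ᴴ {m}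
T-id {m} = Hᴿ.reflexive (cong Tw (empty (lehmer (Perm.id {suc m}))
    (trans (length-lehmer (Perm.id {suc m})) (inv-id {m}))))
  where
  empty : ∀ (is : List (Fin m)) → length is ≡ 0 → is ≡ []
  empty [] _ = refl

Stab-1 : ∀ (μ : Weight (suc m)) → Span (Stab μ) 1ᴴ
Stab-1 μ with Stab-complete μ Perm.id (λ _ → refl)
... | v , v∈ , e = span-resp T-id (span-T (Stab-distinct μ) Perm.id v∈ e)

past-ι : ∀ c (x y : H m) → ι c *ᴴ (x *ᴴ y) ≈ᴴ x *ᴴ (ι c *ᴴ y)
past-ι c x y = transᴴ (symᴴ (*-assoc _ _ _)) (transᴴ (*-cong (ι-central c x) reflᴴ) (*-assoc _ _ _))

-- Existence of the decomposition along the T_{u_F}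

u-raise : ∀ {m} {i : Fin m} {p} → At inside outside i p → T[ uPerm (sw i p) ] ≈ᴴ T i *ᴴ T[ uPerm p ]
u-raise {i = i} {p} at = symᴴ (transᴴ (T-ascˡ i (uPerm p) (pos-ascent at))
  (T[]-cong (uPerm p ∘ₚ s i) (uPerm (sw i p)) (λ k → sym (u-sw at k))))

Decomposition : ∀ l → H m → Set
Decomposition {m} l z = Σ[ h ∈ (Column (suc m) l → H m) ]
  (∀ F → Span (Stab (ϖ l)) (h F)) × z ≈ᴴ ∑ᴴ (columns (suc m) l) (λ F → T[ u F ] *ᴴ h F)

module _ {m l : ℕ} where

  dec-resp : ∀ {x y : H m} → x ≈ᴴ y → Decomposition l x → Decomposition l y
  dec-resp e (h , h∈ , e′) = h , h∈ , transᴴ (symᴴ e) e′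

  dec-0 : Decomposition l (0ᴴ {m})
  dec-0 = (λ _ → 0ᴴ) , (λ _ → span-0) , symᴴ (∑H.∑-zero (columns (suc m) l) (λ _ → Hᴿ.zeroʳ _))

  dec-+ : ∀ {x y : H m} → Decomposition l x → Decomposition l y → Decomposition l (x +ᴴ y)
  dec-+ (h , h∈ , e) (g , g∈ , e′) = (λ F → h F +ᴴ g F) , (λ F → span-+ (h∈ F) (g∈ F)) , transᴴ (+-cong e e′)
    (transᴴ (symᴴ (∑H.∑-⊕ (columns (suc m) l) _ _)) (∑H.∑-cong (columns (suc m) l) (λ _ → symᴴ (distribˡ _ _ _))))

  dec-ι : ∀ c {x : H m} → Decomposition l x → Decomposition l (ι c *ᴴ x)
  dec-ι c (h , h∈ , e) = (λ F → ι c *ᴴ h F) , (λ F → span-ι c (h∈ F)) , transᴴ (*-cong reflᴴ e)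
    (transᴴ (∑ᴴ-*ˡ _ (columns (suc m) l) _) (∑H.∑-cong (columns (suc m) l) (λ _ → past-ι c _ _)))

  dec-∑ : ∀ (xs : List A) {f : A → H m} → (∀ {x} → x ∈ xs → Decomposition l (f x)) → Decomposition l (∑ᴴ xs f)
  dec-∑ []       h = dec-0
  dec-∑ (x ∷ xs) h = dec-+ (h (here refl)) (dec-∑ xs (λ p → h (there p)))

  dec-column : ∀ (F : Column (suc m) l) {x : H m} → Span (Stab (ϖ l)) x → Decomposition l (T[ u F ] *ᴴ x)
  dec-column F {x} x∈ = h , h∈ , symᴴ (transᴴ
    (∑H.∑-pick {_~_ = λ C D → set C ≡ set D} (columns-distinct (suc m) l) (columns-complete F)
      (λ {G} _ ¬e → vanish G ¬e) (λ {G} _ ¬e → vanish G (λ e → ¬e (sym e))))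
    (*-cong reflᴴ hit))
    where
    _≟ˢ_ : (p q : Subset (suc m)) → Dec (p ≡ q)
    _≟ˢ_ = Vecₚ.≡-dec Boolₚ._≟_
    h : Column (suc m) l → H m
    h G = if does (set G ≟ˢ set F) then x else 0ᴴ
    h∈ : ∀ G → Span (Stab (ϖ l)) (h G)
    h∈ G with does (set G ≟ˢ set F)
    ... | true  = x∈
    ... | false = span-0
    hit : h F ≈ᴴ x
    hit with set F ≟ˢ set F
    ... | yes _ = reflᴴ
    ... | no ¬e = contradiction refl ¬e
    vanish : ∀ G → set G ≢ set F → T[ u G ] *ᴴ h G ≈ᴴ 0ᴴ
    vanish G ¬e with set G ≟ˢ set F
    ... | yes e = contradiction e ¬e
    ... | no _  = Hᴿ.zeroʳ _

  dec-T-equal : ∀ {i} (F : Column (suc m) l) → Conjugate i (set F) → ∀ {x} → Span (Stab (ϖ l)) x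
      → Decomposition l (T i *ᴴ (T[ u F ] *ᴴ x))
  dec-T-equal {i} F c {x} x∈ = dec-resp
    (symᴴ (transᴴ (symᴴ (*-assoc _ _ _)) (transᴴ (*-cong slide-u reflᴴ) (*-assoc _ _ _))))
    (dec-column F (Stab-Tˡ {μ = ϖ l} (ϖ-stabilises l i′ (λ e → interior (trans e (sym (size-of F))))) x∈))
    where
    open Conjugate c
    slide-u : T i *ᴴ T[ u F ] ≈ᴴ T[ u F ] *ᴴ T i′
    slide-u = transᴴ (T-ascˡ i (u F) ascentˡ) (transᴴ (T[]-cong (u F ∘ₚ s i) (s i′ ∘ₚ u F) conj)
        (symᴴ (T-ascʳ i′ (u F) ascentʳ)))

  -- Three situations: if only i lies in F, T_i raises the column; if only i + 1 does, the quadratic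
  -- relation yields F and the lowered column; otherwise T_i slides through T_{u_F} as T_{i′} and is
  -- absorbed by the parabolic subalgebra.
  dec-T-column : ∀ i (F : Column (suc m) l) {x : H m} → Span (Stab (ϖ l)) x → Decomposition l (T i *ᴴ (T[ u F ] *ᴴ x))
  dec-T-column i F {x} x∈ with at? i (set F)
  ... | true , false , at = dec-resp
    (transᴴ (*-cong (u-raise at) reflᴴ) (*-assoc _ _ _)) (dec-column (swᶜ i F) x∈)
  ... | false , true , at = dec-resp
    (symᴴ (begin
      T i *ᴴ (T[ u F ] *ᴴ x)                                 ≈⟨ *-cong reflᴴ lower ⟩
      T i *ᴴ (T i *ᴴ (T[ u F′ ] *ᴴ x))                       ≈⟨ quadraticˡ i _ ⟩
      sᴴ *ᴴ (T i *ᴴ (T[ u F′ ] *ᴴ x)) +ᴴ qᴴ *ᴴ (T[ u F′ ] *ᴴ x)  ≈⟨ +-cong (*-cong reflᴴ lower) reflᴴ ⟨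
      sᴴ *ᴴ (T[ u F ] *ᴴ x) +ᴴ qᴴ *ᴴ (T[ u F′ ] *ᴴ x)        ∎))
    (dec-+ (dec-ι _ (dec-column F x∈)) (dec-ι _ (dec-column F′ x∈)))
    where
    open H-Reasoning
    F′ = swᶜ i F
    lower : T[ u F ] *ᴴ x ≈ᴴ T i *ᴴ (T[ u F′ ] *ᴴ x)
    lower = transᴴ (*-cong (transᴴ (Hᴿ.reflexive (cong (λ p → T[ uPerm p ]) (sym (sw-sw i (set F)))))
        (u-raise (sw-at at))) reflᴴ)
      (*-assoc _ _ _)
  ... | true , true , at = dec-T-equal F (conjugate at) x∈
  ... | false , false , at = dec-T-equal F (conjugate at) x∈

  dec-T : ∀ i {x : H m} → Decomposition l x → Decomposition l (T i *ᴴ x)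
  dec-T i (h , h∈ , e) = dec-resp (symᴴ (transᴴ (*-cong reflᴴ e) (∑ᴴ-*ˡ (T i) (columns (suc m) l) _)))
    (dec-∑ (columns (suc m) l) (λ {F} _ → dec-T-column i F (h∈ F)))

  dec-1 : l ≤ suc m → Decomposition l (1ᴴ {m})
  dec-1 l≤n = dec-resp
    (transᴴ (*-identityʳ _) (transᴴ (T[]-cong (uPerm (top (suc m) l)) Perm.id (u-top (suc m) l)) T-id))
    (dec-column (col (top (suc m) l) (∣top∣ l≤n)) (Stab-1 (ϖ l)))

-- Membership in the subalgebra H_n, closed under `_≈ᴴ_`. A predicate that contains 1 and is stable
-- under sums, scalars and left multiplication by each T_i contains all of it; expansions and
-- decompositions are produced this way.
data Finite {m} : H m → Set where
  fin-ι    : ∀ a → Finite (ι a)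
  fin-T    : ∀ i → Finite (T i)
  fin-+    : ∀ {x y} → Finite x → Finite y → Finite (x +ᴴ y)
  fin-*    : ∀ {x y} → Finite x → Finite y → Finite (x *ᴴ y)
  fin-resp : ∀ {x y} → x ≈ᴴ y → Finite x → Finite y

fin-Tw : ∀ (is : List (Fin m)) → Finite (Tw is)
fin-Tw []       = fin-ι _
fin-Tw (i ∷ is) = fin-* (fin-T i) (fin-Tw is)

fin-Tw⁻¹ : ∀ (is : List (Fin m)) → Finite (Tw⁻¹ is)
fin-Tw⁻¹ []       = fin-ι _
fin-Tw⁻¹ (i ∷ is) = fin-* (fin-Tw⁻¹ is) (fin-* (fin-ι _) (fin-+ (fin-T i) (fin-ι _)))

fin-∑ : ∀ (xs : List A) {f : A → H m} → (∀ x → Finite (f x)) → Finite (∑ᴴ xs f)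
fin-∑ []       h = fin-ι _
fin-∑ (x ∷ xs) h = fin-+ (h x) (fin-∑ xs h)

fin-span : ∀ {L} {x : H m} → Span L x → Finite x
fin-span {L = L} (a , e) = fin-resp (symᴴ e) (fin-∑ L (λ w → fin-* (fin-ι _) (fin-Tw (lehmer w))))

module _ (Q : H m → Set) (Q-resp : ∀ {x y} → x ≈ᴴ y → Q x → Q y) (Q-+ : ∀ {x y} → Q x → Q y → Q (x +ᴴ y))
         (Q-ι : ∀ c {x} → Q x → Q (ι c *ᴴ x)) (Q-T : ∀ i {x} → Q x → Q (T i *ᴴ x)) where
  finite-ideal : ∀ {x} → Finite x → ∀ {y} → Q y → Q (x *ᴴ y)
  finite-ideal (fin-ι a)      h = Q-ι a h
  finite-ideal (fin-T i)      h = Q-T i h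
  finite-ideal (fin-+ f g)    h = Q-resp (symᴴ (distribʳ _ _ _)) (Q-+ (finite-ideal f h) (finite-ideal g h))
  finite-ideal (fin-* f g)    h = Q-resp (symᴴ (*-assoc _ _ _)) (finite-ideal f (finite-ideal g h))
  finite-ideal (fin-resp e f) h = Q-resp (*-cong e reflᴴ) (finite-ideal f h)

  finite-contained : Q 1ᴴ → ∀ {x} → Finite x → Q x
  finite-contained h f = Q-resp (*-identityʳ _) (finite-ideal f h)

finite-span : ∀ {x : H m} → Finite x → Span (𝔖 (suc m)) x
finite-span {m} = finite-contained (Span (𝔖 (suc m))) span-resp span-+ span-ι
  (λ i → span-Tˡ (𝔖-distinct (suc m)) i (λ {w} _ → 𝔖-complete (w ∘ₚ s i)))
  (let v , v∈ , e = 𝔖-complete Perm.id in span-resp T-id (span-T (𝔖-distinct (suc m)) Perm.id v∈ e))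

finite-decomposition : l ≤ suc m → ∀ {x : H m} → Finite x → Decomposition l x
finite-decomposition {l} l≤n = finite-contained (Decomposition l) dec-resp dec-+ dec-ι dec-T (dec-1 l≤n)

-- Right invariance of the symmetrisers

σ : H m → H (suc m)
σ (ι a)    = ι a
σ (T i)    = T (suc i)
σ (X i)    = X (suc i)
σ (X⁻¹ i)  = X⁻¹ (suc i)
σ (x +ᴴ y) = σ x +ᴴ σ y
σ (x *ᴴ y) = σ x *ᴴ σ y

σ-cong : ∀ {x y : H m} → x ≈ᴴ y → σ x ≈ᴴ σ y
σ-cong reflᴴ            = reflᴴ
σ-cong (symᴴ e)         = symᴴ (σ-cong e)
σ-cong (transᴴ e e′)    = transᴴ (σ-cong e) (σ-cong e′)
σ-cong (+-cong e e′)    = +-cong (σ-cong e) (σ-cong e′)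
σ-cong (*-cong e e′)    = *-cong (σ-cong e) (σ-cong e′)
σ-cong (+-assoc x y z)  = +-assoc _ _ _
σ-cong (+-comm x y)     = +-comm _ _
σ-cong (+-identityˡ x)  = +-identityˡ _
σ-cong (+-inverseˡ x)   = +-inverseˡ _
σ-cong (*-assoc x y z)  = *-assoc _ _ _
σ-cong (*-identityˡ x)  = *-identityˡ _
σ-cong (*-identityʳ x)  = *-identityʳ _
σ-cong (distribˡ x y z) = distribˡ _ _ _
σ-cong (distribʳ x y z) = distribʳ _ _ _
σ-cong (ι-cong e)       = ι-cong e
σ-cong (ι-+ a b)        = ι-+ a b
σ-cong (ι-* a b)        = ι-* a b
σ-cong (ι-central a x)  = ι-central a _
σ-cong (quadratic i)    = quadratic (suc i)
σ-cong (braid i j e)    = braid (suc i) (suc j) (cong suc e)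
σ-cong (T-comm i j e)   = T-comm (suc i) (suc j) e
σ-cong (X-comm i j)     = X-comm (suc i) (suc j)
σ-cong (X-X⁻¹ i)        = X-X⁻¹ (suc i)
σ-cong (X⁻¹-X i)        = X⁻¹-X (suc i)
σ-cong (TXT i)          = TXT (suc i)
σ-cong (TX-comm i j p p′) = TX-comm (suc i) (suc j) (λ e → p (Finₚ.suc-injective e)) (λ e → p′ (Finₚ.suc-injective e))

σ-Tw : ∀ (is : List (Fin m)) → σ (Tw is) ≡ Tw (map suc is)
σ-Tw []       = refl
σ-Tw (i ∷ is) = cong (T (suc i) *ᴴ_) (σ-Tw is)

σ-∑ : ∀ (xs : List A) (f : A → H m) → σ (∑ᴴ xs f) ≡ ∑ᴴ xs (λ x → σ (f x))
σ-∑ []       f = refl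
σ-∑ (x ∷ xs) f = cong (σ (f x) +ᴴ_) (σ-∑ xs f)

T₀-σσ : ∀ (L : List (List (Fin m))) → T 0F *ᴴ σ (σ (∑ᴴ L Tw)) ≈ᴴ σ (σ (∑ᴴ L Tw)) *ᴴ T 0F
T₀-σσ L = begin
  T 0F *ᴴ σ (σ (∑ᴴ L Tw))                           ≡⟨ cong (T 0F *ᴴ_) expand ⟩
  T 0F *ᴴ ∑ᴴ L (λ is → Tw (map suc (map suc is)))    ≈⟨ ∑ᴴ-*ˡ (T 0F) L _ ⟩
  ∑ᴴ L (λ is → Tw (0F ∷ map suc (map suc is)))       ≈⟨ ∑H.∑-cong L
    (λ {is} _ → transᴴ (Tw-∼ (past is)) (Tw-snoc (map suc (map suc is)) 0F)) ⟩
  ∑ᴴ L (λ is → Tw (map suc (map suc is)) *ᴴ T 0F)    ≈⟨ ∑ᴴ-*ʳ (T 0F) L _ ⟨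
  ∑ᴴ L (λ is → Tw (map suc (map suc is))) *ᴴ T 0F    ≡⟨ cong (_*ᴴ T 0F) expand ⟨
  σ (σ (∑ᴴ L Tw)) *ᴴ T 0F                           ∎
  where
  open H-Reasoning
  expand : σ (σ (∑ᴴ L Tw)) ≡ ∑ᴴ L (λ is → Tw (map suc (map suc is)))
  expand = trans (cong σ (σ-∑ L Tw)) (trans (σ-∑ L (λ is → σ (Tw is))) (go L))
    where
    go : ∀ L → ∑ᴴ L (λ is → σ (σ (Tw is))) ≡ ∑ᴴ L (λ is → Tw (map suc (map suc is)))
    go []       = refl
    go (is ∷ L) = cong₂ _+ᴴ_ (trans (cong σ (σ-Tw is)) (σ-Tw (map suc is))) (go L)
  past : ∀ is → 0F ∷ map suc (map suc is) ∼ map suc (map suc is) ++ 0F ∷ []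
  past is = ∼trans (∼-reflexive (cong (0F ∷_) (sym (Listₚ.++-identityʳ _)))) (0-past is [])

-- The sum of the minimal coset representatives of S_n / S_(n-1)
D : ∀ m → H m
D m = ∑ᴴ (allFin (suc m)) (λ j → Tw (down j))

D-suc : ∀ m → D (suc m) ≈ᴴ 1ᴴ +ᴴ σ (D m) *ᴴ T 0F
D-suc m = +-cong reflᴴ (begin
  ∑ᴴ (List.tabulate suc) (λ j → Tw (down j))        ≡⟨ cong (λ L → ∑ᴴ L (λ j → Tw (down j)))
    (Listₚ.map-tabulate (λ j → j) suc) ⟨
  ∑ᴴ (map suc (allFin (suc m))) (λ j → Tw (down j)) ≡⟨ ∑H.∑-map Fin.suc (allFin (suc m)) (λ j → Tw (down j)) ⟩
  ∑ᴴ (allFin (suc m)) (λ j → Tw (down (suc j)))     ≈⟨ ∑H.∑-cong (allFin (suc m)) (λ {j} _ →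
                                                          transᴴ (Tw-snoc (map suc (down j)) 0F)
                                                            (*-cong (symᴴ (Hᴿ.reflexive (σ-Tw (down j)))) reflᴴ)) ⟩
  ∑ᴴ (allFin (suc m)) (λ j → σ (Tw (down j)) *ᴴ T 0F) ≈⟨ ∑ᴴ-*ʳ (T 0F) (allFin (suc m)) _ ⟨
  ∑ᴴ (allFin (suc m)) (λ j → σ (Tw (down j))) *ᴴ T 0F ≡⟨ cong (_*ᴴ T 0F) (σ-∑ (allFin (suc m)) (λ j → Tw (down j))) ⟨
  σ (D m) *ᴴ T 0F                                   ∎)
  where open H-Reasoning

1+s-* : ∀ (x : H m) → x +ᴴ sᴴ *ᴴ x ≈ᴴ qᴴ *ᴴ x
1+s-* x = transᴴ (+-cong (symᴴ (*-identityˡ x)) reflᴴ) (transᴴ (symᴴ (distribʳ x _ _)) (*-cong 1+s reflᴴ))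

-- The element is the sum over minimal representatives of S_n / S_(n-2), and the coset of s_0
-- permutes them from the right. With U, V the shifted and doubly shifted coset sums, Y = U + U T₀ U
-- and U = 1 + V T₁. In T₀ U T₀ one summand is quadratic in T₀; the other is reduced by the braid
-- relation to the shifted induction hypothesis.
D-invariant : ∀ m → (D (suc m) *ᴴ σ (D m)) *ᴴ T 0F ≈ᴴ qᴴ *ᴴ (D (suc m) *ᴴ σ (D m))
D-invariant zero = begin
  (D 1 *ᴴ σ (D 0)) *ᴴ T 0F          ≈⟨ *-cong Y≈ reflᴴ ⟩
  (1ᴴ +ᴴ T 0F) *ᴴ T 0F              ≈⟨ distribʳ _ _ _ ⟩
  1ᴴ *ᴴ T 0F +ᴴ T 0F *ᴴ T 0F        ≈⟨ +-cong (*-identityˡ _) (quadratic 0F) ⟩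
  T 0F +ᴴ (sᴴ *ᴴ T 0F +ᴴ qᴴ)        ≈⟨ +-assoc _ _ _ ⟨
  (T 0F +ᴴ sᴴ *ᴴ T 0F) +ᴴ qᴴ        ≈⟨ +-cong (1+s-* _) (symᴴ (*-identityʳ qᴴ)) ⟩
  qᴴ *ᴴ T 0F +ᴴ qᴴ *ᴴ 1ᴴ            ≈⟨ +-comm _ _ ⟩
  qᴴ *ᴴ 1ᴴ +ᴴ qᴴ *ᴴ T 0F            ≈⟨ distribˡ _ _ _ ⟨
  qᴴ *ᴴ (1ᴴ +ᴴ T 0F)                ≈⟨ *-cong reflᴴ Y≈ ⟨
  qᴴ *ᴴ (D 1 *ᴴ σ (D 0))            ∎
  where
  open H-Reasoning
  D0 : σ (D 0) ≈ᴴ 1ᴴ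
  D0 = Hᴿ.+-identityʳ 1ᴴ
  Y≈ : D 1 *ᴴ σ (D 0) ≈ᴴ 1ᴴ +ᴴ T 0F
  Y≈ = transᴴ (*-cong (transᴴ (D-suc 0) (+-cong reflᴴ (transᴴ (*-cong D0 reflᴴ) (*-identityˡ _)))) D0) (*-identityʳ _)
D-invariant (suc m) = begin
  Y *ᴴ T₀                                                                ≈⟨ *-cong Y≈ reflᴴ ⟩
  (U +ᴴ U *ᴴ (T₀ *ᴴ U)) *ᴴ T₀                                            ≈⟨ transᴴ (distribʳ _ _ _)
    (+-cong reflᴴ (*-assoc _ _ _)) ⟩
  U *ᴴ T₀ +ᴴ U *ᴴ ((T₀ *ᴴ U) *ᴴ T₀)                                      ≈⟨ +-cong reflᴴ (*-cong reflᴴ T₀UT₀) ⟩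
  U *ᴴ T₀ +ᴴ U *ᴴ ((sᴴ *ᴴ T₀ +ᴴ qᴴ) +ᴴ V *ᴴ (T₁ *ᴴ (T₀ *ᴴ T₁)))          ≈⟨ +-cong reflᴴ
    (transᴴ (distribˡ _ _ _) (+-cong (distribˡ _ _ _) last)) ⟩
  U *ᴴ T₀ +ᴴ ((U *ᴴ (sᴴ *ᴴ T₀) +ᴴ U *ᴴ qᴴ) +ᴴ qᴴ *ᴴ (U *ᴴ (V *ᴴ (T₀ *ᴴ T₁))))
    ≈⟨ transᴴ (symᴴ (+-assoc _ _ _)) (+-cong (transᴴ (symᴴ (+-assoc _ _ _))
      (+-cong (+-cong reflᴴ (symᴴ (past-ι _ _ _))) (symᴴ (ι-central _ U)))) reflᴴ) ⟩
  ((U *ᴴ T₀ +ᴴ sᴴ *ᴴ (U *ᴴ T₀)) +ᴴ qᴴ *ᴴ U) +ᴴ qᴴ *ᴴ (U *ᴴ (V *ᴴ (T₀ *ᴴ T₁)))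
    ≈⟨ +-cong (transᴴ (+-cong (1+s-* _) reflᴴ) (+-comm _ _)) reflᴴ ⟩
  (qᴴ *ᴴ U +ᴴ qᴴ *ᴴ (U *ᴴ T₀)) +ᴴ qᴴ *ᴴ (U *ᴴ (V *ᴴ (T₀ *ᴴ T₁)))         ≈⟨ transᴴ (+-assoc _ _ _)
    (+-cong reflᴴ (symᴴ (distribˡ _ _ _))) ⟩
  qᴴ *ᴴ U +ᴴ qᴴ *ᴴ (U *ᴴ T₀ +ᴴ U *ᴴ (V *ᴴ (T₀ *ᴴ T₁)))                   ≈⟨ +-cong reflᴴ
    (*-cong reflᴴ (transᴴ (*-cong reflᴴ T₀U) (distribˡ _ _ _))) ⟨
  qᴴ *ᴴ U +ᴴ qᴴ *ᴴ (U *ᴴ (T₀ *ᴴ U))                                      ≈⟨ distribˡ _ _ _ ⟨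
  qᴴ *ᴴ (U +ᴴ U *ᴴ (T₀ *ᴴ U))                                            ≈⟨ *-cong reflᴴ Y≈ ⟨
  qᴴ *ᴴ Y                                                                ∎
  where
  open H-Reasoning
  T₀ = T 0F
  T₁ = T 1F
  U  = σ (D (suc m))
  V  = σ (σ (D m))
  Y  = D (suc (suc m)) *ᴴ U
  Y≈ : Y ≈ᴴ U +ᴴ U *ᴴ (T₀ *ᴴ U)
  Y≈ = transᴴ (*-cong (D-suc (suc m)) reflᴴ) (transᴴ (distribʳ _ _ _) (+-cong (*-identityˡ U) (*-assoc _ _ _)))
  U≈ : U ≈ᴴ 1ᴴ +ᴴ V *ᴴ T₁
  U≈ = σ-cong (D-suc m)
  T₀V : T₀ *ᴴ V ≈ᴴ V *ᴴ T₀
  T₀V = transᴴ (*-cong reflᴴ (symᴴ V≈)) (transᴴ (T₀-σσ (map down (allFin (suc m)))) (*-cong V≈ reflᴴ))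
    where
    V≈ : σ (σ (∑ᴴ (map down (allFin (suc m))) Tw)) ≈ᴴ V
    V≈ = Hᴿ.reflexive (cong (λ x → σ (σ x)) (∑H.∑-map down (allFin (suc m)) Tw))
  T₀U : T₀ *ᴴ U ≈ᴴ T₀ +ᴴ V *ᴴ (T₀ *ᴴ T₁)
  T₀U = transᴴ (*-cong reflᴴ U≈) (transᴴ (distribˡ _ _ _) (+-cong (*-identityʳ T₀)
    (transᴴ (symᴴ (*-assoc _ _ _)) (transᴴ (*-cong T₀V reflᴴ) (*-assoc _ _ _)))))
  -- T₀ commutes with V; the braid relation then brings T₁ next to V, where `UV` turns it into the
  -- factor t.
  T₀UT₀ : (T₀ *ᴴ U) *ᴴ T₀ ≈ᴴ (sᴴ *ᴴ T₀ +ᴴ qᴴ) +ᴴ V *ᴴ (T₁ *ᴴ (T₀ *ᴴ T₁))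
  T₀UT₀ = transᴴ (*-cong T₀U reflᴴ) (transᴴ (distribʳ _ _ _) (+-cong (quadratic 0F)
    (transᴴ (*-assoc _ _ _) (*-cong reflᴴ (transᴴ (braid 0F 1F refl) (*-assoc _ _ _))))))
  UV : (U *ᴴ V) *ᴴ T₁ ≈ᴴ qᴴ *ᴴ (U *ᴴ V)
  UV = σ-cong (D-invariant m)
  last : U *ᴴ (V *ᴴ (T₁ *ᴴ (T₀ *ᴴ T₁))) ≈ᴴ qᴴ *ᴴ (U *ᴴ (V *ᴴ (T₀ *ᴴ T₁)))
  last = transᴴ (assoc₄ _ _ _ _) (transᴴ (*-cong UV reflᴴ) (transᴴ (*-assoc _ _ _) (*-cong reflᴴ (*-assoc _ _ _))))

symmetriser : Weight (suc m) → H m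
symmetriser μ = ∑ᴴ (words μ) Tw

𝟏-words : ∀ {μ : Weight (suc m)} → Dominant μ → 𝟏 μ ≡ symmetriser μ
𝟏-words {μ = μ} d = trans (sym (∑H.∑-map lehmer (Stab μ) Tw)) (cong (λ L → ∑ᴴ L Tw) (map-lehmer-Stab {μ = μ} d))

symmetriser-suc : ∀ (μ : Weight (suc (suc m))) →
                  symmetriser μ ≈ᴴ ∑ᴴ (block μ) (λ j → Tw (down j)) *ᴴ σ (symmetriser (tail μ))
symmetriser-suc μ = begin
  ∑ᴴ (words μ) Tw
    ≈⟨ ∑H.∑-concatMap-map (λ j is → down j ++ map suc is) (words (tail μ)) (block μ) Tw ⟩
  ∑ᴴ (block μ) (λ j → ∑ᴴ (words (tail μ)) (λ is → Tw (down j ++ map suc is)))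
    ≈⟨ ∑H.∑-cong (block μ) (λ {j} _ → transᴴ
         (∑H.∑-cong (words (tail μ)) (λ {is} _ → transᴴ (Tw-++ (down j) (map suc is))
           (*-cong reflᴴ (symᴴ (Hᴿ.reflexive (σ-Tw is))))))
         (transᴴ (symᴴ (∑ᴴ-*ˡ (Tw (down j)) (words (tail μ)) _))
           (*-cong reflᴴ (symᴴ (Hᴿ.reflexive (σ-∑ (words (tail μ)) Tw)))))) ⟩
  ∑ᴴ (block μ) (λ j → Tw (down j) *ᴴ σ (symmetriser (tail μ)))
    ≈⟨ ∑ᴴ-*ʳ _ (block μ) _ ⟨
  ∑ᴴ (block μ) (λ j → Tw (down j)) *ᴴ σ (symmetriser (tail μ)) ∎
  where open H-Reasoning

block-all : ∀ (μ : Weight (suc n)) → (∀ j → μ j ≡ μ 0F) → block μ ≡ allFin (suc n)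
block-all μ h = Listₚ.filter-all (λ j → μ j ℤₚ.≟ μ 0F) (All.universal h _)

-- Removing first positions reduces to i = 0. From there on the weight is constant, so the first two
-- block sums are full coset sums covered by `D-invariant`, and T₀ commutes with the doubly shifted
-- remainder.
symmetriser-invariant : ∀ (μ : Weight (suc m)) i → (∀ x y → toℕ i ≤ toℕ x → toℕ i ≤ toℕ y → μ x ≡ μ y) →
                        symmetriser μ *ᴴ T i ≈ᴴ qᴴ *ᴴ symmetriser μ
symmetriser-invariant {suc m} μ (suc i) h = begin
  symmetriser μ *ᴴ T (suc i)            ≈⟨ *-cong (symmetriser-suc μ) reflᴴ ⟩
  (C *ᴴ σ S) *ᴴ T (suc i)               ≈⟨ *-assoc _ _ _ ⟩
  C *ᴴ σ (S *ᴴ T i)                     ≈⟨ *-cong reflᴴ (σ-cong (symmetriser-invariant (tail μ) i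
                                             (λ x y i≤x i≤y → h (suc x) (suc y) (s≤s i≤x) (s≤s i≤y)))) ⟩
  C *ᴴ (qᴴ *ᴴ σ S)                      ≈⟨ past-ι _ _ _ ⟨
  qᴴ *ᴴ (C *ᴴ σ S)                      ≈⟨ *-cong reflᴴ (symmetriser-suc μ) ⟨
  qᴴ *ᴴ symmetriser μ                   ∎
  where
  open H-Reasoning
  C = ∑ᴴ (block μ) (λ j → Tw (down j))
  S = symmetriser (tail μ)
symmetriser-invariant {suc zero} μ zero h = transᴴ (*-cong e reflᴴ) (transᴴ (D-invariant 0) (*-cong reflᴴ (symᴴ e)))
  where
  e : symmetriser μ ≈ᴴ D 1 *ᴴ σ (D 0)
  e = transᴴ (symmetriser-suc μ) (*-cong (Hᴿ.reflexive (cong (λ L → ∑ᴴ L (λ j → Tw (down j)))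
      (block-all μ (λ j → h j 0F z≤n z≤n)))) reflᴴ)
symmetriser-invariant {suc (suc m)} μ zero h = begin
  symmetriser μ *ᴴ T 0F           ≈⟨ *-cong e reflᴴ ⟩
  (Y *ᴴ Z) *ᴴ T 0F                ≈⟨ *-assoc _ _ _ ⟩
  Y *ᴴ (Z *ᴴ T 0F)                ≈⟨ *-cong reflᴴ (T₀-σσ (words (tail (tail μ)))) ⟨
  Y *ᴴ (T 0F *ᴴ Z)                ≈⟨ *-assoc _ _ _ ⟨
  (Y *ᴴ T 0F) *ᴴ Z                ≈⟨ *-cong (D-invariant (suc m)) reflᴴ ⟩
  (qᴴ *ᴴ Y) *ᴴ Z                  ≈⟨ *-assoc _ _ _ ⟩
  qᴴ *ᴴ (Y *ᴴ Z)                  ≈⟨ *-cong reflᴴ e ⟨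
  qᴴ *ᴴ symmetriser μ             ∎
  where
  open H-Reasoning
  Y = D (suc (suc m)) *ᴴ σ (D (suc m))
  Z = σ (σ (symmetriser (tail (tail μ))))
  all : ∀ (ν : Weight (suc n)) → (∀ j → ν j ≡ ν 0F) → ∑ᴴ (block ν) (λ j → Tw (down j)) ≈ᴴ D n
  all ν f = Hᴿ.reflexive (cong (λ L → ∑ᴴ L (λ j → Tw (down j))) (block-all ν f))
  e : symmetriser μ ≈ᴴ Y *ᴴ Z
  e = transᴴ (symmetriser-suc μ) (transᴴ
    (*-cong (all μ (λ j → h j 0F z≤n z≤n)) (σ-cong (transᴴ (symmetriser-suc (tail μ))
      (*-cong (all (tail μ) (λ j → h (suc j) 1F z≤n z≤n)) reflᴴ))))
    (symᴴ (*-assoc _ _ _)))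

𝟏-invariant : ∀ k (i : Fin m) → k ≤ toℕ i → 𝟏 (ϖ k) *ᴴ T i ≈ᴴ qᴴ *ᴴ 𝟏 (ϖ k)
𝟏-invariant {m} k i k≤i = transᴴ (*-cong e reflᴴ) (transᴴ
  (symmetriser-invariant (ϖ k) i (λ x y i≤x i≤y → Splits.const (ϖ-splits k) x y (ℕₚ.≤-trans k≤i i≤x)
    (ℕₚ.≤-trans k≤i i≤y)))
  (*-cong reflᴴ (symᴴ e)))
  where
  e : 𝟏 {m} (ϖ k) ≈ᴴ symmetriser (ϖ k)
  e = Hᴿ.reflexive (𝟏-words {μ = ϖ k} (ϖ-dominant k))

-- Uniqueness of the decomposition along the cosets of S_l × S_(n-l)

top-∣top∣ : ∀ n l → top n ∣ top n l ∣ ≡ top n l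
top-∣top∣ zero    l       = refl
top-∣top∣ (suc n) zero    = cong (top (suc n)) (∣top∣ {n = n} z≤n)
top-∣top∣ (suc n) (suc l) = cong (inside ∷_) (top-∣top∣ n l)

top-tabulate : ∀ n l → tabulate (λ i → toℕ i ℕ.<ᵇ l) ≡ top n l
top-tabulate zero    l       = refl
top-tabulate (suc n) zero    = cong (outside ∷_) (top-tabulate n zero)
top-tabulate (suc n) (suc l) = cong (inside ∷_) (top-tabulate n l)

module Uniqueness (R : CommutativeRing 0ℓ 0ℓ) (Σc : Scalars R) (m l : ℕ)
  (φ-injective : ∀ a b → CommutativeRing._≈_ R (Scalars.φ Σc a) (Scalars.φ Σc b) → a ≈ₗ b) where

  open Action R Σc (Fin (suc m)) Finₚ._≟_ toℕ

  -- One-line notation of w⁻¹, so that left multiplication by s_i swaps two neighbouring letters.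
  word : Permutation′ (suc m) → Vec (Fin (suc m)) (suc m)
  word w = tabulate (w ⟨$⟩ˡ_)

  word-cong : ∀ v w → v ≈ w → word v ≡ word w
  word-cong v w e = Vecₚ.tabulate-cong (flip-cong v w e)

  word-injective : ∀ v w → word v ≡ word w → v ≈ w
  word-injective v w e = flip-cong (flip v) (flip w) (λ k →
    trans (sym (Vecₚ.lookup∘tabulate (v ⟨$⟩ˡ_) k)) (trans (cong (λ y → lookup y k) e)
      (Vecₚ.lookup∘tabulate (w ⟨$⟩ˡ_) k)))

  e₀ : Fun (suc m)
  e₀ = δ (word Perm.id)

  acts-ascending : ∀ {is} → Ascending is → acts is e₀ ≐ δ (word (eval is))
  acts-ascending []                       = ≐refl
  acts-ascending (_∷_ {i} {is} a as) = ≐trans (F-cong (τ-linear i) (acts-ascending as))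
    (≐trans (τ-δ-up i (word (eval is)) ascent) (λ w → ≈reflexive (cong (λ y → δ y w)
      (trans (sw-tabulate i (eval is ⟨$⟩ˡ_)) (Vecₚ.tabulate-cong (λ k → cong (eval is ⟨$⟩ˡ_) (sym (s-flip i k))))))))
    where
    ascent : ord i (word (eval is)) ≡ lt
    ascent = trans (ord-at (at-lookup i (word (eval is))))
      (cmp-< (subst₂ ℕ._<_ (cong toℕ (sym (Vecₚ.lookup∘tabulate (eval is ⟨$⟩ˡ_) (inject₁ i))))
        (cong toℕ (sym (Vecₚ.lookup∘tabulate (eval is ⟨$⟩ˡ_) (suc i)))) a))

  -- All letters of a reduced word are ascents, so the R-matrix only ever swaps. Distinct w thus
  -- give distinct indicators, which exhibits every coefficient of an expansion as a value.
  T-e₀ : ∀ w → ⟪ T[ w ] ⟫ e₀ ≐ δ (word w)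
  T-e₀ w = ≐trans (⟪Tw⟫ (lehmer w) e₀) (≐trans (acts-ascending (lehmer-ascending w))
    (λ y → ≈reflexive (cong (λ v → δ v y) (word-cong (eval (lehmer w)) w (eval-lehmer w)))))

  expand-e₀ : ∀ {L : List (Permutation′ (suc m))} {x : H m} (h : Span L x) (f : Fun (suc m)) → ⟪ x ⟫ f ≐ λ y
      → ∑ L (λ w → φ (Span.coefficient h w) ⊗ ⟪ T[ w ] ⟫ f y)
  expand-e₀ {L} (a , e) f y = ≈trans (sound e f y) (⟪∑⟫ L _ f y)

  coefficient-at : ∀ {L : List (Permutation′ (suc m))} → Distinct L → ∀ {x : H m} (h : Span L x) {v} → v ∈ L
      → ⟪ x ⟫ e₀ (word v) ≈ᴿ φ (Span.coefficient h v)
  coefficient-at {L} dist {x} h@(a , _) {v} v∈L = begin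
    ⟪ x ⟫ e₀ (word v)                             ≈⟨ expand-e₀ h e₀ (word v) ⟩
    ∑ L (λ w → φ (a w) ⊗ ⟪ T[ w ] ⟫ e₀ (word v))  ≈⟨ ∑R.∑-cong L (λ {w} _ → ⊗-congˡ (T-e₀ w (word v))) ⟩
    ∑ L (λ w → φ (a w) ⊗ δ (word w) (word v))     ≈⟨ ∑R.∑-pick {_~_ = _≈_} dist v∈L
                                                       (λ {w} _ w≉v → vanish w (λ e → w≉v (word-injective w v e)))
                                                       (λ {w} _ v≉w → vanish w (λ e → v≉w
                                                         (word-injective v w (sym e)))) ⟩
    φ (a v) ⊗ δ (word v) (word v)                 ≈⟨ ⊗-congˡ (δ-same (word v)) ⟩
    φ (a v) ⊗ 1ᴿ                                  ≈⟨ ≈trans (⊗-comm _ _) (⊗-identityˡ _) ⟩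
    φ (a v)                                       ∎
    where
    open ≈-Reasoning
    vanish : ∀ w → word w ≢ word v → φ (a w) ⊗ δ (word w) (word v) ≈ᴿ 0ᴿ
    vanish w ¬e = ≈trans (⊗-congˡ (δ-diff ¬e)) (⊗-zeroʳ _)

  faithful : ∀ {L : List (Permutation′ (suc m))} → Distinct L → ∀ {x y : H m} → Span L x → Span L y
      → ⟪ x ⟫ e₀ ≐ ⟪ y ⟫ e₀ → x ≈ᴴ y
  faithful {L} dist {x} {y} h@(a , e) g@(b , e′) same = transᴴ e (transᴴ
    (∑H.∑-cong L (λ {v} v∈L → *-cong (ι-cong {a = a v} {b = b v} (φ-injective (a v) (b v)
      (≈trans (≈sym (coefficient-at dist h v∈L)) (≈trans (same (word v)) (coefficient-at dist g v∈L))))) reflᴴ))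
    (symᴴ e′))

  -- Marks the letters below l, and with them the coset: the component along F, applied to `e₀`,
  -- lives on the words of pattern `set F`, so the components of a sum have disjoint supports.
  pattern-of : ∀ {n} → Vec (Fin (suc m)) n → Subset n
  pattern-of = Vec.map (λ a → toℕ a ℕ.<ᵇ l)

  Supported : Subset (suc m) → Fun (suc m) → Set
  Supported p f = ∀ y → pattern-of y ≢ p → f y ≈ᴿ 0ᴿ

  supported-cong : ∀ {p f g} → f ≐ g → Supported p f → Supported p g
  supported-cong e h y ¬p = ≈trans (≈sym (e y)) (h y ¬p)

  pattern-sw : ∀ (i : Fin m) y → pattern-of (sw i y) ≡ sw i (pattern-of y)
  pattern-sw = sw-map (λ a → toℕ a ℕ.<ᵇ l)

  -- On a word of pattern `p` the two letters ascend, and there the diagonal coefficient `β lt` is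
  -- 0; nothing stays behind on the old pattern.
  supported-up : ∀ {i : Fin m} {p f} → At inside outside i p → Supported p f → Supported (sw i p) (τ i f)
  supported-up {i} {p} {f} at h y ¬e = ≈trans (⊕-cong (≈trans (⊗-congˡ swapped) (⊗-zeroʳ _))
      (stay (Vecₚ.≡-dec Boolₚ._≟_ (pattern-of y) p)))
    (⊕-identityˡ 0ᴿ)
    where
    swapped : f (sw i y) ≈ᴿ 0ᴿ
    swapped = h (sw i y) (λ e → ¬e (trans (sym (sw-sw i (pattern-of y)))
        (cong (sw i) (trans (sym (pattern-sw i y)) e))))
    ascending : pattern-of y ≡ p → ord i y ≡ lt
    ascending refl with at? i y
    ... | a , b , at′ with at-unique (at-map (λ a → toℕ a ℕ.<ᵇ l) at′) at
    ... | a<l , b≮l = trans (ord-at at′) (cmp-< (ℕₚ.<-≤-trans (ℕₚ.<ᵇ⇒< (toℕ a) l (subst Data.Bool.Base.T (sym a<l) _))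
                        (ℕₚ.≮⇒≥ (λ b<l → subst Data.Bool.Base.T b≮l (ℕₚ.<⇒<ᵇ b<l)))))
    stay : Dec (pattern-of y ≡ p) → β (ord i y) ⊗ f y ≈ᴿ 0ᴿ
    stay (yes e) = ≈trans (⊗-cong (≈reflexive (cong β (ascending e))) ≈refl) (⊗-zeroˡ (f y))
    stay (no ¬p) = ≈trans (⊗-congˡ (h y ¬p)) (⊗-zeroʳ _)

  supported-fixed : ∀ {i : Fin m} {p f} → sw i p ≡ p → Supported p f → Supported p (τ i f)
  supported-fixed {i} {p} {f} e h y ¬p = ≈trans (⊕-cong
    (≈trans (⊗-congˡ (h (sw i y) (λ e′ → ¬p (trans (sym (sw-sw i (pattern-of y)))
      (trans (cong (sw i) (trans (sym (pattern-sw i y)) e′)) e))))) (⊗-zeroʳ _))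
    (≈trans (⊗-congˡ (h y ¬p)) (⊗-zeroʳ _))) (⊕-identityˡ 0ᴿ)

  supported-e₀ : Supported (top (suc m) l) e₀
  supported-e₀ y ¬e = δ-diff (λ e → ¬e (trans (cong pattern-of (sym e))
    (trans (sym (Vecₚ.tabulate-∘ (λ a → toℕ a ℕ.<ᵇ l) (λ i → i))) (top-tabulate (suc m) l))))

  supported-acts : ∀ {is : List (Fin m)} → All (Stabilises (ϖ l)) is → Supported (top (suc m) l) (acts is e₀)
  supported-acts []                 = supported-e₀
  supported-acts (_∷_ {i} st sts) = supported-fixed (sw-fixed (proj₂ (top-at i l (stabilises-ϖ l i st))))
      (supported-acts sts)

  supported-span : ∀ {x : H m} → Span (Stab (ϖ l)) x → Supported (top (suc m) l) (⟪ x ⟫ e₀)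
  supported-span h y ¬p = ≈trans (expand-e₀ {Stab (ϖ l)} h e₀ y) (∑R.∑-zero (Stab (ϖ l)) (λ {w} w∈ →
    ≈trans (⊗-congˡ (≈trans (⟪Tw⟫ (lehmer w) e₀ y)
      (supported-acts (lehmer-stabilises {μ = ϖ l} (ϖ-dominant l) w (Stab-fixes (ϖ l) w∈)) y ¬p))) (⊗-zeroʳ _)))

  supported-u : ∀ {p} → Reach p → ∀ f → Supported (top (suc m) ∣ p ∣) f → Supported p (⟪ T[ uPerm p ] ⟫ f)
  supported-u (base .(suc m) l′) f h = supported-cong
    (≐sym (≐trans (sound (transᴴ (T[]-cong (uPerm (top (suc m) l′)) Perm.id (u-top (suc m) l′)) T-id) f) (⟪1⟫ f)))
    (subst (λ p → Supported p f) (top-∣top∣ (suc m) l′) h)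
  supported-u (step {i = i} {p} at r) f h = supported-cong (≐sym (sound (u-raise at) f))
    (supported-up at (supported-u r f (subst (λ k → Supported (top (suc m) k) f) (∣sw∣ i p) h)))

  component : (Column (suc m) l → H m) → Column (suc m) l → Fun (suc m)
  component h F = ⟪ T[ u F ] ⟫ (⟪ h F ⟫ e₀)

  supported-component : ∀ {h} → (∀ F → Span (Stab (ϖ l)) (h F)) → ∀ F → Supported (set F) (component h F)
  supported-component {h} h∈ F = supported-u (reach (set F)) (⟪ h F ⟫ e₀)
    (subst (λ k → Supported (top (suc m) k) (⟪ h F ⟫ e₀)) (sym (size-of F)) (supported-span (h∈ F)))

  component-at : ∀ {z} (d : Decomposition l z) C y → pattern-of y ≡ set C → ⟪ z ⟫ e₀ y ≈ᴿ component (proj₁ d) C y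
  component-at (h , h∈ , e) C y p = ≈trans (sound e e₀ y) (≈trans (⟪∑⟫ (columns (suc m) l) _ e₀ y)
    (∑R.∑-pick {_~_ = λ C D → set C ≡ set D} (columns-distinct (suc m) l) (columns-complete C)
      (λ {F} _ F≢C → supported-component h∈ F y (λ e → F≢C (trans (sym e) p)))
      (λ {F} _ C≢F → supported-component h∈ F y (λ e → C≢F (trans (sym p) e)))))

  -- Restriction to the words of pattern `set C` isolates one component; T_{u_C} acts injectively,
  -- and the T_w of the stabiliser are separated by `faithful`.
  decomposition-unique : ∀ {z z′} → z ≈ᴴ z′ → (d : Decomposition l z) (d′ : Decomposition l z′) → ∀ C
      → proj₁ d C ≈ᴴ proj₁ d′ C
  decomposition-unique e d@(h , h∈ , _) d′@(h′ , h′∈ , _) C = faithful (Stab-distinct (ϖ l)) (h∈ C) (h′∈ C)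
    (acts-injective (lehmer (u C)) (≐trans (≐sym (⟪Tw⟫ (lehmer (u C)) _)) (≐trans same (⟪Tw⟫ (lehmer (u C)) _))))
    where
    same : component h C ≐ component h′ C
    same y with Vecₚ.≡-dec Boolₚ._≟_ (pattern-of y) (set C)
    ... | yes p = ≈trans (≈sym (component-at d C y p))
                    (≈trans (sound e e₀ y) (component-at d′ C y p))
    ... | no ¬p = ≈trans (supported-component h∈ C y ¬p) (≈sym (supported-component h′∈ C y ¬p))

-- The symmetriser of S_a × S_(n-a) applied to the highest vector of B(ϖ_b)

words-cong : ∀ (μ ν : Weight (suc m)) → (∀ i → μ i ≡ ν i) → words μ ≡ words ν
words-cong {zero}  μ ν e = refl
words-cong {suc m} μ ν e = cong₂ (λ L ws → concatMap (λ j → map (λ is → down j ++ map suc is) ws) L)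
  (Listₚ.filter-≐ (λ j → μ j ℤₚ.≟ μ 0F) (λ j → ν j ℤₚ.≟ ν 0F)
    ((λ {j} p → trans (sym (e j)) (trans p (e 0F))) , (λ {j} p → trans (e j) (trans p (sym (e 0F))))) (allFin _))
  (words-cong (tail μ) (tail ν) (λ i → e (suc i)))

Wt-cong : ∀ (μ ν : Weight n) → (∀ i → μ i ≡ ν i) → Wt μ ≡ Wt ν
Wt-cong μ ν e = Wt-pattern μ ν (λ i j p → trans (sym (e i)) (trans p (e j)))
    (λ i j p → trans (e i) (trans p (sym (e j))))

ϖ-suc : ∀ k (i : Fin n) → tail (ϖ (suc k)) i ≡ ϖ k i
ϖ-suc k i with toℕ i ℕₚ.<? k
... | yes i<k = ϖ-< (suc k) (suc i) (s≤s i<k)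
... | no  i≮k = ϖ-≥ (suc k) (suc i) (s≤s (ℕₚ.≮⇒≥ i≮k))

ϖ-0 : ∀ (i j : Fin n) → ϖ 0 i ≡ ϖ 0 j
ϖ-0 i j = trans (ϖ-≥ 0 i z≤n) (sym (ϖ-≥ 0 j z≤n))

filter-suc : ∀ {P : Fin (suc n) → Set} (P? : ∀ j → Dec (P j)) (xs : List (Fin n)) →
             filter P? (map suc xs) ≡ map suc (filter (λ j → P? (suc j)) xs)
filter-suc P? []       = refl
filter-suc P? (x ∷ xs) with does (P? (suc x))
... | true  = cong (suc x ∷_) (filter-suc P? xs)
... | false = filter-suc P? xs

q-number : ℕ → ℤ[t]
q-number zero    = 0ₚ
q-number (suc b) = 1ₚ +ₚ t *ₚ q-number b

∑-below : ∀ n b → b ≤ n → ∑ₚ (filter (λ j → toℕ j ℕₚ.<? b) (allFin n)) (λ j → t ^ₚ toℕ j) ≋ q-number b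
∑-below n zero _ = P.reflexive (cong (λ L → ∑ₚ L (λ j → t ^ₚ toℕ j))
  (Listₚ.filter-none (λ j → toℕ j ℕₚ.<? 0) (All.universal (λ j ()) (allFin n))))
∑-below (suc n) (suc b) (s≤s b≤n) = +ₚ-cong (P.refl {1ₚ}) (begin
  ∑ₚ (filter below (List.tabulate suc)) f
    ≡⟨ cong (λ L → ∑ₚ (filter below L) f) (Listₚ.map-tabulate (λ j → j) suc) ⟨
  ∑ₚ (filter below (map suc (allFin n))) f
    ≡⟨ cong (λ L → ∑ₚ L f) (filter-suc below (allFin n)) ⟩
  ∑ₚ (map suc (filter (λ j → suc (toℕ j) ℕₚ.<? suc b) (allFin n))) f
    ≡⟨ ∑P.∑-map suc (filter (λ j → suc (toℕ j) ℕₚ.<? suc b) (allFin n)) f ⟩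
  ∑ₚ (filter (λ j → suc (toℕ j) ℕₚ.<? suc b) (allFin n)) (λ j → t *ₚ t ^ₚ toℕ j)
    ≡⟨ cong (λ L → ∑ₚ L (λ j → t *ₚ t ^ₚ toℕ j)) (Listₚ.filter-≐ (λ j → suc (toℕ j) ℕₚ.<? suc b)
      (λ j → toℕ j ℕₚ.<? b) (ℕ.s≤s⁻¹ , s≤s) (allFin n)) ⟩
  ∑ₚ (filter (λ j → toℕ j ℕₚ.<? b) (allFin n)) (λ j → t *ₚ t ^ₚ toℕ j)
    ≈⟨ ∑-*ₚˡ t (filter (λ j → toℕ j ℕₚ.<? b) (allFin n)) (λ j → t ^ₚ toℕ j) ⟨
  t *ₚ ∑ₚ (filter (λ j → toℕ j ℕₚ.<? b) (allFin n)) (λ j → t ^ₚ toℕ j)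
    ≈⟨ *ₚ-cong (P.refl {t}) (∑-below n b b≤n) ⟩
  t *ₚ q-number b ∎)
  where
  open SetoidReasoning P.setoid
  below : ∀ (j : Fin (suc n)) → Dec (toℕ j ℕ.< suc b)
  below j = toℕ j ℕₚ.<? suc b
  f : Fin (suc n) → ℤ[t]
  f j = t ^ₚ toℕ j

block-sum-ϖ : ∀ {n} b → suc b ≤ suc n → block-sum {n} (ϖ (suc b) ⊞ ϖ 0) ≋ q-number (suc b)
block-sum-ϖ {n} b b≤n = P.trans (P.reflexive (cong (λ L → ∑ₚ L (λ j → t ^ₚ toℕ j))
    (Listₚ.filter-≐ (λ j → ν j ℤₚ.≟ ν (Fin.zero {n})) (λ j → toℕ j ℕₚ.<? suc b)
      ((λ {j} → to j) , (λ {j} → from j)) (allFin (suc n)))))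
  (∑-below (suc n) (suc b) b≤n)
  where
  ν : Weight (suc n)
  ν = ϖ (suc b) ⊞ ϖ 0
  to : ∀ (j : Fin (suc n)) → ν j ≡ ν (Fin.zero {n}) → toℕ j ℕ.< suc b
  to j e = ℕₚ.≰⇒> λ b≤j → 0≢1 (trans (sym (ϖ-≥ (suc b) j b≤j)) (trans
    (ℤ+.∙-cancelʳ (ϖ 0 (Fin.zero {n})) (ϖ (suc b) j) (ϖ (suc b) (Fin.zero {n}))
      (trans (cong (λ z → ϖ (suc b) j ℤ.+ z) (ϖ-0 0F j)) e))
    (ϖ-< (suc b) (Fin.zero {n}) (s≤s z≤n))))
    where
    0≢1 : 0ℤ ≢ 1ℤ
    0≢1 ()
  from : ∀ (j : Fin (suc n)) → toℕ j ℕ.< suc b → ν j ≡ ν (Fin.zero {n})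
  from j j<b = cong₂ ℤ._+_ (trans (ϖ-< (suc b) j j<b) (sym (ϖ-< (suc b) (Fin.zero {n}) (s≤s z≤n)))) (ϖ-0 j 0F)

letter-rank : Bool → ℕ
letter-rank b = if b then 0 else 1

module Highest (R : CommutativeRing 0ℓ 0ℓ) (Σc : Scalars R) where
  open Action R Σc Bool Boolₚ._≟_ letter-rank public

  κ : ℤ[t] → C
  κ p = φ ⟦ p ⟧ₗ

  κ-cong : ∀ {p p′} → p ≋ p′ → κ p ≈ᴿ κ p′
  κ-cong {p} {p′} e = φ-cong {⟦ p ⟧ₗ} {⟦ p′ ⟧ₗ} (_≋_.at (*ₚ-cong e (P.refl {1ₚ})))

  κ-+ : ∀ p p′ → κ (p +ₚ p′) ≈ᴿ κ p ⊕ κ p′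
  κ-+ p p′ = ≈trans (φ-cong {⟦ p +ₚ p′ ⟧ₗ} {⟦ p ⟧ₗ +ₗ ⟦ p′ ⟧ₗ} (_≋_.at (*ₚ-cong
    (+ₚ-cong (P.sym (P.*-identityʳ p)) (P.sym (P.*-identityʳ p′))) (P.refl {1ₚ})))) (φ-+ ⟦ p ⟧ₗ ⟦ p′ ⟧ₗ)

  κ-* : ∀ p p′ → κ (p *ₚ p′) ≈ᴿ κ p ⊗ κ p′
  κ-* p p′ = φ-* ⟦ p ⟧ₗ ⟦ p′ ⟧ₗ

  κ-pow : ∀ k → κ (t ^ₚ k) ≈ᴿ pow q k
  κ-pow zero    = φ-1
  κ-pow (suc k) = ≈trans (κ-* t (t ^ₚ k)) (⊗-cong φ-t (κ-pow k))

  κ-∑ : ∀ (xs : List A) f → κ (∑ₚ xs f) ≈ᴿ ∑ xs (λ x → κ (f x))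
  κ-∑ xs f = ∑R.∑-hom _+ₚ_ 0ₚ κ φ-0 κ-+ xs f

  F-∑ : ∀ {F : Fun m → Fun n} → Linear F → ∀ (xs : List A) (f : A → Fun m) → F (λ p → ∑ xs (λ x → f x p)) ≐ λ p
      → ∑ xs (λ x → F (f x) p)
  F-∑ {F = F} LF [] f p = ≈trans (F-cong LF {g = 0ᴿ ∙ (λ _ → 0ᴿ)} (λ _ → ≈sym (⊗-zeroˡ 0ᴿ)) p)
    (≈trans (F-∙ LF 0ᴿ (λ _ → 0ᴿ) p) (⊗-zeroˡ _))
  F-∑ LF (x ∷ xs) f p = ≈trans (F-⊹ LF (f x) _ p) (⊕-congˡ (F-∑ LF xs f p))

  acts-inner : ∀ (is : List (Fin m)) f x w → acts (map suc is) f (x ∷ w) ≈ᴿ acts is (λ w → f (x ∷ w)) w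
  acts-inner []       f x w = ≈refl
  acts-inner (i ∷ is) f x w = ⊕-cong (⊗-congˡ (acts-inner is f x (sw i w))) (⊗-congˡ (acts-inner is f x w))

  acts-cong : ∀ (is : List (Fin m)) {f g} → f ≐ g → acts is f ≐ acts is g
  acts-cong is = F-cong (acts-linear is)

  symmetrise : Weight (suc m) → Fun (suc m) → Fun (suc m)
  symmetrise μ f p = ∑ (words μ) (λ is → acts is f p)

  symmetrise-cong : ∀ (μ : Weight (suc m)) {f g} → f ≐ g → symmetrise μ f ≐ symmetrise μ g
  symmetrise-cong μ e p = ∑R.∑-cong (words μ) (λ {is} _ → acts-cong is e p)

  symmetrise-suc : ∀ (μ : Weight (suc (suc m))) f → symmetrise μ f ≐
    λ p → ∑ (block μ) (λ j → acts (down j) (λ y → ∑ (words (tail μ)) (λ is → acts (map suc is) f y)) p)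
  symmetrise-suc μ f p = ≈trans
    (∑R.∑-concatMap-map (λ j is → down j ++ map suc is) (words (tail μ)) (block μ) (λ is → acts is f p))
    (∑R.∑-cong (block μ) (λ {j} _ → ≈trans
      (∑R.∑-cong (words (tail μ)) (λ {is} _ → acts-++ (down j) (map suc is) f p))
      (≈sym (F-∑ (acts-linear (down j)) (words (tail μ)) (λ is → acts (map suc is) f) p))))

  Φ₀ : ℕ → ℕ → Fun n
  Φ₀ a b p = if prefix a p then (if ∣ p ∣ ℕ.≡ᵇ b then 1ᴿ else 0ᴿ) else 0ᴿ

  Φ₀-sw : ∀ a b (i : Fin m) p → suc (toℕ i) ≢ a → Φ₀ a b (sw i p) ≡ Φ₀ a b p
  Φ₀-sw a b i p h = cong₂ (λ x y → if x then (if y ℕ.≡ᵇ b then 1ᴿ else 0ᴿ) else 0ᴿ) (prefix-sw a i p h) (∣sw∣ i p)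

  α+β : ∀ x → α x ⊕ β x ≈ᴿ q
  α+β lt = ⊕-identityʳ q
  α+β eq = ⊕-identityˡ q
  α+β gt = ≈sym q≈1+s

  Φ₀-eigen : ∀ a b (i : Fin m) → suc (toℕ i) ≢ a → τ i (Φ₀ a b) ≐ q ∙ Φ₀ a b
  Φ₀-eigen a b i h p = ≈trans (⊕-cong (⊗-congˡ (≈reflexive (Φ₀-sw a b i p h))) ≈refl)
    (≈trans (≈sym (⊗-distribʳ _ _ _)) (⊗-cong (α+β (ord i p)) ≈refl))

  δ-∷ : ∀ x (y w : Vec Bool n) → δ (x ∷ y) (x ∷ w) ≈ᴿ δ y w
  δ-∷ {n} x y w = cases (y ≟ᵛ w)
    where
    cases : Dec (y ≡ w) → δ (x ∷ y) (x ∷ w) ≈ᴿ δ y w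
    cases (yes refl) = ≈trans (δ-same (x ∷ y)) (≈sym (δ-same y))
    cases (no ¬e)    = ≈trans (δ-diff {y = x ∷ y} {x ∷ w} (λ e → ¬e (Vecₚ.∷-injectiveʳ e))) (≈sym (δ-diff ¬e))

  δ-∷-≢ : ∀ {x x′} (y w : Vec Bool n) → x ≢ x′ → δ (x ∷ y) (x′ ∷ w) ≈ᴿ 0ᴿ
  δ-∷-≢ {x = x} {x′} y w x≢x′ = δ-diff {y = x ∷ y} {x′ ∷ w} (λ e → x≢x′ (Vecₚ.∷-injectiveˡ e))

  -- Indicator of the subsets of size b + 1 that contain the first position.
  J : ℕ → Fun (suc n)
  J b (true  ∷ p) = Φ₀ 0 b p
  J b (false ∷ p) = 0ᴿ

  -- From D = 1 + σ(D) T₀: split by the first letter, T₀ J_b is q J_{b-1} behind `true` and J_b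
  -- behind `false`. By induction these contribute q times the t-number of b and the t-number of b +
  -- 1, and the summand 1 completes the former to the latter.
  D-J : ∀ m b → (λ p → ∑ (allFin (suc m)) (λ j → acts (down j) (J b) p)) ≐ κ (q-number (suc b)) ∙ Φ₀ {suc m} 0 (suc b)
  D-J zero zero    (true  ∷ []) = ≈trans (⊕-identityʳ 1ᴿ) (≈sym (≈trans
    (⊗-cong (≈trans (κ-cong (P.trans (+ₚ-cong (P.refl {1ₚ}) (*ₚ-zeroʳ t)) (+ₚ-identityʳ 1ₚ))) φ-1) ≈refl)
      (⊗-identityˡ 1ᴿ)))
  D-J zero (suc b) (true  ∷ []) = ≈trans (⊕-identityʳ 0ᴿ) (≈sym (⊗-zeroʳ _))
  D-J zero b       (false ∷ []) = ≈trans (⊕-identityʳ 0ᴿ) (≈sym (⊗-zeroʳ _))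
  D-J (suc m) b (x ∷ w) = ≈trans (⊕-congˡ (≈trans rest (inner x))) (outer x w b)
    where
    open ≈-Reasoning
    τJ : Bool → Fun (suc m)
    τJ x w = τ 0F (J b) (x ∷ w)
    rest : ∑ (List.tabulate suc) (λ j → acts (down j) (J b) (x ∷ w)) ≈ᴿ ∑ (allFin (suc m))
        (λ j → acts (down j) (τJ x) w)
    rest = begin
      ∑ (List.tabulate suc) (λ j → acts (down j) (J b) (x ∷ w))
        ≡⟨ cong (λ L → ∑ L (λ j → acts (down j) (J b) (x ∷ w))) (Listₚ.map-tabulate (λ j → j) suc) ⟨
      ∑ (map suc (allFin (suc m))) (λ j → acts (down j) (J b) (x ∷ w))
        ≡⟨ ∑R.∑-map Fin.suc (allFin (suc m)) (λ j → acts (down j) (J b) (x ∷ w)) ⟩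
      ∑ (allFin (suc m)) (λ j → acts (map suc (down j) ++ 0F ∷ []) (J b) (x ∷ w))
        ≈⟨ ∑R.∑-cong (allFin (suc m)) (λ {j} _ → ≈trans (acts-++ (map suc (down j)) (0F ∷ []) (J b) (x ∷ w))
             (acts-inner (down j) (τ 0F (J b)) x w)) ⟩
      ∑ (allFin (suc m)) (λ j → acts (down j) (τJ x) w) ∎
    J-pred : ℕ → Fun (suc m)
    J-pred zero    w = 0ᴿ
    J-pred (suc b) w = J b w
    τJ-value : ∀ x → τJ x ≐ (if x then q ∙ J-pred b else J b)
    τJ-value true (true ∷ w) = ≈trans (⊕-cong (⊗-zeroˡ _) ≈refl) (≈trans (⊕-identityˡ _) (⊗-congˡ (shift b)))
      where
      shift : ∀ b → Φ₀ 0 b (true ∷ w) ≈ᴿ J-pred b (true ∷ w)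
      shift zero    = ≈refl
      shift (suc b) = ≈refl
    τJ-value true (false ∷ w) = ≈trans (⊕-cong (⊗-zeroʳ q) (⊗-zeroˡ _))
        (≈trans (⊕-identityʳ 0ᴿ) (≈sym (≈trans (⊗-congˡ (shift b)) (⊗-zeroʳ q))))
      where
      shift : ∀ b → J-pred b (false ∷ w) ≈ᴿ 0ᴿ
      shift zero    = ≈refl
      shift (suc b) = ≈refl
    τJ-value false (true ∷ w) = ≈trans (⊕-cong (⊗-identityˡ _) (⊗-zeroʳ s′)) (⊕-identityʳ _)
    τJ-value false (false ∷ w) = ≈trans (⊕-cong (⊗-zeroˡ _) (⊗-zeroʳ q)) (⊕-identityʳ 0ᴿ)
    value : Bool → ℕ → Fun (suc m)
    value false b       = κ (q-number (suc b)) ∙ Φ₀ 0 (suc b)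
    value true  zero    = λ _ → 0ᴿ
    value true  (suc b) = q ∙ κ (q-number (suc b)) ∙ Φ₀ 0 (suc b)
    inner : ∀ x → ∑ (allFin (suc m)) (λ j → acts (down j) (τJ x) w) ≈ᴿ value x b w
    inner false = ≈trans (∑R.∑-cong (allFin (suc m)) (λ {j} _ → acts-cong (down j) (τJ-value false) w)) (D-J m b w)
    inner true  = ≈trans (∑R.∑-cong (allFin (suc m)) (λ {j} _ → ≈trans (acts-cong (down j) (τJ-value true) w)
        (F-∙ (acts-linear (down j)) q (J-pred b) w)))
      (≈trans (≈trans (∑R.∑-cong (allFin (suc m)) (λ _ → ⊗-comm q _))
        (≈trans (≈sym (∑-⊗ (allFin (suc m)) _ q)) (⊗-comm _ q))) (last b))
      where
      last : ∀ b → q ⊗ ∑ (allFin (suc m)) (λ j → acts (down j) (J-pred b) w) ≈ᴿ value true b w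
      last zero    = ≈trans (⊗-congˡ (∑R.∑-zero (allFin (suc m)) (λ {j} _ →
        ≈trans (acts-cong (down j) {g = 0ᴿ ∙ J-pred zero} (λ _ → ≈sym (⊗-zeroˡ _)) w)
          (≈trans (F-∙ (acts-linear (down j)) 0ᴿ (J-pred zero) w) (⊗-zeroˡ _))))) (⊗-zeroʳ q)
      last (suc b) = ⊗-congˡ (D-J m b w)
    outer : ∀ x w b → J b (x ∷ w) ⊕ value x b w ≈ᴿ κ (q-number (suc b)) ⊗ Φ₀ 0 (suc b) (x ∷ w)
    outer false w b       = ⊕-identityˡ _
    outer true  w zero    = ≈trans (⊕-identityʳ _) (≈sym (≈trans
      (⊗-cong (≈trans (κ-cong (P.trans (+ₚ-cong (P.refl {1ₚ}) (*ₚ-zeroʳ t)) (+ₚ-identityʳ 1ₚ))) φ-1) ≈refl)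
        (⊗-identityˡ _)))
    outer true  w (suc b) = ≈sym (≈trans
      (⊗-cong (≈trans (κ-+ 1ₚ (t *ₚ q-number (suc b))) (⊕-cong φ-1
        (≈trans (κ-* t (q-number (suc b))) (⊗-cong φ-t ≈refl)))) ≈refl)
      (solve 3 (λ q c x → (con 1 :+ q :* c) :* x := x :+ q :* (c :* x)) ≈refl q (κ (q-number (suc b)))
        (Φ₀ 0 (suc b) w)))

  block-eigen : ∀ {μ : Weight (suc m)} → Dominant μ → ∀ {f} → (∀ i → Stabilises μ i → τ i f ≐ q ∙ f) →
                (λ p → ∑ (block μ) (λ j → acts (down j) f p)) ≐ κ (block-sum μ) ∙ f
  block-eigen {μ = μ} d {f} e p = begin
    ∑ (block μ) (λ j → acts (down j) f p)
      ≈⟨ ∑R.∑-cong (block μ) (λ {j} j∈ → ≈trans (acts-eigen (All.map (λ {i} → e i)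
           (down-stabilises {μ = μ} d j (proj₂ (∈ₚ.∈-filter⁻ (λ j → μ j ℤₚ.≟ μ 0F) {xs = allFin _} j∈)))) p)
           (⊗-cong (≈trans (≈reflexive (cong (pow q) (length-down j))) (≈sym (κ-pow (toℕ j)))) ≈refl)) ⟩
    ∑ (block μ) (λ j → κ (t ^ₚ toℕ j) ⊗ f p)   ≈⟨ ∑-⊗ (block μ) (λ j → κ (t ^ₚ toℕ j)) (f p) ⟨
    ∑ (block μ) (λ j → κ (t ^ₚ toℕ j)) ⊗ f p   ≈⟨ ⊗-cong (κ-∑ (block μ) (λ j → t ^ₚ toℕ j)) ≈refl ⟨
    κ (block-sum μ) ⊗ f p                     ∎
    where open ≈-Reasoning

  ∑-block-∙ : ∀ (L : List (Fin (suc m))) a f p → ∑ L (λ j → acts (down j) (a ∙ f) p) ≈ᴿ a ⊗ ∑ L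
      (λ j → acts (down j) f p)
  ∑-block-∙ L a f p = ≈trans (∑R.∑-cong L (λ {j} _ → ≈trans (F-∙ (acts-linear (down j)) a f p) (⊗-comm a _)))
    (≈trans (≈sym (∑-⊗ L _ a)) (⊗-comm _ a))

  assemble : ∀ (L : List (Fin (suc m))) {g h x : Fun (suc m)} {c d e} → g ≐ c ∙ h →
      (λ p → ∑ L (λ j → acts (down j) h p)) ≐ d ∙ x →
             d ⊗ c ≈ᴿ e → (λ p → ∑ L (λ j → acts (down j) g p)) ≐ e ∙ x
  assemble L {g} {h} {x} {c} {d} g≐ sum≐ dc p = ≈trans (∑R.∑-cong L (λ {j} _ → acts-cong (down j) g≐ p))
    (≈trans (∑-block-∙ L c h p) (≈trans (⊗-congˡ (sum≐ p))
      (≈trans (≈sym (⊗-assoc c d (x p))) (⊗-cong (≈trans (⊗-comm c d) dc) ≈refl))))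

  inner-sum : ∀ (μ ν : Weight (suc m)) → (∀ i → μ i ≡ ν i) → ∀ f x w →
              ∑ (words μ) (λ is → acts (map suc is) f (x ∷ w)) ≈ᴿ symmetrise ν (λ w → f (x ∷ w)) w
  inner-sum μ ν e f x w = ≈trans (∑R.∑-cong (words μ) (λ {is} _ → acts-inner is f x w))
    (≈reflexive (cong (λ L → ∑ L (λ is → acts is (λ w → f (x ∷ w)) w)) (words-cong μ ν e)))

  symmetrise-zero : ∀ (μ : Weight (suc m)) {f} → (∀ w → f w ≈ᴿ 0ᴿ) → ∀ w → symmetrise μ f w ≈ᴿ 0ᴿ
  symmetrise-zero μ {f} e w = ∑R.∑-zero (words μ) (λ {is} _ →
    ≈trans (acts-cong is {g = 0ᴿ ∙ f} (λ w → ≈trans (e w) (≈sym (⊗-zeroˡ _))) w)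
      (≈trans (F-∙ (acts-linear is) 0ᴿ f w) (⊗-zeroˡ _)))

  -- The induction hypothesis symmetrises the tail; the block of the first position then contributes
  -- its sum. For a > 0 its letters multiply Φ₀ by t. For a = 0 < b the block is everything and
  -- `D-J` supplies the t-number of b. For b = 0 only the empty column occurs.
  highest : ∀ m a b → a ≤ b → b ≤ suc m →
            symmetrise {m} (ϖ a) (δ (top (suc m) b)) ≐ κ (Wt {suc m} (pair-weight b a)) ∙ Φ₀ a b
  highest zero a b a≤b b≤1 p = ≈trans (⊕-identityʳ _) (≈trans (one-letter a b a≤b b≤1 p)
    (≈sym (≈trans (⊗-cong (≈trans (κ-cong (P.sym (words-Wt {zero} (pair-weight b a))))
      (≈trans (κ-cong (+ₚ-identityʳ 1ₚ)) φ-1)) ≈refl) (⊗-identityˡ _))))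
    where
    one-letter : ∀ a b → a ≤ b → b ≤ 1 → ∀ p → δ (top 1 b) p ≈ᴿ Φ₀ a b p
    one-letter zero    zero       _ _ (true  ∷ []) = ≈refl
    one-letter zero    zero       _ _ (false ∷ []) = ≈refl
    one-letter zero    (suc zero) _ _ (true  ∷ []) = ≈refl
    one-letter zero    (suc zero) _ _ (false ∷ []) = ≈refl
    one-letter (suc zero) (suc zero) _ _ (true  ∷ []) = ≈refl
    one-letter (suc zero) (suc zero) _ _ (false ∷ []) = ≈refl
    one-letter a             (suc (suc b)) _ (s≤s ())
    one-letter (suc (suc a)) (suc zero)    (s≤s ())
  highest (suc m) (suc a) (suc b) (s≤s a≤b) (s≤s b≤n) = ≐trans (symmetrise-suc (ϖ (suc a)) f)
      (assemble (block (ϖ (suc a))) g-value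
      (block-eigen {μ = ϖ (suc a)} (ϖ-dominant (suc a))
        (λ i st → Φ₀-eigen (suc a) (suc b) i (stabilises-ϖ (suc a) i st))) total)
    where
    f = δ (top (suc (suc m)) (suc b))
    g : Fun (suc (suc m))
    g y = ∑ (words (tail (ϖ {suc (suc m)} (suc a)))) (λ is → acts (map suc is) f y)
    c = κ (Wt {suc m} (pair-weight b a))
    g-value : g ≐ c ∙ Φ₀ (suc a) (suc b)
    g-value (true  ∷ w) = ≈trans (inner-sum (tail (ϖ (suc a))) (ϖ a) (ϖ-suc a) f true w)
      (≈trans (symmetrise-cong (ϖ a) (δ-∷ true (top (suc m) b)) w) (highest m a b a≤b b≤n w))
    g-value (false ∷ w) = ≈trans (inner-sum (tail (ϖ (suc a))) (ϖ a) (ϖ-suc a) f false w)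
      (≈trans (symmetrise-zero (ϖ a) (λ w → δ-∷-≢ {x = true} {false} (top (suc m) b) w (λ ())) w) (≈sym (⊗-zeroʳ c)))
    total : κ (block-sum {suc m} (ϖ (suc a))) ⊗ c ≈ᴿ κ (Wt {suc (suc m)} (pair-weight (suc b) (suc a)))
    total = ≈trans (≈sym (κ-* (block-sum {suc m} (ϖ (suc a))) (Wt {suc m} (pair-weight b a))))
        (≈reflexive (cong κ (cong₂ _*ₚ_
      (block-⊞ {suc m} a {ϖ (suc a)} {ϖ (suc b)} (ϖ-splits (suc a)) (ϖ-dominant (suc b))
        (λ j j<a → trans (ϖ-< (suc b) (Fin.zero {suc m}) (s≤s z≤n))
          (sym (ϖ-< (suc b) j (ℕₚ.<-≤-trans j<a (s≤s a≤b))))))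
      (Wt-cong {suc m} (pair-weight b a) (tail (pair-weight (suc b) (suc a)))
        (λ i → sym (cong₂ ℤ._+_ (ϖ-suc b i) (ϖ-suc a i)))))))
  highest (suc m) zero zero _ _ = ≐trans (symmetrise-suc (ϖ 0) f) (assemble (block (ϖ 0)) g-value
      (block-eigen {μ = ϖ 0} (ϖ-dominant 0) (λ i _ → Φ₀-eigen 0 0 i (λ ()))) total)
    where
    f = δ (top (suc (suc m)) 0)
    g : Fun (suc (suc m))
    g y = ∑ (words (tail (ϖ {suc (suc m)} 0))) (λ is → acts (map suc is) f y)
    c = κ (Wt {suc m} (pair-weight 0 0))
    tail-0 : ∀ (i : Fin (suc m)) → tail (ϖ 0) i ≡ ϖ 0 i
    tail-0 i = trans (ϖ-≥ 0 (suc i) z≤n) (sym (ϖ-≥ 0 i z≤n))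
    g-value : g ≐ c ∙ Φ₀ 0 0
    g-value (false ∷ w) = ≈trans (inner-sum (tail (ϖ 0)) (ϖ 0) tail-0 f false w)
      (≈trans (symmetrise-cong (ϖ 0) (δ-∷ false (top (suc m) 0)) w) (highest m 0 0 z≤n z≤n w))
    g-value (true  ∷ w) = ≈trans (inner-sum (tail (ϖ 0)) (ϖ 0) tail-0 f true w)
      (≈trans (symmetrise-zero (ϖ 0) (λ w → δ-∷-≢ {x = false} {true} (top (suc m) 0) w (λ ())) w) (≈sym (⊗-zeroʳ c)))
    total : κ (block-sum {suc m} (ϖ 0)) ⊗ c ≈ᴿ κ (Wt {suc (suc m)} (pair-weight 0 0))
    total = ≈trans (≈sym (κ-* (block-sum {suc m} (ϖ 0)) (Wt {suc m} (pair-weight 0 0))))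
        (≈reflexive (cong κ (cong₂ _*ₚ_
      (block-cong {suc m} (ϖ 0) (pair-weight 0 0) (λ j _ → cong₂ ℤ._+_ (ϖ-0 j 0F) (ϖ-0 j 0F)) (λ j _ → ϖ-0 j 0F))
      (Wt-cong {suc m} (pair-weight 0 0) (tail (pair-weight 0 0)) (λ i → sym (cong₂ ℤ._+_ (tail-0 i) (tail-0 i)))))))
  highest (suc m) zero (suc b) _ (s≤s b≤n) = ≐trans (symmetrise-suc (ϖ 0) f) (≐trans
      (λ p → ≈reflexive (cong (λ L → ∑ L (λ j → acts (down j) g p)) (block-all (ϖ {suc (suc m)} 0) (λ j → ϖ-0 j 0F))))
      (assemble (allFin (suc (suc m))) g-value (D-J (suc m) b) total))
    where
    f = δ (top (suc (suc m)) (suc b))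
    g : Fun (suc (suc m))
    g y = ∑ (words (tail (ϖ {suc (suc m)} 0))) (λ is → acts (map suc is) f y)
    c = κ (Wt {suc m} (pair-weight b 0))
    tail-0 : ∀ (i : Fin (suc m)) → tail (ϖ 0) i ≡ ϖ 0 i
    tail-0 i = trans (ϖ-≥ 0 (suc i) z≤n) (sym (ϖ-≥ 0 i z≤n))
    g-value : g ≐ c ∙ J b
    g-value (true  ∷ w) = ≈trans (inner-sum (tail (ϖ 0)) (ϖ 0) tail-0 f true w)
      (≈trans (symmetrise-cong (ϖ 0) (δ-∷ true (top (suc m) b)) w) (highest m 0 b z≤n b≤n w))
    g-value (false ∷ w) = ≈trans (inner-sum (tail (ϖ 0)) (ϖ 0) tail-0 f false w)
      (≈trans (symmetrise-zero (ϖ 0) (λ w → δ-∷-≢ {x = true} {false} (top (suc m) b) w (λ ())) w) (≈sym (⊗-zeroʳ c)))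
    total : κ (q-number (suc b)) ⊗ c ≈ᴿ κ (Wt {suc (suc m)} (pair-weight (suc b) 0))
    total = ≈trans (≈sym (κ-* (q-number (suc b)) (Wt {suc m} (pair-weight b 0)))) (κ-cong (*ₚ-cong
      (P.sym (block-sum-ϖ {suc m} b (s≤s b≤n)))
      (P.reflexive (Wt-cong {suc m} (pair-weight b 0) (tail (pair-weight (suc b) 0))
        (λ i → sym (cong₂ ℤ._+_ (ϖ-suc b i) (tail-0 i)))))))

-- Two-column values as coefficients of Φ

column-≡ : ∀ {C D : Column n k} → set C ≡ set D → C ≡ D
column-≡ refl = refl

ℓ-id : ∀ {m} → ℓ (Perm.id {suc m}) ≡ 0
ℓ-id {m} = trans (length-lehmer (Perm.id {suc m})) (inv-id {m})

ℓ-raise : ∀ (i : Fin m) w → Ascentˡ i w → ℓ (w ∘ₚ s i) ≡ suc (ℓ w)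
ℓ-raise i w a = sym (∼-length (ascˡ i w a))

module PairValues (R : CommutativeRing 0ℓ 0ℓ) (Σc : Scalars R) where
  open Highest R Σc public

  ⟪T⟫ : ∀ (w : Permutation′ (suc m)) f → ⟪ T[ w ] ⟫ f ≐ acts (lehmer w) f
  ⟪T⟫ w f = ⟪Tw⟫ (lehmer w) f

  ⟪T⟫-injective : ∀ (w : Permutation′ (suc m)) {f g} → ⟪ T[ w ] ⟫ f ≐ ⟪ T[ w ] ⟫ g → f ≐ g
  ⟪T⟫-injective w e = acts-injective (lehmer w) (≐trans (≐sym (⟪T⟫ w _)) (≐trans e (⟪T⟫ w _)))

  ⟪T⟫-linear : ∀ (w : Permutation′ (suc m)) → Linear ⟪ T[ w ] ⟫
  ⟪T⟫-linear w = ⟪⟫-linear T[ w ]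

  -- The value of t^ℓ(u_E) (T_{u_E⁻¹})⁻¹ at Φ₀; its coefficient at a column F
  -- of length b is ψ̃ of F ⊗ E.
  Φ : Column (suc m) k → ℕ → Fun (suc m)
  Φ {k = k} E b = acts′ (reverse (lehmer (flip (u E)))) (Φ₀ k b)

  Φ-spec : ∀ (E : Column (suc m) k) b → ⟪ T[ flip (u E) ] ⟫ (Φ E b) ≐ pow q (ℓ (u E)) ∙ Φ₀ k b
  Φ-spec {k = k} E b = ≐trans (⟪T⟫ (flip (u E)) (Φ E b)) (λ p → ≈trans
    (≈reflexive (cong (λ is → acts is (Φ E b) p) (sym (Listₚ.reverse-involutive L))))
    (≈trans (acts-acts′ (reverse L) (Φ₀ k b) p)
      (≈reflexive (cong (λ d → pow q d ⊗ Φ₀ k b p) (trans (Listₚ.length-reverse L) (ℓ-flip (u E)))))))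
    where L = lehmer (flip (u E))

  Φ-unique : ∀ (E : Column (suc m) k) b {f} → ⟪ T[ flip (u E) ] ⟫ f ≐ pow q (ℓ (u E)) ∙ Φ₀ k b → Φ E b ≐ f
  Φ-unique E b e = ⟪T⟫-injective (flip (u E)) (≐trans (Φ-spec E b) (≐sym e))

  Φ-inverse : ∀ (E : Column (suc m) k) b {y} → IsInverse T[ flip (u E) ] y → pow q (ℓ (u E)) ∙ ⟪ y ⟫ (Φ₀ k b) ≐ Φ E b
  Φ-inverse {k = k} E b {y} (_ , yT) = ≐trans (≐sym (F-∙ (⟪⟫-linear y) (pow q (ℓ (u E))) (Φ₀ k b)))
    (≐trans (F-cong (⟪⟫-linear y) (≐sym (Φ-spec E b))) (≐trans (sound yT (Φ E b)) (⟪1⟫ (Φ E b))))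

  -- Here u_E = s_j u_{E′} with lengths adding, hence T_{u_E⁻¹} = T_{u_{E′}⁻¹} T_j and the
  -- definition of Φ acquires the factor t T_j⁻¹.
  Φ-raise : ∀ (j : Fin m) (E E′ : Column (suc m) k) b → At inside outside j (set E′) → set E ≡ sw j (set E′)
      → Φ E b ≐ τ′ j (Φ E′ b)
  Φ-raise {k = k} j E E′ b at e = Φ-unique E b (≐trans (sound factor (τ′ j (Φ E′ b)))
    (≐trans (F-cong (⟪T⟫-linear (flip (u E′))) (ττ′ j (Φ E′ b)))
      (≐trans (F-∙ (⟪T⟫-linear (flip (u E′))) q (Φ E′ b)) (≐trans (∙-cong ≈refl (Φ-spec E′ b))
        (≐trans (∙-assoc q _ (Φ₀ k b)) (λ p → ≈reflexive (cong (λ d → pow q d ⊗ Φ₀ k b p) (sym length-u))))))))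
    where
    u≈ : u E ≈ u E′ ∘ₚ s j
    u≈ x = trans (cong (λ p → uPerm p ⟨$⟩ʳ x) e) (u-sw at x)
    factor : T[ flip (u E) ] ≈ᴴ T[ flip (u E′) ] *ᴴ T j
    factor = transᴴ (T[]-cong (flip (u E)) (s j ∘ₚ flip (u E′))
      (λ x → trans (flip-cong (u E) (u E′ ∘ₚ s j) u≈ x) (cong (u E′ ⟨$⟩ˡ_) (s-flip j x))))
      (symᴴ (T-ascʳ j (flip (u E′)) (pos-ascent at)))
    length-u : ℓ (u E) ≡ suc (ℓ (u E′))
    length-u = trans (ℓ-cong (u E) (u E′ ∘ₚ s j) u≈) (ℓ-raise j (u E′) (pos-ascent at))

  -- T_{u⁻¹} T_j = T_{i′} T_{u⁻¹}, where s_{i′} stabilises ϖ_k and Φ₀ has T_{i′}-eigenvalue t. So Φ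
  -- has T_j-eigenvalue t and t T_j⁻¹ fixes it.
  Φ-equal : ∀ {a} (j : Fin m) (E : Column (suc m) k) b → At a a j (set E) → Φ E b ≐ τ′ j (Φ E b)
  Φ-equal {k = k} j E b at = Φ-unique E b (τ-injective i′ (≐trans
    (≐trans (sound (symᴴ slide-T) (τ′ j (Φ E b))) (≐trans (F-cong (⟪T⟫-linear w) (ττ′ j (Φ E b)))
      (≐trans (F-∙ (⟪T⟫-linear w) q (Φ E b)) (∙-cong ≈refl (Φ-spec E b)))))
    (≐sym (≐trans (F-∙ (τ-linear i′) (pow q (ℓ (u E))) (Φ₀ k b)) (≐trans
      (∙-cong ≈refl (Φ₀-eigen k b i′ (λ e → interior (trans e (sym (size-of E))))))
      (λ p → solve 3 (λ x y z → x :* (y :* z) := y :* (x :* z)) ≈refl (pow q (ℓ (u E))) q (Φ₀ k b p)))))))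
    where
    open Conjugate (conjugate at)
    w = flip (u E)
    slide-T : T[ w ] *ᴴ T j ≈ᴴ T i′ *ᴴ T[ w ]
    slide-T = transᴴ (T-ascʳ j w ascentˡ) (transᴴ (T[]-cong (s j ∘ₚ w) (w ∘ₚ s i′) (λ x →
      trans (cong (u E ⟨$⟩ˡ_) (sym (s-flip j x))) (trans (flip-cong (u E ∘ₚ s j) (s i′ ∘ₚ u E) conj x)
        (s-flip i′ (u E ⟨$⟩ˡ x)))))
      (symᴴ (T-ascˡ i′ w ascentʳ)))

  private
    relabel : ∀ (j : Fin m) (E E′ : Column (suc m) k) b → set E′ ≡ set E → Φ E b ≐ τ′ j (Φ E b) → Φ E b ≐ τ′ j
        (Φ E′ b)
    relabel j E E′ b e h with column-≡ {C = E′} {E} e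
    ... | refl = h

  -- When both or neither of j, j + 1 lie in E, the swapped column is E itself, so raising and
  -- invariance obey one formula.
  Φ-step : ∀ (j : Fin m) (E E′ : Column (suc m) k) b → ¬ At inside outside j (set E) → set E′ ≡ sw j (set E)
      → Φ E b ≐ τ′ j (Φ E′ b)
  Φ-step j E E′ b ¬drop e with at? j (set E)
  ... | true , false , at  = contradiction at ¬drop
  ... | false , true , at  = Φ-raise j E E′ b (subst (At inside outside j) (sym e) (sw-at at))
      (sym (trans (cong (sw j) e) (sw-sw j (set E))))
  ... | true , true , at   = relabel j E E′ b (trans e (sw-fixed at)) (Φ-equal j E b at)
  ... | false , false , at = relabel j E E′ b (trans e (sw-fixed at)) (Φ-equal j E b at)

  Φ-top : ∀ (E : Column (suc m) k) b → set E ≡ top (suc m) k → Φ E b ≐ Φ₀ k b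
  Φ-top {m} {k} E b e = Φ-unique E b (≐trans (sound (transᴴ (T[]-cong (flip (u E)) Perm.id flip≈) T-id) (Φ₀ k b))
    (≐trans (⟪1⟫ (Φ₀ k b)) (λ p → ≈sym (≈trans
      (≈reflexive (cong (λ d → pow q d ⊗ Φ₀ k b p) (trans (ℓ-cong (u E) Perm.id u≈) (ℓ-id {m})))) (⊗-identityˡ _)))))
    where
    u≈ : u E ≈ Perm.id
    u≈ x = trans (cong (λ p → uPerm p ⟨$⟩ʳ x) e) (u-top (suc m) k x)
    flip≈ : flip (u E) ≈ Perm.id
    flip≈ = flip-cong (u E) Perm.id u≈

  -- The operator τ′ only involves the values at F and at s_i F. If either dominated the lower
  -- column, F would dominate the raised one. At the initial column, Φ₀ lives on columns that
  -- dominate it.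
  Φ-vanishes : ∀ {p} → Reach p → ∀ (E : Column (suc m) k) b → set E ≡ p → ∀ F → ¬ Dominates F p → Φ E b F ≈ᴿ 0ᴿ
  Φ-vanishes {m} {k} (base .(suc m) l) E b e F ¬d = ≈trans (Φ-top E b e′ F) (vanish (prefix k F) refl)
    where
    e′ : set E ≡ top (suc m) k
    e′ = trans e (trans (sym (top-∣top∣ (suc m) l)) (cong (top (suc m)) (trans (cong ∣_∣ (sym e)) (size-of E))))
    vanish : ∀ x → prefix k F ≡ x → (if x then (if ∣ F ∣ ℕ.≡ᵇ b then 1ᴿ else 0ᴿ) else 0ᴿ) ≈ᴿ 0ᴿ
    vanish false _ = ≈refl
    vanish true  h = contradiction (subst (Dominates F) (trans (sym e′) e) (prefix-dominates k F h)) ¬d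
  Φ-vanishes {m} {k} (step {i = i} {p} at r) E b e F ¬d = ≈trans
      (Φ-raise i E E′ b (subst (At inside outside i) (sym e′) at) (trans e (cong (sw i) (sym e′))) F)
    (≈trans (⊕-cong (⊗-congˡ (Φ-vanishes r E′ b e′ (sw i F) (λ d → ¬d (dominates-swap at d))))
      (⊗-congˡ (Φ-vanishes r E′ b e′ F (λ d → ¬d (dominates-raise {p = F} at d)))))
      (solve 2 (λ a b → a :* con 0 :+ b :* con 0 := con 0) ≈refl (α (ord i F)) (β′ (ord i F))))
    where
    E′ : Column (suc m) k
    E′ = swᶜ i E
    e′ : set E′ ≡ p
    e′ = trans (cong (sw i) e) (sw-sw i p)

  module _ {a b : ℕ} .(a≤b : a ≤ b) (F : Column (suc m) b) (E : Column (suc m) a) where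

    Φ-not-semistandard : ¬ Semistandard a≤b F E → Φ E b (set F) ≈ᴿ 0ᴿ
    Φ-not-semistandard ¬ss = Φ-vanishes (reach (set E)) E b refl (set F)
        (λ d → ¬ss (dominates-semistandard a≤b F E d))

    Φ-highest : (∀ i → toℕ (entry E i) ≡ toℕ i) → Semistandard a≤b F E → Φ E b (set F) ≈ᴿ 1ᴿ
    Φ-highest h ss = ≈trans (Φ-top E b (prefix-top a (set E) (low-entries-prefix E ℕₚ.≤-refl (λ i →
        ℕₚ.≤-reflexive (trans (h (inject≤ i ℕₚ.≤-refl)) (Finₚ.toℕ-inject≤ i ℕₚ.≤-refl)))) (size-of E)) (set F))
      (≈reflexive (trans (cong (λ x → if x then (if ∣ set F ∣ ℕ.≡ᵇ b then 1ᴿ else 0ᴿ) else 0ᴿ)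
          (low-entries-prefix F a≤b (λ i → ℕₚ.≤-trans (ss i) (ℕₚ.≤-reflexive (h i)))))
        (trans (cong (λ d → if d ℕ.≡ᵇ b then 1ᴿ else 0ᴿ) (size-of F))
          (cong (λ x → if x then 1ᴿ else 0ᴿ) (≡ᵇ-refl b)))))
      where
      ≡ᵇ-refl : ∀ b → (b ℕ.≡ᵇ b) ≡ true
      ≡ᵇ-refl zero    = refl
      ≡ᵇ-refl (suc b) = ≡ᵇ-refl b

    module _ (j : Fin m) (E↓ : s j · E ⊑ E) where

      private
        E′ = s j · E
        F′ = s j · F
        f  = Φ E′ b

        step-value : ∀ {x y} → At x y j (set F) → Φ E b (set F) ≈ᴿ
                     α (cmp (letter-rank x) (letter-rank y)) ⊗ f (set F′)
                     ⊕ β′ (cmp (letter-rank x) (letter-rank y)) ⊗ f (set F)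
        step-value at = ≈trans (Φ-step j E E′ b (no-drop j E E↓) (set-· j E) (set F))
          (op-at α β′ j f (ord-at at) (sym (set-· j F)))

        fixed : ∀ {x} → At x x j (set F) → f (set F′) ≈ᴿ f (set F)
        fixed at = ≈reflexive (cong f (trans (set-· j F) (sw-fixed at)))

        equal-value : ∀ {x} → At x x j (set F) → Φ E b (set F) ≈ᴿ f (set F)
        equal-value {x} at = ≈trans (step-value at) (≈trans
          (≈reflexive (cong (λ o → α o ⊗ f (set F′) ⊕ β′ o ⊗ f (set F)) (cmp-refl (letter-rank x))))
          (≈trans (⊕-cong (⊗-zeroˡ _) (⊗-identityˡ _)) (⊕-identityˡ _)))

      -- If j ∈ F and j + 1 ∉ F this is the ascending row of τ′. If s_j fixes F, τ′ acts by 1, and 1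
      -- = q + r brings the value into the same form.
      Φ-up : F ⊑ F′ → Φ E b (set F) ≈ᴿ q ⊗ f (set F′) ⊕ r ⊗ f (set F)
      Φ-up F↑ = let x , y , at = at? j (set F) in cases x y at
        where
        cases : ∀ x y → At x y j (set F) → Φ E b (set F) ≈ᴿ q ⊗ f (set F′) ⊕ r ⊗ f (set F)
        cases true  false at = step-value at
        cases false true  at = contradiction at (no-rise j F F↑)
        cases true  true  at = ≈trans (equal-value at) (≈trans (absorb-r (f (set F)))
            (⊕-cong (⊗-congˡ (≈sym (fixed at))) ≈refl))
        cases false false at = ≈trans (equal-value at) (≈trans (absorb-r (f (set F)))
            (⊕-cong (⊗-congˡ (≈sym (fixed at))) ≈refl))

      Φ-down : F′ ⊑ F → Φ E b (set F) ≈ᴿ f (set F′)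
      Φ-down F↓ = let x , y , at = at? j (set F) in cases x y at
        where
        cases : ∀ x y → At x y j (set F) → Φ E b (set F) ≈ᴿ f (set F′)
        cases true  false at = contradiction at (no-drop j F F↓)
        cases false true  at = ≈trans (step-value at) (≈trans
            (⊕-cong (⊗-identityˡ (f (set F′))) (⊗-zeroˡ (f (set F)))) (⊕-identityʳ (f (set F′))))
        cases true  true  at = ≈trans (equal-value at) (≈sym (fixed at))
        cases false false at = ≈trans (equal-value at) (≈sym (fixed at))

  Polynomial : C → Set
  Polynomial c = ∃[ p ] c ≈ᴿ κ p

  poly-0 : Polynomial 0ᴿ
  poly-0 = 0ₚ , ≈sym φ-0

  poly-1 : Polynomial 1ᴿ
  poly-1 = 1ₚ , ≈sym φ-1

  poly-⊕ : ∀ {a b} → Polynomial a → Polynomial b → Polynomial (a ⊕ b)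
  poly-⊕ (p , e) (p′ , e′) = p +ₚ p′ , ≈trans (⊕-cong e e′) (≈sym (κ-+ p p′))

  poly-⊗ : ∀ {a b} → Polynomial a → Polynomial b → Polynomial (a ⊗ b)
  poly-⊗ (p , e) (p′ , e′) = p *ₚ p′ , ≈trans (⊗-cong e e′) (≈sym (κ-* p p′))

  poly-τ′ : ∀ (i : Fin m) {f} → (∀ p → Polynomial (f p)) → ∀ p → Polynomial (τ′ i f p)
  poly-τ′ i h p = poly-⊕ (poly-⊗ (poly-α (ord i p)) (h _)) (poly-⊗ (poly-β′ (ord i p)) (h _))
    where
    poly-α : ∀ x → Polynomial (α x)
    poly-α lt = t , ≈sym φ-t
    poly-α eq = poly-0
    poly-α gt = poly-1
    poly-β′ : ∀ x → Polynomial (β′ x)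
    poly-β′ lt = 1ₚ +ₚ -ₚ t , ≈sym φ-r
    poly-β′ eq = poly-1
    poly-β′ gt = poly-0

  poly-Φ : ∀ (E : Column (suc m) k) b p → Polynomial (Φ E b p)
  poly-Φ {k = k} E b = go (reverse (lehmer (flip (u E))))
    where
    go : ∀ is p → Polynomial (acts′ is (Φ₀ k b) p)
    go []       p with prefix k p | ∣ p ∣ ℕ.≡ᵇ b
    ... | false | _     = poly-0
    ... | true  | false = poly-0
    ... | true  | true  = poly-1
    go (i ∷ is) p = poly-τ′ i (go is) p

-- The values of all tensors

far-apart : ∀ a b → suc a < b → 1 < ∣ a - b ∣
far-apart zero    b       h       = h
far-apart (suc a) (suc b) (s≤s h) = far-apart a b h

module Values (R : CommutativeRing 0ℓ 0ℓ) (Σc : Scalars R)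
  (φ-injective : ∀ a b → CommutativeRing._≈_ R (Scalars.φ Σc a) (Scalars.φ Σc b) → a ≈ₗ b)
  (κ-cancel : ∀ p a b → ¬ p ≈ₚ 0ₚ →
    CommutativeRing._≈_ R (CommutativeRing._*_ R (Scalars.φ Σc ⟦ p ⟧ₗ) a)
      (CommutativeRing._*_ R (Scalars.φ Σc ⟦ p ⟧ₗ) b) →
    CommutativeRing._≈_ R a b) where

  open PairValues R Σc public

  v : ℕ → Fun (suc m)
  v {m} l = δ (top (suc m) l)

  v-eigen : ∀ l (i : Fin m) → suc (toℕ i) ≢ l → τ i (v l) ≐ q ∙ v l
  v-eigen {m} l i h = let a , at = top-at i l h in
    τ-δ-eq i (top (suc m) l) (trans (ord-at at) (cmp-refl (letter-rank a))) (sw-fixed at)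

  -- The word is constant, so every T_i acts by t: this vector carries the index character of the
  -- whole of H_n.
  v-full : ∀ (i : Fin m) → τ i (v (suc m)) ≐ q ∙ v (suc m)
  v-full {m} i = v-eigen (suc m) i (λ e → ℕₚ.<-irrefl (ℕₚ.suc-injective e) (Finₚ.toℕ<n i))

  T-eigen : ∀ (w : Permutation′ (suc m)) {f} → All (λ i → τ i f ≐ q ∙ f) (lehmer w) → ⟪ T[ w ] ⟫ f ≐ pow q (ℓ w) ∙ f
  T-eigen w {f} e = ≐trans (⟪T⟫ w f) (acts-eigen e)

  expand : ∀ {L : List (Permutation′ (suc m))} {x} (h : Span L x) f → ⟪ x ⟫ f ≐ λ y → ∑ L
      (λ w → φ (Span.coefficient h w) ⊗ ⟪ T[ w ] ⟫ f y)
  expand {L = L} (a , e) f y = ≈trans (sound e f y) (⟪∑⟫ L _ f y)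

  -- The value of the index character T_w ↦ t^ℓ(w)
  χ : ∀ {L : List (Permutation′ (suc m))} {x} → Span L x → C
  χ {L = L} (a , _) = ∑ L (λ w → φ (a w) ⊗ pow q (ℓ w))

  span-eigen : ∀ {L : List (Permutation′ (suc m))} {x} (h : Span L x) {f} →
               (∀ {w} → w ∈ L → All (λ i → τ i f ≐ q ∙ f) (lehmer w)) → ⟪ x ⟫ f ≐ χ h ∙ f
  span-eigen {L = L} h@(a , _) {f} e y = ≈trans (expand h f y) (≈trans
    (∑R.∑-cong L (λ {w} w∈ → ≈trans (⊗-congˡ (T-eigen w (e w∈) y)) (≈sym (⊗-assoc _ _ _))))
    (≈sym (∑-⊗ L (λ w → φ (a w) ⊗ pow q (ℓ w)) (f y))))

  stab-letters : ∀ l (w : Permutation′ (suc m)) → w ∈ Stab (ϖ l) → All (λ i → suc (toℕ i) ≢ l) (lehmer w)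
  stab-letters l w w∈ = All.map (λ {i} → stabilises-ϖ l i)
      (lehmer-stabilises {μ = ϖ l} (ϖ-dominant l) w (Stab-fixes (ϖ l) w∈))

  κ-W : ∀ (μ : Weight (suc m)) → ∑ (Stab μ) (λ w → pow q (ℓ w)) ≈ᴿ κ (W μ)
  κ-W μ = ≈sym (≈trans (κ-∑ (Stab μ) (λ w → t ^ₚ ℓ w)) (∑R.∑-cong (Stab μ) (λ {w} _ → κ-pow (ℓ w))))

  -- The operator `F` in front covers both uses: T_w may act on an eigenvector, or be absorbed by an
  -- invariant element on its left.
  ⟪𝟏⟫ : ∀ (μ : Weight (suc m)) (F : Fun (suc m) → Fun (suc m)) {f g} →
        Linear F → (∀ {w} → w ∈ Stab μ → F (⟪ T[ w ] ⟫ f) ≐ pow q (ℓ w) ∙ g) → F (⟪ 𝟏 μ ⟫ f) ≐ κ (W μ) ∙ g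
  ⟪𝟏⟫ μ F {f} {g} LF e p = ≈trans (F-cong LF (⟪∑⟫ (Stab μ) T[_] f) p)
    (≈trans (F-∑ LF (Stab μ) (λ w → ⟪ T[ w ] ⟫ f) p) (≈trans (∑R.∑-cong (Stab μ) (λ w∈ → e w∈ p))
      (≈trans (≈sym (∑-⊗ (Stab μ) (λ w → pow q (ℓ w)) (g p))) (⊗-cong (κ-W μ) ≈refl))))

  𝟏-full : ∀ k → ⟪ 𝟏 {m} (ϖ k) ⟫ (v (suc m)) ≐ κ (W {m} (ϖ k)) ∙ v (suc m)
  𝟏-full k = ⟪𝟏⟫ (ϖ k) (λ f → f) id-linear (λ {w} _ → T-eigen w (All.universal v-full (lehmer w)))

  𝟏-highest : ∀ k l → k ≤ l → l ≤ suc m → ⟪ 𝟏 {m} (ϖ k) ⟫ (v l) ≐ κ (W {m} (pair-weight l k)) ∙ Φ₀ k l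
  𝟏-highest {m} k l k≤l l≤n p = ≈trans (sound (Hᴿ.reflexive (𝟏-words {m} {ϖ k} (ϖ-dominant k))) (v l) p)
    (≈trans (⟪∑⟫ (words {m} (ϖ k)) Tw (v l) p) (≈trans (∑R.∑-cong (words {m} (ϖ k)) (λ {is} _ → ⟪Tw⟫ is (v l) p))
      (≈trans (highest m k l k≤l l≤n p) (⊗-cong (κ-cong
        (P.sym (W-Wt {m} {pair-weight l k} (pair-weight-dominant l k)))) ≈refl))))

  RightInvariant : ℕ → H m → Set
  RightInvariant {m} k x = ∀ (i : Fin m) → k ≤ toℕ i → x *ᴴ T i ≈ᴴ qᴴ *ᴴ x

  invariant-*ˡ : ∀ {k} (y : H m) {x} → RightInvariant k x → RightInvariant k (y *ᴴ x)
  invariant-*ˡ y {x} h i k≤i = transᴴ (*-assoc y x (T i)) (transᴴ (*-cong reflᴴ (h i k≤i)) (symᴴ (past-ι _ y x)))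

  invariant-resp : ∀ {k} {x y : H m} → x ≈ᴴ y → RightInvariant k x → RightInvariant k y
  invariant-resp e h i k≤i = transᴴ (*-cong (symᴴ e) reflᴴ) (transᴴ (h i k≤i) (*-cong reflᴴ e))

  -- On a right invariant h the letters ≥ k act from the right by t, the
  -- letters < k commute with them and act by t on v l.
  absorb : ∀ k l → k ≤ l → ∀ {h : H m} → RightInvariant k h → ∀ is → All (λ i → suc (toℕ i) ≢ k) is →
           ⟪ h ⟫ (acts is (v l)) ≐ pow q (length is) ∙ ⟪ h ⟫ (v l)
  absorb k l k≤l inv-h []       _        p = ≈sym (⊗-identityˡ _)
  absorb {m} k l k≤l {h} inv-h (i ∷ is) (i≢ ∷ is≢) with k ℕₚ.≤? toℕ i
  ... | yes k≤i = ≐trans (sound (inv-h i k≤i) (acts is (v l)))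
    (≐trans (∙-cong φ-t (absorb k l k≤l inv-h is is≢)) (∙-assoc q _ _))
  ... | no  k≰i = ≐trans (absorb k l k≤l {h *ᴴ T i} inv-hT is is≢)
    (≐trans (∙-cong ≈refl (≐trans (F-cong (⟪⟫-linear h) (v-eigen l i (λ e → ℕₚ.<-irrefl e (ℕₚ.<-≤-trans i<k k≤l))))
      (F-∙ (⟪⟫-linear h) q (v l)))) (≐trans (∙-assoc _ q _) (∙-cong (⊗-comm _ q) ≐refl)))
    where
    i<k : suc (toℕ i) < k
    i<k = ℕₚ.≤∧≢⇒< (ℕₚ.≰⇒> k≰i) i≢
    inv-hT : RightInvariant k (h *ᴴ T i)
    inv-hT j k≤j = transᴴ (*-assoc h (T i) (T j)) (transᴴ
        (*-cong reflᴴ (T-comm i j (far-apart _ _ (ℕₚ.<-≤-trans i<k k≤j))))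
      (transᴴ (symᴴ (*-assoc h (T j) (T i))) (transᴴ (*-cong (inv-h j k≤j) reflᴴ) (*-assoc _ h (T i)))))

  T-u-v : ∀ {p : Subset (suc m)} → Reach p → ⟪ T[ uPerm p ] ⟫ (v ∣ p ∣) ≐ δ p
  T-u-v {m} (base .(suc m) l) = ≐trans (sound (transᴴ (T[]-cong (uPerm (top (suc m) l)) Perm.id
      (u-top (suc m) l)) T-id) (v ∣ top (suc m) l ∣))
    (≐trans (⟪1⟫ (v ∣ top (suc m) l ∣)) (λ y → ≈reflexive (cong (λ p → δ p y) (top-∣top∣ (suc m) l))))
  T-u-v {m} (step {i = i} {p} at r) = ≐trans (sound (u-raise at) (v ∣ sw i p ∣))
    (≐trans (F-cong (τ-linear i) (≐trans (λ y → ≈reflexive (cong (λ d → ⟪ T[ uPerm p ] ⟫ (v d) y) (∣sw∣ i p)))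
      (T-u-v r)))
      (τ-δ-up i p (ord-at at)))

  -- Built from Φ alone, without a representative of Ψ_S. That it is the value defined through Ψ_S
  -- is the content of `trace`.
  ψ : Tensor (suc m) k → C
  ψ (single _ _)         = 1ᴿ
  ψ (cons {l = l} _ F S) = ψ S ⊗ Φ (leftmost S) l (set F)

  ⟪t^⟫ : ∀ d (f : Fun (suc m)) → ⟪ t^ d ⟫ f ≐ pow q d ∙ f
  ⟪t^⟫ d f p = ⊗-cong (κ-pow d) ≈refl

  -- What must be carried along the tensor: `invariant` passes to the components of the next
  -- decomposition, `vector` evaluates the next character, and `character` gives the numerator of
  -- ψ̃. The denominator W_{ϖ_k} in `vector` is cleared.
  record Value (S : Tensor (suc m) k) (x : H m) : Set where
    field
      invariant : RightInvariant k x
      character : ⟪ x ⟫ (v (suc m)) ≐ (κ (W (shape S)) ⊗ ψ S) ∙ v (suc m)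
      vector    : ∀ l → k ≤ l → l ≤ suc m →
                  κ (W {m} (ϖ k)) ∙ ⟪ x ⟫ (v l) ≐ (κ (W (shape S)) ⊗ ψ S) ∙ κ (W {m} (pair-weight l k)) ∙ Φ
                    (leftmost S) l

  -- The factor t^ℓ(u_C) (T_{u_C⁻¹})⁻¹ acts as the identity on the constant word and carries Φ₀ to Φ
  -- C; each field of `Value` thus reduces to a statement about the element on its right.
  module Translate (C : Column (suc m) k) {y : H m} (y-inverse : IsInverse T[ flip (u C) ] y) where

    translate : H m → H m
    translate h = t^ (ℓ (u C)) *ᴴ (y *ᴴ h)

    ⟪translate⟫ : ∀ h f → ⟪ translate h ⟫ f ≐ pow q (ℓ (u C)) ∙ ⟪ y ⟫ (⟪ h ⟫ f)
    ⟪translate⟫ h f = ⟪t^⟫ (ℓ (u C)) (⟪ y ⟫ (⟪ h ⟫ f))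

    translate-invariant : ∀ {k h} → RightInvariant k h → RightInvariant k (translate h)
    translate-invariant inv-h = invariant-*ˡ (t^ (ℓ (u C))) (invariant-*ˡ y inv-h)

    translate-full : ∀ h a → ⟪ h ⟫ (v (suc m)) ≐ a ∙ v (suc m) → ⟪ translate h ⟫ (v (suc m)) ≐ a ∙ v (suc m)
    translate-full h a e = ≐trans (⟪translate⟫ h (v (suc m))) (≐trans
      (∙-cong ≈refl (≐trans (F-cong (⟪⟫-linear y) e) (F-∙ (⟪⟫-linear y) a (v (suc m)))))
      (≐trans (λ p → solve 3 (λ x y z → x :* (y :* z) := y :* (x :* z)) ≈refl (pow q (ℓ (u C))) a
        (⟪ y ⟫ (v (suc m)) p))
        (∙-cong ≈refl undo)))
      where
      undo : pow q (ℓ (u C)) ∙ ⟪ y ⟫ (v (suc m)) ≐ v (suc m)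
      undo = ≐trans (≐sym (F-∙ (⟪⟫-linear y) (pow q (ℓ (u C))) (v (suc m)))) (≐trans
        (F-cong (⟪⟫-linear y) (≐trans (λ p → ≈reflexive (cong (λ d → pow q d ⊗ v (suc m) p) (sym (ℓ-flip (u C)))))
          (≐sym (T-eigen (flip (u C)) (All.universal v-full (lehmer (flip (u C))))))))
        (≐trans (sound (proj₂ y-inverse) (v (suc m))) (⟪1⟫ (v (suc m)))))

    translate-vector : ∀ h l b c → b ∙ ⟪ h ⟫ (v l) ≐ c ∙ Φ₀ k l → b ∙ ⟪ translate h ⟫ (v l) ≐ c ∙ Φ C l
    translate-vector h l b c e = ≐trans (∙-cong ≈refl (⟪translate⟫ h (v l))) (≐trans
      (λ p → solve 3 (λ x y z → x :* (y :* z) := y :* (x :* z)) ≈refl b (pow q (ℓ (u C))) (⟪ y ⟫ (⟪ h ⟫ (v l)) p))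
      (≐trans (∙-cong ≈refl (≐trans (≐sym (F-∙ (⟪⟫-linear y) b (⟪ h ⟫ (v l))))
        (≐trans (F-cong (⟪⟫-linear y) e) (F-∙ (⟪⟫-linear y) c (Φ₀ k l)))))
        (≐trans (λ p → solve 3 (λ x y z → x :* (y :* z) := y :* (x :* z)) ≈refl (pow q (ℓ (u C))) c
          (⟪ y ⟫ (Φ₀ k l) p))
          (∙-cong ≈refl (Φ-inverse C l y-inverse)))))

  value-resp : ∀ {S : Tensor (suc m) k} {x y} → x ≈ᴴ y → Value S x → Value S y
  value-resp e V = record
    { invariant = invariant-resp e invariant
    ; character = ≐trans (≐sym (sound e _)) character
    ; vector    = λ l k≤l l≤n → ≐trans (∙-cong ≈refl (≐sym (sound e (v l)))) (vector l k≤l l≤n) }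
    where open Value V

  value-single : ∀ .(1≤k : 1 ≤ k) (C : Column (suc m) k) {y} → IsInverse T[ flip (u C) ] y →
                 Value (single 1≤k C) (t^ (ℓ (u C)) *ᴴ (y *ᴴ 𝟏 (ϖ k)))
  value-single {k} {m} 1≤k C y-inverse = record
    { invariant = translate-invariant (λ i k≤i → 𝟏-invariant k i k≤i)
    ; character = translate-full (𝟏 (ϖ k)) (κ (W {m} (ϖ k)) ⊗ 1ᴿ) (≐trans (𝟏-full k) (∙-cong (≈sym 1-right) ≐refl))
    ; vector    = λ l k≤l l≤n → ≐trans (translate-vector (𝟏 (ϖ k)) l (κ (W {m} (ϖ k)))
        (κ (W {m} (ϖ k)) ⊗ κ (W {m} (pair-weight l k)))
        (≐trans (∙-cong ≈refl (𝟏-highest k l k≤l l≤n)) (∙-assoc _ _ (Φ₀ k l))))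
        (≐trans (≐sym (∙-assoc _ _ (Φ C l))) (∙-cong (≈sym 1-right) ≐refl)) }
    where
    open Translate C y-inverse
    1-right : κ (W {m} (ϖ k)) ⊗ 1ᴿ ≈ᴿ κ (W {m} (ϖ k))
    1-right = ≈trans (⊗-comm _ _) (⊗-identityˡ _)

  column-bound : ∀ (C : Column (suc m) l) → l ≤ suc m
  column-bound C = subst (_≤ _) (size-of C) (∣p∣≤n (set C))

  module Cons {k l} .(k≤l : k ≤ l) (F : Column (suc m) l) (S : Tensor (suc m) k) {z : H m} (V : Value S z) (d : Decomposition l z) where

    private
      h : Column (suc m) l → H m
      h = proj₁ d

      h∈ : ∀ G → Span (Stab (ϖ l)) (h G)
      h∈ = proj₁ (proj₂ d)

      k≤l′ : k ≤ l
      k≤l′ = recompute-≤ k≤l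

      l≤n : l ≤ suc m
      l≤n = column-bound F

      χF : C
      χF = χ (h∈ F)

      S′ : Tensor (suc m) l
      S′ = cons k≤l F S

    open Value V
    open Uniqueness R Σc m l φ-injective using (decomposition-unique)

    -- Both sides of z T_i = t z decompose, with components h_G T_i and t h_G; T_i stays in the
    -- parabolic subalgebra because i ≥ l. Uniqueness equates them.
    h-invariant : RightInvariant l (h F)
    h-invariant i l≤i = decomposition-unique (invariant i (ℕₚ.≤-trans k≤l′ l≤i))
      ((λ G → h G *ᴴ T i) , (λ G → Stab-Tʳ {μ = ϖ l} (ϖ-stabilises l i (λ e → ℕₚ.<-irrefl (sym e) (s≤s l≤i))) (h∈ G))
        , transᴴ (*-cong (proj₂ (proj₂ d)) reflᴴ) (transᴴ (∑ᴴ-*ʳ (T i) (columns (suc m) l) _)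
          (∑H.∑-cong (columns (suc m) l) (λ _ → *-assoc _ _ _))))
      (dec-ι ⟦ t ⟧ₗ d) F

    h-eigen : ∀ G {f} → (∀ i → suc (toℕ i) ≢ l → τ i f ≐ q ∙ f) → ⟪ h G ⟫ f ≐ χ (h∈ G) ∙ f
    h-eigen G {f} e = span-eigen (h∈ G) {f} (λ {w} w∈ → All.map (λ {i} → e i) (stab-letters l w w∈))

    coefficient : ⟪ z ⟫ (v l) (set F) ≈ᴿ χF
    coefficient = ≈trans (sound (proj₂ (proj₂ d)) (v l) (set F))
        (≈trans (⟪∑⟫ (columns (suc m) l) (λ G → T[ u G ] *ᴴ h G) (v l) (set F))
      (≈trans (∑R.∑-cong (columns (suc m) l) {g = λ G → χ (h∈ G) ⊗ δ (set G) (set F)}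
        (λ {G} _ → component-value G (set F)))
        (≈trans (∑R.∑-pick {_~_ = λ G G′ → set G ≡ set G′} (columns-distinct (suc m) l) (columns-complete F)
          (λ {G} _ ¬e → ≈trans (⊗-congˡ (δ-diff {y = set G} {set F} ¬e)) (⊗-zeroʳ _))
          (λ {G} _ ¬e → ≈trans (⊗-congˡ (δ-diff {y = set G} {set F} (λ e → ¬e (sym e)))) (⊗-zeroʳ _)))
          (≈trans (⊗-congˡ (δ-same (set F))) (≈trans (⊗-comm _ _) (⊗-identityˡ _))))))
      where
      component-value : ∀ G → ⟪ T[ u G ] ⟫ (⟪ h G ⟫ (v l)) ≐ χ (h∈ G) ∙ δ (set G)
      component-value G = ≐trans (F-cong (⟪T⟫-linear (u G)) (h-eigen G (λ i → v-eigen l i)))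
        (≐trans (F-∙ (⟪T⟫-linear (u G)) (χ (h∈ G)) (v l)) (∙-cong ≈refl
          (≐trans (λ y → ≈reflexive (cong (λ d → ⟪ T[ u G ] ⟫ (v d) y) (sym (size-of G)))) (T-u-v (reach (set G))))))

    -- The coefficient of z v_l at F is computed once through the components and once through
    -- `vector`. `W-shape` trades the Poincaré factors, and W_{ϖ_k} is cancelled.
    χF-value : χF ≈ᴿ κ (W (shape S′)) ⊗ ψ S′
    χF-value = κ-cancel (W {m} (ϖ k)) χF (κ (W (shape S′)) ⊗ ψ S′) (W≉0 {m} {ϖ k} (ϖ-dominant k)) (begin
      a ⊗ χF                                 ≈⟨ ⊗-congˡ coefficient ⟨
      a ⊗ ⟪ z ⟫ (v l) (set F)                ≈⟨ vector l k≤l′ l≤n (set F) ⟩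
      (b ⊗ ψ S) ⊗ (c ⊗ x)                    ≈⟨ solve 4
        (λ b s c x → (b :* s) :* (c :* x) := (b :* c) :* (s :* x)) ≈refl b (ψ S) c x ⟩
      (b ⊗ c) ⊗ (ψ S ⊗ x)                    ≈⟨ ⊗-cong (≈trans (≈sym (κ-* (W (shape S)) (W {m} (pair-weight l k))))
                                                  (≈trans (κ-cong (W-shape k≤l F S))
                                                    (κ-* (W {m} (ϖ k)) (W (shape S′))))) ≈refl ⟩
      (a ⊗ κ (W (shape S′))) ⊗ (ψ S ⊗ x)     ≈⟨ ⊗-assoc _ _ _ ⟩
      a ⊗ (κ (W (shape S′)) ⊗ ψ S′)          ∎)
      where
      open ≈-Reasoning
      a = κ (W {m} (ϖ k))
      b = κ (W (shape S))
      c = κ (W {m} (pair-weight l k))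
      x = Φ (leftmost S) l (set F)

    -- By `absorb`, W_{ϖ_l} h v equals h 𝟏_{ϖ_l} v. There 𝟏_{ϖ_l} v is a multiple of Φ₀, on which
    -- the letters of the stabiliser act by t, so h acts by its index character.
    h-vector : ∀ l′ → l ≤ l′ → l′ ≤ suc m → κ (W {m} (ϖ l)) ∙ ⟪ h F ⟫ (v l′) ≐
        (χF ⊗ κ (W {m} (pair-weight l′ l))) ∙ Φ₀ l l′
    h-vector l′ l≤l′ l′≤n = ≐trans
      (≐sym (⟪𝟏⟫ (ϖ l) ⟪ h F ⟫ (⟪⟫-linear (h F)) (λ {w} w∈ →
        ≐trans (F-cong (⟪⟫-linear (h F)) (⟪T⟫ w (v l′)))
          (absorb l l′ l≤l′ h-invariant (lehmer w) (stab-letters l w w∈)))))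
      (≐trans (F-cong (⟪⟫-linear (h F)) (𝟏-highest l l′ l≤l′ l′≤n))
        (≐trans (F-∙ (⟪⟫-linear (h F)) c (Φ₀ l l′)) (≐trans (∙-cong ≈refl (h-eigen F (λ i → Φ₀-eigen l l′ i)))
          (≐trans (∙-assoc c χF (Φ₀ l l′)) (∙-cong (⊗-comm c χF) ≐refl)))))
      where c = κ (W {m} (pair-weight l′ l))

    value-cons : ∀ {y} → IsInverse T[ flip (u F) ] y → Value S′ (t^ (ℓ (u F)) *ᴴ (y *ᴴ h F))
    value-cons y-inverse = record
      { invariant = translate-invariant h-invariant
      ; character = ≐trans (translate-full (h F) χF (h-eigen F (λ i _ → v-full i))) (∙-cong χF-value ≐refl)
      ; vector    = λ l′ l≤l′ l′≤n → ≐trans (translate-vector (h F) l′ (κ (W {m} (ϖ l))) _ (h-vector l′ l≤l′ l′≤n))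
          (≐trans (≐sym (∙-assoc χF _ (Φ F l′))) (∙-cong χF-value ≐refl)) }
      where open Translate F y-inverse

  value : ∀ (S : Tensor (suc m) k) {x} → IsΨ S x → Value S x
  value (single 1≤k C) (y , y-inverse , e) = value-resp (symᴴ e) (value-single 1≤k C y-inverse)
  value (cons {l = l} k≤l F S) (z , h , y , Ψz , h∈ , e , y-inverse , e′) = value-resp (symᴴ e′)
    (Cons.value-cons k≤l F S (value S Ψz) (h , (λ G → ∈⇒span (ϖ l) (h∈ G)) , e) y-inverse)

  -- The representative is kept in H_n, since that is what guarantees the next decomposition and, at
  -- the end, an expansion in the T_w.
  Ψ-exists : ∀ (S : Tensor (suc m) k) → ∃[ x ] IsΨ S x × Finite x
  Ψ-exists (single {k} 1≤k C) = t^ (ℓ (u C)) *ᴴ (Tw⁻¹ L *ᴴ 𝟏 (ϖ k)) , (Tw⁻¹ L , Tw-inverse L , reflᴴ)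
    , fin-* (fin-ι _) (fin-* (fin-Tw⁻¹ L) (fin-∑ (Stab (ϖ k)) (λ w → fin-Tw (lehmer w))))
    where L = lehmer (flip (u C))
  Ψ-exists (cons {l = l} k≤l F S) =
    let z , Ψz , fz = Ψ-exists S
        h , h∈ , e  = finite-decomposition (column-bound F) fz
        L           = lehmer (flip (u F))
    in t^ (ℓ (u F)) *ᴴ (Tw⁻¹ L *ᴴ h F)
     , (z , h , Tw⁻¹ L , Ψz , (λ G → span⇒∈ (ϖ l) (h∈ G)) , e , Tw-inverse L , reflᴴ)
     , fin-* (fin-ι _) (fin-* (fin-Tw⁻¹ L) (fin-span (h∈ F)))

  -- Evaluating x on the constant word replaces each T_w by t^ℓ(w), whatever expansion is chosen;
  -- `character` knows the result.
  trace : ∀ (S : Tensor (suc m) k) {x} → IsΨ S x → ∀ (a : Permutation′ (suc m) → ℤ[t^±1]) →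
          x ≈ᴴ ∑ᴴ (𝔖 (suc m)) (λ w → ι (a w) *ᴴ T[ w ]) →
          φ (∑ₗ (𝔖 (suc m)) (λ w → a w *ₗ ⟦ t ^ₚ ℓ w ⟧ₗ)) ≈ᴿ κ (W (shape S)) ⊗ ψ S
  trace {m} S {x} Ψx a e = begin
    φ (∑ₗ (𝔖 (suc m)) (λ w → a w *ₗ ⟦ t ^ₚ ℓ w ⟧ₗ))  ≈⟨ ∑R.∑-hom _+ₗ_ ⟦ 0ₚ ⟧ₗ φ φ-0 φ-+ (𝔖 (suc m)) _ ⟩
    ∑ (𝔖 (suc m)) (λ w → φ (a w *ₗ ⟦ t ^ₚ ℓ w ⟧ₗ))   ≈⟨ ∑R.∑-cong (𝔖 (suc m))
      (λ {w} _ → ≈trans (φ-* (a w) ⟦ t ^ₚ ℓ w ⟧ₗ) (⊗-congˡ (κ-pow (ℓ w)))) ⟩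
    χ expansion                                      ≈⟨ unit (χ expansion) ⟨
    χ expansion ⊗ v (suc m) (top (suc m) (suc m))    ≈⟨ span-eigen expansion
      (λ {w} _ → All.universal v-full (lehmer w)) (top (suc m) (suc m)) ⟨
    ⟪ x ⟫ (v (suc m)) (top (suc m) (suc m))          ≈⟨ Value.character (value S Ψx) (top (suc m) (suc m)) ⟩
    (κ (W (shape S)) ⊗ ψ S) ⊗ v (suc m) (top (suc m) (suc m))  ≈⟨ unit _ ⟩
    κ (W (shape S)) ⊗ ψ S                            ∎
    where
    open ≈-Reasoning
    expansion : Span (𝔖 (suc m)) x
    expansion = a , e
    unit : ∀ b → b ⊗ v (suc m) (top (suc m) (suc m)) ≈ᴿ b
    unit b = ≈trans (⊗-congˡ (δ-same (top (suc m) (suc m)))) (≈trans (⊗-comm b 1ᴿ) (⊗-identityˡ b))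

  poly-ψ : ∀ (S : Tensor (suc m) k) → Polynomial (ψ S)
  poly-ψ (single _ _)         = poly-1
  poly-ψ (cons {l = l} _ F S) = poly-⊗ (poly-ψ S) (poly-Φ (leftmost S) l (set F))

-- Specialisation to ℚ(t)

lift≅ : ∀ x y → x ≃ y → x ≅ y
lift≅ x y = mk≅

ℚ⟨t⟩-scalars : Scalars ℚ⟨t⟩-ring
ℚ⟨t⟩-scalars = record
  { q = ⟦ t ⟧ ; s′ = ⟦ t +ₚ -ₚ 1ₚ ⟧ ; r = ⟦ 1ₚ +ₚ -ₚ t ⟧ ; q⁻¹ = frac 1ₚ (t ^ₚ 1) (t^≉0 1)
  ; q≈1+s  = mk≅ λ { zero → refl ; (suc zero) → refl ; (suc (suc zero)) → refl ; (suc (suc (suc _))) → refl }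
  ; s+r≈0  = mk≅ λ { zero → refl ; (suc zero) → refl ; (suc (suc zero)) → refl ; (suc (suc (suc _))) → refl }
  ; q⊗q⁻¹  = mk≅ λ { zero → refl ; (suc zero) → refl ; (suc (suc zero)) → refl ; (suc (suc (suc zero))) → refl ;
      (suc (suc (suc (suc _)))) → refl }
  ; φ      = fromLaurent
  ; φ-cong = λ {a} {b} e → lift≅ (fromLaurent a) (fromLaurent b) e
  ; φ-+    = fromLaurent-+
  ; φ-*    = fromLaurent-*
  ; φ-0    = ≅.refl
  ; φ-1    = ≅.refl
  ; φ-t    = ≅.refl
  ; φ-s    = ≅.refl
  ; φ-r    = ≅.refl
  ; φ-neg  = mk≅ λ { zero → refl ; (suc zero) → refl ; (suc (suc _)) → refl }
  }

open Values ℚ⟨t⟩-ring ℚ⟨t⟩-scalars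
  (λ a b e → _≅_.un e)
  (λ p a b p≉0 e → ⟦⟧-cancelˡ p a b p≉0 e)
  using (ψ; trace; Ψ-exists; poly-ψ; Φ; Φ-not-semistandard; Φ-highest; Φ-up; Φ-down)

ψ-pair : ∀ {m a b} .(1≤a : 1 ≤ a) .(a≤b : a ≤ b) (F : Column (suc m) b) (E : Column (suc m) a) →
         ψ (pair 1≤a a≤b F E) ≅ Φ E b (set F)
ψ-pair {b = b} 1≤a a≤b F E = K.*-identityˡ (Φ E b (set F))

ψ-∏ : ∀ {m k} (S : Tensor (suc m) k) → ψ S ≅ ∏ (neighbours S) (λ (_ , P) → ψ P)
ψ-∏ (single 1≤k C)               = ≅.refl
ψ-∏ (cons {k = k} {l} k≤l C S) = ≅.trans (K.*-comm (ψ S) (Φ (leftmost S) l (set C)))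
  (K.*-cong (≅.sym (ψ-pair (1≤ S) k≤l C (leftmost S))) (ψ-∏ S))

theorem7p1 : (m : ℕ) → let n = suc m in
    Σ[ ψ̃ ∈ (∀ {k} → Tensor n k → ℚ⟨t⟩) ]
    (∀ {k} (S : Tensor n k) (p : ℚ⟨t⟩) → Isψ̃ S p ⇔ p ≃ ψ̃ S)
    × (∀ {k} (S : Tensor n k) → ψ̃ S ≃ ∏ (neighbours S) (λ (_ , P) → ψ̃ P))
    × (∀ {a b} (1≤a : 1 ≤ a) (a≤b : a ≤ b) (F : Column n b) (E : Column n a) →
    let _⊗_ = pair 1≤a a≤b in
    (¬ Semistandard a≤b F E → ψ̃ (F ⊗ E) ≃ ⟦ 0ₚ ⟧)
    × ((∀ i → toℕ (entry E i) ≡ toℕ i) → Semistandard a≤b F E → ψ̃ (F ⊗ E) ≃ ⟦ 1ₚ ⟧)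
    × (∀ (j : Fin m) → Semistandard a≤b F E → s j · E ⊑ E →
    (F ⊑ s j · F →
    ψ̃ (F ⊗ E) ≃ ⟦ t ⟧ * ψ̃ ((s j · F) ⊗ (s j · E)) + ⟦ 1ₚ +ₚ -ₚ t ⟧ * ψ̃ (F ⊗ (s j · E)))
    × (s j · F ⊑ F → ψ̃ (F ⊗ E) ≃ ψ̃ ((s j · F) ⊗ (s j · E)))))
    × (∀ {k} (S : Tensor n k) → ∃[ p ] ψ̃ S ≃ ⟦ p ⟧)
theorem7p1 m = ψ
  , (λ S p → mk⇔ (determined S p) (attained S p))
  , (λ S → _≅_.un (ψ-∏ S))
  , (λ 1≤a a≤b F E →
        (λ ¬ss → _≅_.un (≅.trans (ψ-pair 1≤a a≤b F E) (Φ-not-semistandard a≤b F E ¬ss)))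
      , (λ h ss → _≅_.un (≅.trans (ψ-pair 1≤a a≤b F E) (Φ-highest a≤b F E h ss)))
      , (λ j ss E↓ →
          (λ F↑ → _≅_.un (≅.trans (ψ-pair 1≤a a≤b F E) (≅.trans (Φ-up a≤b F E j E↓ F↑) (K.+-cong
            (K.*-cong (≅.refl {⟦ t ⟧}) (≅.sym (ψ-pair 1≤a a≤b (s j · F) (s j · E))))
            (K.*-cong (≅.refl {⟦ 1ₚ +ₚ -ₚ t ⟧}) (≅.sym (ψ-pair 1≤a a≤b F (s j · E))))))))
        , (λ F↓ → _≅_.un (≅.trans (ψ-pair 1≤a a≤b F E) (≅.trans (Φ-down a≤b F E j E↓ F↓) (≅.sym (ψ-pair 1≤a a≤b (s j · F) (s j · E))))))))
  , (λ S → let p , e = poly-ψ S in p , _≅_.un e)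
  where
  determined : ∀ {k} (S : Tensor (suc m) k) p → Isψ̃ S p → p ≃ ψ S
  determined S p (x , a , Ψx , e , e′) = _≅_.un (⟦⟧-cancelˡ (W (shape S)) p (ψ S) (W≉0 {m} {shape S} (shape-dominant S))
    (≅.trans (lift≅ (⟦ W (shape S) ⟧ * p) (fromLaurent (∑ₗ (𝔖 (suc m)) (λ w → a w *ₗ ⟦ t ^ₚ ℓ w ⟧ₗ))) e′) (trace S Ψx a e)))
  -- Any representative with any expansion serves as a witness, since `trace` fixes the numerator in
  -- advance.
  attained : ∀ {k} (S : Tensor (suc m) k) p → p ≃ ψ S → Isψ̃ S p
  attained S p p≃ψ =
    let x , Ψx , fx = Ψ-exists S
        (a , e)     = finite-span fx
    in x , a , Ψx , e , _≅_.un (≅.trans (K.*-cong (≅.refl {⟦ W (shape S) ⟧}) (lift≅ p (ψ S) p≃ψ)) (≅.sym (trace S Ψx a e)))
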